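{- If two shares $I_1,I_2$ have isomorphic two-colored intersection graphs (via an isomorphism preserving colors), then $I_1$ and $I_2$ are equivalent, i.e. they define the same element of $\mathcal S$.
   Context: A share consists of two ordered oriented lines (strand 1, strand 2) with $2n$ distinct marked points partitioned into $n$ pairs (chords), up to orientation-preserving diffeomorphisms of each strand. A chord is an arch if both endpoints are on one strand, a bridge otherwise. $A_2$ is the complex vector space with basis the shares. The closure of a share is the chord diagram obtained by gluing the end of strand 1 to the beginning of strand 2 and the end of strand 2 to the beginning of strand 1 into an oriented circle; two chords of a share intersect if their endpoints alternate in the closure. The two-colored intersection graph of a share has the chords as vertices, arches colored white and bridges black, two vertices adjacent iff the chords intersect. For shares $I,H$ the dot product $I\cdot H$ has as strand $i$ the strand $i$ of $I$ followed by strand $i$ of $H$; $(I,H)$ is the closure of $I\cdot H$, extended bilinearly. $w_{\mathfrak{sl}_2}$ on chord diagrams: with $x_1=\tfrac12\begin{pmatrix}0&1\\1&0\end{pmatrix}$, $x_2=\tfrac12\begin{pmatrix}0&-i\\ i&0\end{pmatrix}$, $x_3=\tfrac12\begin{pmatrix}1&0\\0&-1\end{pmatrix}$, for a chord diagram $D$ with endpoints $p_1,\dots,p_{2n}$ listed along the circle from a cut point, $w_{\mathfrak{sl}_2}(D)=\sum_\varphi x_{\varphi(p_1)}\cdots x_{\varphi(p_{2n})}$ over all maps $\varphi$ from chords to $\{1,2,3\}$; it is a polynomial in the Casimir $c=x_1^2+x_2^2+x_3^2$. Two elements $I_1,I_2\in A_2$ are equivalent if $w_{\mathfrak{sl}_2}((I_1,H))=w_{\mathfrak{sl}_2}((I_2,H))$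 for every share $H$; $\mathcal S$ is the quotient of $A_2$ by this equivalence. -}

module Defs where

open import Data.Nat using (ℕ; zero; suc; _+_)
open import Data.Fin using (Fin; zero; suc; _↑ˡ_; _↑ʳ_; _<_)
open import Data.Fin.Properties using () renaming (_≟_ to _≟ᶠ_)
open import Data.List using (List; []; _∷_; _++_; map; concatMap; length; lookup; [_])
open import Data.List.Properties using (≡-dec)
open import Data.Rational using (ℚ; 0ℚ; 1ℚ) renaming (_+_ to _+ℚ_; _*_ to _*ℚ_; _-_ to _-ℚ_; -_ to -ℚ_)
open import Data.Product using (_×_; _,_; ∃; ∃-syntax; Σ-syntax)
open import Data.Sum using (_⊎_)
open import Data.Bool using (Bool; true; false; if_then_else_)
open import Relation.Nullary using (yes; no; Dec)
open import Relation.Nullary.Decidable using (does)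
open import Relation.Binary.PropositionalEquality using (_≡_)

-- Gaussian rationals ℚ[i] ⊂ ℂ (all coefficients that occur are here)

record ℚᵢ : Set where
  constructor _+i_
  field re im : ℚ

0ᵢ 1ᵢ iᵢ : ℚᵢ
0ᵢ = 0ℚ +i 0ℚ
1ᵢ = 1ℚ +i 0ℚ
iᵢ = 0ℚ +i 1ℚ

_+ᵢ_ : ℚᵢ → ℚᵢ → ℚᵢ
(a +i b) +ᵢ (c +i d) = (a +ℚ c) +i (b +ℚ d)

_*ᵢ_ : ℚᵢ → ℚᵢ → ℚᵢ
(a +i b) *ᵢ (c +i d) = ((a *ℚ c) -ℚ (b *ℚ d)) +i ((a *ℚ d) +ℚ (b *ℚ c))

-ᵢ_ : ℚᵢ → ℚᵢ
-ᵢ (a +i b) = (-ℚ a) +i (-ℚ b)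

-- Universal enveloping algebra U(sl₂) over ℚ[i], with generators
-- x₁, x₂, x₃ (indices Fin 3 = 0,1,2), as the tensor algebra modulo
-- the two-sided ideal generated by  x_a x_b − x_b x_a − [x_a, x_b],
-- where, for x_a = σ_a / 2 as in the paper, [x₁,x₂] = i x₃,
-- [x₂,x₃] = i x₁, [x₃,x₁] = i x₂.

Word : Set
Word = List (Fin 3)

-- Element of the free (tensor) algebra: a formal finite linear
-- combination of words (repetitions allowed; coefficients add up).
Elem : Set
Elem = List (ℚᵢ × Word)

coeff : Elem → Word → ℚᵢ
coeff [] w = 0ᵢ
coeff ((κ , u) ∷ L) w with ≡-dec _≟ᶠ_ u w
... | yes _ = κ +ᵢ coeff L w
... | no  _ = coeff L w

x₁ x₂ x₃ : Fin 3
x₁ = zero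
x₂ = suc zero
x₃ = suc (suc zero)

rel : Fin 3 → Elem
rel zero = (1ᵢ , x₁ ∷ x₂ ∷ []) ∷ ((-ᵢ 1ᵢ) , x₂ ∷ x₁ ∷ []) ∷ ((-ᵢ iᵢ) , [ x₃ ]) ∷ []
rel (suc zero) = (1ᵢ , x₂ ∷ x₃ ∷ []) ∷ ((-ᵢ 1ᵢ) , x₃ ∷ x₂ ∷ []) ∷ ((-ᵢ iᵢ) , [ x₁ ]) ∷ []
rel (suc (suc zero)) = (1ᵢ , x₃ ∷ x₁ ∷ []) ∷ ((-ᵢ 1ᵢ) , x₁ ∷ x₃ ∷ []) ∷ ((-ᵢ iᵢ) , [ x₂ ]) ∷ []

sandwich : ℚᵢ × Word × Fin 3 × Word → Elem
sandwich (κ , u , k , v) = map (λ { (c , w) → (κ *ᵢ c , u ++ w ++ v) }) (rel k)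

idealElem : List (ℚᵢ × Word × Fin 3 × Word) → Elem
idealElem gs = concatMap sandwich gs

_≈U_ : Elem → Elem → Set
L₁ ≈U L₂ = ∃[ gs ] (∀ (w : Word) → coeff L₁ w ≡ coeff L₂ w +ᵢ coeff (idealElem gs) w)

-- The sl₂ weight system on a chord diagram with k chords, given by the
-- sequence of chord labels of its 2k endpoints read along the circle
-- from a cut point.

extend : {k : ℕ} → Fin 3 → (Fin k → Fin 3) → Fin (suc k) → Fin 3
extend c φ zero = c
extend c φ (suc i) = φ i

assignments : (k : ℕ) → List (Fin k → Fin 3)
assignments zero = (λ ()) ∷ []
assignments (suc k) =
  concatMap (λ φ → extend x₁ φ ∷ extend x₂ φ ∷ extend x₃ φ ∷ []) (assignments k)

wsl2 : {k : ℕ} → List (Fin k) → Elem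
wsl2 {k} D = map (λ φ → (1ᵢ , map φ D)) (assignments k)

count : {n : ℕ} → Fin n → List (Fin n) → ℕ
count a [] = 0
count a (b ∷ l) = if does (a ≟ᶠ b) then suc (count a l) else count a l

-- A share with n chords labelled by Fin n: the sequences of chord
-- labels met along strand 1 and along strand 2 (this is the data up to
-- orientation-preserving diffeomorphisms of each strand); every chord
-- has exactly two endpoints.
record Share (n : ℕ) : Set where
  field
    strand₁ strand₂ : List (Fin n)
    twice : ∀ (a : Fin n) → count a (strand₁ ++ strand₂) ≡ 2
open Share public

closure : {n : ℕ} → Share n → List (Fin n)
closure I = strand₁ I ++ strand₂ I

-- (I , H): the closure of the dot product I · H (chords of I labelled
-- by the first n labels, chords of H by the last m), read from the
-- beginning of strand 1:  s₁(I) s₁(H) s₂(I) s₂(H).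
pairing : {n m : ℕ} → Share n → Share m → List (Fin (n + m))
pairing {n} {m} I H =
  map (_↑ˡ m) (strand₁ I) ++ map (n ↑ʳ_) (strand₁ H)
  ++ map (_↑ˡ m) (strand₂ I) ++ map (n ↑ʳ_) (strand₂ H)

Equivalent : {n₁ n₂ : ℕ} → Share n₁ → Share n₂ → Set
Equivalent I₁ I₂ =
  ∀ (m : ℕ) (H : Share m) → wsl2 (pairing I₁ H) ≈U wsl2 (pairing I₂ H)

Pattern : {n : ℕ} → List (Fin n) → Fin n → Fin n → Set
Pattern w a b =
  Σ[ p ∈ Fin (length w) ] Σ[ q ∈ Fin (length w) ] Σ[ r ∈ Fin (length w) ] Σ[ s ∈ Fin (length w) ]
    (p < q × q < r × r < s ×
     lookup w p ≡ a × lookup w q ≡ b × lookup w r ≡ a × lookup w s ≡ b)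

Intersect : {n : ℕ} → Share n → Fin n → Fin n → Set
Intersect I a b = Pattern (closure I) a b ⊎ Pattern (closure I) b a

data Colour : Set where
  white black : Colour

module _ {n : ℕ} where
  open import Data.List.Membership.DecPropositional (_≟ᶠ_ {n}) public using (_∈?_)

colour : {n : ℕ} → Share n → Fin n → Colour
colour I a with a ∈? strand₁ I | a ∈? strand₂ I
... | yes _ | yes _ = black
... | _     | _     = white

{-# OPTIONS --safe #-}
module Submission where

-- A chord diagram is a word in which every letter occurs twice; two words are mutants (∼) if they are related by
-- reversals of both strands of shares.  Close a share by one marker chord: a chord is a bridge iff it crosses the
-- marker, and substituting the two strands of H for the ends of the marker turns mutants into mutants.  Hence it
-- suffices to know two things.
--
-- Words with the same labelled intersection graph are mutants.  An isolated or pendant chord or a twin is deleted and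
-- reinserted; a disconnected graph yields a closed segment; a minimal nontrivial share is contracted to one chord.
-- What remains is prime: in the 4-regular graph with the chords as vertices and the arcs as edges, all nontrivial
-- cuts have at least six edges.  Such a word is determined by its graph up to rotation and reflection: one of the
-- three ways of splitting a suitable vertex (two of them seen after local complementations) leaves a prime word, into
-- which the chord can be reinserted in one way only; the words with five chords are checked by exhaustive search.
--
-- Mutants have the same weight.  Exchanging two neighbouring endpoints in a share changes the weight by a term with a
-- trivalent vertex, which changes sign under reversal (move a leg next to another one, using ε ε = δ δ − δ δ).  So
-- weight minus reversed weight is invariant under all permutations of the endpoints, and it is odd under reversal.

open import Defs
open import Data.Nat using (ℕ; zero; suc; _+_; _≤_; _<_; z≤n; s≤s; _≤ᵇ_; _≡ᵇ_)
open import Data.Nat.Properties using (≤-trans; ≤-reflexive; ≤-refl)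
open import Data.Fin using (Fin; zero; suc; _↑ˡ_; _↑ʳ_; splitAt) renaming (_<_ to _<ᶠ_)
open import Data.Fin.Properties using (all?; ¬∀⟶∃¬; any?; splitAt-↑ˡ; splitAt-↑ʳ; splitAt⁻¹-↑ˡ; splitAt⁻¹-↑ʳ; ↑ˡ-injective; ↑ʳ-injective; suc-injective) renaming (_≟_ to _≟ᶠ_)
open import Data.Bool using (Bool; true; false; if_then_else_; _∧_; _∨_; _xor_; not) renaming (T to IsTrue)
open import Data.Bool.Properties using () renaming (_≟_ to _≟ᵇ_)
open import Data.List using (List; []; _∷_; _++_; map; length; [_]; lookup; _ʳ++_; concatMap; allFin) renaming (reverse to rev)
open import Data.List.Properties using (++-monoid; unfold-reverse; reverse-++; reverse-involutive; ++-assoc; ++-identityʳ; length-++; length-reverse; ∷-injective; ʳ++-defn; map-++; reverse-map; length-map; concatMap-++; ≡-dec; map-cong; map-∘; length-tabulate)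
open import Data.List.Relation.Binary.Permutation.Propositional using (_↭_; refl; prep; swap; ↭-sym; ↭-refl) renaming (trans to ↭trans)
open import Data.List.Relation.Binary.Permutation.Propositional.Properties using (↭-reverse; ++-comm; ++-commutativeMonoid; ↭-length; ++⁺ʳ; ++⁺ˡ)
open import Data.Product using (_×_; _,_; ∃; ∃-syntax; Σ-syntax; proj₁; proj₂)
open import Data.Sum using (_⊎_; inj₁; inj₂)
open import Data.Empty using (⊥; ⊥-elim)
open import Data.Unit using (⊤; tt)
open import Function using (_∘_; case_of_; id)
open import Relation.Nullary using (yes; no; Dec; ¬_)
open import Relation.Nullary.Decidable using (does; dec-true; dec-false; _×-dec_; ¬?; _→-dec_; map′; from-yes)
open import Relation.Binary.PropositionalEquality hiding ([_]; J)
open import Data.List.Relation.Unary.All using (All; []; _∷_)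
open import Data.Rational using (0ℚ; 1ℚ)
open import Data.Rational.Solver using (module +-*-Solver)
open import Algebra.Bundles using (CommutativeRing)
open import Level using (0ℓ)
open import Data.Fin.Permutation using (↔⇒≡)
open import Data.List.Membership.Propositional using (_∈_)
open import Data.List.Membership.Propositional.Properties using (∈-allFin)
open import Data.List.Relation.Unary.Any using (here; there)
open import Function.Bundles using (_↔_; Inverse; _⇔_; Equivalence)
import Data.Nat.Properties as ℕ
import Algebra.Solver.Monoid as MonoidSolver
import Data.Nat.Tactic.RingSolver as ℕRing
import Data.List.Relation.Unary.All.Properties as All
import Data.Rational.Properties as ℚ
import Algebra.Solver.Ring.AlmostCommutativeRing as ACR
import Algebra.Solver.Ring.Simple as RingSimple
import Algebra.Solver.CommutativeMonoid as CMSolver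

-- Primality is measured by edge cuts of the 4-regular graph and not by splits of the intersection
-- graph, because local complementation only reads a closed walk of that graph backwards and so
-- keeps every cut. Each vertex therefore offers three reductions, one for each way of joining its
-- four edges in pairs. Any one of them may destroy primality. If all three do, the cuts that
-- witness it are uncrossed by submodularity; this forces so many edges around the vertex that
-- failure at a second, suitably chosen vertex leaves room for no chords besides the first vertex
-- and its four neighbours. That is why five chords, where the graph is complete, have to be
-- inspected one by one.
--
-- In the weights, labels that occur nowhere are still summed over, and each of them contributes a
-- factor 3. Such idle labels are a resource: they serve as the new chord or leg that appears when
-- two letters are exchanged. The factors are divided out afterwards, which is the origin of the
-- constants 1/3 and 1/9.

module LS {A : Set} = MonoidSolver (++-monoid A)
open LS using (_⊜_) renaming (solve to ls; id to nil; _⊕_ to _&_)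

-- Boolean identities by truth tables

BFun : ℕ → Set
BFun zero = Bool
BFun (suc n) = Bool → BFun n

BEq : ∀ n → BFun n → BFun n → Set
BEq zero f g = f ≡ g
BEq (suc n) f g = ∀ b → BEq n (f b) (g b)

check : ∀ n → BFun n → BFun n → Bool
check zero f g = not (f xor g)
check (suc n) f g = check n (f true) (g true) ∧ check n (f false) (g false)

-- Both sides are evaluated at all points, so that a use of it at closed expressions needs only the
-- trivial proof of `IsTrue`.
taut : ∀ n (f g : BFun n) → IsTrue (check n f g) → BEq n f g
taut zero true true _ = refl
taut zero false false _ = refl
taut (suc n) f g t b = taut n (f b) (g b) (branch b)
  where
  split : ∀ x y → IsTrue (x ∧ y) → IsTrue x × IsTrue y
  split true true _ = tt , tt
  branch : ∀ b → IsTrue (check n (f b) (g b))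
  branch true = proj₁ (split (check n (f true) (g true)) _ t)
  branch false = proj₂ (split (check n (f true) (g true)) _ t)

-- Words, parities of occurrences and crossing chords

Wd : ℕ → Set
Wd k = List (Fin k)

Side : ℕ → Set
Side k = Fin k → Bool

variable
  k : ℕ

true≢false : true ≢ false
true≢false ()

bool-cases : ∀ b → (b ≡ true) ⊎ (b ≡ false)
bool-cases true = inj₁ refl
bool-cases false = inj₂ refl

eqb : Fin k → Fin k → Bool
eqb a b = does (a ≟ᶠ b)

eqb-refl : (a : Fin k) → eqb a a ≡ true
eqb-refl a = dec-true (a ≟ᶠ a) refl

eqb-≢ : {a b : Fin k} → a ≢ b → eqb a b ≡ false
eqb-≢ {a = a} {b} = dec-false (a ≟ᶠ b)

eqb-≡ : {a b : Fin k} → eqb a b ≡ true → a ≡ b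
eqb-≡ {a = a} {b} e with a ≟ᶠ b
... | yes p = p

-- par a w is the parity of the number of occurrences of a, and
-- ord a b w that of the number of pairs "a before b".  For letters
-- occurring twice, ord a b w says whether the chords a and b cross.

par : Fin k → Wd k → Bool
par a [] = false
par a (x ∷ w) = eqb a x xor par a w

ord : Fin k → Fin k → Wd k → Bool
ord a b [] = false
ord a b (x ∷ w) = (eqb a x ∧ par b w) xor ord a b w

Even : Wd k → Set
Even w = ∀ a → par a w ≡ false

par-++ : (a : Fin k) (u v : Wd k) → par a (u ++ v) ≡ par a u xor par a v
par-++ a [] v = refl
par-++ a (x ∷ u) v rewrite par-++ a u v =
  taut 3 (λ x y z → x xor (y xor z)) (λ x y z → (x xor y) xor z) tt (eqb a x) (par a u) (par a v)

ord-++ : (a b : Fin k) (u v : Wd k) →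
  ord a b (u ++ v) ≡ (ord a b u xor ord a b v) xor (par a u ∧ par b v)
ord-++ a b [] v = taut 1 (λ x → x) (λ x → x xor false) tt (ord a b v)
ord-++ a b (x ∷ u) v rewrite ord-++ a b u v | par-++ b u v =
  taut 6 (λ e pu pv ou ov pa → (e ∧ (pu xor pv)) xor ((ou xor ov) xor (pa ∧ pv)))
         (λ e pu pv ou ov pa → (((e ∧ pu) xor ou) xor ov) xor ((e xor pa) ∧ pv)) tt
         (eqb a x) (par b u) (par b v) (ord a b u) (ord a b v) (par a u)

par-reverse : (a : Fin k) (w : Wd k) → par a (rev w) ≡ par a w
par-reverse a [] = refl
par-reverse a (x ∷ w) rewrite unfold-reverse x w | par-++ a (rev w) [ x ] | par-reverse a w =
  taut 2 (λ p e → p xor (e xor false)) (λ p e → e xor p) tt (par a w) (eqb a x)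

ord-reverse : (a b : Fin k) (w : Wd k) → ord a b (rev w) ≡ ord b a w
ord-reverse a b [] = refl
ord-reverse a b (x ∷ w) rewrite unfold-reverse x w | ord-++ a b (rev w) [ x ] | ord-reverse a b w | par-reverse a w =
  taut 4 (λ o p e f → (o xor ((f ∧ false) xor false)) xor (p ∧ (e xor false))) (λ o p e f → (e ∧ p) xor o) tt
    (ord b a w) (par a w) (eqb b x) (eqb a x)

-- Each pair of an occurrence of `a` and one of `b` stands in exactly one of the two orders, so the
-- two parities add up to the parity of the product of the numbers of occurrences.
ord-swap : {a b : Fin k} → a ≢ b → (w : Wd k) → ord b a w ≡ ord a b w xor (par a w ∧ par b w)
ord-swap a≢b [] = refl
ord-swap {a = a} {b} a≢b (x ∷ w) rewrite ord-swap a≢b w = go (a ≟ᶠ x) (b ≟ᶠ x)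
  where
  go : (p : Dec (a ≡ x)) (q : Dec (b ≡ x)) →
    (does q ∧ par a w) xor (ord a b w xor (par a w ∧ par b w)) ≡
    ((does p ∧ par b w) xor ord a b w) xor ((does p xor par a w) ∧ (does q xor par b w))
  go (yes refl) (yes refl) = ⊥-elim (a≢b refl)
  go (yes _) (no _) = taut 3 (λ p q o → o xor (p ∧ q)) (λ p q o → (q xor o) xor (not p ∧ q)) tt (par a w) (par b w) (ord a b w)
  go (no _) (yes _) = taut 3 (λ p q o → p xor (o xor (p ∧ q))) (λ p q o → o xor (p ∧ not q)) tt (par a w) (par b w) (ord a b w)
  go (no _) (no _) = refl

count-++ : (a : Fin k) (u v : Wd k) → count a (u ++ v) ≡ count a u + count a v
count-++ a [] v = refl
count-++ a (x ∷ u) v with does (a ≟ᶠ x)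
... | true = cong suc (count-++ a u v)
... | false = count-++ a u v

count-↭ : (a : Fin k) {u v : Wd k} → u ↭ v → count a u ≡ count a v
count-↭ a refl = refl
count-↭ a (prep x p) with does (a ≟ᶠ x)
... | true = cong suc (count-↭ a p)
... | false = count-↭ a p
count-↭ a (swap x y p) with does (a ≟ᶠ x) | does (a ≟ᶠ y)
... | true | true = cong (2 +_) (count-↭ a p)
... | true | false = cong suc (count-↭ a p)
... | false | true = cong suc (count-↭ a p)
... | false | false = count-↭ a p
count-↭ a (↭trans p q) = trans (count-↭ a p) (count-↭ a q)

count-reverse : (a : Fin k) (w : Wd k) → count a (rev w) ≡ count a w
count-reverse a w = count-↭ a (↭-reverse w)

odd : ℕ → Bool
odd zero = false
odd (suc n) = not (odd n)

par-count : (a : Fin k) (w : Wd k) → par a w ≡ odd (count a w)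
par-count a [] = refl
par-count a (x ∷ w) with does (a ≟ᶠ x)
... | true = cong not (par-count a w)
... | false = par-count a w

count-head : (a : Fin k) (w : Wd k) → count a (a ∷ w) ≡ suc (count a w)
count-head a w rewrite eqb-refl a = refl

count-other : {a x : Fin k} → a ≢ x → (w : Wd k) → count a (x ∷ w) ≡ count a w
count-other a≢x w rewrite eqb-≢ a≢x = refl

par-head : (a : Fin k) (w : Wd k) → par a (a ∷ w) ≡ not (par a w)
par-head a w rewrite eqb-refl a = refl

par-other : {a x : Fin k} → a ≢ x → (w : Wd k) → par a (x ∷ w) ≡ par a w
par-other a≢x w rewrite eqb-≢ a≢x = refl

-- Double occurrence words over a fixed label set: letters may be absent, so that chords can be
-- deleted without changing `k`.
DO : Wd k → Set
DO w = ∀ a → (count a w ≡ 0) ⊎ (count a w ≡ 2)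

DO⇒Even : (w : Wd k) → DO w → Even w
DO⇒Even w dw a with dw a
... | inj₁ e = trans (par-count a w) (cong odd e)
... | inj₂ e = trans (par-count a w) (cong odd e)

Same : Wd k → Wd k → Set
Same u v = ∀ a → count a u ≡ count a v

DO-resp : (u v : Wd k) → Same u v → DO u → DO v
DO-resp u v s du a with du a
... | inj₁ e = inj₁ (trans (sym (s a)) e)
... | inj₂ e = inj₂ (trans (sym (s a)) e)

-- Same labelled intersection graph.

record SG (u v : Wd k) : Set where
  constructor sg
  field
    same : Same u v
    ords : ∀ a b → ord a b u ≡ ord a b v
open SG public

SG-refl : {u : Wd k} → SG u u
SG-refl = sg (λ _ → refl) (λ _ _ → refl)

SG-sym : {u v : Wd k} → SG u v → SG v u
SG-sym (sg s o) = sg (λ a → sym (s a)) (λ a b → sym (o a b))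

SG-trans : {u v w : Wd k} → SG u v → SG v w → SG u w
SG-trans (sg s o) (sg s' o') = sg (λ a → trans (s a) (s' a)) (λ a b → trans (o a b) (o' a b))

SG-DO : {u v : Wd k} → SG u v → DO u → DO v
SG-DO {u = u} {v} g = DO-resp u v (same g)

-- Restriction of a word to a set of letters

flt : Side k → Wd k → Wd k
flt S [] = []
flt S (x ∷ w) = if S x then x ∷ flt S w else flt S w

flt-++ : (S : Side k) (u v : Wd k) → flt S (u ++ v) ≡ flt S u ++ flt S v
flt-++ S [] v = refl
flt-++ S (x ∷ u) v with S x
... | true = cong (x ∷_) (flt-++ S u v)
... | false = flt-++ S u v

flt-reverse : (S : Side k) (w : Wd k) → flt S (rev w) ≡ rev (flt S w)
flt-reverse S [] = refl
flt-reverse S (x ∷ w) rewrite unfold-reverse x w | flt-++ S (rev w) [ x ] | flt-reverse S w with S x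
... | true = sym (unfold-reverse x (flt S w))
... | false = ++-identityʳ _

count-flt-in : (S : Side k) {a : Fin k} → S a ≡ true → (w : Wd k) → count a (flt S w) ≡ count a w
count-flt-in S Sa [] = refl
count-flt-in S {a} Sa (x ∷ w) with a ≟ᶠ x
... | yes refl rewrite Sa | eqb-refl a = cong suc (count-flt-in S Sa w)
... | no a≢x with S x
...   | true rewrite eqb-≢ a≢x = count-flt-in S Sa w
...   | false = count-flt-in S Sa w

count-flt-out : (S : Side k) {a : Fin k} → S a ≡ false → (w : Wd k) → count a (flt S w) ≡ 0
count-flt-out S Sa [] = refl
count-flt-out S {a} Sa (x ∷ w) with S x in e
... | false = count-flt-out S Sa w
... | true with a ≟ᶠ x
...   | yes refl = ⊥-elim (true≢false (trans (sym e) Sa))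
...   | no _ = count-flt-out S Sa w

par-flt : (S : Side k) {a : Fin k} → S a ≡ true → (w : Wd k) → par a (flt S w) ≡ par a w
par-flt S {a} Sa w rewrite par-count a w | par-count a (flt S w) = cong odd (count-flt-in S Sa w)

par-flt-out : (S : Side k) {a : Fin k} → S a ≡ false → (w : Wd k) → par a (flt S w) ≡ false
par-flt-out S {a} Sa w rewrite par-count a (flt S w) = cong odd (count-flt-out S Sa w)

ord-0ˡ : {a b : Fin k} (w : Wd k) → count a w ≡ 0 → ord a b w ≡ false
ord-0ˡ [] e = refl
ord-0ˡ {a = a} (x ∷ w) e with a ≟ᶠ x
... | no _ = ord-0ˡ w e

ord-0ʳ : {a b : Fin k} (w : Wd k) → count b w ≡ 0 → ord a b w ≡ false
ord-0ʳ [] e = refl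
ord-0ʳ {a = a} {b} (x ∷ w) e with b ≟ᶠ x
... | no _ rewrite ord-0ʳ {a = a} w e | par-count b w | e = taut 1 (λ p → (p ∧ false) xor false) (λ _ → false) tt (eqb a x)

ord-flt : (S : Side k) {a b : Fin k} → S a ≡ true → S b ≡ true → (w : Wd k) → ord a b (flt S w) ≡ ord a b w
ord-flt S Sa Sb [] = refl
ord-flt S {a} {b} Sa Sb (x ∷ w) with S x in e
... | true rewrite ord-flt S Sa Sb w | par-flt S Sb w = refl
... | false with a ≟ᶠ x
...   | yes refl = ⊥-elim (true≢false (trans (sym Sa) e))
...   | no _ = ord-flt S Sa Sb w

DO-flt : (S : Side k) (w : Wd k) → DO w → DO (flt S w)
DO-flt S w dw a with S a in e
... | false = inj₁ (count-flt-out S e w)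
... | true rewrite count-flt-in S e w = dw a

SG-flt : (S : Side k) {u v : Wd k} → SG u v → SG (flt S u) (flt S v)
SG-flt S {u} {v} (sg s o) = sg cnt go
  where
  cnt : Same (flt S u) (flt S v)
  cnt a with S a in e
  ... | true rewrite count-flt-in S e u | count-flt-in S e v = s a
  ... | false rewrite count-flt-out S e u | count-flt-out S e v = refl
  go : ∀ a b → ord a b (flt S u) ≡ ord a b (flt S v)
  go a b with S a in ea | S b in eb
  ... | true | true rewrite ord-flt S ea eb u | ord-flt S ea eb v = o a b
  ... | false | _ rewrite ord-0ˡ {b = b} (flt S u) (count-flt-out S ea u) | ord-0ˡ {b = b} (flt S v) (count-flt-out S ea v) = refl
  ... | true | false rewrite ord-0ʳ {a = a} (flt S u) (count-flt-out S eb u) | ord-0ʳ {a = a} (flt S v) (count-flt-out S eb v) = refl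

flt-all : (S : Side k) (w : Wd k) → (∀ a → count a w ≢ 0 → S a ≡ true) → flt S w ≡ w
flt-all S [] h = refl
flt-all S (x ∷ w) h rewrite h x (λ e → case trans (sym e) (count-head x w) of λ ()) =
  cong (x ∷_) (flt-all S w λ a n → h a λ e → n (lem a e))
  where
  lem : ∀ a → count a (x ∷ w) ≡ 0 → count a w ≡ 0
  lem a e with a ≟ᶠ x
  ... | no _ = e

flt-none : (S : Side k) (w : Wd k) → (∀ a → count a w ≢ 0 → S a ≡ false) → flt S w ≡ []
flt-none S [] h = refl
flt-none S (x ∷ w) h rewrite h x (λ e → case trans (sym e) (count-head x w) of λ ()) =
  flt-none S w λ a n → h a λ e → n (lem a e)
  where
  lem : ∀ a → count a (x ∷ w) ≡ 0 → count a w ≡ 0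
  lem a e with a ≟ᶠ x
  ... | no _ = e

-- Needed to lift rotations of a restricted word to the word itself, as in `≅-flt`.
flt-split : (S : Side k) (w : Wd k) {P Q : Wd k} → flt S w ≡ P ++ Q →
  ∃[ u ] ∃[ v ] (w ≡ u ++ v × flt S u ≡ P × flt S v ≡ Q)
flt-split S w {[]} {Q} e = [] , w , refl , refl , e
flt-split S [] {x ∷ P} ()
flt-split S (y ∷ w) {x ∷ P} e with S y in ey
... | false = let u , v , e1 , e2 , e3 = flt-split S w {x ∷ P} e in
  y ∷ u , v , cong (y ∷_) e1 , trans (cong (λ b → if b then y ∷ flt S u else flt S u) ey) e2 , e3
... | true with ∷-injective e
...   | refl , e' = let u , v , e1 , e2 , e3 = flt-split S w {P} e' in
  y ∷ u , v , cong (y ∷_) e1 , trans (cong (λ b → if b then y ∷ flt S u else flt S u) ey) (cong (y ∷_) e2) , e3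

length-flt : (S : Side k) (w : Wd k) → length (flt S w) ≤ length w
length-flt S [] = z≤n
length-flt S (x ∷ w) with S x
... | true = s≤s (length-flt S w)
... | false = ℕ.m≤n⇒m≤1+n (length-flt S w)

length-flt-< : (S : Side k) {a : Fin k} → S a ≡ false → (w : Wd k) → count a w ≢ 0 → length (flt S w) < length w
length-flt-< S Sa [] n = ⊥-elim (n refl)
length-flt-< S {a} Sa (x ∷ w) n with S x in e
... | false = s≤s (length-flt S w)
... | true with a ≟ᶠ x
...   | yes refl = ⊥-elim (true≢false (trans (sym e) Sa))
...   | no _ = s≤s (length-flt-< S Sa w n)

rm : Fin k → Wd k → Wd k
rm v = flt (λ x → not (eqb v x))

locate : (a : Fin k) (w : Wd k) → count a w ≢ 0 →
  ∃[ P ] ∃[ Q ] (w ≡ P ++ a ∷ Q × count a P ≡ 0 × count a w ≡ suc (count a Q))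
locate a [] n = ⊥-elim (n refl)
locate a (x ∷ w) n with a ≟ᶠ x
... | yes refl = [] , w , refl , refl , refl
... | no a≢x = let P , Q , e , c , c' = locate a w n in
  x ∷ P , Q , cong (x ∷_) e , trans (count-other a≢x P) c , c'

locate2 : (a : Fin k) (w : Wd k) → count a w ≡ 2 →
  ∃[ P ] ∃[ Q ] ∃[ R ] (w ≡ P ++ a ∷ Q ++ a ∷ R × count a P ≡ 0 × count a Q ≡ 0 × count a R ≡ 0)
locate2 a w e with locate a w (λ e₀ → case trans (sym e₀) e of λ ())
... | P , Q , refl , p0 , c with locate a Q (λ e₀ → case trans (sym e) (trans c (cong suc e₀)) of λ ())
...   | Q1 , R , refl , q0 , c' = P , Q1 , R , refl , p0 , q0 ,
  ℕ.suc-injective (ℕ.suc-injective (trans (cong suc (sym c')) (trans (sym c) e)))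

nonzero-or : (a : Fin k) (w : Wd k) → (count a w ≡ 0) ⊎ (count a w ≢ 0)
nonzero-or a w with count a w
... | zero = inj₁ refl
... | suc n = inj₂ λ ()

empty-word : (w : Wd k) → (∀ a → count a w ≡ 0) → w ≡ []
empty-word [] h = refl
empty-word (x ∷ w) h = case trans (sym (h x)) (count-head x w) of λ ()

+≡0 : ∀ {m n} → m + n ≡ 0 → m ≡ 0 × n ≡ 0
+≡0 {zero} e = refl , e

zeros : (a : Fin k) (u v : Wd k) → count a (u ++ v) ≡ 0 → count a u ≡ 0 × count a v ≡ 0
zeros a u v e = +≡0 (trans (sym (count-++ a u v)) e)

cong3 : {A B C D : Set} (f : A → B → C → D) {a a' : A} {b b' : B} {c c' : C} → a ≡ a' → b ≡ b' → c ≡ c' → f a b c ≡ f a' b' c'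
cong3 f refl refl refl = refl

-- Mutation of words

infix 4 _∼_

-- In a word with every letter twice, the parity condition says that a chord with an end in `A` or
-- `B` has its other end there as well, so `A` and `B` are the strands of a share. As `B` may be
-- empty, closed segments and the whole word can be reversed too.
data _∼_ {k} : Wd k → Wd k → Set where
  ∼refl : ∀ {u} → u ∼ u
  ∼sym : ∀ {u v} → u ∼ v → v ∼ u
  ∼trans : ∀ {u v w} → u ∼ v → v ∼ w → u ∼ w
  ∼rev : ∀ X A Y B Z → Even (A ++ B) → X ++ A ++ Y ++ B ++ Z ∼ X ++ rev A ++ Y ++ rev B ++ Z

∼≡ : {u v : Wd k} → u ≡ v → u ∼ v
∼≡ refl = ∼refl

mut : ∀ (X A Y B Z : Wd k) {u v} → Even (A ++ B) →
  u ≡ X ++ A ++ Y ++ B ++ Z → v ≡ X ++ rev A ++ Y ++ rev B ++ Z → u ∼ v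
mut X A Y B Z e refl refl = ∼rev X A Y B Z e

Even-resp : (u v : Wd k) → (∀ a → par a v ≡ par a u) → Even u → Even v
Even-resp u v h e a = trans (h a) (e a)

SG-par : {u v : Wd k} → SG u v → ∀ a → par a u ≡ par a v
SG-par {u = u} {v} g a = trans (par-count a u) (trans (cong odd (same g a)) (sym (par-count a v)))

SG-++ : {u u' v v' : Wd k} → SG u u' → SG v v' → SG (u ++ v) (u' ++ v')
SG-++ {u = u} {u'} {v} {v'} g h = sg cnt os
  where
  cnt : Same (u ++ v) (u' ++ v')
  cnt a rewrite count-++ a u v | count-++ a u' v' | same g a | same h a = refl
  os : ∀ a b → ord a b (u ++ v) ≡ ord a b (u' ++ v')
  os a b rewrite ord-++ a b u v | ord-++ a b u' v' | ords g a b | ords h a b | SG-par g a | SG-par h b = refl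

par-pair : (a : Fin k) (A B : Wd k) → Even (A ++ B) → par a B ≡ par a A
par-pair a A B e with par a A | par a B | trans (sym (par-++ a A B)) (e a)
... | true | true | _ = refl
... | false | false | _ = refl

-- Inside `A` and inside `B` the order of `a` and `b` is turned round, which by `ord-swap` adds the
-- product of their parities there. These parities are the same on `A` and on `B`, so the two
-- corrections cancel.
rev-core : (A Y B : Wd k) → Even (A ++ B) → SG (A ++ Y ++ B) (rev A ++ Y ++ rev B)
rev-core A Y B e = sg cnt os
  where
  cnt : Same (A ++ Y ++ B) (rev A ++ Y ++ rev B)
  cnt a rewrite count-++ a A (Y ++ B) | count-++ a Y B | count-++ a (rev A) (Y ++ rev B)
    | count-++ a Y (rev B) | count-reverse a A | count-reverse a B = refl
  expand : ∀ a b A' B' → ord a b (A' ++ Y ++ B') ≡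
    (ord a b A' xor ((ord a b Y xor ord a b B') xor (par a Y ∧ par b B'))) xor (par a A' ∧ (par b Y xor par b B'))
  expand a b A' B' rewrite ord-++ a b A' (Y ++ B') | ord-++ a b Y B' | par-++ b Y B' = refl
  os : ∀ a b → ord a b (A ++ Y ++ B) ≡ ord a b (rev A ++ Y ++ rev B)
  os a b with a ≟ᶠ b
  ... | yes refl rewrite expand a a A B | expand a a (rev A) (rev B)
        | ord-reverse a a A | ord-reverse a a B | par-reverse a A | par-reverse a B = refl
  ... | no a≢b rewrite expand a b A B | expand a b (rev A) (rev B)
        | ord-reverse a b A | ord-reverse a b B | par-reverse a A | par-reverse b B
        | ord-swap a≢b A | ord-swap a≢b B | par-pair a A B e | par-pair b A B e =
    taut 7 (λ oA oY oB aA aY bA bY → (oA xor ((oY xor oB) xor (aY ∧ bA))) xor (aA ∧ (bY xor bA)))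
           (λ oA oY oB aA aY bA bY → ((oA xor (aA ∧ bA)) xor ((oY xor (oB xor (aA ∧ bA))) xor (aY ∧ bA))) xor (aA ∧ (bY xor bA)))
           tt (ord a b A) (ord a b Y) (ord a b B) (par a A) (par a Y) (par b A) (par b Y)

∼-SG : {u v : Wd k} → u ∼ v → SG u v
∼-SG ∼refl = SG-refl
∼-SG (∼sym p) = SG-sym (∼-SG p)
∼-SG (∼trans p q) = SG-trans (∼-SG p) (∼-SG q)
∼-SG (∼rev X A Y B Z e) =
  subst₂ SG (ls 5 (λ x a y b z → x & (a & y & b) & z ⊜ x & a & y & b & z) refl X A Y B Z)
            (ls 5 (λ x a y b z → x & (a & y & b) & z ⊜ x & a & y & b & z) refl X (rev A) Y (rev B) Z)
            (SG-++ (SG-refl {u = X}) (SG-++ (rev-core A Y B e) (SG-refl {u = Z})))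

∼-Even : {u v : Wd k} → u ∼ v → Even u → Even v
∼-Even {u = u} {v} p = Even-resp u v λ a → sym (SG-par (∼-SG p) a)

∼-ctx : (P Q : Wd k) {u v : Wd k} → u ∼ v → P ++ u ++ Q ∼ P ++ v ++ Q
∼-ctx P Q ∼refl = ∼refl
∼-ctx P Q (∼sym p) = ∼sym (∼-ctx P Q p)
∼-ctx P Q (∼trans p q) = ∼trans (∼-ctx P Q p) (∼-ctx P Q q)
∼-ctx P Q (∼rev X A Y B Z e) = mut (P ++ X) A Y B (Z ++ Q) e
  (ls 7 (λ p x a y b z q → p & (x & a & y & b & z) & q ⊜ (p & x) & a & y & b & z & q) refl P X A Y B Z Q)
  (ls 7 (λ p x a y b z q → p & (x & a & y & b & z) & q ⊜ (p & x) & a & y & b & z & q) refl P X (rev A) Y (rev B) Z Q)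

Even-++-comm : (U V : Wd k) → Even (U ++ V) → Even (V ++ U)
Even-++-comm U V e a rewrite par-++ a V U | par-pair a U V e = taut 1 (λ x → x xor x) (λ _ → false) tt (par a U)

Even-rev2 : (U V : Wd k) → Even (U ++ V) → Even (rev U ++ rev V)
Even-rev2 U V e a rewrite par-++ a (rev U) (rev V) | par-reverse a U | par-reverse a V = trans (sym (par-++ a U V)) (e a)

∼-reverse : (w : Wd k) → Even w → w ∼ rev w
∼-reverse w e = mut [] w [] [] [] (subst Even (sym (++-identityʳ w)) e)
  (sym (++-identityʳ w)) (sym (++-identityʳ (rev w)))

-- Rotating a closed segment: reverse it as a whole, then both halves.

∼-rotate : (X U V Z : Wd k) → Even (U ++ V) → X ++ U ++ V ++ Z ∼ X ++ V ++ U ++ Z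
∼-rotate X U V Z e = ∼trans step1 step2
  where
  step1 : X ++ U ++ V ++ Z ∼ X ++ rev V ++ [] ++ rev U ++ Z
  step1 = mut X (U ++ V) [] [] Z (subst Even (sym (++-identityʳ (U ++ V))) e)
    (ls 4 (λ x u v z → x & u & v & z ⊜ x & (u & v) & z) refl X U V Z)
    (trans (ls 4 (λ x u v z → x & v & u & z ⊜ x & (v & u) & z) refl X (rev U) (rev V) Z)
           (cong (λ t → X ++ t ++ Z) (sym (reverse-++ U V))))
  step2 : X ++ rev V ++ [] ++ rev U ++ Z ∼ X ++ V ++ U ++ Z
  step2 = mut X (rev V) [] (rev U) Z (Even-rev2 V U (Even-++-comm U V e)) refl
    (cong₂ (λ s t → X ++ s ++ t ++ Z) (sym (reverse-involutive V)) (sym (reverse-involutive U)))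

∼-rot : (U V : Wd k) → Even (U ++ V) → U ++ V ∼ V ++ U
∼-rot U V e = subst₂ _∼_ (cong (U ++_) (++-identityʳ V)) (cong (V ++_) (++-identityʳ U)) (∼-rotate [] U V [] e)

reverse5 : (X A Y B Z : Wd k) →
  rev (X ++ A ++ Y ++ B ++ Z) ≡ rev Z ++ rev B ++ rev Y ++ rev A ++ rev X
reverse5 X A Y B Z
  rewrite reverse-++ X (A ++ Y ++ B ++ Z) | reverse-++ A (Y ++ B ++ Z) | reverse-++ Y (B ++ Z) | reverse-++ B Z =
  ls 5 (λ x a y b z → (((z & b) & y) & a) & x ⊜ z & b & y & a & x) refl
    (rev X) (rev A) (rev Y) (rev B) (rev Z)

par5 : (a : Fin k) (X A Y B Z : Wd k) →
  par a (X ++ A ++ Y ++ B ++ Z) ≡ par a X xor (par a A xor (par a Y xor (par a B xor par a Z)))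
par5 a X A Y B Z rewrite par-++ a X (A ++ Y ++ B ++ Z) | par-++ a A (Y ++ B ++ Z) | par-++ a Y (B ++ Z) | par-++ a B Z = refl

-- Exchanging the two strands of a share K: reverse everything, then K,
-- then the complementary share.

∼-swap : (X K Y L Z : Wd k) → Even (K ++ L) → Even (X ++ K ++ Y ++ L ++ Z) →
  X ++ K ++ Y ++ L ++ Z ∼ X ++ L ++ Y ++ K ++ Z
∼-swap {k} X K Y L Z eK eW = ∼trans s1 (∼trans s2 (∼trans s3 (∼trans s4 s5)))
  where
  eKL : Even (L ++ K)
  eKL = Even-++-comm K L eK
  rest : ∀ a → par a X xor (par a Y xor par a Z) ≡ false
  rest a with trans (sym (par5 a X K Y L Z)) (eW a)
  ... | e rewrite par-pair a K L eK = trans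
    (taut 4 (λ x k y z → x xor (y xor z)) (λ x k y z → x xor (k xor (y xor (k xor z)))) tt (par a X) (par a K) (par a Y) (par a Z)) e
  s1 : X ++ K ++ Y ++ L ++ Z ∼ rev Z ++ rev L ++ rev Y ++ rev K ++ rev X
  s1 = ∼trans (∼-reverse _ eW) (∼≡ (reverse5 X K Y L Z))
  s2 : rev Z ++ rev L ++ rev Y ++ rev K ++ rev X ∼ rev Z ++ L ++ rev Y ++ K ++ rev X
  s2 = mut (rev Z) (rev L) (rev Y) (rev K) (rev X) (Even-rev2 L K eKL) refl
    (cong₂ (λ s t → rev Z ++ s ++ rev Y ++ t ++ rev X) (sym (reverse-involutive L)) (sym (reverse-involutive K)))
  e3 : Even ((rev Z ++ L ++ rev Y ++ K) ++ rev X)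
  e3 = subst Even (ls 5 (λ z l y k x → z & l & y & k & x ⊜ (z & l & y & k) & x) refl (rev Z) L (rev Y) K (rev X))
         (∼-Even s2 (∼-Even s1 eW))
  s3 : rev Z ++ L ++ rev Y ++ K ++ rev X ∼ rev X ++ rev Z ++ L ++ rev Y ++ K
  s3 = ∼trans (∼≡ (ls 5 (λ z l y k x → z & l & y & k & x ⊜ (z & l & y & k) & x) refl (rev Z) L (rev Y) K (rev X)))
              (∼-rot (rev Z ++ L ++ rev Y ++ K) (rev X) e3)
  e4 : Even ((rev X ++ rev Z) ++ rev Y)
  e4 a rewrite par-++ a (rev X ++ rev Z) (rev Y) | par-++ a (rev X) (rev Z)
    | par-reverse a X | par-reverse a Y | par-reverse a Z =
    trans (taut 3 (λ x y z → (x xor z) xor y) (λ x y z → x xor (y xor z)) tt (par a X) (par a Y) (par a Z)) (rest a)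
  s4 : rev X ++ rev Z ++ L ++ rev Y ++ K ∼ Z ++ X ++ L ++ Y ++ K
  s4 = mut [] (rev X ++ rev Z) L (rev Y) K e4
    (ls 5 (λ x z l y k → x & z & l & y & k ⊜ (x & z) & l & y & k) refl (rev X) (rev Z) L (rev Y) K)
    (trans (ls 5 (λ x z l y k → z & x & l & y & k ⊜ (z & x) & l & y & k) refl X Z L Y K)
      (cong₂ (λ s t → s ++ L ++ t ++ K)
        (trans (sym (cong₂ _++_ (reverse-involutive Z) (reverse-involutive X))) (sym (reverse-++ (rev X) (rev Z))))
        (sym (reverse-involutive Y))))
  s5 : Z ++ X ++ L ++ Y ++ K ∼ X ++ L ++ Y ++ K ++ Z
  s5 = ∼trans (∼-rot Z (X ++ L ++ Y ++ K) (∼-Even s4 (∼-Even s3 (∼-Even s2 (∼-Even s1 eW)))))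
        (∼≡ (ls 5 (λ x l y k z → (x & l & y & k) & z ⊜ x & l & y & k & z) refl X L Y K Z))

-- Substitution of a share for a chord

-- The two words change places after each hit, so that the first end of `u` receives `K` and the
-- second one `L`.
sub : Fin k → Wd k → Wd k → Wd k → Wd k
sub u K L [] = []
sub u K L (x ∷ w) = if eqb u x then K ++ sub u L K w else x ∷ sub u K L w

sub-0 : (u : Fin k) (K L w : Wd k) → count u w ≡ 0 → sub u K L w ≡ w
sub-0 u K L [] e = refl
sub-0 u K L (x ∷ w) e with u ≟ᶠ x
... | no _ = cong (x ∷_) (sub-0 u K L w e)

sub-++⁰ : (u : Fin k) (K L P Q : Wd k) → par u P ≡ false → sub u K L (P ++ Q) ≡ sub u K L P ++ sub u K L Q
sub-++¹ : (u : Fin k) (K L P Q : Wd k) → par u P ≡ true → sub u K L (P ++ Q) ≡ sub u K L P ++ sub u L K Q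
sub-++⁰ u K L [] Q e = refl
sub-++⁰ u K L (x ∷ P) Q e with u ≟ᶠ x
... | no _ = cong (x ∷_) (sub-++⁰ u K L P Q e)
... | yes _ with par u P in p
...   | true = trans (cong (K ++_) (sub-++¹ u L K P Q p)) (sym (++-assoc K _ _))
sub-++¹ u K L (x ∷ P) Q e with u ≟ᶠ x
... | no _ = cong (x ∷_) (sub-++¹ u K L P Q e)
... | yes _ with par u P in p
...   | false = trans (cong (K ++_) (sub-++⁰ u L K P Q p)) (sym (++-assoc K _ _))

sub-1 : (u : Fin k) (K L P Q : Wd k) → count u P ≡ 0 → sub u K L (P ++ u ∷ Q) ≡ P ++ K ++ sub u L K Q
sub-1 u K L P Q p = trans (sub-++⁰ u K L P (u ∷ Q) (trans (par-count u P) (cong odd p)))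
  (cong₂ _++_ (sub-0 u K L P p) (cong (λ b → if b then K ++ sub u L K Q else u ∷ sub u K L Q) (eqb-refl u)))

sub-2 : (u : Fin k) (K L P Q R : Wd k) → count u P ≡ 0 → count u Q ≡ 0 → count u R ≡ 0 →
  sub u K L (P ++ u ∷ Q ++ u ∷ R) ≡ P ++ K ++ Q ++ L ++ R
sub-2 u K L P Q R p q r = trans (sub-1 u K L P (Q ++ u ∷ R) p)
  (cong (λ t → P ++ K ++ t) (trans (sub-1 u L K Q R q) (cong (λ t → Q ++ L ++ t) (sub-0 u K L R r))))

par-sub : (u : Fin k) (K L P Q R : Wd k) → Even (K ++ L) → Even (P ++ u ∷ Q ++ u ∷ R) → Even (P ++ K ++ Q ++ L ++ R)
par-sub u K L P Q R eK e a = trans (par5 a P K Q L R)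
  (trans (cong (λ t → par a P xor (par a K xor (par a Q xor (t xor par a R)))) (par-pair a K L eK))
  (trans (taut 5 (λ p k q r x → p xor (k xor (q xor (k xor r)))) (λ p k q r x → p xor ((x xor false) xor (q xor ((x xor false) xor r)))) tt
            (par a P) (par a K) (par a Q) (par a R) (eqb a u))
  (trans (sym (par5 a P [ u ] Q [ u ] R)) (e a))))

Twice : Fin k → Wd k → Set
Twice u w = (count u w ≡ 0) ⊎ (count u w ≡ 2)

sub-swap : (u : Fin k) (K L w : Wd k) → Even (K ++ L) → Even w → Twice u w → sub u K L w ∼ sub u L K w
sub-swap u K L w eK ew (inj₁ c) rewrite sub-0 u K L w c | sub-0 u L K w c = ∼refl
sub-swap u K L w eK ew (inj₂ c) with locate2 u w c
... | P , Q , R , refl , p , q , r rewrite sub-2 u K L P Q R p q r | sub-2 u L K P Q R p q r =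
  ∼-swap P K Q L R eK (par-sub u K L P Q R eK ew)

sub-rev : (u : Fin k) (K L w : Wd k) → Even (K ++ L) → Twice u w → sub u K L w ∼ sub u (rev K) (rev L) w
sub-rev u K L w eK (inj₁ c) rewrite sub-0 u K L w c | sub-0 u (rev K) (rev L) w c = ∼refl
sub-rev u K L w eK (inj₂ c) with locate2 u w c
... | P , Q , R , refl , p , q , r rewrite sub-2 u K L P Q R p q r | sub-2 u (rev K) (rev L) P Q R p q r =
  ∼rev P K Q L R eK

count-rev0 : (u : Fin k) (P : Wd k) → count u P ≡ 0 → count u (rev P) ≡ 0
count-rev0 u P p = trans (count-reverse u P) p

reverse-mid : (P : Wd k) (u : Fin k) (Q : Wd k) → rev (P ++ u ∷ Q) ≡ rev Q ++ u ∷ rev P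
reverse-mid P u Q = trans (reverse-++ P (u ∷ Q))
  (trans (cong (_++ rev P) (unfold-reverse u Q)) (++-assoc (rev Q) [ u ] (rev P)))

reverse3 : (P K Q : Wd k) → rev (P ++ K ++ Q) ≡ rev Q ++ rev K ++ rev P
reverse3 P K Q = trans (reverse-++ P (K ++ Q)) (trans (cong (_++ rev P) (reverse-++ K Q)) (++-assoc (rev Q) (rev K) (rev P)))

subrev-1 : (u : Fin k) (K L L' A : Wd k) → count u A ≡ 1 → sub u K L (rev A) ≡ rev (sub u (rev K) L' A)
subrev-1 u K L L' A c with locate u A (λ e → case trans (sym e) c of λ ())
... | P , Q , refl , p , c' = begin
  sub u K L (rev (P ++ u ∷ Q))            ≡⟨ cong (sub u K L) (reverse-mid P u Q) ⟩
  sub u K L (rev Q ++ u ∷ rev P)      ≡⟨ sub-1 u K L (rev Q) (rev P) (count-rev0 u Q q) ⟩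
  rev Q ++ K ++ sub u L K (rev P)     ≡⟨ cong (λ t → rev Q ++ K ++ t) (sub-0 u L K (rev P) (count-rev0 u P p)) ⟩
  rev Q ++ K ++ rev P                 ≡⟨ cong (λ t → rev Q ++ t ++ rev P) (sym (reverse-involutive K)) ⟩
  rev Q ++ rev (rev K) ++ rev P ≡⟨ sym (reverse3 P (rev K) Q) ⟩
  rev (P ++ rev K ++ Q)               ≡⟨ cong (λ t → rev (P ++ rev K ++ t)) (sym (sub-0 u L' (rev K) Q q)) ⟩
  rev (P ++ rev K ++ sub u L' (rev K) Q) ≡⟨ cong rev (sym (sub-1 u (rev K) L' P Q p)) ⟩
  rev (sub u (rev K) L' (P ++ u ∷ Q)) ∎
  where
  open ≡-Reasoning
  q : count u Q ≡ 0
  q = ℕ.suc-injective (trans (sym c') c)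

-- In the reversed word the second end of `u` comes first, which exchanges the roles of `K` and `L`.
subrev-2 : (u : Fin k) (K L A : Wd k) → count u A ≡ 2 → sub u K L (rev A) ≡ rev (sub u (rev L) (rev K) A)
subrev-2 u K L A c with locate2 u A c
... | P , Q , R , refl , p , q , r = begin
  sub u K L (rev (P ++ u ∷ Q ++ u ∷ R))   ≡⟨ cong (sub u K L) (trans (reverse5 P [ u ] Q [ u ] R) refl) ⟩
  sub u K L (rev R ++ u ∷ rev Q ++ u ∷ rev P) ≡⟨ sub-2 u K L (rev R) (rev Q) (rev P) (count-rev0 u R r) (count-rev0 u Q q) (count-rev0 u P p) ⟩
  rev R ++ K ++ rev Q ++ L ++ rev P ≡⟨ cong₂ (λ s t → rev R ++ s ++ rev Q ++ t ++ rev P) (sym (reverse-involutive K)) (sym (reverse-involutive L)) ⟩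
  rev R ++ rev (rev K) ++ rev Q ++ rev (rev L) ++ rev P ≡⟨ sym (reverse5 P (rev L) Q (rev K) R) ⟩
  rev (P ++ rev L ++ Q ++ rev K ++ R) ≡⟨ cong rev (sym (sub-2 u (rev L) (rev K) P Q R p q r)) ⟩
  rev (sub u (rev L) (rev K) (P ++ u ∷ Q ++ u ∷ R)) ∎
  where open ≡-Reasoning

count5 : (a : Fin k) (X A Y B Z : Wd k) →
  count a (X ++ A ++ Y ++ B ++ Z) ≡ count a X + (count a A + (count a Y + (count a B + count a Z)))
count5 a X A Y B Z rewrite count-++ a X (A ++ Y ++ B ++ Z) | count-++ a A (Y ++ B ++ Z) | count-++ a Y (B ++ Z) | count-++ a B Z = refl

sum5 : ∀ x a y b z → x + (a + (y + (b + z))) ≡ 2 → a + b ≡ 2 → x ≡ 0 × y ≡ 0 × z ≡ 0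
sum5 x a y b z e ab =
  let e₀ : x + (y + z) ≡ 0
      e₀ = ℕ.+-cancelˡ-≡ (a + b) _ _ (trans (rearr x a y b z) (trans e (trans (sym ab) (sym (ℕ.+-identityʳ (a + b))))))
      x0 , yz0 = +≡0 e₀
      y0 , z0 = +≡0 yz0
  in x0 , y0 , z0
  where
  rearr : ∀ x a y b z → (a + b) + (x + (y + z)) ≡ x + (a + (y + (b + z)))
  rearr = ℕRing.solve-∀

-- Numbers of ends of the substituted chord in the pieces `X`, `A`, `Y`, `B`, `Z`: it avoids the
-- strands of the share, has both ends on one of them, or one end on each.
data Dist (x a y b z : ℕ) : Set where
  none : a ≡ 0 → b ≡ 0 → Dist x a y b z
  left : a ≡ 2 → b ≡ 0 → x ≡ 0 → y ≡ 0 → z ≡ 0 → Dist x a y b z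
  right : a ≡ 0 → b ≡ 2 → x ≡ 0 → y ≡ 0 → z ≡ 0 → Dist x a y b z
  both : a ≡ 1 → b ≡ 1 → x ≡ 0 → y ≡ 0 → z ≡ 0 → Dist x a y b z

dist : ∀ x a y b z → x + (a + (y + (b + z))) ≡ 2 → odd b ≡ odd a → Dist x a y b z
dist x 0 y 0 z e o = none refl refl
dist x 2 y 0 z e o = let p , q , r = sum5 x 2 y 0 z e refl in left refl refl p q r
dist x 0 y 2 z e o = let p , q , r = sum5 x 0 y 2 z e refl in right refl refl p q r
dist x 1 y 1 z e o = let p , q , r = sum5 x 1 y 1 z e refl in both refl refl p q r
dist x (suc (suc (suc a))) y b z e o = ⊥-elim (ℕ.<-irrefl (sym e)
  (≤-trans (ℕ.m≤m+n 3 _) (≤-trans (ℕ.m≤m+n (3 + a) (y + (b + z))) (ℕ.m≤n+m _ x))))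
dist x a y (suc (suc (suc b))) z e o = ⊥-elim (ℕ.<-irrefl (sym e)
  (≤-trans (ℕ.m≤m+n 3 _) (≤-trans (ℕ.m≤m+n (3 + b) z) (≤-trans (ℕ.m≤n+m _ y) (≤-trans (ℕ.m≤n+m _ a) (ℕ.m≤n+m _ x))))))
dist x 2 y 2 z e o = ⊥-elim (ℕ.<-irrefl (sym e)
  (≤-trans (ℕ.m≤m+n 3 _) (≤-trans (ℕ.+-monoʳ-≤ 2 (≤-trans (ℕ.m≤m+n 2 z) (ℕ.m≤n+m _ y))) (ℕ.m≤n+m _ x))))

sub-five : (u : Fin k) (K L X A Y B Z : Wd k) → count u X ≡ 0 → count u Y ≡ 0 → count u Z ≡ 0 → par u A ≡ false →
  sub u K L (X ++ A ++ Y ++ B ++ Z) ≡ X ++ sub u K L A ++ Y ++ sub u K L B ++ Z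
sub-five u K L X A Y B Z x y z a = begin
  sub u K L (X ++ A ++ Y ++ B ++ Z) ≡⟨ sub-++⁰ u K L X _ (trans (par-count u X) (cong odd x)) ⟩
  sub u K L X ++ sub u K L (A ++ Y ++ B ++ Z) ≡⟨ cong₂ _++_ (sub-0 u K L X x) (sub-++⁰ u K L A _ a) ⟩
  X ++ sub u K L A ++ sub u K L (Y ++ B ++ Z) ≡⟨ cong (λ t → X ++ sub u K L A ++ t) (tail Y B Z y z K L) ⟩
  X ++ sub u K L A ++ Y ++ sub u K L B ++ Z ∎
  where
  open ≡-Reasoning
  end : ∀ B Z → count u Z ≡ 0 → ∀ K L → sub u K L (B ++ Z) ≡ sub u K L B ++ Z
  end B Z z K L with par u B in pb
  ... | true = trans (sub-++¹ u K L B Z pb) (cong (sub u K L B ++_) (sub-0 u L K Z z))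
  ... | false = trans (sub-++⁰ u K L B Z pb) (cong (sub u K L B ++_) (sub-0 u K L Z z))
  tail : ∀ Y B Z → count u Y ≡ 0 → count u Z ≡ 0 → ∀ K L → sub u K L (Y ++ B ++ Z) ≡ Y ++ sub u K L B ++ Z
  tail Y B Z y z K L = trans (sub-++⁰ u K L Y _ (trans (par-count u Y) (cong odd y))) (cong₂ _++_ (sub-0 u K L Y y) (end B Z z K L))

sub-five' : (u : Fin k) (K L X A Y B Z : Wd k) → count u X ≡ 0 → count u Y ≡ 0 → count u Z ≡ 0 → par u A ≡ true →
  sub u K L (X ++ A ++ Y ++ B ++ Z) ≡ X ++ sub u K L A ++ Y ++ sub u L K B ++ Z
sub-five' u K L X A Y B Z x y z a = begin
  sub u K L (X ++ A ++ Y ++ B ++ Z) ≡⟨ sub-++⁰ u K L X _ (trans (par-count u X) (cong odd x)) ⟩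
  sub u K L X ++ sub u K L (A ++ Y ++ B ++ Z) ≡⟨ cong₂ _++_ (sub-0 u K L X x) (sub-++¹ u K L A _ a) ⟩
  X ++ sub u K L A ++ sub u L K (Y ++ B ++ Z) ≡⟨ cong (λ t → X ++ sub u K L A ++ t)
     (sub-five u L K [] [] Y B Z refl y z refl) ⟩
  X ++ sub u K L A ++ Y ++ sub u L K B ++ Z ∎
  where open ≡-Reasoning

Even-sub : (u : Fin k) (K L A B : Wd k) → Even (K ++ L) → Even (A ++ B) → Twice u (A ++ B) → Even (sub u K L (A ++ B))
Even-sub u K L A B eK e (inj₁ c) = subst Even (sym (sub-0 u K L (A ++ B) c)) e
Even-sub u K L A B eK e (inj₂ c) with locate2 u (A ++ B) c
... | P , Q , R , eq , p , q , r rewrite eq | sub-2 u K L P Q R p q r = par-sub u K L P Q R eK e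

-- If both ends of `u` lie on one strand, reversing the strand exchanges the ends and reverses the
-- inserted words; with one end on each strand the inserted words are only reversed. These
-- discrepancies are mutations themselves, by `sub-swap` and `sub-rev`, and after them the enlarged
-- strands are reversed in one move.
sub-∼rev : (u : Fin k) (K L : Wd k) → Even (K ++ L) → (X A Y B Z : Wd k) → Even (A ++ B) →
  Twice u (X ++ A ++ Y ++ B ++ Z) → Even (X ++ A ++ Y ++ B ++ Z) →
  sub u K L (X ++ A ++ Y ++ B ++ Z) ∼ sub u K L (X ++ rev A ++ Y ++ rev B ++ Z)
sub-∼rev u K L eK X A Y B Z e (inj₁ c) _
  = subst₂ _∼_ (sym (sub-0 u K L (X ++ A ++ Y ++ B ++ Z) c))
      (sym (sub-0 u K L (X ++ rev A ++ Y ++ rev B ++ Z) (trans (sym (same (∼-SG (∼rev X A Y B Z e)) u)) c)))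
      (∼rev X A Y B Z e)
sub-∼rev {k} u K L eK X A Y B Z e tw@(inj₂ c) eW
  with dist (count u X) (count u A) (count u Y) (count u B) (count u Z) (trans (sym (count5 u X A Y B Z)) c)
            (trans (sym (par-count u B)) (trans (par-pair u A B e) (par-count u A)))
... | none a b = go X Y Z K L
  where
  piece : ∀ X W K L → sub u K L (X ++ W) ≡ sub u K L X ++ (if par u X then sub u L K W else sub u K L W)
  piece X W K L with par u X in p
  ... | true = sub-++¹ u K L X W p
  ... | false = sub-++⁰ u K L X W p
  zero-part : ∀ A W K L → count u A ≡ 0 → sub u K L (A ++ W) ≡ A ++ sub u K L W
  zero-part A W K L a = trans (sub-++⁰ u K L A W (trans (par-count u A) (cong odd a))) (cong (_++ sub u K L W) (sub-0 u K L A a))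
  tailpart : ∀ Y Z K L → ∃[ Y' ] ∃[ Z' ] (∀ A B → count u A ≡ 0 → count u B ≡ 0 → sub u K L (A ++ Y ++ B ++ Z) ≡ A ++ Y' ++ B ++ Z')
  tailpart Y Z K L = sub u K L Y , (if par u Y then sub u L K Z else sub u K L Z) , λ A B a b →
    trans (zero-part A _ K L a) (cong (A ++_) (trans (piece Y (B ++ Z) K L) (cong (sub u K L Y ++_) (fin A B b))))
    where
    fin : ∀ A B → count u B ≡ 0 → (if par u Y then sub u L K (B ++ Z) else sub u K L (B ++ Z)) ≡ B ++ (if par u Y then sub u L K Z else sub u K L Z)
    fin A B b with par u Y
    ... | true = zero-part B Z L K b
    ... | false = zero-part B Z K L b
  go : ∀ X Y Z K L → sub u K L (X ++ A ++ Y ++ B ++ Z) ∼ sub u K L (X ++ rev A ++ Y ++ rev B ++ Z)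
  go X Y Z K L with par u X in p
  ... | true = let Y' , Z' , f = tailpart Y Z L K in
        mut (sub u K L X) A Y' B Z' e
          (trans (sub-++¹ u K L X _ p) (cong (sub u K L X ++_) (f A B a b)))
          (trans (sub-++¹ u K L X _ p) (cong (sub u K L X ++_) (f (rev A) (rev B) (count-rev0 u A a) (count-rev0 u B b))))
  ... | false = let Y' , Z' , f = tailpart Y Z K L in
        mut (sub u K L X) A Y' B Z' e
          (trans (sub-++⁰ u K L X _ p) (cong (sub u K L X ++_) (f A B a b)))
          (trans (sub-++⁰ u K L X _ p) (cong (sub u K L X ++_) (f (rev A) (rev B) (count-rev0 u A a) (count-rev0 u B b))))
... | left a b x y z = ∼trans (sub-swap u K L (X ++ A ++ Y ++ B ++ Z) eK eW tw) (∼trans (sub-rev u L K (X ++ A ++ Y ++ B ++ Z) eKL tw)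
    (mut X (sub u L' K' A) Y (sub u L' K' B) Z ev (sub-five u L' K' X A Y B Z x y z pA) eq))
  where
  eKL = Even-++-comm K L eK
  K' = rev K
  L' = rev L
  pA : par u A ≡ false
  pA = trans (par-count u A) (cong odd a)
  ev : Even (sub u L' K' A ++ sub u L' K' B)
  ev = subst Even (sub-++⁰ u L' K' A B pA) (Even-sub u L' K' A B (Even-rev2 L K eKL) e (inj₂ (trans (count-++ u A B) (cong₂ _+_ a b))))
  eq : sub u K L (X ++ rev A ++ Y ++ rev B ++ Z) ≡ X ++ rev (sub u L' K' A) ++ Y ++ rev (sub u L' K' B) ++ Z
  eq = trans (sub-five u K L X (rev A) Y (rev B) Z x y z (trans (par-reverse u A) pA))
    (cong₂ (λ s t → X ++ s ++ Y ++ t ++ Z) (subrev-2 u K L A a)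
      (trans (sub-0 u K L (rev B) (count-rev0 u B b)) (cong rev (sym (sub-0 u L' K' B b)))))
... | right a b x y z = ∼trans (sub-swap u K L (X ++ A ++ Y ++ B ++ Z) eK eW tw) (∼trans (sub-rev u L K (X ++ A ++ Y ++ B ++ Z) eKL tw)
    (mut X (sub u L' K' A) Y (sub u L' K' B) Z ev (sub-five u L' K' X A Y B Z x y z pA) eq))
  where
  eKL = Even-++-comm K L eK
  K' = rev K
  L' = rev L
  pA : par u A ≡ false
  pA = trans (par-count u A) (cong odd a)
  ev : Even (sub u L' K' A ++ sub u L' K' B)
  ev = subst Even (sub-++⁰ u L' K' A B pA) (Even-sub u L' K' A B (Even-rev2 L K eKL) e (inj₂ (trans (count-++ u A B) (cong₂ _+_ a b))))
  eq : sub u K L (X ++ rev A ++ Y ++ rev B ++ Z) ≡ X ++ rev (sub u L' K' A) ++ Y ++ rev (sub u L' K' B) ++ Z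
  eq = trans (sub-five u K L X (rev A) Y (rev B) Z x y z (trans (par-reverse u A) pA))
    (cong₂ (λ s t → X ++ s ++ Y ++ t ++ Z)
      (trans (sub-0 u K L (rev A) (count-rev0 u A a)) (cong rev (sym (sub-0 u L' K' A a)))) (subrev-2 u K L B b))
... | both a b x y z = ∼trans (sub-rev u K L (X ++ A ++ Y ++ B ++ Z) eK tw)
    (mut X (sub u K' L' A) Y (sub u L' K' B) Z ev (sub-five' u K' L' X A Y B Z x y z pA) eq)
  where
  K' = rev K
  L' = rev L
  pA : par u A ≡ true
  pA = trans (par-count u A) (cong odd a)
  ev : Even (sub u K' L' A ++ sub u L' K' B)
  ev = subst Even (sub-++¹ u K' L' A B pA) (Even-sub u K' L' A B (Even-rev2 K L eK) e (inj₂ (trans (count-++ u A B) (cong₂ _+_ a b))))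
  eq : sub u K L (X ++ rev A ++ Y ++ rev B ++ Z) ≡ X ++ rev (sub u K' L' A) ++ Y ++ rev (sub u L' K' B) ++ Z
  eq = trans (sub-five' u K L X (rev A) Y (rev B) Z x y z (trans (par-reverse u A) pA))
    (cong₂ (λ s t → X ++ s ++ Y ++ t ++ Z) (subrev-1 u K L L' A a) (subrev-1 u L K K' B b))

sub-∼ : (u : Fin k) (K L : Wd k) → Even (K ++ L) → {v w : Wd k} → v ∼ w → Even v → Twice u v → sub u K L v ∼ sub u K L w
sub-∼ u K L eK ∼refl ev tv = ∼refl
sub-∼ u K L eK (∼sym p) ev tv = ∼sym (sub-∼ u K L eK p (∼-Even (∼sym p) ev) (subst (λ c → (c ≡ 0) ⊎ (c ≡ 2)) (sym (same (∼-SG p) u)) tv))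
sub-∼ u K L eK (∼trans p q) ev tv = ∼trans (sub-∼ u K L eK p ev tv)
  (sub-∼ u K L eK q (∼-Even p ev) (subst (λ c → (c ≡ 0) ⊎ (c ≡ 2)) (same (∼-SG p) u) tv))
sub-∼ u K L eK (∼rev X A Y B Z e) ev tv = sub-∼rev u K L eK X A Y B Z e tv ev

-- Two insertions of one chord into a word

++-compare : (P P' : Wd k) {S S' : Wd k} → P ++ S ≡ P' ++ S' →
  (∃[ D ] (P' ≡ P ++ D × S ≡ D ++ S')) ⊎ (∃[ D ] (P ≡ P' ++ D × S' ≡ D ++ S))
++-compare [] P' e = inj₁ (P' , refl , e)
++-compare (x ∷ P) [] e = inj₂ (x ∷ P , refl , sym e)
++-compare (x ∷ P) (y ∷ P') e with ∷-injective e
  where open import Data.List.Properties using (∷-injective)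
... | refl , e' with ++-compare P P' e'
...   | inj₁ (D , p , s) = inj₁ (D , cong (x ∷_) p , s)
...   | inj₂ (D , p , s) = inj₂ (D , cong (x ∷_) p , s)

-- The arcs cut off by the two insertions of `v` are disjoint, overlapping or nested. If both
-- insertions cross the same letters, the symmetric difference of the arcs, whose two pieces are `B`
-- and `D`, is a share.
data Moved (v : Fin k) (W T1 T2 : Wd k) : Set where
  apart : ∀ A B C D E → W ≡ A ++ B ++ C ++ D ++ E →
    T1 ≡ A ++ [ v ] ++ B ++ [ v ] ++ C ++ D ++ E → T2 ≡ A ++ B ++ C ++ [ v ] ++ D ++ [ v ] ++ E →
    Even (B ++ D) → Moved v W T1 T2
  linked : ∀ A B C D E → W ≡ A ++ B ++ C ++ D ++ E →
    T1 ≡ A ++ [ v ] ++ B ++ C ++ [ v ] ++ D ++ E → T2 ≡ A ++ B ++ [ v ] ++ C ++ D ++ [ v ] ++ E →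
    Even (B ++ D) → Moved v W T1 T2
  nested : ∀ A B C D E → W ≡ A ++ B ++ C ++ D ++ E →
    T1 ≡ A ++ [ v ] ++ B ++ C ++ D ++ [ v ] ++ E → T2 ≡ A ++ B ++ [ v ] ++ C ++ [ v ] ++ D ++ E →
    Even (B ++ D) → Moved v W T1 T2

rm-self : (v : Fin k) (w : Wd k) → rm v (v ∷ w) ≡ rm v w
rm-self v w rewrite eqb-refl v = refl

rm-0 : (v : Fin k) (w : Wd k) → count v w ≡ 0 → rm v w ≡ w
rm-0 v w c = flt-all _ w λ a n → cong not (eqb-≢ {a = v} {a} λ { refl → n c })

rm-2 : (v : Fin k) (P Q R : Wd k) → count v P ≡ 0 → count v Q ≡ 0 → count v R ≡ 0 →
  rm v (P ++ v ∷ Q ++ v ∷ R) ≡ P ++ Q ++ R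
rm-2 v P Q R p q r
  rewrite flt-++ (λ x → not (eqb v x)) P (v ∷ Q ++ v ∷ R) | rm-0 v P p | rm-self v (Q ++ v ∷ R)
  | flt-++ (λ x → not (eqb v x)) Q (v ∷ R) | rm-0 v Q q | rm-self v R | rm-0 v R r = refl

ord-2 : (v : Fin k) {a : Fin k} → a ≢ v → (P Q R : Wd k) → count v P ≡ 0 → count v Q ≡ 0 → count v R ≡ 0 →
  ord v a (P ++ v ∷ Q ++ v ∷ R) ≡ par a Q
ord-2 v {a} a≢v P Q R p q r
  rewrite ord-++ v a P (v ∷ Q ++ v ∷ R) | ord-0ˡ {b = a} P p | par-count v P | p | eqb-refl v
  | ord-++ v a Q (v ∷ R) | ord-0ˡ {b = a} Q q | par-count v Q | q | eqb-refl v | ord-0ˡ {b = a} R r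
  | par-++ a Q (v ∷ R) | eqb-≢ a≢v =
  taut 2 (λ x y → ((x xor y) xor ((y xor false) xor false)) xor false) (λ x y → x) tt (par a Q) (par a R)

ord-self : (v : Fin k) (w : Wd k) → count v w ≡ 2 → ord v v w ≡ true
ord-self v w c with locate2 v w c
... | P , Q , R , refl , p , q , r
  rewrite ord-++ v v P (v ∷ Q ++ v ∷ R) | ord-0ˡ {b = v} P p | par-count v P | p | eqb-refl v
  | ord-++ v v Q (v ∷ R) | ord-0ˡ {b = v} Q q | par-count v Q | q | eqb-refl v | ord-0ˡ {b = v} R r
  | par-count v R | r | par-++ v Q (v ∷ R) | par-count v Q | q | eqb-refl v | par-count v R | r = refl

moved : (v : Fin k) (T1 T2 : Wd k) → count v T1 ≡ 2 → count v T2 ≡ 2 → rm v T1 ≡ rm v T2 →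
  (∀ a → a ≢ v → ord v a T1 ≡ ord v a T2) → Moved v (rm v T1) T1 T2 ⊎ Moved v (rm v T1) T2 T1
moved {k} v T1 T2 c₁ c2 e oo with locate2 v T1 c₁ | locate2 v T2 c2
... | P , Q , R , refl , p , q , r | P' , Q' , R' , refl , p' , q' , r' = go
  where
  eq : P ++ Q ++ R ≡ P' ++ Q' ++ R'
  eq = trans (sym (rm-2 v P Q R p q r)) (trans e (rm-2 v P' Q' R' p' q' r'))
  W≡ : rm v (P ++ v ∷ Q ++ v ∷ R) ≡ P ++ Q ++ R
  W≡ = rm-2 v P Q R p q r
  pq : ∀ a → par a Q ≡ par a Q'
  pq a with a ≟ᶠ v
  ... | yes refl rewrite par-count a Q | par-count a Q' | q | q' = refl
  ... | no a≢v = trans (sym (ord-2 v a≢v P Q R p q r)) (trans (oo a a≢v) (ord-2 v a≢v P' Q' R' p' q' r'))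
  half : ∀ {W} P Q R P' Q' R' → W ≡ P ++ Q ++ R → (∀ a → par a Q ≡ par a Q') →
    ∀ D → P' ≡ P ++ D → Q ++ R ≡ D ++ Q' ++ R' → Moved v W (P ++ v ∷ Q ++ v ∷ R) (P' ++ v ∷ Q' ++ v ∷ R')
  half {W} P Q R _ Q' R' W≡ pq D refl e with ++-compare Q D e
  ... | inj₁ (E , refl , refl) = apart P Q E Q' R' W≡
        refl (ls 6 (λ p q e v q' r → (p & q & e) & v & q' & v & r ⊜ p & q & e & v & q' & v & r) refl P Q E [ v ] Q' R')
        λ a → trans (par-++ a Q Q') (trans (cong (_xor par a Q') (pq a)) (taut 1 (λ x → x xor x) (λ _ → false) tt (par a Q')))
  ... | inj₂ (E , refl , e') with ++-compare E Q' (sym e')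
  ...   | inj₁ (F , refl , refl) = linked P D E F R'
          (trans W≡ (ls 5 (λ p d e f r → p & (d & e) & f & r ⊜ p & d & e & f & r) refl P D E F R'))
          (ls 6 (λ p d e v f r → p & v & (d & e) & v & f & r ⊜ p & v & d & e & v & f & r) refl P D E [ v ] F R')
          (ls 6 (λ p d e v f r → (p & d) & v & (e & f) & v & r ⊜ p & d & v & e & f & v & r) refl P D E [ v ] F R')
          λ a → trans (par-++ a D F) (cancel (par a D) (par a E) (par a F)
            (trans (sym (par-++ a D E)) (trans (pq a) (par-++ a E F))))
    where
    cancel : ∀ d e f → d xor e ≡ e xor f → d xor f ≡ false
    cancel true true true _ = refl
    cancel true false true _ = refl
    cancel false true false _ = refl
    cancel false false false _ = refl
  ...   | inj₂ (F , refl , refl) = nested P D Q' F R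
          (trans W≡ (ls 5 (λ p d q f r → p & (d & q & f) & r ⊜ p & d & q & f & r) refl P D Q' F R))
          (ls 6 (λ p d q f r v → p & v & (d & q & f) & v & r ⊜ p & v & d & q & f & v & r) refl P D Q' F R [ v ])
          (ls 6 (λ p d q f r v → (p & d) & v & q & v & f & r ⊜ p & d & v & q & v & f & r) refl P D Q' F R [ v ])
          λ a → trans (par-++ a D F) (cancel (par a D) (par a Q') (par a F)
            (trans (cong (par a D xor_) (sym (par-++ a Q' F))) (trans (sym (par-++ a D (Q' ++ F))) (pq a))))
    where
    cancel : ∀ d e f → d xor (e xor f) ≡ e → d xor f ≡ false
    cancel true true true _ = refl
    cancel true false true _ = refl
    cancel false true false _ = refl
    cancel false false false _ = refl
  go : Moved v _ _ _ ⊎ Moved v _ _ _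
  go with ++-compare P P' eq
  ... | inj₁ (D , e1 , e2) = inj₁ (half P Q R P' Q' R' W≡ pq D e1 e2)
  ... | inj₂ (D , e1 , e2) = inj₂ (half P' Q' R' P Q R (trans W≡ eq) (λ a → sym (pq a)) D e1 e2)

Even-cons2 : (v : Fin k) (B D : Wd k) → Even (B ++ D) → Even ((v ∷ B) ++ v ∷ D)
Even-cons2 v B D e a rewrite par-++ a (v ∷ B) (v ∷ D) =
  trans (taut 3 (λ x b d → (x xor b) xor (x xor d)) (λ x b d → b xor d) tt (eqb a v) (par a B) (par a D))
        (trans (sym (par-++ a B D)) (e a))

Even-snoc2 : (v : Fin k) (B D : Wd k) → Even (B ++ D) → Even ((v ∷ B) ++ D ++ [ v ])
Even-snoc2 v B D e a rewrite par-++ a (v ∷ B) (D ++ [ v ]) | par-++ a D [ v ] =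
  trans (taut 3 (λ x b d → (x xor b) xor (d xor (x xor false))) (λ x b d → b xor d) tt (eqb a v) (par a B) (par a D))
        (trans (sym (par-++ a B D)) (e a))

-- Reversing the share together with the ends of `v`, and then once more without them, carries these
-- ends across `B` and `D`.
linked-∼ : (v : Fin k) (A B C D E : Wd k) → Even (B ++ D) →
  A ++ [ v ] ++ B ++ C ++ [ v ] ++ D ++ E ∼ A ++ B ++ [ v ] ++ C ++ D ++ [ v ] ++ E
linked-∼ v A B C D E e = ∼trans
  (mut A (v ∷ B) C (v ∷ D) E (Even-cons2 v B D e) refl
    (trans (ls 6 (λ a b v c d e → a & b & (v & c) & d & v & e ⊜ a & (b & v) & c & (d & v) & e) refl A (rev B) [ v ] C (rev D) E)
      (sym (cong₂ (λ s t → A ++ s ++ C ++ t ++ E) (unfold-reverse v B) (unfold-reverse v D)))))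
  (mut A (rev B) (v ∷ C) (rev D) (v ∷ E) (Even-rev2 B D e) refl
    (cong₂ (λ s t → A ++ s ++ v ∷ C ++ t ++ v ∷ E) (sym (reverse-involutive B)) (sym (reverse-involutive D))))

nested-∼ : (v : Fin k) (A B C D E : Wd k) → Even (B ++ D) →
  A ++ [ v ] ++ B ++ C ++ D ++ [ v ] ++ E ∼ A ++ B ++ [ v ] ++ C ++ [ v ] ++ D ++ E
nested-∼ v A B C D E e = ∼trans
  (mut A (v ∷ B) C (D ++ [ v ]) E (Even-snoc2 v B D e)
    (ls 6 (λ a v b c d e → a & v & b & c & d & v & e ⊜ a & (v & b) & c & (d & v) & e) refl A [ v ] B C D E)
    (trans (ls 6 (λ a b v c d e → a & b & (v & c & v) & d & e ⊜ a & (b & v) & c & (v & d) & e) refl A (rev B) [ v ] C (rev D) E)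
      (sym (cong₂ (λ s t → A ++ s ++ C ++ t ++ E) (unfold-reverse v B) (reverse-++ D [ v ])))))
  (mut A (rev B) (v ∷ C ++ [ v ]) (rev D) E (Even-rev2 B D e) refl
    (trans (ls 6 (λ a b v c d e → a & b & v & c & v & d & e ⊜ a & b & (v & c & v) & d & e) refl A B [ v ] C D E)
      (cong₂ (λ s t → A ++ s ++ (v ∷ C ++ [ v ]) ++ t ++ E) (sym (reverse-involutive B)) (sym (reverse-involutive D)))))

Moved-∼ : (v : Fin k) {W T1 T2 : Wd k} → Even T1 → Even T2 → Moved v W T1 T2 → T1 ∼ T2
Moved-∼ v e1 e2 (linked A B C D E _ refl refl e) = linked-∼ v A B C D E e
Moved-∼ v e1 e2 (nested A B C D E _ refl refl e) = nested-∼ v A B C D E e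
-- The complementary pieces `C` and `E ++ A` form a share as well. In the word rotated to start at
-- the second end of `v` the two arcs are nested, with these pieces as their difference.
Moved-∼ v e1 e2 (apart A B C D E _ refl refl e) = ∼trans
  (∼trans (∼≡ eq1) (∼-rot (A ++ [ v ] ++ B) ([ v ] ++ C ++ D ++ E) (subst Even eq1 e1)))
  (∼trans (∼≡ (ls 6 (λ a b c d e v → (v & c & d & e) & a & v & b ⊜ v & c & d & (e & a) & v & b) refl A B C D E [ v ]))
  (∼trans (nested-∼ v [] C D (E ++ A) B ev)
  (∼trans (∼≡ (ls 6 (λ a b c d e v → c & v & d & v & (e & a) & b ⊜ (c & v & d & v & e) & (a & b)) refl A B C D E [ v ]))
  (∼trans (∼sym (∼-rot (A ++ B) (C ++ [ v ] ++ D ++ [ v ] ++ E) (subst Even eq2 e2))) (∼≡ (sym eq2))))))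
  where
  eq1 : A ++ [ v ] ++ B ++ [ v ] ++ C ++ D ++ E ≡ (A ++ [ v ] ++ B) ++ [ v ] ++ C ++ D ++ E
  eq1 = ls 6 (λ a b c d e v → a & v & b & v & c & d & e ⊜ (a & v & b) & v & c & d & e) refl A B C D E [ v ]
  eq2 : A ++ B ++ C ++ [ v ] ++ D ++ [ v ] ++ E ≡ (A ++ B) ++ C ++ [ v ] ++ D ++ [ v ] ++ E
  eq2 = ls 6 (λ a b c d e v → a & b & c & v & d & v & e ⊜ (a & b) & c & v & d & v & e) refl A B C D E [ v ]
  ev : Even (C ++ E ++ A)
  ev a = trans (par-++ a C (E ++ A)) (trans (cong (par a C xor_) (par-++ a E A))
    (lem (par a A) (par a B) (par a C) (par a D) (par a E) (eqb a v)
      (trans (sym (par-++ a B D)) (e a))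
      (trans (sym (trans (par-++ a A _) (cong (par a A xor_) (trans (cong ((eqb a v) xor_) (trans (par-++ a B _)
        (cong (par a B xor_) (cong ((eqb a v) xor_) (trans (par-++ a C _) (cong (par a C xor_) (par-++ a D E))))))) refl)))) (e1 a))))
    where
    lem : ∀ x b c d e v → b xor d ≡ false → x xor (v xor (b xor (v xor (c xor (d xor e))))) ≡ false → c xor (e xor x) ≡ false
    lem x true c true e v _ h = trans (taut 4 (λ x c e v → c xor (e xor x)) (λ x c e v → x xor (v xor (true xor (v xor (c xor (true xor e)))))) tt x c e v) h
    lem x false c false e v _ h = trans (taut 4 (λ x c e v → c xor (e xor x)) (λ x c e v → x xor (v xor (false xor (v xor (c xor (false xor e)))))) tt x c e v) h

reinsert : (v : Fin k) (T1 T2 : Wd k) → Even T1 → count v T1 ≡ 2 → rm v T1 ≡ rm v T2 → SG T1 T2 → T1 ∼ T2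
reinsert v T1 T2 e c er g with moved v T1 T2 c (trans (sym (same g v)) c) er (λ a _ → ords g v a)
... | inj₁ m = Moved-∼ v e e2 m
  where e2 = Even-resp T1 T2 (λ a → sym (SG-par g a)) e
... | inj₂ m = ∼sym (Moved-∼ v e2 e m)
  where e2 = Even-resp T1 T2 (λ a → sym (SG-par g a)) e

-- Pendant and isolated chords and twins: v can be reinserted next to u.

record Del (u v : Fin k) (t : Bool) (D : Wd k) : Set where
  field
    u≢v : u ≢ v
    cu : count u D ≡ 2
    cv : count v D ≡ 2
    twin : ∀ a → a ≢ u → a ≢ v → ord v a D ≡ t ∧ ord u a D

-- Replacements for the two ends of `u`, with `v` put next to them: `t` distinguishes twins from
-- pendant or isolated chords, and `ad` says whether `v` is to cross `u`. A twin gets one end beside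
-- each end of `u`; otherwise both ends of `v` stay beside the same end of `u`.
blob1 blob2 : (u v : Fin k) (t ad : Bool) → Wd k
blob1 u v true _ = u ∷ v ∷ []
blob1 u v false true = v ∷ u ∷ v ∷ []
blob1 u v false false = v ∷ v ∷ u ∷ []
blob2 u v true true = u ∷ v ∷ []
blob2 u v true false = v ∷ u ∷ []
blob2 u v false _ = [ u ]

Even-blob : (u v : Fin k) (t ad : Bool) → Even (blob1 u v t ad ++ blob2 u v t ad)
Even-blob u v true true a = taut 2 (λ x y → x xor (y xor (x xor (y xor false)))) (λ _ _ → false) tt (eqb a u) (eqb a v)
Even-blob u v true false a = taut 2 (λ x y → x xor (y xor (y xor (x xor false)))) (λ _ _ → false) tt (eqb a u) (eqb a v)
Even-blob u v false true a = taut 2 (λ x y → y xor (x xor (y xor (x xor false)))) (λ _ _ → false) tt (eqb a u) (eqb a v)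
Even-blob u v false false a = taut 2 (λ x y → y xor (y xor (x xor (x xor false)))) (λ _ _ → false) tt (eqb a u) (eqb a v)

ord5 : (v a : Fin k) (P K Q L R : Wd k) → count v P ≡ 0 → count v Q ≡ 0 → count v R ≡ 0 →
  ord v a (P ++ K ++ Q ++ L ++ R) ≡
  (ord v a K xor (ord v a L xor (par v L ∧ par a R))) xor (par v K ∧ (par a Q xor (par a L xor par a R)))
ord5 v a P K Q L R p q r
  rewrite ord-++ v a P (K ++ Q ++ L ++ R) | ord-0ˡ {b = a} P p | par-count v P | p
  | ord-++ v a K (Q ++ L ++ R) | ord-++ v a Q (L ++ R) | ord-0ˡ {b = a} Q q | par-count v Q | q
  | ord-++ v a L R | ord-0ˡ {b = a} R r | par-++ a Q (L ++ R) | par-++ a L R =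
  taut 7 (λ oK oL vL aR vK aQ aL → ((oK xor (((oL xor false) xor (vL ∧ aR)) xor false)) xor (vK ∧ (aQ xor (aL xor aR)))) xor false)
         (λ oK oL vL aR vK aQ aL → (oK xor (oL xor (vL ∧ aR))) xor (vK ∧ (aQ xor (aL xor aR)))) tt
         (ord v a K) (ord v a L) (par v L) (par a R) (par v K) (par a Q) (par a L)

-- In the blob `v` crosses the same chords as in `D`, so it is one more insertion of `v` into
-- `rm v D` with the same graph, and `reinsert` applies.
reblob : {u v : Fin k} {t : Bool} {D : Wd k} → Even D → Del u v t D →
  D ∼ sub u (blob1 u v t (ord v u D)) (blob2 u v t (ord v u D)) (rm v D)
reblob {k} {u} {v} {t} {D} eD del with locate2 u (rm v D) (trans (count-flt-in _ (cong not (eqb-≢ (Del.u≢v del ∘ sym))) D) (Del.cu del))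
... | P , Q , R , eq , p , q , r rewrite eq | sub-2 u (blob1 u v t (ord v u D)) (blob2 u v t (ord v u D)) P Q R p q r =
  reinsert v D D* eD cv (sym rmD*) (sg cnt os)
  where
  open Del del
  ad = ord v u D
  K = blob1 u v t ad
  L = blob2 u v t ad
  D* = P ++ K ++ Q ++ L ++ R
  vuF : eqb v u ≡ false
  vuF = eqb-≢ (u≢v ∘ sym)
  uvF : eqb u v ≡ false
  uvF = eqb-≢ u≢v
  zero' : ∀ w → (∃[ x ] ∃[ y ] (rm v D ≡ x ++ w ++ y)) → count v w ≡ 0
  zero' w (x , y , e) = proj₁ (zeros v w y (proj₂ (zeros v x (w ++ y) (trans (cong (count v) (sym e)) (count-flt-out _ (cong not (eqb-refl v)) D)))))
  pv : count v P ≡ 0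
  pv = zero' P ([] , u ∷ Q ++ u ∷ R , eq)
  qv : count v Q ≡ 0
  qv = zero' Q (P ++ [ u ] , u ∷ R , trans eq (ls 4 (λ p u q r → p & u & q & r ⊜ (p & u) & q & r) refl P [ u ] Q (u ∷ R)))
  rv : count v R ≡ 0
  rv = zero' R (P ++ [ u ] ++ Q ++ [ u ] , [] , trans eq (ls 4 (λ p u q r → p & u & q & u & r ⊜ (p & u & q & u) & r & nil) refl P [ u ] Q R))
  rmK : ∀ t ad → rm v (blob1 u v t ad) ≡ [ u ]
  rmK true _ rewrite vuF | eqb-refl v = refl
  rmK false true rewrite vuF | eqb-refl v = refl
  rmK false false rewrite vuF | eqb-refl v = refl
  rmL : ∀ t ad → rm v (blob2 u v t ad) ≡ [ u ]
  rmL true true rewrite vuF | eqb-refl v = refl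
  rmL true false rewrite vuF | eqb-refl v = refl
  rmL false _ rewrite vuF = refl
  rmD* : rm v D* ≡ rm v D
  rmD* = let S = λ x → not (eqb v x) in
    trans (flt-++ S P _) (trans (cong₂ _++_ (rm-0 v P pv) (trans (flt-++ S K _) (cong₂ _++_ (rmK t ad)
      (trans (flt-++ S Q _) (cong₂ _++_ (rm-0 v Q qv) (trans (flt-++ S L R) (cong₂ _++_ (rmL t ad) (rm-0 v R rv)))))))) (sym eq))
  cKL : ∀ t ad → count v (blob1 u v t ad) + count v (blob2 u v t ad) ≡ 2
  cKL true true rewrite vuF | eqb-refl v = refl
  cKL true false rewrite vuF | eqb-refl v = refl
  cKL false true rewrite vuF | eqb-refl v = refl
  cKL false false rewrite vuF | eqb-refl v = refl
  cD* : count v D* ≡ 2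
  cD* rewrite count5 v P K Q L R | pv | qv | rv | ℕ.+-identityʳ (count v L) = cKL t ad
  cnt : Same D D*
  cnt a with a ≟ᶠ v
  ... | yes refl = trans cv (sym cD*)
  ... | no a≢v = trans (sym (count-flt-in _ (cong not (eqb-≢ (a≢v ∘ sym))) D))
                   (trans (cong (count a) (sym rmD*)) (count-flt-in _ (cong not (eqb-≢ (a≢v ∘ sym))) D*))
  eD* : Even D*
  eD* = Even-resp D D* (λ a → trans (par-count a D*) (trans (cong odd (sym (cnt a))) (sym (par-count a D)))) eD
  parK : ∀ t ad → par v (blob1 u v t ad) ≡ t
  parK true _ rewrite vuF | eqb-refl v = refl
  parK false true rewrite vuF | eqb-refl v = refl
  parK false false rewrite vuF | eqb-refl v = refl
  parL : ∀ t ad → par v (blob2 u v t ad) ≡ t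
  parL true true rewrite vuF | eqb-refl v = refl
  parL true false rewrite vuF | eqb-refl v = refl
  parL false _ rewrite vuF = refl
  inner : ∀ t ad → (ord v u (blob1 u v t ad) xor ord v u (blob2 u v t ad)) xor (t ∧ par u (blob2 u v t ad)) ≡ ad
  inner true true rewrite vuF | uvF | eqb-refl v | eqb-refl u = refl
  inner true false rewrite vuF | uvF | eqb-refl v | eqb-refl u = refl
  inner false true rewrite vuF | uvF | eqb-refl v | eqb-refl u = refl
  inner false false rewrite vuF | uvF | eqb-refl v | eqb-refl u = refl
  other : ∀ a → a ≢ u → a ≢ v → ∀ t ad → count a (blob1 u v t ad) ≡ 0 × count a (blob2 u v t ad) ≡ 0
  other a au av true true rewrite eqb-≢ au | eqb-≢ av = refl , refl
  other a au av true false rewrite eqb-≢ au | eqb-≢ av = refl , refl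
  other a au av false true rewrite eqb-≢ au | eqb-≢ av = refl , refl
  other a au av false false rewrite eqb-≢ au | eqb-≢ av = refl , refl
  ordv : ∀ a → a ≢ v → ord v a D* ≡ ord v a D
  ordv a a≢v with a ≟ᶠ u
  ... | yes refl rewrite ord5 v u P K Q L R pv qv rv | par-count u Q | q | par-count u R | r | parK t ad | parL t ad =
    trans (taut 4 (λ oK oL t pL → (oK xor (oL xor (t ∧ false))) xor (t ∧ (false xor (pL xor false)))) (λ oK oL t pL → (oK xor oL) xor (t ∧ pL)) tt
      (ord v u K) (ord v u L) t (par u L)) (inner t ad)
  ... | no a≢u with other a a≢u a≢v t ad
  ...   | k0 , l0 rewrite ord5 v a P K Q L R pv qv rv | ord-0ʳ {a = v} K k0 | ord-0ʳ {a = v} L l0 | par-count a L | l0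
          | parK t ad | parL t ad =
    trans (taut 3 (λ t aQ aR → (t ∧ aR) xor (t ∧ (aQ xor aR))) (λ t aQ aR → t ∧ aQ) tt t (par a Q) (par a R))
      (trans (cong (t ∧_) (trans (sym (ord-2 u a≢u P Q R p q r)) (trans (cong (ord u a) (sym eq))
         (ord-flt _ (cong not (eqb-≢ (u≢v ∘ sym))) (cong not (eqb-≢ (a≢v ∘ sym))) D)))) (sym (twin a a≢u a≢v)))
  os : ∀ a b → ord a b D ≡ ord a b D*
  os a b with a ≟ᶠ v | b ≟ᶠ v
  ... | yes refl | yes refl = trans (ord-self v D cv) (sym (ord-self v D* cD*))
  ... | yes refl | no b≢v = sym (ordv b b≢v)
  ... | no a≢v | yes refl rewrite ord-swap (a≢v ∘ sym) D | ord-swap (a≢v ∘ sym) D* | eD v | eD* v | ordv a a≢v = refl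
  ... | no a≢v | no b≢v =
    let Sa = cong not (eqb-≢ (a≢v ∘ sym)) ; Sb = cong not (eqb-≢ (b≢v ∘ sym)) in
    trans (sym (ord-flt _ Sa Sb D)) (trans (cong (ord a b) (sym rmD*)) (ord-flt _ Sa Sb D*))

Del-resp : {u v : Fin k} {t : Bool} {D D' : Wd k} → SG D D' → Del u v t D → Del u v t D'
Del-resp {u = u} {v} {t} g del = record { u≢v = u≢v ; cu = trans (sym (same g u)) cu ; cv = trans (sym (same g v)) cv
    ; twin = λ a au av → trans (sym (ords g v a)) (trans (twin a au av) (cong (t ∧_) (ords g u a))) }
  where open Del del

-- Substitution of a blob for `u` turns a mutation between the shortened words into one between the
-- original words. The blob is the same for both, since it depends only on whether `u` and `v`
-- cross.
delete-step : {u v : Fin k} {t : Bool} (D1 D2 : Wd k) → Even D1 → SG D1 D2 → Del u v t D1 → rm v D1 ∼ rm v D2 → D1 ∼ D2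
delete-step {u = u} {v} {t} D1 D2 e1 g del ih = ∼trans (reblob e1 del)
  (∼trans (sub-∼ u (blob1 u v t _) (blob2 u v t _) (Even-blob u v t _) ih er
     (inj₂ (trans (count-flt-in _ (cong not (eqb-≢ (Del.u≢v del ∘ sym))) D1) (Del.cu del))))
  (∼sym (subst (λ z → D2 ∼ sub u (blob1 u v t z) (blob2 u v t z) (rm v D2)) (sym (ords g v u))
     (reblob (Even-resp D1 D2 (λ a → sym (SG-par g a)) e1) (Del-resp g del)))))
  where
  er : Even (rm v D1)
  er a with eqb v a in e
  ... | true = par-flt-out _ (cong not e) D1
  ... | false = trans (par-flt _ (cong not e) D1) (e1 a)

-- Words with a disconnected intersection graph

Mono : Side k → Bool → Wd k → Set
Mono S s = All (λ x → S x ≡ s)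

Mono-in : (S : Side k) {s : Bool} (w : Wd k) → Mono S s w → ∀ a → count a w ≢ 0 → S a ≡ s
Mono-in S [] [] a n = ⊥-elim (n refl)
Mono-in S (x ∷ w) (e ∷ m) a n with a ≟ᶠ x
... | yes refl = e
... | no _ = Mono-in S w m a n

in-Mono : (S : Side k) {s : Bool} (w : Wd k) → (∀ a → count a w ≢ 0 → S a ≡ s) → Mono S s w
in-Mono S [] h = []
in-Mono S (x ∷ w) h = h x (λ e → case trans (sym e) (count-head x w) of λ ()) ∷ in-Mono S w λ a n → h a λ e → n (lem a e)
  where
  lem : ∀ a → count a (x ∷ w) ≡ 0 → count a w ≡ 0
  lem a e with a ≟ᶠ x
  ... | no _ = e

Mono-out : (S : Side k) {s : Bool} (w : Wd k) → Mono S s w → ∀ a → S a ≢ s → count a w ≡ 0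
Mono-out S w m a n with nonzero-or a w
... | inj₁ e = e
... | inj₂ e = ⊥-elim (n (Mono-in S w m a e))

≢⇒≡not : ∀ {a b} → a ≢ b → a ≡ not b
≢⇒≡not {true} {true} n = ⊥-elim (n refl)
≢⇒≡not {true} {false} n = refl
≢⇒≡not {false} {true} n = refl
≢⇒≡not {false} {false} n = ⊥-elim (n refl)

not≢ : ∀ {b} → not b ≢ b
not≢ {true} ()
not≢ {false} ()

run : (S : Side k) (s : Bool) (w : Wd k) →
  ∃[ T ] ∃[ R ] (w ≡ T ++ R × Mono S s T × ((R ≡ []) ⊎ (∃[ y ] ∃[ R' ] (R ≡ y ∷ R' × S y ≡ not s))))
run S s [] = [] , [] , refl , [] , inj₁ refl
run S s (x ∷ w) with S x ≟ᵇ s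
... | no n = [] , x ∷ w , refl , [] , inj₂ (x , w , refl , ≢⇒≡not n)
... | yes e = let T , R , eq , m , r = run S s w in x ∷ T , R , cong (x ∷_) eq , e ∷ m , r

even? : (w : Wd k) → Even w ⊎ ∃[ a ] (par a w ≡ true)
even? {k} w with all? (λ a → par a w ≟ᵇ false)
... | yes e = inj₁ e
... | no n with ¬∀⟶∃¬ k (λ a → par a w ≡ false) (λ a → par a w ≟ᵇ false) n
...   | a , p = inj₂ (a , ≢⇒≡not p)

par⇒count : (a : Fin k) (w : Wd k) → par a w ≡ true → count a w ≢ 0
par⇒count a w e c = true≢false (trans (sym e) (trans (par-count a w) (cong odd c)))

NonCrossing : Side k → Wd k → Set
NonCrossing S D = ∀ a b → S a ≢ S b → ord a b D ≡ false

one-one : ∀ {m n} → odd m ≡ true → odd n ≡ true → m + n ≤ 2 → m ≡ 1 × n ≡ 1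
one-one {1} {1} _ _ _ = refl , refl
one-one {suc (suc (suc m))} _ _ (s≤s (s≤s ()))
one-one {1} {suc (suc (suc n))} _ _ (s≤s (s≤s ()))

count-part : (a : Fin k) (P w Q : Wd k) → count a w ≤ count a (P ++ w ++ Q)
count-part a P w Q rewrite count-++ a P (w ++ Q) | count-++ a w Q = ≤-trans (ℕ.m≤m+n _ (count a Q)) (ℕ.m≤n+m _ (count a P))

head-in : {z a : Fin k} (R1 : Wd k) {R2 R″ : Wd k} → R1 ++ a ∷ R2 ≡ z ∷ R″ → z ≢ a → count z R1 ≢ 0
head-in [] e z≢a = ⊥-elim (z≢a (sym (proj₁ (∷-injective e))))
head-in {z = z} (x ∷ R1) e z≢a c with ∷-injective e
... | refl , _ = case trans (sym c) (count-head z R1) of λ ()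

-- A minimal interval argument: the first maximal monochromatic run inside
-- an interval is either closed or contains an endpoint of a chord cutting
-- off a shorter interval.

closed-run : (n : ℕ) (S : Side k) (D : Wd k) → DO D → NonCrossing S D →
  ∀ s U M Z → D ≡ U ++ M ++ Z → length M ≤ n → (∀ a → S a ≡ s → par a M ≡ false) → ∀ t → S t ≡ s → count t M ≢ 0 →
  ∃[ s' ] ∃[ U' ] ∃[ T ] ∃[ Z' ] (D ≡ U' ++ T ++ Z' × Even T × T ≢ [] × Mono S s' T)
closed-run zero S D dD nc s U [] Z eD len cl t St nt = ⊥-elim (nt refl)
closed-run (suc n) S D dD nc s U M Z eD len cl t St nt with run S (not s) M
... | M0 , R , refl , m0 , inj₁ refl = ⊥-elim (nt (trans (count-++ t M0 []) (cong (_+ 0) (Mono-out S M0 m0 t (λ e → not≢ (trans (sym e) St))))))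
... | M0 , _ , refl , m0 , inj₂ (y , R' , refl , Sy) with run S s R'
...   | T0 , R , refl , m , r = go (even? T)
  where
  T = y ∷ T0
  Sy' : S y ≡ s
  Sy' = trans Sy (notnot s)
    where
    notnot : ∀ b → not (not b) ≡ b
    notnot true = refl
    notnot false = refl
  mT : Mono S s T
  mT = Sy' ∷ m
  eqM : M0 ++ T ++ R ≡ M0 ++ T ++ R
  eqM = refl
  go : Even T ⊎ (∃[ a ] (par a T ≡ true)) → ∃[ s' ] ∃[ U' ] ∃[ T ] ∃[ Z' ] (D ≡ U' ++ T ++ Z' × Even T × T ≢ [] × Mono S s' T)
  go (inj₁ e) = s , U ++ M0 , T , R ++ Z ,
    trans eD (ls 5 (λ u m t r z → u & (m & t & r) & z ⊜ (u & m) & t & r & z) refl U M0 T R Z) , e , (λ ()) , mT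
  go (inj₂ (a , pa)) with locate a T (par⇒count a T pa) | locate a R (par⇒count a R pR)
    where
    Sa : S a ≡ s
    Sa = Mono-in S T mT a (par⇒count a T pa)
    a0 : count a M0 ≡ 0
    a0 = Mono-out S M0 m0 a (λ e → not≢ (trans (sym e) Sa))
    pR : par a R ≡ true
    pR with cl a Sa
    ... | e rewrite par-++ a M0 (T ++ R) | par-count a M0 | a0 | par-++ a T R | pa with par a R
    ...   | true = refl
  ... | T1 , T2 , eT , t1 , ct | R1 , R2 , eR , r1 , cr = cut r
    where
    Sa : S a ≡ s
    Sa = Mono-in S T mT a (par⇒count a T pa)
    pR : par a R ≡ true
    pR with cl a Sa
    ... | e rewrite par-++ a M0 (T ++ R) | par-count a M0 | Mono-out S M0 m0 a (λ e → not≢ (trans (sym e) Sa)) | par-++ a T R | pa with par a R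
    ...   | true = refl
    a≤2 : count a D ≤ 2
    a≤2 with dD a
    ... | inj₁ e = ≤-trans (≤-reflexive e) z≤n
    ... | inj₂ e = ≤-reflexive e
    eqD0 : D ≡ (U ++ M0) ++ (T ++ R) ++ Z
    eqD0 = trans eD (ls 5 (λ u m t r z → u & (m & t & r) & z ⊜ (u & m) & (t & r) & z) refl U M0 T R Z)
    total : count a T + count a R ≤ 2
    total = ≤-trans (≤-reflexive (sym (count-++ a T R)))
      (≤-trans (count-part a (U ++ M0) (T ++ R) Z) (≤-trans (≤-reflexive (cong (count a) (sym eqD0))) a≤2))
    ones : count a T ≡ 1 × count a R ≡ 1
    ones = one-one (trans (sym (par-count a T)) pa) (trans (sym (par-count a R)) pR) total
    t2 : count a T2 ≡ 0
    t2 = ℕ.suc-injective (trans (sym ct) (proj₁ ones))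
    r2 : count a R2 ≡ 0
    r2 = ℕ.suc-injective (trans (sym cr) (proj₂ ones))
    Pre = U ++ M0 ++ T1
    M' = T2 ++ R1
    Post = R2 ++ Z
    eqD : D ≡ Pre ++ [ a ] ++ M' ++ [ a ] ++ Post
    eqD = trans eD (trans (cong₂ (λ t r → U ++ (M0 ++ t ++ r) ++ Z) eT eR)
      (ls 8 (λ u m t1 a t2 r1 r2 z → u & (m & (t1 & a & t2) & (r1 & a & r2)) & z ⊜ (u & m & t1) & a & (t2 & r1) & a & r2 & z) refl
        U M0 T1 [ a ] T2 R1 R2 Z))
    cM' : count a M' ≡ 0
    cM' = trans (count-++ a T2 R1) (cong₂ _+_ t2 r1)
    cD : count a D ≡ 2
    cD with dD a
    ... | inj₂ e = e
    ... | inj₁ e = ⊥-elim (par⇒count a T pa (proj₁ (zeros a T R (ℕ.n≤0⇒n≡0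
          (≤-trans (count-part a (U ++ M0) (T ++ R) Z) (≤-reflexive (trans (cong (count a) (sym eqD0)) e)))))))
    outer : count a Pre + (1 + (count a M' + (1 + count a Post))) ≡ 2
    outer = trans (sym (trans (count5 a Pre [ a ] M' [ a ] Post) (cong (λ z → count a Pre + (z + (count a M' + (z + count a Post)))) (count-head a []))))
      (trans (cong (count a) (sym eqD)) cD)
    zs = sum5 (count a Pre) 1 (count a M') 1 (count a Post) outer refl
    -- Letters of the other side do not cross `a`, so the interval between the ends of `a` is closed
    -- for them, and the search goes on there with the sides exchanged.
    closed : ∀ b → S b ≡ not s → par b M' ≡ false
    closed b Sb = trans (sym (ord-2 a b≢a Pre M' Post (proj₁ zs) cM' (proj₂ (proj₂ zs))))
      (trans (cong (ord a b) (sym eqD)) (nc a b λ e → not≢ (trans (sym Sb) (trans (sym e) Sa))))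
      where
      b≢a : b ≢ a
      b≢a refl = not≢ (trans (sym Sb) Sa)
    shorter : length M' ≤ n
    shorter = ℕ.≤-pred (≤-trans lem len)
      where
      arith : ∀ m t1 t2 r1 r2 → suc (t2 + r1) + (m + t1 + 1 + r2) ≡ m + ((t1 + suc t2) + (r1 + suc r2))
      arith = ℕRing.solve-∀
      len≡ : length (M0 ++ T ++ R) ≡ length M0 + ((length T1 + suc (length T2)) + (length R1 + suc (length R2)))
      len≡ = trans (length-++ M0) (cong (length M0 +_) (trans (length-++ T)
        (cong₂ _+_ (trans (cong length eT) (length-++ T1)) (trans (cong length eR) (length-++ R1)))))
      lem : suc (length M') ≤ length (M0 ++ T ++ R)
      lem = ≤-trans (≤-reflexive (cong suc (length-++ T2)))
        (≤-trans (ℕ.m≤m+n _ (length M0 + length T1 + 1 + length R2))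
          (≤-reflexive (trans (arith (length M0) (length T1) (length T2) (length R1) (length R2)) (sym len≡))))
    cut : ((R ≡ []) ⊎ (∃[ y ] ∃[ R″ ] (R ≡ y ∷ R″ × S y ≡ not s))) → _
    cut (inj₁ refl) = ⊥-elim (par⇒count a R pR refl)
    cut (inj₂ (z , R″ , eR″ , Sz)) = closed-run n S D dD nc (not s) (Pre ++ [ a ]) M' ([ a ] ++ Post)
      (trans eqD (ls 4 (λ p a m q → p & a & m & a & q ⊜ (p & a) & m & a & q) refl Pre [ a ] M' Post)) shorter closed
      z Sz λ e → head-in R1 (trans (sym eR) eR″) (λ { refl → not≢ (trans (sym Sz) Sa) })
        (proj₂ (zeros z T2 R1 e))

Even-++⁻ʳ : (u v : Wd k) → Even (u ++ v) → Even u → Even v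
Even-++⁻ʳ u v e eu a = trans (par-pair a u v e) (eu a)

Even-split : (S : Side k) (P Q : Wd k) → Mono S true P → Mono S false Q → Even (P ++ Q) → Even P
Even-split S P Q mP mQ e a with S a in Sa
... | true rewrite par-count a P = trans (cong odd (sym (trans (count-++ a P Q)
      (trans (cong (count a P +_) (Mono-out S Q mQ a λ f → true≢false (trans (sym Sa) f))) (ℕ.+-identityʳ _)))))
      (trans (sym (par-count a (P ++ Q))) (e a))
... | false = trans (par-count a P) (cong odd (Mono-out S P mP a λ f → true≢false (trans (sym f) Sa)))

∼-length : {u v : Wd k} → u ∼ v → length u ≡ length v
∼-length ∼refl = refl
∼-length (∼sym p) = sym (∼-length p)
∼-length (∼trans p q) = trans (∼-length p) (∼-length q)
∼-length (∼rev X A Y B Z e)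
  rewrite length-++ X {A ++ Y ++ B ++ Z} | length-++ A {Y ++ B ++ Z} | length-++ Y {B ++ Z} | length-++ B {Z}
  | length-++ X {rev A ++ Y ++ rev B ++ Z} | length-++ (rev A) {Y ++ rev B ++ Z} | length-++ Y {rev B ++ Z}
  | length-++ (rev B) {Z} | length-reverse A | length-reverse B = refl

even-DO : (u v : Wd k) → DO (u ++ v) → Even u → ∀ a → (count a u ≡ 0) ⊎ (count a v ≡ 0)
even-DO u v d e a with count a u in cu | count a v in cv
... | zero | _ = inj₁ refl
... | suc _ | zero = inj₂ refl
... | suc m | suc n = ⊥-elim (go (d a))
  where
  c : count a (u ++ v) ≡ suc m + suc n
  c = trans (count-++ a u v) (cong₂ _+_ cu cv)
  odd-suc : ∀ m n → suc m + suc n ≡ 2 → odd (suc m) ≢ false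
  odd-suc zero zero _ ()
  odd-suc zero (suc n) ()
  odd-suc (suc zero) n ()
  odd-suc (suc (suc m)) n ()
  go : ¬ ((count a (u ++ v) ≡ 0) ⊎ (count a (u ++ v) ≡ 2))
  go (inj₁ z) = case trans (sym c) z of λ ()
  go (inj₂ z) = odd-suc m n (trans (sym c) z) (trans (cong odd (sym cu)) (trans (sym (par-count a u)) (e a)))

DO-++⁻ʳ : (u v : Wd k) → DO (u ++ v) → Even u → DO v
DO-++⁻ʳ u v d e a with even-DO u v d e a
... | inj₂ z = inj₁ z
... | inj₁ z = subst (λ c → (c ≡ 0) ⊎ (c ≡ 2)) (trans (count-++ a u v) (cong (_+ count a v) z)) (d a)

NonCrossing-resp : {S : Side k} {u v : Wd k} → SG u v → NonCrossing S u → NonCrossing S v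
NonCrossing-resp g nc a b n = trans (sym (ords g a b)) (nc a b n)

-- A closed monochromatic segment is rotated to the front and the remaining word is sorted by
-- induction. If the segment belongs to the side `false`, it still has to pass the block `P`, which
-- is closed too, so that the two can be rotated past each other.
separate : (n : ℕ) (S : Side k) (D : Wd k) → length D ≤ n → DO D → NonCrossing S D →
  ∃[ P ] ∃[ Q ] (D ∼ P ++ Q × Mono S true P × Mono S false Q)
separate {k} n S D len dD nc with all? (λ a → present? a true) | all? (λ a → present? a false)
  where
  present? : ∀ a s → Dec (count a D ≢ 0 → S a ≡ s)
  present? a s with nonzero-or a D | S a ≟ᵇ s
  ... | inj₁ e | _ = yes λ n → ⊥-elim (n e)
  ... | inj₂ _ | yes e = yes λ _ → e
  ... | inj₂ n | no ne = no λ f → ne (f n)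
... | yes allT | _ = D , [] , ∼≡ (sym (++-identityʳ D)) , in-Mono S D allT , []
... | no _ | yes allF = [] , D , ∼refl , [] , in-Mono S D allF
separate {k} zero S [] len dD nc | no nT | no nF = ⊥-elim (nT λ a n → ⊥-elim (n refl))
separate {k} (suc n) S D len dD nc | no nT | no nF = go
  (closed-run (length D) S D dD nc true [] D [] (sym (++-identityʳ D)) ≤-refl (λ a _ → eD a) (proj₁ wit) (proj₁ (proj₂ wit)) (proj₂ (proj₂ wit)))
  where
  eD : Even D
  eD = DO⇒Even D dD
  wit : ∃[ a ] (S a ≡ true × count a D ≢ 0)
  wit with ¬∀⟶∃¬ k (λ a → count a D ≢ 0 → S a ≡ false) dec nF
    where
    dec : ∀ a → Dec (count a D ≢ 0 → S a ≡ false)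
    dec a with nonzero-or a D | S a ≟ᵇ false
    ... | inj₁ e | _ = yes λ n → ⊥-elim (n e)
    ... | inj₂ _ | yes e = yes λ _ → e
    ... | inj₂ n | no ne = no λ f → ne (f n)
  ... | a , na = a , ≢⇒≡not (λ e → na λ _ → e) , λ z → na λ nz → ⊥-elim (nz z)
  go : ∃[ s' ] ∃[ U ] ∃[ T ] ∃[ Z ] (D ≡ U ++ T ++ Z × Even T × T ≢ [] × Mono S s' T) → ∃[ P ] ∃[ Q ] (D ∼ P ++ Q × Mono S true P × Mono S false Q)
  go (s , U , T , Z , eq , eT , T≢ , mT) = finish s mT (separate n S D' len' dD' nc')
    where
    D' = Z ++ U
    rotated : D ∼ T ++ D'
    rotated = ∼trans (∼≡ eq) (∼trans (∼-rot U (T ++ Z) (subst Even eq eD)) (∼≡ (++-assoc T Z U)))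
    dTD' : DO (T ++ D')
    dTD' = SG-DO (∼-SG rotated) dD
    dD' : DO D'
    dD' = DO-++⁻ʳ T D' dTD' eT
    len' : length D' ≤ n
    len' = ℕ.≤-pred (≤-trans (shorter T T≢) (≤-trans (≤-reflexive (trans (sym (length-++ T)) (sym (∼-length rotated)))) len))
      where
      shorter : ∀ T → T ≢ [] → suc (length D') ≤ length T + length D'
      shorter [] n = ⊥-elim (n refl)
      shorter (x ∷ T) _ = s≤s (ℕ.m≤n+m _ (length T))
    nc' : NonCrossing S D'
    nc' a b n with even-DO T D' dTD' eT a
    ... | inj₂ z = ord-0ˡ D' z
    ... | inj₁ z with trans (sym (ord-++ a b T D')) (NonCrossing-resp (∼-SG rotated) nc a b n)
    ...   | e rewrite ord-0ˡ {b = b} T z | par-count a T | z with ord a b D'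
    ...     | false = refl
    finish : ∀ s → Mono S s T → ∃[ P ] ∃[ Q ] (D' ∼ P ++ Q × Mono S true P × Mono S false Q) → ∃[ P ] ∃[ Q ] (D ∼ P ++ Q × Mono S true P × Mono S false Q)
    finish true mT (P , Q , p , mP , mQ) = T ++ P , Q ,
      ∼trans rotated (∼trans (subst₂ _∼_ (cong (T ++_) (++-identityʳ D')) (cong (T ++_) (++-identityʳ (P ++ Q))) (∼-ctx T [] p)) (∼≡ (sym (++-assoc T P Q)))) ,
      All.++⁺ mT mP , mQ
    finish false mT (P , Q , p , mP , mQ) = P , T ++ Q ,
      ∼trans rotated (∼trans (subst₂ _∼_ (cong (T ++_) (++-identityʳ D')) (cong (T ++_) (++-identityʳ (P ++ Q))) (∼-ctx T [] p))
        (∼-rotate [] T P Q eTP)) , mP , All.++⁺ mT mQ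
      where
      eP : Even P
      eP = Even-split S P Q mP mQ (∼-Even p (DO⇒Even D' dD'))
      eTP : Even (T ++ P)
      eTP a rewrite par-++ a T P | eT a = eP a

flt-Mono : (S : Side k) (P Q : Wd k) → Mono S true P → Mono S false Q → flt S (P ++ Q) ≡ P
flt-Mono S P Q mP mQ = trans (flt-++ S P Q) (trans (cong₂ _++_ (flt-all S P (Mono-in S P mP)) (flt-none S Q (Mono-in S Q mQ))) (++-identityʳ P))

flt-Mono' : (S : Side k) (P Q : Wd k) → Mono S true P → Mono S false Q → flt (not ∘ S) (P ++ Q) ≡ Q
flt-Mono' S P Q mP mQ = trans (flt-++ (not ∘ S) P Q) (cong₂ _++_ (flt-none (not ∘ S) P λ a n → cong not (Mono-in S P mP a n)) (flt-all (not ∘ S) Q λ a n → cong not (Mono-in S Q mQ a n)))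

-- After sorting, the two blocks are the restrictions of the words to the two sides. They have the
-- same graphs and are shorter, because both sides are inhabited.
split-step : (S : Side k) (D1 D2 : Wd k) → DO D1 → SG D1 D2 → NonCrossing S D1 →
  ∃[ a ] (S a ≡ true × count a D1 ≢ 0) → ∃[ a ] (S a ≡ false × count a D1 ≢ 0) →
  (∀ u v → length u < length D1 → DO u → SG u v → u ∼ v) → D1 ∼ D2
split-step S D1 D2 dD g nc (a , Sa , ca) (b , Sb , cb) ih
  with separate (length D1) S D1 ≤-refl dD nc | separate (length D2) S D2 ≤-refl (SG-DO g dD) (NonCrossing-resp g nc)
... | P1 , Q1 , p1 , mP1 , mQ1 | P2 , Q2 , p2 , mP2 , mQ2 =
  ∼trans p1 (∼trans (∼-ctx [] Q1 P∼) (∼trans (subst₂ _∼_ (cong (P2 ++_) (++-identityʳ Q1)) (cong (P2 ++_) (++-identityʳ Q2)) (∼-ctx P2 [] Q∼)) (∼sym p2)))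
  where
  g' : SG (P1 ++ Q1) (P2 ++ Q2)
  g' = SG-trans (SG-sym (∼-SG p1)) (SG-trans g (∼-SG p2))
  d1 : DO (P1 ++ Q1)
  d1 = SG-DO (∼-SG p1) dD
  P∼ : P1 ∼ P2
  P∼ = ih P1 P2 (subst₂ _<_ (cong length (flt-Mono S P1 Q1 mP1 mQ1)) (sym (∼-length p1))
        (length-flt-< S Sb (P1 ++ Q1) (λ e → cb (trans (same (∼-SG p1) b) e))))
      (subst DO (flt-Mono S P1 Q1 mP1 mQ1) (DO-flt S (P1 ++ Q1) d1))
      (subst₂ SG (flt-Mono S P1 Q1 mP1 mQ1) (flt-Mono S P2 Q2 mP2 mQ2) (SG-flt S g'))
  Q∼ : Q1 ∼ Q2
  Q∼ = ih Q1 Q2 (subst₂ _<_ (cong length (flt-Mono' S P1 Q1 mP1 mQ1)) (sym (∼-length p1))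
        (length-flt-< (not ∘ S) (cong not Sa) (P1 ++ Q1) (λ e → ca (trans (same (∼-SG p1) a) e))))
      (subst DO (flt-Mono' S P1 Q1 mP1 mQ1) (DO-flt (not ∘ S) (P1 ++ Q1) d1))
      (subst₂ SG (flt-Mono' S P1 Q1 mP1 mQ1) (flt-Mono' S P2 Q2 mP2 mQ2) (SG-flt (not ∘ S) g'))

-- Edge cuts of the 4-regular graph

-- The number of places where the cyclic word w passes from one side of
-- the bipartition S to the other.

jump : Bool → Bool → ℕ
jump b c = if b xor c then 1 else 0

path : Side k → Bool → Wd k → Bool → ℕ
path S b [] c = jump b c
path S b (x ∷ w) c = jump b (S x) + path S (S x) w c

cut : Side k → Wd k → ℕ
cut S [] = 0
cut S (x ∷ w) = path S (S x) w (S x)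

jump-refl : ∀ b → jump b b ≡ 0
jump-refl true = refl
jump-refl false = refl

jump-sym : ∀ b c → jump b c ≡ jump c b
jump-sym true true = refl
jump-sym true false = refl
jump-sym false true = refl
jump-sym false false = refl

jump-tri : ∀ a b c → jump a c ≤ jump a b + jump b c
jump-tri true true c = ≤-refl
jump-tri false false c = ≤-refl
jump-tri true false true = z≤n
jump-tri true false false = s≤s z≤n
jump-tri false true true = s≤s z≤n
jump-tri false true false = z≤n

path-tri : (S : Side k) (a b : Bool) (w : Wd k) (c : Bool) → path S a w c ≤ jump a b + path S b w c
path-tri S a b [] c = jump-tri a b c
path-tri S a b (x ∷ w) c = ≤-trans (ℕ.+-monoˡ-≤ _ (jump-tri a b (S x))) (≤-reflexive (ℕ.+-assoc (jump a b) _ _))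

path-split : (S : Side k) (b : Bool) (u : Wd k) (x : Fin k) (w : Wd k) (c : Bool) →
  path S b (u ++ x ∷ w) c ≡ path S b u (S x) + path S (S x) w c
path-split S b [] x w c = refl
path-split S b (y ∷ u) x w c = trans (cong (jump b (S y) +_) (path-split S (S y) u x w c)) (sym (ℕ.+-assoc (jump b (S y)) _ _))

path-reverse : (S : Side k) (b : Bool) (w : Wd k) (c : Bool) → path S b (rev w) c ≡ path S c w b
path-reverse S b [] c = jump-sym b c
path-reverse S b (x ∷ w) c rewrite unfold-reverse x w | path-split S b (rev w) x [] c | path-reverse S b w (S x) =
  trans (ℕ.+-comm _ (jump (S x) c)) (cong (_+ path S (S x) w b) (jump-sym (S x) c))

path-mono : (S : Side k) {s : Bool} (b : Bool) (u w : Wd k) (c : Bool) → Mono S s u → path S b (u ++ w) c ≤ jump b s + path S s w c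
path-mono S b [] w c [] = path-tri S b _ w c
path-mono S {s} b (x ∷ u) w c (refl ∷ m) = ℕ.+-monoʳ-≤ (jump b (S x))
  (≤-trans (path-mono S (S x) u w c m) (≤-reflexive (cong (_+ path S (S x) w c) (jump-refl (S x)))))

cut-path : (S : Side k) (x : Fin k) (w : Wd k) → cut S (x ∷ w) ≡ path S (S x) (x ∷ w) (S x)
cut-path S x w = sym (cong (_+ path S (S x) w (S x)) (jump-refl (S x)))

cut-rot : (S : Side k) (u v : Wd k) → cut S (u ++ v) ≡ cut S (v ++ u)
cut-rot S [] v = cong (cut S) (sym (++-identityʳ v))
cut-rot S (x ∷ u) [] = cong (λ z → cut S (x ∷ z)) (++-identityʳ u)
cut-rot S (x ∷ u) (y ∷ v) = trans (path-split S (S x) u y v (S x))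
  (trans (ℕ.+-comm (path S (S x) u (S y)) _) (sym (path-split S (S y) v x u (S y))))

cut-reverse : (S : Side k) (w : Wd k) → cut S (rev w) ≡ cut S w
cut-reverse S [] = refl
cut-reverse S (x ∷ w) = trans (cong (cut S) (unfold-reverse x w)) (trans (cut-rot S (rev w) [ x ]) (path-reverse S (S x) w (S x)))

-- Read cyclically, four alternating segments have at most four boundaries, and an empty segment
-- only removes some.
cut-bound4 : (S : Side k) (X G X' G' : Wd k) → Mono S true X → Mono S false G → Mono S true X' → Mono S false G' →
  cut S (X ++ G ++ X' ++ G') ≤ 4
cut-bound4 {k} S X G X' G' mX mG mX' mG' = go (X ++ G ++ X' ++ G') refl
  where
  b : ∀ c → path S c (X ++ G ++ X' ++ G') c ≤ 4
  b c = ≤-trans (path-mono S c X _ c mX) (≤-trans (ℕ.+-monoʳ-≤ (jump c true) (≤-trans (path-mono S true G _ c mG)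
    (ℕ.+-monoʳ-≤ 1 (≤-trans (path-mono S false X' _ c mX') (ℕ.+-monoʳ-≤ 1 (≤-trans (≤-reflexive (cong (λ z → path S true z c) (sym (++-identityʳ G'))))
    (path-mono S true G' [] c mG'))))))) (fin c))
    where
    fin : ∀ c → jump c true + (1 + (1 + (1 + jump false c))) ≤ 4
    fin true = ≤-refl
    fin false = ≤-refl
  go : ∀ W → W ≡ X ++ G ++ X' ++ G' → cut S W ≤ 4
  go [] e = z≤n
  go (x ∷ w) e = ≤-trans (≤-reflexive (cut-path S x w)) (subst (λ z → path S (S x) z (S x) ≤ 4) (sym e) (b (S x)))

cut-bound2 : (S : Side k) (X G : Wd k) → Mono S true X → Mono S false G → cut S (X ++ G) ≤ 2
cut-bound2 {k} S X G mX mG = go (X ++ G) refl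
  where
  b : ∀ c → path S c (X ++ G) c ≤ 2
  b c = ≤-trans (path-mono S c X _ c mX) (≤-trans (ℕ.+-monoʳ-≤ (jump c true)
    (≤-trans (≤-reflexive (cong (λ z → path S true z c) (sym (++-identityʳ G)))) (path-mono S true G [] c mG))) (fin c))
    where
    fin : ∀ c → jump c true + (1 + jump false c) ≤ 2
    fin true = ≤-refl
    fin false = ≤-refl
  go : ∀ W → W ≡ X ++ G → cut S W ≤ 2
  go [] e = z≤n
  go (x ∷ w) e = ≤-trans (≤-reflexive (cut-path S x w)) (subst (λ z → path S (S x) z (S x) ≤ 2) (sym e) (b (S x)))

path-ext : {S S' : Side k} → (∀ a → S a ≡ S' a) → ∀ b w c → path S b w c ≡ path S' b w c
path-ext h b [] c = refl
path-ext h b (x ∷ w) c rewrite h x = cong (jump b _ +_) (path-ext h _ w c)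

cut-ext : {S S' : Side k} → (∀ a → S a ≡ S' a) → ∀ w → cut S w ≡ cut S' w
cut-ext h [] = refl
cut-ext h (x ∷ w) rewrite h x = path-ext h _ w _

jump-not : ∀ b c → jump (not b) (not c) ≡ jump b c
jump-not true true = refl
jump-not true false = refl
jump-not false true = refl
jump-not false false = refl

jump-odd : ∀ b c → odd (jump b c) ≡ b xor c
jump-odd true true = refl
jump-odd true false = refl
jump-odd false true = refl
jump-odd false false = refl

path-not : (S : Side k) (b : Bool) (w : Wd k) (c : Bool) → path (not ∘ S) (not b) w (not c) ≡ path S b w c
path-not S b [] c = jump-not b c
path-not S b (x ∷ w) c = cong₂ _+_ (jump-not b (S x)) (path-not S (S x) w c)

cut-not : (S : Side k) (w : Wd k) → cut (not ∘ S) w ≡ cut S w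
cut-not S [] = refl
cut-not S (x ∷ w) = path-not S (S x) w (S x)

path-odd : (S : Side k) (b : Bool) (w : Wd k) (c : Bool) → odd (path S b w c) ≡ b xor c
path-odd S b [] c = jump-odd b c
path-odd S b (x ∷ w) c = trans (odd-+ (jump b (S x)) (path S (S x) w c)) (trans (cong₂ _xor_ (jump-odd b (S x)) (path-odd S (S x) w c))
  (taut 3 (λ b s c → (b xor s) xor (s xor c)) (λ b s c → b xor c) _ b (S x) c))
  where
  odd-+ : ∀ m n → odd (m + n) ≡ odd m xor odd n
  odd-+ zero n = refl
  odd-+ (suc m) n = trans (cong not (odd-+ m n)) (taut 2 (λ a b → not (a xor b)) (λ a b → not a xor b) _ (odd m) (odd n))

cut-even : (S : Side k) (w : Wd k) → odd (cut S w) ≡ false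
cut-even S [] = refl
cut-even S (x ∷ w) = trans (path-odd S (S x) w (S x)) (taut 1 (λ b → b xor b) (λ _ → false) _ (S x))

≤5⇒≤4 : ∀ n → odd n ≡ false → n < 6 → n ≤ 4
≤5⇒≤4 0 _ _ = z≤n
≤5⇒≤4 2 _ _ = s≤s (s≤s z≤n)
≤5⇒≤4 4 _ _ = ≤-refl
≤5⇒≤4 (suc (suc (suc (suc (suc (suc n)))))) _ (s≤s (s≤s (s≤s (s≤s (s≤s (s≤s ()))))))

-- Rotation and reflection

infix 4 _≅_
-- Equality of cyclic words up to reflection. Unlike `∼` it preserves the 4-regular graph and hence
-- all cuts.
data _≅_ {k} : Wd k → Wd k → Set where
  ≅refl : ∀ {u} → u ≅ u
  ≅sym : ∀ {u v} → u ≅ v → v ≅ u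
  ≅trans : ∀ {u v w} → u ≅ v → v ≅ w → u ≅ w
  ≅rot : ∀ U V → U ++ V ≅ V ++ U
  ≅rev : ∀ w → w ≅ rev w

≅≡ : {u v : Wd k} → u ≡ v → u ≅ v
≅≡ refl = ≅refl

≅-cut : {u v : Wd k} → u ≅ v → ∀ S → cut S u ≡ cut S v
≅-cut ≅refl S = refl
≅-cut (≅sym p) S = sym (≅-cut p S)
≅-cut (≅trans p q) S = trans (≅-cut p S) (≅-cut q S)
≅-cut (≅rot U V) S = cut-rot S U V
≅-cut (≅rev w) S = sym (cut-reverse S w)

≅-Same : {u v : Wd k} → u ≅ v → Same u v
≅-Same ≅refl a = refl
≅-Same (≅sym p) a = sym (≅-Same p a)
≅-Same (≅trans p q) a = trans (≅-Same p a) (≅-Same q a)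
≅-Same (≅rot U V) a = trans (count-++ a U V) (trans (ℕ.+-comm (count a U) _) (sym (count-++ a V U)))
≅-Same (≅rev w) a = sym (count-reverse a w)

Same-Even : (u v : Wd k) → Same u v → Even u → Even v
Same-Even u v s e = Even-resp u v (λ a → trans (par-count a v) (trans (cong odd (sym (s a))) (sym (par-count a u)))) e

≅⇒∼ : {u v : Wd k} → u ≅ v → Even u → u ∼ v
≅⇒∼ ≅refl e = ∼refl
≅⇒∼ {u = u} {v} (≅sym p) e = ∼sym (≅⇒∼ p (Same-Even u v (≅-Same (≅sym p)) e))
≅⇒∼ {u = u} (≅trans {v = v} p q) e = ∼trans (≅⇒∼ p e) (≅⇒∼ q (Same-Even u v (≅-Same p) e))
≅⇒∼ (≅rot U V) e = ∼-rot U V e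
≅⇒∼ (≅rev w) e = ∼-reverse w e

≅-SG : {u v : Wd k} → u ≅ v → Even u → SG u v
≅-SG p e = ∼-SG (≅⇒∼ p e)

-- Rotations and reflections of a restricted word extend to the whole word. The two directions are
-- proved together because of the constructor `≅sym`.
≅-flt : (S : Side k) {u v : Wd k} → u ≅ v →
  (∀ D → flt S D ≡ u → ∃[ D' ] (D ≅ D' × flt S D' ≡ v)) × (∀ D → flt S D ≡ v → ∃[ D' ] (D ≅ D' × flt S D' ≡ u))
≅-flt S ≅refl = (λ D e → D , ≅refl , e) , λ D e → D , ≅refl , e
≅-flt S (≅sym p) = proj₂ (≅-flt S p) , proj₁ (≅-flt S p)
≅-flt S (≅trans p q) = (λ D e → let D1 , p1 , e1 = proj₁ (≅-flt S p) D e ; D2 , p2 , e2 = proj₁ (≅-flt S q) D1 e1 in D2 , ≅trans p1 p2 , e2) ,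
  λ D e → let D1 , p1 , e1 = proj₂ (≅-flt S q) D e ; D2 , p2 , e2 = proj₂ (≅-flt S p) D1 e1 in D2 , ≅trans p1 p2 , e2
≅-flt S (≅rot U V) = lift U V , lift V U
  where
  lift : ∀ U V D → flt S D ≡ U ++ V → ∃[ D' ] (D ≅ D' × flt S D' ≡ V ++ U)
  lift U V D e with flt-split S D {U} {V} e
  ... | u , v , refl , eu , ev = v ++ u , ≅rot u v , trans (flt-++ S v u) (cong₂ _++_ ev eu)
≅-flt S (≅rev w) = (λ D e → rev D , ≅rev D , trans (flt-reverse S D) (cong rev e)) ,
  λ D e → rev D , ≅rev D , trans (flt-reverse S D) (trans (cong rev e) (reverse-involutive w))

-- Prime words and their trivial shares

record Two (S : Side k) (s : Bool) (W : Wd k) : Set where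
  constructor two
  field
    x y : Fin k
    x≢y : x ≢ y
    Sx : S x ≡ s
    Sy : S y ≡ s
    cx : count x W ≢ 0
    cy : count y W ≢ 0

Two-resp : {S : Side k} {s : Bool} {u v : Wd k} → Same u v → Two S s u → Two S s v
Two-resp h (two x y n a b c d) = two x y n a b (λ e → c (trans (h x) e)) (λ e → d (trans (h y) e))

-- Only trivial splits: a share is a single chord or misses a single chord.

record Prime (W : Wd k) : Set where
  field
    single : ∀ x → count x W ≢ 0 → 4 ≤ cut (eqb x) W
    cuts : ∀ S → Two S true W → Two S false W → 6 ≤ cut S W

Prime-resp : {u v : Wd k} → Same u v → (∀ S → cut S u ≡ cut S v) → Prime u → Prime v
Prime-resp {u = u} {v} h c P = record
  { single = λ x n → subst (4 ≤_) (c (eqb x)) (single x (λ e → n (trans (sym (h x)) e)))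
  ; cuts = λ S t f → subst (6 ≤_) (c S) (cuts S (Two-resp {u = v} {v = u} (λ a → sym (h a)) t) (Two-resp {u = v} {v = u} (λ a → sym (h a)) f)) }
  where open Prime P

Prime-≅ : {u v : Wd k} → u ≅ v → Prime u → Prime v
Prime-≅ p = Prime-resp (≅-Same p) (≅-cut p)

-- At least four letters.

Big : Wd k → Set
Big W = ∀ x y → ∃[ p ] ∃[ q ] (p ≢ q × (p ≢ x × p ≢ y) × (q ≢ x × q ≢ y) × count p W ≢ 0 × count q W ≢ 0)

data Shape (w : Wd k) : Set where
  none : w ≡ [] → Shape w
  one : ∀ a → All (_≡ a) w → w ≢ [] → Shape w
  more : ∀ x y → x ≢ y → count x w ≢ 0 → count y w ≢ 0 → Shape w

cons≢0 : (x y : Fin k) (w : Wd k) → count x w ≢ 0 → count x (y ∷ w) ≢ 0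
cons≢0 x y w n e with x ≟ᶠ y
... | no _ = n e

head≢0 : (x : Fin k) (w : Wd k) → count x (x ∷ w) ≢ 0
head≢0 x w e = case trans (sym e) (count-head x w) of λ ()

shape : (w : Wd k) → Shape w
shape [] = none refl
shape (x ∷ w) with shape w
... | none refl = one x (refl ∷ []) λ ()
... | more a b n ca cb = more a b n (cons≢0 a x w ca) (cons≢0 b x w cb)
... | one a all n with x ≟ᶠ a
...   | yes refl = one x (refl ∷ all) λ ()
...   | no x≢a = more x a x≢a (head≢0 x w) (cons≢0 a x w (in-list all n))
  where
  in-list : ∀ {w} → All (_≡ a) w → w ≢ [] → count a w ≢ 0
  in-list [] n = ⊥-elim (n refl)
  in-list {_ ∷ w} (refl ∷ _) _ = head≢0 a w

data Trivial (X G X' G' : Wd k) : Set where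
  noX : X ≡ [] → X' ≡ [] → Trivial X G X' G'
  noG : G ≡ [] → G' ≡ [] → Trivial X G X' G'
  oneX : ∀ a → X ≡ [ a ] → X' ≡ [ a ] → Trivial X G X' G'
  oneG : ∀ a → G ≡ [ a ] → G' ≡ [ a ] → Trivial X G X' G'

count-All : (a : Fin k) (w : Wd k) → All (_≡ a) w → count a w ≡ length w
count-All a [] [] = refl
count-All a (_ ∷ w) (refl ∷ m) = trans (count-head a w) (cong suc (count-All a w m))

inX : Wd k → Fin k → Bool
inX w a with nonzero-or a w
... | inj₁ _ = false
... | inj₂ _ = true

inX-false : (w : Wd k) (a : Fin k) → count a w ≡ 0 → inX w a ≡ false
inX-false w a e with nonzero-or a w
... | inj₁ _ = refl
... | inj₂ n = ⊥-elim (n e)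

inX-true : (w : Wd k) (a : Fin k) → count a w ≢ 0 → inX w a ≡ true
inX-true w a n with nonzero-or a w
... | inj₁ e = ⊥-elim (n e)
... | inj₂ _ = refl

Same4 : (X G X' G' : Wd k) → Same (X ++ G ++ X' ++ G') ((X ++ X') ++ (G ++ G'))
Same4 X G X' G' a rewrite count-++ a X (G ++ X' ++ G') | count-++ a G (X' ++ G') | count-++ a X' G'
  | count-++ a (X ++ X') (G ++ G') | count-++ a X X' | count-++ a G G' = arith (count a X) (count a G) (count a X') (count a G')
  where
  arith : ∀ x g x' g' → x + (g + (x' + g')) ≡ (x + x') + (g + g')
  arith = ℕRing.solve-∀

one-letter : {a : Fin k} (X X' G G' : Wd k) → Prime (X ++ G ++ X' ++ G') → DO (X ++ G ++ X' ++ G') →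
  All (_≡ a) (X ++ X') → X ++ X' ≢ [] → count a (G ++ G') ≡ 0 → X ≡ [ a ] × X' ≡ [ a ]
one-letter {k} {a} X X' G G' P d all ne cG = go X X' all len refl refl
  where
  W = X ++ G ++ X' ++ G'
  cW : count a W ≡ length (X ++ X')
  cW = trans (Same4 X G X' G' a) (trans (count-++ a (X ++ X') (G ++ G')) (trans (cong₂ _+_ (count-All a (X ++ X') all) cG) (ℕ.+-identityʳ _)))
  len : length (X ++ X') ≡ 2
  len with d a
  ... | inj₂ e = trans (sym cW) e
  ... | inj₁ e = ⊥-elim (nz (X ++ X') ne (trans (sym cW) e))
    where
    nz : ∀ (w : Wd k) → w ≢ [] → length w ≢ 0
    nz [] n _ = n refl
  present : count a W ≢ 0
  present e = case trans (sym e) (trans cW len) of λ ()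
  monoG : ∀ w → count a w ≡ 0 → Mono (eqb a) false w
  monoG w c = in-Mono (eqb a) w λ b n → eqb-≢ {a = a} {b} λ { refl → n c }
  gs : count a G ≡ 0 × count a G' ≡ 0
  gs = zeros a G G' cG
  aa : Mono (eqb a) true (a ∷ a ∷ [])
  aa = eqb-refl a ∷ eqb-refl a ∷ []
  go : ∀ Y Y' → All (_≡ a) (Y ++ Y') → length (Y ++ Y') ≡ 2 → X ≡ Y → X' ≡ Y' → X ≡ [ a ] × X' ≡ [ a ]
  go [] (_ ∷ _ ∷ []) (refl ∷ refl ∷ []) _ e e' = ⊥-elim (ℕ.<⇒≱ (ℕ.m≤m+n 3 _)
    (≤-trans (Prime.single P a present) (≤-trans (≤-reflexive (trans (cong (cut (eqb a)) (cong₂ (λ s t → s ++ G ++ t ++ G') e e')) (cut-rot (eqb a) G (a ∷ a ∷ G'))))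
      (cut-bound2 (eqb a) (a ∷ a ∷ []) (G' ++ G) aa (All.++⁺ (monoG G' (proj₂ gs)) (monoG G (proj₁ gs)))))))
  go (_ ∷ []) (_ ∷ []) (refl ∷ refl ∷ []) _ e e' = e , e'
  go (_ ∷ _ ∷ []) [] (refl ∷ refl ∷ []) _ e e' = ⊥-elim (ℕ.<⇒≱ (ℕ.m≤m+n 3 _)
    (≤-trans (Prime.single P a present) (≤-trans (≤-reflexive (cong (cut (eqb a)) (cong₂ (λ s t → s ++ G ++ t ++ G') e e')))
      (cut-bound2 (eqb a) (a ∷ a ∷ []) (G ++ G') aa (All.++⁺ (monoG G (proj₁ gs)) (monoG G' (proj₂ gs)))))))

-- A share gives a cut with at most four edges, so primality leaves at most one letter on one of its
-- two sides. The ends of such a letter lie on different strands, as it would otherwise form a loop,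
-- with only two edges leaving it.
trivial-share : (X G X' G' : Wd k) → Prime (X ++ G ++ X' ++ G') → DO (X ++ G ++ X' ++ G') → Even (X ++ X') → Trivial X G X' G'
trivial-share {k} X G X' G' P d e with shape (X ++ X') | shape (G ++ G')
... | none z | _ = let p , q = nils X X' z in noX p q
  where
  nils : ∀ (X X' : Wd k) → X ++ X' ≡ [] → X ≡ [] × X' ≡ []
  nils [] X' z = refl , z
... | _ | none z = let p , q = nils G G' z in noG p q
  where
  nils : ∀ (X X' : Wd k) → X ++ X' ≡ [] → X ≡ [] × X' ≡ []
  nils [] X' z = refl , z
... | one a all ne | _ = let p , q = one-letter X X' G G' P d all ne (other (even-DO (X ++ X') (G ++ G') d' e a)) in oneX a p q
  where
  d' = DO-resp (X ++ G ++ X' ++ G') ((X ++ X') ++ (G ++ G')) (Same4 X G X' G') d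
  other : (count a (X ++ X') ≡ 0) ⊎ (count a (G ++ G') ≡ 0) → count a (G ++ G') ≡ 0
  other (inj₂ z) = z
  other (inj₁ z) = ⊥-elim (ne (empty (X ++ X') (trans (sym (count-All a (X ++ X') all)) z)))
    where
    empty : ∀ (w : Wd k) → length w ≡ 0 → w ≡ []
    empty [] _ = refl
... | more _ _ _ _ _ | one a all ne = let p , q = one-letter G G' X' X P' dr all ne cX in oneG a p q
  where
  d' = DO-resp (X ++ G ++ X' ++ G') ((X ++ X') ++ (G ++ G')) (Same4 X G X' G') d
  ro : X ++ G ++ X' ++ G' ≅ G ++ X' ++ G' ++ X
  ro = ≅trans (≅rot X (G ++ X' ++ G')) (≅≡ (ls 4 (λ x g x' g' → (g & x' & g') & x ⊜ g & x' & g' & x) refl X G X' G'))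
  P' = Prime-≅ ro P
  dr = DO-resp (X ++ G ++ X' ++ G') (G ++ X' ++ G' ++ X) (≅-Same ro) d
  other : (count a (X ++ X') ≡ 0) ⊎ (count a (G ++ G') ≡ 0) → count a (X ++ X') ≡ 0
  other (inj₁ z) = z
  other (inj₂ z) = ⊥-elim (ne (empty (G ++ G') (trans (sym (count-All a (G ++ G') all)) z)))
    where
    empty : ∀ (w : Wd k) → length w ≡ 0 → w ≡ []
    empty [] _ = refl
  cX : count a (X' ++ X) ≡ 0
  cX = trans (≅-Same (≅rot X' X) a) (other (even-DO (X ++ X') (G ++ G') d' e a))
... | more x y x≢y cx cy | more x' y' x'≢y' cx' cy' = ⊥-elim (ℕ.<⇒≱ (ℕ.m≤m+n 5 _) (≤-trans
    (Prime.cuts P S (two x y x≢y (inX-true (X ++ X') x cx) (inX-true (X ++ X') y cy) (big x (inj₁ cx)) (big y (inj₁ cy)))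
                    (two x' y' x'≢y' (inX-false (X ++ X') x' (out x' cx')) (inX-false (X ++ X') y' (out y' cy')) (big x' (inj₂ cx')) (big y' (inj₂ cy'))))
    (cut-bound4 S X G X' G' (proj₁ monoX) (proj₁ monoG) (proj₂ monoX) (proj₂ monoG))))
  where
  S = inX (X ++ X')
  d' = DO-resp (X ++ G ++ X' ++ G') ((X ++ X') ++ (G ++ G')) (Same4 X G X' G') d
  out : ∀ a → count a (G ++ G') ≢ 0 → count a (X ++ X') ≡ 0
  out a n with even-DO (X ++ X') (G ++ G') d' e a
  ... | inj₁ z = z
  ... | inj₂ z = ⊥-elim (n z)
  monoX = All.++⁻ X (in-Mono S (X ++ X') (inX-true (X ++ X')))
  monoG = All.++⁻ G (in-Mono S (G ++ G') λ a n → inX-false (X ++ X') a (out a n))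
  big : ∀ a → (count a (X ++ X') ≢ 0) ⊎ (count a (G ++ G') ≢ 0) → count a (X ++ G ++ X' ++ G') ≢ 0
  big a h z with +≡0 {count a (X ++ X')} {count a (G ++ G')} (trans (sym (count-++ a (X ++ X') (G ++ G'))) (trans (sym (Same4 X G X' G' a)) z))
  big a (inj₁ n) z | zx , zg = n zx
  big a (inj₂ n) z | zx , zg = n zg

path-run : (S : Side k) {s : Bool} (u w : Wd k) (c : Bool) → Mono S s u → path S s (u ++ w) c ≡ path S s w c
path-run S [] w c [] = refl
path-run S (x ∷ u) w c (refl ∷ m) = trans (cong (_+ path S (S x) (u ++ w) c) (jump-refl (S x))) (path-run S u w c m)

path-turn : (S : Side k) (s : Bool) (y : Fin k) (R : Wd k) (c : Bool) → S y ≡ not s →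
  path S s (y ∷ R) c ≡ suc (path S (not s) (y ∷ R) c)
path-turn S true y R c e rewrite e = refl
path-turn S false y R c e rewrite e = refl

Shares : Side k → Wd k → Set
Shares S W = ∃[ A ] ∃[ B ] ∃[ A' ] ∃[ B' ] (W ≅ A ++ B ++ A' ++ B' × Mono S true A × Mono S false B × Mono S true A' × Mono S false B')

-- The word is rotated to start with a letter of the side `true` and cut into maximal runs. Four
-- changes of side leave room for five runs in the linear word; the fifth is on the same side as the
-- first and joins it across the cut point.
shares : (S : Side k) (W : Wd k) → cut S W ≤ 4 → Shares S W
shares {k} S W le with run S false W
... | B0 , _ , refl , mB0 , inj₁ refl = [] , B0 , [] , [] , ≅refl , [] , mB0 , [] , []
... | B0 , R , refl , mB0 , inj₂ (y , R' , eR , Sy) = start (run S true (R ++ B0))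
  where
  le0 : path S true (R ++ B0) true ≤ 4
  le0 = ≤-trans (≤-reflexive (trans (cong (λ b → path S b (R ++ B0) b) (sym Sy)) (trans (cong (λ z → path S (S y) (z ++ B0) (S y)) eR) (trans (sym (cut-path S y (R' ++ B0)))
    (trans (cong (λ z → cut S (z ++ B0)) (sym eR)) (cut-rot S R B0)))))) le
  Rest : Bool → Wd k → Set
  Rest s Q = (Q ≡ []) ⊎ (∃[ y ] ∃[ Q' ] (Q ≡ y ∷ Q' × S y ≡ not s))
  turn : ∀ {n} s u Q → Mono S s u → path S s (u ++ Q) true ≤ suc n → ∃[ y ] ∃[ Q' ] (Q ≡ y ∷ Q' × S y ≡ not s) → path S (not s) Q true ≤ n
  turn s u _ m le (y , Q' , refl , Sy) = ℕ.≤-pred (≤-trans (≤-reflexive (sym (trans (path-run S u (y ∷ Q') true m) (path-turn S s y Q' true Sy)))) le)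
  ro : ∀ {W} → R ++ B0 ≡ W → B0 ++ R ≅ W
  ro e = ≅trans (≅rot B0 R) (≅≡ e)
  start : ∃[ T ] ∃[ Q ] (R ++ B0 ≡ T ++ Q × Mono S true T × Rest true Q) → Shares S (B0 ++ R)
  start (A , _ , e , mA , inj₁ refl) = A , [] , [] , [] , ro e , mA , [] , [] , []
  start (A , Q1 , e , mA , inj₂ r1) with run S false Q1 | turn true A Q1 mA (subst (λ z → path S true z true ≤ 4) e le0) r1
  ... | B , _ , e1 , mB , inj₁ refl | _ = A , B , [] , [] , ro (trans e (cong (A ++_) e1)) , mA , mB , [] , []
  ... | B , Q2 , e1 , mB , inj₂ r2 | le1 with run S true Q2 | turn false B Q2 mB (subst (λ z → path S false z true ≤ 3) e1 le1) r2
  ...   | A' , _ , e2 , mA' , inj₁ refl | _ = A , B , A' , [] ,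
          ro (trans e (cong (A ++_) (trans e1 (cong (B ++_) e2)))) , mA , mB , mA' , []
  ...   | A' , Q3 , e2 , mA' , inj₂ r3 | le2 with run S false Q3 | turn true A' Q3 mA' (subst (λ z → path S true z true ≤ 2) e2 le2) r3
  ...     | B' , _ , e3 , mB' , inj₁ refl | _ = A , B , A' , B' ,
            ro (trans e (cong (A ++_) (trans e1 (cong (B ++_) (trans e2 (cong (A' ++_) (trans e3 (++-identityʳ B')))))))) , mA , mB , mA' , mB'
  ...     | B' , Q4 , e3 , mB' , inj₂ r4 | le3 with run S true Q4 | turn false B' Q4 mB' (subst (λ z → path S false z true ≤ 1) e3 le3) r4
  ...       | A″ , Q5 , e4 , mA″ , inj₂ (y5 , Q5' , refl , Sy5) | le4 = ⊥-elim (ℕ.<⇒≱ (s≤s z≤n)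
               (≤-trans (≤-reflexive (sym (trans (path-run S A″ (y5 ∷ Q5') true mA″) (path-turn S true y5 Q5' true Sy5)))) (subst (λ z → path S true z true ≤ 0) e4 le4)))
  ...       | A″ , _ , e4 , mA″ , inj₁ refl | _ = A″ ++ A , B , A' , B' ,
              ≅trans (ro (trans e (trans (cong (A ++_) (trans e1 (cong (B ++_) (trans e2 (cong (A' ++_) (trans e3 (cong (B' ++_) (trans e4 (++-identityʳ A″)))))))))
                 (ls 5 (λ a b a' b' a″ → a & b & a' & b' & a″ ⊜ (a & b & a' & b') & a″) refl A B A' B' A″))))
                (≅trans (≅rot (A ++ B ++ A' ++ B') A″) (≅≡ (ls 5 (λ a b a' b' a″ → a″ & a & b & a' & b' ⊜ (a″ & a) & b & a' & b') refl A B A' B' A″))) ,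
              All.++⁺ mA″ mA , mB , mA' , mB'

-- Rigidity of insertions into prime words

rot≡ : {T W : Wd k} (U V : Wd k) → T ≡ U ++ V → V ++ U ≡ W → T ≅ W
rot≡ U V refl refl = ≅rot U V

duo : Fin k → Fin k → Fin k → Bool
duo v a x = eqb v x ∨ eqb a x

duo-l : (v a : Fin k) → duo v a v ≡ true
duo-l v a rewrite eqb-refl v = refl

duo-r : (v a : Fin k) → duo v a a ≡ true
duo-r v a rewrite eqb-refl a with eqb v a
... | true = refl
... | false = refl

duo-no : {v a x : Fin k} → x ≢ v → x ≢ a → duo v a x ≡ false
duo-no nv na rewrite eqb-≢ (nv ∘ sym) | eqb-≢ (na ∘ sym) = refl

-- If all ends of `v` and `a` fill just two segments, at most four edges leave this pair of
-- vertices. `Big` supplies two letters outside the pair, and then primality demands six.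
digon : {v a : Fin k} (T X G X' G' : Wd k) → v ≢ a → Prime T → Big T → T ≅ X ++ G ++ X' ++ G' →
  count v X ≢ 0 → count a X ≢ 0 → Mono (duo v a) true X → Mono (duo v a) true X' →
  count v (G ++ G') ≡ 0 → count a (G ++ G') ≡ 0 → ⊥
digon {v = v} {a} T X G X' G' v≢a P big iso cv ca mX mX' gv ga with big v a
... | p , q , p≢q , (pv , pa) , (qv , qa) , cp , cq = ℕ.<⇒≱ (ℕ.m≤m+n 5 _) (≤-trans
    (Prime.cuts P (duo v a) (two v a v≢a (duo-l v a) (duo-r v a) (now v cv) (now a ca)) (two p q p≢q (duo-no pv pa) (duo-no qv qa) cp cq))
    (≤-trans (≤-reflexive (≅-cut iso (duo v a))) (cut-bound4 (duo v a) X G X' G' mX (proj₁ mG) mX' (proj₂ mG))))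
  where
  now : ∀ x → count x X ≢ 0 → count x T ≢ 0
  now x n e = n (proj₁ (zeros x X _ (trans (sym (≅-Same iso x)) e)))
  mG = All.++⁻ G (in-Mono (duo v a) (G ++ G') λ b n → duo-no {v = v} {a} {b} (λ { refl → n gv }) (λ { refl → n ga }))

no-loop : {v : Fin k} (T G : Wd k) → Prime T → T ≅ v ∷ v ∷ G → count v G ≡ 0 → ⊥
no-loop {v = v} T G P iso gv = ℕ.<⇒≱ (ℕ.m≤m+n 3 _) (≤-trans (Prime.single P v λ e → head≢0 v (v ∷ G) (trans (sym (≅-Same iso v)) e))
  (≤-trans (≤-reflexive (≅-cut iso (eqb v))) (cut-bound2 (eqb v) (v ∷ v ∷ []) G (eqb-refl v ∷ eqb-refl v ∷ [])
    (in-Mono (eqb v) G λ b n → eqb-≢ {a = v} {b} λ { refl → n gv }))))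

zeros5 : (v : Fin k) (A B C D E : Wd k) → count v (A ++ B ++ C ++ D ++ E) ≡ 0 →
  count v A ≡ 0 × count v B ≡ 0 × count v C ≡ 0 × count v D ≡ 0 × count v E ≡ 0
zeros5 v A B C D E e =
  let a , e1 = +≡0 (trans (sym (count5 v A B C D E)) e) ; b , e2 = +≡0 e1 ; c , e3 = +≡0 e2 ; d , e4 = +≡0 e3 in a , b , c , d , e4

snoc-nil : (E A : Wd k) {a : Fin k} → E ++ A ≡ [ a ] → (E ≡ [ a ] × A ≡ []) ⊎ (E ≡ [] × A ≡ [ a ])
snoc-nil [] A e = inj₂ (refl , e)
snoc-nil (x ∷ []) [] refl = inj₁ (refl , refl)

++-nil : (E A : Wd k) → E ++ A ≡ [] → E ≡ [] × A ≡ []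
++-nil [] A e = refl , e

-- By `trivial-share` the symmetric difference of the two arcs of `v` is empty, everything, the two
-- ends of one letter `a`, or all but these two. In the last two cases `v` and `a` would be joined
-- by a double edge in both words. In the first two the arcs are equal, complementary, or bound a
-- loop at `v` in both words. Since one of `T`, `T'` is prime, only equality up to rotation
-- survives.
module Rigid {v : Fin k} {W T T' : Wd k} (PW : Prime W) (dW : DO W) (vW : count v W ≡ 0)
  (bT : Big T) (bT' : Big T') (pr : Prime T ⊎ Prime T') where

  contra : (Prime T → ⊥) → (Prime T' → ⊥) → T ≅ T'
  contra f g = case pr of λ { (inj₁ p) → ⊥-elim (f p) ; (inj₂ p) → ⊥-elim (g p) }

  module _ (A B C D E : Wd k) (eW : W ≡ A ++ B ++ C ++ D ++ E) (eBD : Even (B ++ D)) where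
    roW : W ≅ B ++ C ++ D ++ E ++ A
    roW = rot≡ A (B ++ C ++ D ++ E) eW (ls 5 (λ a b c d e → (b & c & d & e) & a ⊜ b & c & d & e & a) refl A B C D E)

    triv : Trivial B C D (E ++ A)
    triv = trivial-share B C D (E ++ A) (Prime-≅ roW PW) (DO-resp W (B ++ C ++ D ++ E ++ A) (≅-Same roW) dW) eBD

    zv : count v A ≡ 0 × count v B ≡ 0 × count v C ≡ 0 × count v D ≡ 0 × count v E ≡ 0
    zv = zeros5 v A B C D E (trans (cong (count v) (sym eW)) vW)

    v≢ : ∀ a → count a W ≢ 0 → v ≢ a
    v≢ a n refl = n vW

    zX : ∀ a → B ≡ [ a ] → D ≡ [ a ] → v ≢ a × count a A ≡ 0 × count a C ≡ 0 × count a E ≡ 0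
    zX a eB eD with dW a
    ... | inj₁ e = ⊥-elim (head≢0 a [] (trans (cong (count a) (sym eB)) (proj₁ (proj₂ (zeros5 a A B C D E (trans (cong (count a) (sym eW)) e))))))
    ... | inj₂ e = v≢ a (λ z → case trans (sym z) e of λ ()) , sum5 (count a A) (count a B) (count a C) (count a D) (count a E)
        (trans (sym (count5 a A B C D E)) (trans (cong (count a) (sym eW)) e))
        (cong₂ _+_ (trans (cong (count a) eB) (count-head a [])) (trans (cong (count a) eD) (count-head a [])))

    zG : ∀ a → C ≡ [ a ] → E ++ A ≡ [ a ] → v ≢ a × count a B ≡ 0 × count a D ≡ 0
    zG a eC eEA with dW a
    ... | inj₁ e = ⊥-elim (head≢0 a [] (trans (cong (count a) (sym eC)) (proj₁ (proj₂ (proj₂ (zeros5 a A B C D E (trans (cong (count a) (sym eW)) e)))))))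
    ... | inj₂ e = v≢ a (λ z → case trans (sym z) e of λ ()) ,
      let x , y , z = sum5 0 (count a C) (count a B + count a D) (count a (E ++ A)) 0 (trans (arith (count a A) (count a B) (count a C) (count a D) (count a E) _ (count-++ a E A))
              (trans (sym (count5 a A B C D E)) (trans (cong (count a) (sym eW)) e)))
              (cong₂ _+_ (trans (cong (count a) eC) (count-head a [])) (trans (cong (count a) eEA) (count-head a []))) in +≡0 y
      where
      arith : ∀ a b c d e f → f ≡ e + a → 0 + (c + (b + d + (f + 0))) ≡ a + (b + (c + (d + e)))
      arith a b c d e _ refl = lem a b c d e
        where
        lem : ∀ a b c d e → 0 + (c + (b + d + (e + a + 0))) ≡ a + (b + (c + (d + e)))
        lem = ℕRing.solve-∀

    two0 : ∀ (x : Fin k) (P Q : Wd k) → count x P ≡ 0 → count x Q ≡ 0 → count x (P ++ Q) ≡ 0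
    two0 x P Q p q = trans (count-++ x P Q) (cong₂ _+_ p q)

    cEA : ∀ x → count x E ≡ 0 → count x A ≡ 0 → ∀ P → count x P ≡ 0 → count x (P ++ E ++ A) ≡ 0
    cEA x e a P p = two0 x P (E ++ A) p (two0 x E A e a)

    va : ∀ a → Mono (duo v a) true (v ∷ a ∷ [])
    va a = duo-l v a ∷ duo-r v a ∷ []
    av : ∀ a → Mono (duo v a) true (a ∷ v ∷ [])
    av a = duo-r v a ∷ duo-l v a ∷ []
    vav : ∀ a → Mono (duo v a) true (v ∷ a ∷ v ∷ [])
    vav a = duo-l v a ∷ duo-r v a ∷ duo-l v a ∷ []
    a1 : ∀ a → Mono (duo v a) true [ a ]
    a1 a = duo-r v a ∷ []

    digX : ∀ a (Y : Wd k) → Big Y → B ≡ [ a ] → D ≡ [ a ] → ∀ X X' → Y ≅ X ++ C ++ X' ++ E ++ A → count v X ≢ 0 → count a X ≢ 0 →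
      Mono (duo v a) true X → Mono (duo v a) true X' → Prime Y → ⊥
    digX a Y bY eB eD X X' iso cv ca mX mX' P = let v≢a , a0 , c0 , e0 = zX a eB eD ; va0 , _ , vc0 , _ , ve0 = zv in
      digon Y X C X' (E ++ A) v≢a P bY iso cv ca mX mX' (cEA v ve0 va0 C vc0) (cEA a e0 a0 C c0)

    digG : ∀ a (Y : Wd k) → Big Y → C ≡ [ a ] → E ++ A ≡ [ a ] → ∀ X P X' Q → Y ≅ X ++ P ++ X' ++ Q → ((P ≡ B × Q ≡ D) ⊎ (P ≡ D × Q ≡ B)) →
      count v X ≢ 0 → count a X ≢ 0 → Mono (duo v a) true X → Mono (duo v a) true X' → Prime Y → ⊥
    digG a Y bY eC eEA X P X' Q iso pq cv ca mX mX' PY = let v≢a , b0 , d0 = zG a eC eEA ; _ , vb0 , _ , vd0 , _ = zv in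
      digon Y X P X' Q v≢a PY bY iso cv ca mX mX' (z v vb0 vd0 pq) (z a b0 d0 pq)
      where
      z : ∀ x → count x B ≡ 0 → count x D ≡ 0 → ((P ≡ B × Q ≡ D) ⊎ (P ≡ D × Q ≡ B)) → count x (P ++ Q) ≡ 0
      z x b d (inj₁ (refl , refl)) = two0 x B D b d
      z x b d (inj₂ (refl , refl)) = two0 x D B d b

    cva : ∀ a → count a (v ∷ a ∷ []) ≢ 0
    cva a = cons≢0 a v [ a ] (head≢0 a [])
    cav : ∀ a → count v (a ∷ v ∷ []) ≢ 0
    cav a = cons≢0 v a [ v ] (head≢0 v [])
    cvav : ∀ a → count a (v ∷ a ∷ v ∷ []) ≢ 0
    cvav a = cons≢0 a v (a ∷ v ∷ []) (head≢0 a [ v ])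

    linked-case : T ≡ A ++ [ v ] ++ B ++ C ++ [ v ] ++ D ++ E → T' ≡ A ++ B ++ [ v ] ++ C ++ D ++ [ v ] ++ E → T ≅ T'
    linked-case eT eT' with triv
    ... | noX eB eD = ≅≡ (trans eT (trans (cong₂ (λ b d → A ++ v ∷ b ++ C ++ v ∷ d ++ E) eB eD)
                              (sym (trans eT' (cong₂ (λ b d → A ++ b ++ v ∷ C ++ d ++ v ∷ E) eB eD)))))
    ... | noG eC eEA = let eE , eA = ++-nil E A eEA in
            rot≡ [ v ] (B ++ [ v ] ++ D) (trans eT (trans (cong3 (λ a c e → a ++ v ∷ B ++ c ++ v ∷ D ++ e) eA eC eE) (cong (λ z → v ∷ B ++ v ∷ z) (++-identityʳ D))))
              (trans (ls 3 (λ v b d → (b & v & d) & v ⊜ b & v & d & v) refl [ v ] B D) (sym (trans eT' (cong3 (λ a c e → a ++ B ++ v ∷ c ++ D ++ v ∷ e) eA eC eE))))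
    linked-case eT eT' | oneX a eB eD = contra
      (digX a T bT eB eD (v ∷ a ∷ []) (v ∷ a ∷ []) (rot≡ A ([ v ] ++ [ a ] ++ C ++ [ v ] ++ [ a ] ++ E) (trans eT (cong₂ (λ b d → A ++ v ∷ b ++ C ++ v ∷ d ++ E) eB eD))
         (ls 5 (λ a v b c e → (v & b & c & v & b & e) & a ⊜ (v & b) & c & (v & b) & e & a) refl A [ v ] [ a ] C E)) (head≢0 v [ a ]) (cva a) (va a) (va a))
      (digX a T' bT' eB eD (a ∷ v ∷ []) (a ∷ v ∷ []) (rot≡ A ([ a ] ++ [ v ] ++ C ++ [ a ] ++ [ v ] ++ E) (trans eT' (cong₂ (λ b d → A ++ b ++ v ∷ C ++ d ++ v ∷ E) eB eD))
         (ls 5 (λ a v b c e → (b & v & c & b & v & e) & a ⊜ (b & v) & c & (b & v) & e & a) refl A [ v ] [ a ] C E)) (cav a) (head≢0 a [ v ]) (av a) (av a))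
    linked-case eT eT' | oneG a eC eEA = contra
      (digG a T bT eC eEA (a ∷ v ∷ []) B (a ∷ v ∷ []) D
        (rot≡ (A ++ [ v ] ++ B ++ C ++ [ v ] ++ D) E (trans eT (ls 6 (λ a v b c d e → a & v & b & c & v & d & e ⊜ (a & v & b & c & v & d) & e) refl A [ v ] B C D E))
          (trans (ls 6 (λ a v b c d e → e & a & v & b & c & v & d ⊜ ((e & a) & v) & b & (c & v) & d) refl A [ v ] B C D E)
            (cong₂ (λ s t → (s ++ [ v ]) ++ B ++ (t ++ [ v ]) ++ D) eEA eC))) (inj₁ (refl , refl)) (cav a) (head≢0 a [ v ]) (av a) (av a))
      (digG a T' bT' eC eEA (v ∷ a ∷ []) D (v ∷ a ∷ []) B
        (rot≡ (A ++ B) ([ v ] ++ C ++ D ++ [ v ] ++ E) (trans eT' (ls 6 (λ a v b c d e → a & b & v & c & d & v & e ⊜ (a & b) & v & c & d & v & e) refl A [ v ] B C D E))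
          (trans (ls 6 (λ a v b c d e → (v & c & d & v & e) & a & b ⊜ (v & c) & d & (v & e & a) & b) refl A [ v ] B C D E)
            (cong₂ (λ s t → (v ∷ t) ++ D ++ (v ∷ s) ++ B) eEA eC))) (inj₂ (refl , refl)) (head≢0 v [ a ]) (cva a) (va a) (va a))

    nested-case : T ≡ A ++ [ v ] ++ B ++ C ++ D ++ [ v ] ++ E → T' ≡ A ++ B ++ [ v ] ++ C ++ [ v ] ++ D ++ E → T ≅ T'
    nested-case eT eT' with triv
    ... | noX eB eD = ≅≡ (trans eT (trans (cong₂ (λ b d → A ++ v ∷ b ++ C ++ d ++ v ∷ E) eB eD)
                              (sym (trans eT' (cong₂ (λ b d → A ++ b ++ v ∷ C ++ v ∷ d ++ E) eB eD)))))
    ... | noG eC eEA = let eE , eA = ++-nil E A eEA in contra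
            (λ P → no-loop T (B ++ D) P (rot≡ ([ v ] ++ B ++ D) [ v ] (trans (trans eT (cong3 (λ a c e → a ++ v ∷ B ++ c ++ D ++ v ∷ e) eA eC eE)) (ls 3 (λ v b d → v & b & d & v ⊜ (v & b & d) & v) refl [ v ] B D)) refl)
              (two0 v B D (proj₁ (proj₂ zv)) (proj₁ (proj₂ (proj₂ (proj₂ zv))))))
            (λ P → no-loop T' (D ++ B) P (rot≡ B (v ∷ v ∷ D) (trans (trans eT' (cong3 (λ a c e → a ++ B ++ v ∷ c ++ v ∷ D ++ e) eA eC eE)) (cong (λ z → B ++ v ∷ v ∷ z) (++-identityʳ D))) refl)
              (two0 v D B (proj₁ (proj₂ (proj₂ (proj₂ zv)))) (proj₁ (proj₂ zv))))
    nested-case eT eT' | oneX a eB eD = contra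
      (digX a T bT eB eD (v ∷ a ∷ []) (a ∷ v ∷ []) (rot≡ A ([ v ] ++ [ a ] ++ C ++ [ a ] ++ [ v ] ++ E) (trans eT (cong₂ (λ b d → A ++ v ∷ b ++ C ++ d ++ v ∷ E) eB eD))
         (ls 5 (λ a v b c e → (v & b & c & b & v & e) & a ⊜ (v & b) & c & (b & v) & e & a) refl A [ v ] [ a ] C E)) (head≢0 v [ a ]) (cva a) (va a) (av a))
      (digX a T' bT' eB eD (a ∷ v ∷ []) (v ∷ a ∷ []) (rot≡ A ([ a ] ++ [ v ] ++ C ++ [ v ] ++ [ a ] ++ E) (trans eT' (cong₂ (λ b d → A ++ b ++ v ∷ C ++ v ∷ d ++ E) eB eD))
         (ls 5 (λ a v b c e → (b & v & c & v & b & e) & a ⊜ (b & v) & c & (v & b) & e & a) refl A [ v ] [ a ] C E)) (cav a) (head≢0 a [ v ]) (av a) (va a))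
    nested-case eT eT' | oneG a eC eEA = contra
      (digG a T bT eC eEA (v ∷ a ∷ v ∷ []) B [ a ] D
        (rot≡ (A ++ [ v ] ++ B ++ C ++ D) ([ v ] ++ E) (trans eT (ls 6 (λ a v b c d e → a & v & b & c & d & v & e ⊜ (a & v & b & c & d) & v & e) refl A [ v ] B C D E))
          (trans (ls 6 (λ a v b c d e → (v & e) & a & v & b & c & d ⊜ (v & (e & a) & v) & b & c & d) refl A [ v ] B C D E)
            (cong₂ (λ s t → (v ∷ s ++ [ v ]) ++ B ++ t ++ D) eEA eC))) (inj₁ (refl , refl)) (head≢0 v (a ∷ v ∷ [])) (cvav a) (vav a) (a1 a))
      (digG a T' bT' eC eEA (v ∷ a ∷ v ∷ []) D [ a ] B
        (rot≡ (A ++ B) ([ v ] ++ C ++ [ v ] ++ D ++ E) (trans eT' (ls 6 (λ a v b c d e → a & b & v & c & v & d & e ⊜ (a & b) & v & c & v & d & e) refl A [ v ] B C D E))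
          (trans (ls 6 (λ a v b c d e → (v & c & v & d & e) & a & b ⊜ (v & c & v) & d & (e & a) & b) refl A [ v ] B C D E)
            (cong₂ (λ s t → (v ∷ t ++ [ v ]) ++ D ++ s ++ B) eEA eC))) (inj₂ (refl , refl)) (head≢0 v (a ∷ v ∷ [])) (cvav a) (vav a) (a1 a))

    apart-case : T ≡ A ++ [ v ] ++ B ++ [ v ] ++ C ++ D ++ E → T' ≡ A ++ B ++ C ++ [ v ] ++ D ++ [ v ] ++ E → T ≅ T'
    apart-case eT eT' with triv
    ... | noG eC eEA = let eE , eA = ++-nil E A eEA in
            rot≡ [ v ] (B ++ [ v ] ++ D) (trans eT (trans (cong3 (λ a c e → a ++ v ∷ B ++ v ∷ c ++ D ++ e) eA eC eE) (cong (λ z → v ∷ B ++ v ∷ z) (++-identityʳ D))))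
              (trans (ls 3 (λ v b d → (b & v & d) & v ⊜ b & v & d & v) refl [ v ] B D) (sym (trans eT' (cong3 (λ a c e → a ++ B ++ c ++ v ∷ D ++ v ∷ e) eA eC eE))))
    apart-case eT eT' | noX eB eD = contra
            (λ P → no-loop T (C ++ E ++ A) P (rot≡ A (v ∷ v ∷ C ++ E) (trans eT (cong₂ (λ b d → A ++ v ∷ b ++ v ∷ C ++ d ++ E) eB eD)) (cong (λ z → v ∷ v ∷ z) (++-assoc C E A))) vCEA)
            (λ P → no-loop T' ((E ++ A) ++ C) P (rot≡ (A ++ C) (v ∷ v ∷ E) (trans (trans eT' (cong₂ (λ b d → A ++ b ++ C ++ v ∷ d ++ v ∷ E) eB eD)) (sym (++-assoc A C (v ∷ v ∷ E)))) (cong (λ z → v ∷ v ∷ z) (sym (++-assoc E A C))))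
               (trans (≅-Same (≅rot (E ++ A) C) v) vCEA))
      where
      vCEA = let va0 , _ , vc0 , _ , ve0 = zv in cEA v ve0 va0 C vc0
    apart-case eT eT' | oneX a eB eD = contra
      (digX a T bT eB eD (v ∷ a ∷ v ∷ []) [ a ] (rot≡ A ([ v ] ++ [ a ] ++ [ v ] ++ C ++ [ a ] ++ E) (trans eT (cong₂ (λ b d → A ++ v ∷ b ++ v ∷ C ++ d ++ E) eB eD))
         (ls 5 (λ a v b c e → (v & b & v & c & b & e) & a ⊜ (v & b & v) & c & b & e & a) refl A [ v ] [ a ] C E)) (head≢0 v (a ∷ v ∷ [])) (cvav a) (vav a) (a1 a))
      λ P → let v≢a , a0 , c0 , e0 = zX a eB eD ; va0 , _ , vc0 , _ , ve0 = zv in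
        digon T' (v ∷ a ∷ v ∷ []) (E ++ A) [ a ] C v≢a P bT'
          (rot≡ (A ++ [ a ] ++ C) ([ v ] ++ [ a ] ++ [ v ] ++ E) (trans eT' (trans (cong₂ (λ b d → A ++ b ++ C ++ v ∷ d ++ v ∷ E) eB eD)
             (ls 5 (λ a v b c e → a & b & c & v & b & v & e ⊜ (a & b & c) & v & b & v & e) refl A [ v ] [ a ] C E)))
             (ls 5 (λ a v b c e → (v & b & v & e) & a & b & c ⊜ (v & b & v) & (e & a) & b & c) refl A [ v ] [ a ] C E))
          (head≢0 v (a ∷ v ∷ [])) (cvav a) (vav a) (a1 a)
          (two0 v (E ++ A) C (two0 v E A ve0 va0) vc0) (two0 a (E ++ A) C (two0 a E A e0 a0) c0)
    apart-case eT eT' | oneG a eC eEA = contra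
      (digG a T bT eC eEA (v ∷ a ∷ []) D (a ∷ v ∷ []) B
        (rot≡ (A ++ [ v ] ++ B) ([ v ] ++ C ++ D ++ E) (trans eT (ls 6 (λ a v b c d e → a & v & b & v & c & d & e ⊜ (a & v & b) & v & c & d & e) refl A [ v ] B C D E))
          (trans (ls 6 (λ a v b c d e → (v & c & d & e) & a & v & b ⊜ (v & c) & d & ((e & a) & v) & b) refl A [ v ] B C D E)
            (cong₂ (λ s t → (v ∷ t) ++ D ++ (s ++ [ v ]) ++ B) eEA eC))) (inj₂ (refl , refl)) (head≢0 v [ a ]) (cva a) (va a) (av a))
      (digG a T' bT' eC eEA (a ∷ v ∷ []) D (v ∷ a ∷ []) B
        (rot≡ (A ++ B) (C ++ [ v ] ++ D ++ [ v ] ++ E) (trans eT' (ls 6 (λ a v b c d e → a & b & c & v & d & v & e ⊜ (a & b) & c & v & d & v & e) refl A [ v ] B C D E))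
          (trans (ls 6 (λ a v b c d e → (c & v & d & v & e) & a & b ⊜ (c & v) & d & (v & e & a) & b) refl A [ v ] B C D E)
            (cong₂ (λ s t → (t ++ [ v ]) ++ D ++ (v ∷ s) ++ B) eEA eC))) (inj₂ (refl , refl)) (cav a) (head≢0 a [ v ]) (av a) (va a))

  rigid : Moved v W T T' → T ≅ T'
  rigid (apart A B C D E eW eT eT' e) = apart-case A B C D E eW e eT eT'
  rigid (linked A B C D E eW eT eT' e) = linked-case A B C D E eW e eT eT'
  rigid (nested A B C D E eW eT eT' e) = nested-case A B C D E eW e eT eT'

rigid-insertion : {v : Fin k} (T1 T2 : Wd k) → Prime (rm v T1) → DO T1 → count v T1 ≡ 2 → Prime T1 → Big T1 →
  SG T1 T2 → rm v T1 ≡ rm v T2 → T1 ≅ T2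
rigid-insertion {v = v} T1 T2 PW d c P b g e with moved v T1 T2 c (trans (sym (same g v)) c) e (λ a _ → ords g v a)
... | inj₁ m = Rigid.rigid PW (DO-flt _ T1 d) (count-flt-out _ (cong not (eqb-refl v)) T1) b b2 (inj₁ P) m
  where
  b2 : Big T2
  b2 x y = let p , q , n , np , nq , cp , cq = b x y in p , q , n , np , nq , (λ z → cp (trans (same g p) z)) , λ z → cq (trans (same g q) z)
... | inj₂ m = ≅sym (Rigid.rigid PW (DO-flt _ T1 d) (count-flt-out _ (cong not (eqb-refl v)) T1) b2 b (inj₂ P) m)
  where
  b2 : Big T2
  b2 x y = let p , q , n , np , nq , cp , cq = b x y in p , q , n , np , nq , (λ z → cp (trans (same g p) z)) , λ z → cq (trans (same g q) z)

-- Local complementation.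

lc-go : Fin k → Wd k → Wd k → Wd k
lc-go v acc [] = acc
lc-go v acc (y ∷ w) = if eqb v y then acc ++ v ∷ w else lc-go v (y ∷ acc) w

lc : Fin k → Wd k → Wd k
lc v [] = []
lc v (x ∷ w) = if eqb v x then v ∷ lc-go v [] w else x ∷ lc v w

lc-go-form : (v : Fin k) (acc Q R : Wd k) → count v Q ≡ 0 → lc-go v acc (Q ++ v ∷ R) ≡ (rev Q ++ acc) ++ v ∷ R
lc-go-form v acc [] R q rewrite eqb-refl v = refl
lc-go-form v acc (y ∷ Q) R q with v ≟ᶠ y
... | no _ = trans (lc-go-form v (y ∷ acc) Q R q) (cong (_++ v ∷ R) (trans (sym (++-assoc (rev Q) [ y ] acc)) (cong (_++ acc) (sym (unfold-reverse y Q)))))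

lc-form : (v : Fin k) (P Q R : Wd k) → count v P ≡ 0 → count v Q ≡ 0 →
  lc v (P ++ v ∷ Q ++ v ∷ R) ≡ P ++ v ∷ rev Q ++ v ∷ R
lc-form v [] Q R p q rewrite eqb-refl v = cong (v ∷_) (trans (lc-go-form v [] Q R q) (cong (_++ v ∷ R) (++-identityʳ (rev Q))))
lc-form v (x ∷ P) Q R p q with v ≟ᶠ x
... | no _ = cong (x ∷_) (lc-form v P Q R p q)

lc-reverse : (v : Fin k) (w : Wd k) → count v w ≡ 2 → lc v (rev w) ≡ rev (lc v w)
lc-reverse v w c with locate2 v w c
... | P , Q , R , refl , p , q , r = trans (cong (lc v) (reverse5 P [ v ] Q [ v ] R))
  (trans (lc-form v (rev R) (rev Q) (rev P) (count-rev0 v R r) (count-rev0 v Q q))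
  (sym (trans (cong rev (lc-form v P Q R p q)) (reverse5 P [ v ] (rev Q) [ v ] R))))

lc-involutive : (v : Fin k) (w : Wd k) → count v w ≡ 2 → lc v (lc v w) ≡ w
lc-involutive v w c with locate2 v w c
... | P , Q , R , refl , p , q , r = trans (cong (lc v) (lc-form v P Q R p q))
  (trans (lc-form v P (rev Q) R p (count-rev0 v Q q)) (cong (λ t → P ++ v ∷ t ++ v ∷ R) (reverse-involutive Q)))

lc-Same : (v : Fin k) (w : Wd k) → count v w ≡ 2 → Same w (lc v w)
lc-Same v w c a with locate2 v w c
... | P , Q , R , refl , p , q , r rewrite lc-form v P Q R p q | count5 a P [ v ] Q [ v ] R | count5 a P [ v ] (rev Q) [ v ] R | count-reverse a Q = refl

-- Reversing the arc between the ends of `v` means reading a closed walk through the vertex `v`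
-- backwards, so the 4-regular graph is the same.
lc-cut : (v : Fin k) (w : Wd k) → count v w ≡ 2 → ∀ S → cut S w ≡ cut S (lc v w)
lc-cut v w c S with locate2 v w c
... | P , Q , R , refl , p , q , r rewrite lc-form v P Q R p q = trans (norm Q) (trans (cong (_+ path S (S v) (R ++ P) (S v)) (sym (path-reverse S (S v) Q (S v)))) (sym (norm (rev Q))))
  where
  norm : ∀ Q → cut S (P ++ v ∷ Q ++ v ∷ R) ≡ path S (S v) Q (S v) + path S (S v) (R ++ P) (S v)
  norm Q = trans (cut-rot S P (v ∷ Q ++ v ∷ R)) (trans (cong (cut S) (ls 4 (λ v q r p → (v & q & v & r) & p ⊜ v & q & v & r & p) refl [ v ] Q R P)) (path-split S (S v) Q v (R ++ P) (S v)))

ord-mid : (a b : Fin k) (X M M' Z : Wd k) → par a M ≡ par a M' → par b M ≡ par b M' →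
  ord a b (X ++ M ++ Z) ≡ ord a b (X ++ M' ++ Z) xor (ord a b M xor ord a b M')
ord-mid a b X M M' Z ea eb rewrite ord-++ a b X (M ++ Z) | ord-++ a b M Z | par-++ b M Z | ord-++ a b X (M' ++ Z) | ord-++ a b M' Z | par-++ b M' Z | ea | eb =
  taut 8 (λ oX oM oM' oZ aX aM bM bZ → (oX xor ((oM xor oZ) xor (aM ∧ bZ))) xor (aX ∧ (bM xor bZ)))
         (λ oX oM oM' oZ aX aM bM bZ → ((oX xor ((oM' xor oZ) xor (aM ∧ bZ))) xor (aX ∧ (bM xor bZ))) xor (oM xor oM')) _
    (ord a b X) (ord a b M) (ord a b M') (ord a b Z) (par a X) (par a M') (par b M') (par b Z)

nbr : Fin k → Wd k → Fin k → Bool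
nbr v w a = not (eqb v a) ∧ ord v a w

-- By `ord-swap` the reversal matters exactly when both letters occur an odd number of times in the
-- arc, that is, when both are neighbours of `v` in the intersection graph.
lc-ord : (v : Fin k) (w : Wd k) → count v w ≡ 2 → ∀ a b →
  ord a b (lc v w) ≡ (if eqb a b then ord a b w else ord a b w xor (nbr v w a ∧ nbr v w b))
lc-ord v w c a b with locate2 v w c
... | P , Q , R , refl , p , q , r rewrite lc-form v P Q R p q = go (a ≟ᶠ b)
  where
  nb : ∀ a → nbr v (P ++ v ∷ Q ++ v ∷ R) a ≡ par a Q
  nb a with v ≟ᶠ a
  ... | yes refl = sym (trans (par-count a Q) (cong odd q))
  ... | no v≢a = ord-2 v (v≢a ∘ sym) P Q R p q r
  mid : ord a b (P ++ v ∷ rev Q ++ v ∷ R) ≡ ord a b (P ++ v ∷ Q ++ v ∷ R) xor (ord b a Q xor ord a b Q)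
  mid = trans (cong (ord a b) (assoc (rev Q))) (trans (ord-mid a b (P ++ [ v ]) (rev Q) Q (v ∷ R) (par-reverse a Q) (par-reverse b Q))
    (cong₂ (λ s t → s xor (t xor ord a b Q)) (cong (ord a b) (sym (assoc Q))) (ord-reverse a b Q)))
    where
    assoc : ∀ Q → P ++ v ∷ Q ++ v ∷ R ≡ (P ++ [ v ]) ++ Q ++ v ∷ R
    assoc Q = ls 4 (λ p v q r → p & v & q & r ⊜ (p & v) & q & r) refl P [ v ] Q (v ∷ R)
  go : (d : Dec (a ≡ b)) → ord a b (P ++ v ∷ rev Q ++ v ∷ R) ≡
    (if Dec.does d then ord a b (P ++ v ∷ Q ++ v ∷ R) else ord a b (P ++ v ∷ Q ++ v ∷ R) xor (nbr v (P ++ v ∷ Q ++ v ∷ R) a ∧ nbr v (P ++ v ∷ Q ++ v ∷ R) b))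
  go (yes refl) = trans mid (taut 2 (λ o x → o xor (x xor x)) (λ o x → o) _ (ord a a (P ++ v ∷ Q ++ v ∷ R)) (ord a a Q))
  go (no a≢b) rewrite nb a | nb b = trans mid (trans (cong (λ t → ord a b (P ++ v ∷ Q ++ v ∷ R) xor (t xor ord a b Q)) (ord-swap a≢b Q))
    (taut 3 (λ o x y → o xor ((x xor y) xor x)) (λ o x y → o xor y) _ (ord a b (P ++ v ∷ Q ++ v ∷ R)) (ord a b Q) (par a Q ∧ par b Q)))

lc-SG : (v : Fin k) {u w : Wd k} → count v u ≡ 2 → SG u w → SG (lc v u) (lc v w)
lc-SG v {u} {w} c g = sg (λ a → trans (sym (lc-Same v u c a)) (trans (same g a) (lc-Same v w c' a))) os
  where
  c' = trans (sym (same g v)) c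
  os : ∀ a b → ord a b (lc v u) ≡ ord a b (lc v w)
  os a b rewrite lc-ord v u c a b | lc-ord v w c' a b | ords g a b | ords g v a | ords g v b = refl

-- If the cut point lies inside the arc of `v`, the rotated word gets the other arc reversed
-- instead. Reversing one arc or the other gives the same cyclic word up to reflection.
lc-rot : (v : Fin k) (U V : Wd k) → count v (U ++ V) ≡ 2 → lc v (U ++ V) ≅ lc v (V ++ U)
lc-rot {k} v U V c with locate2 v (U ++ V) c
... | P , Q , R , eq , p , q , r with ++-compare U P eq
...   | inj₁ (D , refl , refl) = inP
  where
  d0 : count v D ≡ 0
  d0 = proj₂ (zeros v U D p)
  inP : lc v (U ++ (D ++ v ∷ Q ++ v ∷ R)) ≅ lc v ((D ++ v ∷ Q ++ v ∷ R) ++ U)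
  inP = ≅trans (≅≡ (trans (cong (lc v) (sym (++-assoc U D (v ∷ Q ++ v ∷ R)))) (trans (lc-form v (U ++ D) Q R p q) (++-assoc U D _))))
    (≅trans (≅rot U (D ++ v ∷ rev Q ++ v ∷ R)) (≅≡ (trans (ls 5 (λ d v q r u → (d & v & q & v & r) & u ⊜ d & v & q & v & r & u) refl D [ v ] (rev Q) R U)
      (trans (sym (lc-form v D Q (R ++ U) d0 q)) (cong (lc v) (ls 5 (λ d v q r u → d & v & q & v & r & u ⊜ (d & v & q & v & r) & u) refl D [ v ] Q R U))))))
...   | inj₂ ([] , refl , refl) = ≅trans (≅≡ (trans (cong (λ z → lc v (z ++ v ∷ Q ++ v ∷ R)) (++-identityʳ P)) (lc-form v P Q R p q)))
    (≅trans (≅rot P (v ∷ rev Q ++ v ∷ R)) (≅≡ (trans (ls 4 (λ v q r u → (v & q & v & r) & u ⊜ v & q & v & r & u) refl [ v ] (rev Q) R P)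
      (trans (sym (lc-form v [] Q (R ++ P) refl q)) (cong (lc v) (trans (ls 4 (λ v q r u → v & q & v & r & u ⊜ (v & q & v & r) & u) refl [ v ] Q R P) (cong ((v ∷ Q ++ v ∷ R) ++_) (sym (++-identityʳ P)))))))))
...   | inj₂ (x ∷ D , refl , eD) with ∷-injective eD
...     | refl , eD' with ++-compare D Q (sym eD')
...       | inj₁ (F , refl , refl) = ≅trans
      (≅≡ (trans (cong (lc v) (ls 5 (λ p v d f r → (p & v & d) & f & v & r ⊜ p & v & (d & f) & v & r) refl P [ v ] D F R))
        (trans (lc-form v P (D ++ F) R p q) (trans (cong (λ t → P ++ v ∷ t ++ v ∷ R) (reverse-++ D F))
          (ls 5 (λ p v d f r → p & v & (f & d) & v & r ⊜ (p & v & f) & d & v & r) refl P [ v ] (rev D) (rev F) R)))))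
      (≅trans (≅rot (P ++ v ∷ rev F) (rev D ++ v ∷ R))
      (≅trans (≅≡ (trans (ls 5 (λ d v r p f → (d & v & r) & p & v & f ⊜ d & v & (r & p) & v & f) refl (rev D) [ v ] R P (rev F))
            (trans (cong (λ t → rev D ++ v ∷ t ++ v ∷ rev F) (sym (reverse-involutive (R ++ P)))) (sym (reverse5 F [ v ] (rev (R ++ P)) [ v ] D)))))
      (≅trans (≅sym (≅rev _)) (≅≡ (trans (sym (lc-form v F (R ++ P) D (proj₂ dq) rp)) (cong (lc v) (ls 5 (λ f v r p d → f & v & (r & p) & v & d ⊜ (f & v & r) & p & v & d) refl F [ v ] R P D)))))))
      where
      dq = +≡0 {count v D} {count v F} (trans (sym (count-++ v D F)) q)
      rp : count v (R ++ P) ≡ 0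
      rp = trans (count-++ v R P) (cong₂ _+_ r p)
...       | inj₂ ([] , refl , refl) = ≅trans
      (≅≡ (trans (cong (lc v) (ls 4 (λ p v q r → (p & v & q & nil) & v & r ⊜ p & v & q & v & r) refl P [ v ] Q R)) (trans (lc-form v P Q R p q)
          (ls 4 (λ p v q r → p & v & q & v & r ⊜ (p & v) & q & v & r) refl P [ v ] (rev Q) R))))
      (≅trans (≅rot (P ++ [ v ]) (rev Q ++ v ∷ R))
      (≅trans (≅≡ (trans (ls 4 (λ q v r p → (q & v & r) & p & v ⊜ q & v & (r & p) & v & nil) refl (rev Q) [ v ] R P)
          (trans (cong (λ t → rev Q ++ v ∷ t ++ v ∷ []) (sym (reverse-involutive (R ++ P)))) (sym (reverse5 [] [ v ] (rev (R ++ P)) [ v ] Q)))))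
      (≅trans (≅sym (≅rev _)) (≅≡ (trans (sym (lc-form v [] (R ++ P) Q refl rp)) (cong (lc v) (ls 4 (λ v r p q → v & (r & p) & v & q ⊜ (v & r) & p & v & q & nil) refl [ v ] R P Q)))))))
      where
      rp : count v (R ++ P) ≡ 0
      rp = trans (count-++ v R P) (cong₂ _+_ r p)
...       | inj₂ (y ∷ F , refl , eF) with ∷-injective eF
...         | refl , refl = ≅trans
      (≅≡ (trans (cong (lc v) (ls 5 (λ p v q f w → (p & v & q & v & f) & w ⊜ p & v & q & v & f & w) refl P [ v ] Q F V))
        (trans (lc-form v P Q (F ++ V) p q) (ls 5 (λ p v q f w → p & v & q & v & f & w ⊜ (p & v & q & v & f) & w) refl P [ v ] (rev Q) F V))))
      (≅trans (≅rot (P ++ v ∷ rev Q ++ v ∷ F) V) (≅≡ (trans (sym (++-assoc V P _)) (trans (sym (lc-form v (V ++ P) Q F vp q)) (cong (lc v) (++-assoc V P _))))))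
      where
      vp : count v (V ++ P) ≡ 0
      vp = trans (count-++ v V P) (cong₂ _+_ (proj₂ (zeros v F V r)) p)

lc-≅ : (v : Fin k) {u w : Wd k} → u ≅ w → count v u ≡ 2 → lc v u ≅ lc v w
lc-≅ v ≅refl c = ≅refl
lc-≅ v (≅sym p) c = ≅sym (lc-≅ v p (trans (≅-Same p v) c))
lc-≅ v (≅trans p q) c = ≅trans (lc-≅ v p c) (lc-≅ v q (trans (sym (≅-Same p v)) c))
lc-≅ v (≅rot U V) c = lc-rot v U V c
lc-≅ v (≅rev w) c = ≅trans (≅rev _) (≅≡ (sym (lc-reverse v w c)))

lc-undo : (v : Fin k) {u w : Wd k} → count v u ≡ 2 → count v w ≡ 2 → lc v u ≅ lc v w → u ≅ w
lc-undo v {u} {w} cu cw p = subst₂ _≅_ (lc-involutive v u cu) (lc-involutive v w cw) (lc-≅ v p (trans (sym (lc-Same v u cu v)) cu))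

lc-Prime : (v : Fin k) {w : Wd k} → count v w ≡ 2 → Prime w → Prime (lc v w)
lc-Prime v {w} c = Prime-resp (lc-Same v w c) (lc-cut v w c)

-- Stars of vertices and submodularity of cuts

-- Unlike `path` it has no closing step, so for an arc between the two ends of a vertex it counts
-- the cut edges that do not meet this vertex.
lin : Side k → Fin k → Wd k → ℕ
lin S a [] = 0
lin S a (x ∷ X) = jump (S a) (S x) + lin S x X

lst : Fin k → Wd k → Fin k
lst a [] = a
lst a (x ∷ X) = lst x X

path-lin : (S : Side k) (a : Fin k) (X W : Wd k) (c : Bool) →
  path S (S a) (X ++ W) c ≡ lin S a X + path S (S (lst a X)) W c
path-lin S a [] W c = refl
path-lin S a (x ∷ X) W c = trans (cong (jump (S a) (S x) +_) (path-lin S x X W c)) (sym (ℕ.+-assoc (jump (S a) (S x)) _ _))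

path-lin0 : (S : Side k) (a : Fin k) (X : Wd k) (c : Bool) → path S (S a) X c ≡ lin S a X + jump (S (lst a X)) c
path-lin0 S a X c = trans (cong (λ z → path S (S a) z c) (sym (++-identityʳ X))) (path-lin S a X [] c)

lin-ext : {S T : Side k} (a : Fin k) (X : Wd k) → (∀ x → count x (a ∷ X) ≢ 0 → S x ≡ T x) → lin S a X ≡ lin T a X
lin-ext a [] h = refl
lin-ext a (x ∷ X) h = cong₂ _+_ (cong₂ jump (h a (head≢0 a (x ∷ X))) (h x (cons≢0 x a (x ∷ X) (head≢0 x X)))) (lin-ext x X λ y n → h y (cons≢0 y a (x ∷ X) n))

lin-not : (S : Side k) (a : Fin k) (X : Wd k) → lin (not ∘ S) a X ≡ lin S a X
lin-not S a [] = refl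
lin-not S a (x ∷ X) = cong₂ _+_ (jump-not (S a) (S x)) (lin-not S x X)

_∩_ _∪_ : Side k → Side k → Fin k → Bool
(S ∩ T) x = S x ∧ T x
(S ∪ T) x = S x ∨ T x

-- Submodularity of the cut function for a single edge, with all sixteen positions of its ends
-- checked.
jump-sub : ∀ s t s' t' → jump (s ∧ t) (s' ∧ t') + jump (s ∨ t) (s' ∨ t') ≤ jump s s' + jump t t'
jump-sub s t s' t' = ℕ.≤ᵇ⇒≤ _ _ (subst IsTrue (sym (taut 4 (λ s t s' t' → (jump (s ∧ t) (s' ∧ t') + jump (s ∨ t) (s' ∨ t')) ≤ᵇ (jump s s' + jump t t')) (λ _ _ _ _ → true) tt s t s' t')) tt)

shuffle : ∀ a b c d → (a + b) + (c + d) ≡ (a + c) + (b + d)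
shuffle = ℕRing.solve-∀

lin-sub : (S T : Side k) (a : Fin k) (X : Wd k) → lin (S ∩ T) a X + lin (S ∪ T) a X ≤ lin S a X + lin T a X
lin-sub S T a [] = z≤n
lin-sub S T a (x ∷ X) = ≤-trans (≤-reflexive (shuffle (jump ((S ∩ T) a) ((S ∩ T) x)) _ (jump ((S ∪ T) a) ((S ∪ T) x)) _))
  (≤-trans (ℕ.+-mono-≤ (jump-sub (S a) (T a) (S x) (T x)) (lin-sub S T x X)) (≤-reflexive (sym (shuffle (jump (S a) (S x)) _ (jump (T a) (T x)) _))))

jumps : Side k → Bool → Wd k → ℕ
jumps S s [] = 0
jumps S s (y ∷ ys) = jump s (S y) + jumps S s ys

jumps-in : (S : Side k) (ys : Wd k) → jumps S false ys ≡ length (flt S ys)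
jumps-in S [] = refl
jumps-in S (y ∷ ys) with S y
... | true = cong suc (jumps-in S ys)
... | false = jumps-in S ys

jumps-out : (S : Side k) (ys : Wd k) → jumps S true ys ≡ length (flt (not ∘ S) ys)
jumps-out S [] = refl
jumps-out S (y ∷ ys) with S y
... | true = jumps-out S ys
... | false = cong suc (jumps-out S ys)

in+out : (S : Side k) (ys : Wd k) → length (flt S ys) + length (flt (not ∘ S) ys) ≡ length ys
in+out S [] = refl
in+out S (y ∷ ys) with S y
... | true = cong suc (in+out S ys)
... | false = trans (ℕ.+-suc _ _) (cong suc (in+out S ys))

flt-ext : {S T : Side k} (w : Wd k) → (∀ x → count x w ≢ 0 → S x ≡ T x) → flt S w ≡ flt T w
flt-ext [] h = refl
flt-ext {S = S} {T} (x ∷ w) h rewrite h x (head≢0 x w) with T x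
... | true = cong (x ∷_) (flt-ext w λ y n → h y (cons≢0 y x w n))
... | false = flt-ext w λ y n → h y (cons≢0 y x w n)

count-length : (x : Fin k) (w : Wd k) → length (flt (eqb x) w) ≡ count x w
count-length x [] = refl
count-length x (y ∷ w) with eqb x y
... | true = cong suc (count-length x w)
... | false = count-length x w

data Uniq {k} : Wd k → Set where
  [] : Uniq []
  _∷_ : ∀ {x xs} → count x xs ≡ 0 → Uniq xs → Uniq (x ∷ xs)

pigeonhole : {xs : Wd k} → Uniq xs → (ys : Wd k) → (∀ x → count x xs ≢ 0 → count x ys ≢ 0) → length xs ≤ length ys
pigeonhole [] ys h = z≤n
pigeonhole {xs = x ∷ xs} (n ∷ u) ys h = ≤-trans (s≤s (pigeonhole u (rm x ys) λ y c e → h y (cons≢0 y x xs c) (trans (sym (count-flt-in _ (cong not (eqb-≢ {a = x} {y} λ { refl → c n })) ys)) e)))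
  (length-flt-< _ (cong not (eqb-refl x)) ys (h x (head≢0 x xs)))

minus plus : Side k → Fin k → Fin k → Bool
minus S v x = S x ∧ not (eqb v x)
plus S v x = S x ∨ eqb v x

minus-self : (S : Side k) (v : Fin k) → minus S v v ≡ false
minus-self S v rewrite eqb-refl v with S v
... | true = refl
... | false = refl

minus-other : (S : Side k) {v x : Fin k} → x ≢ v → minus S v x ≡ S x
minus-other S {v} {x} n rewrite eqb-≢ {a = v} {x} (n ∘ sym) with S x
... | true = refl
... | false = refl

plus-self : (S : Side k) (v : Fin k) → plus S v v ≡ true
plus-self S v rewrite eqb-refl v with S v
... | true = refl
... | false = refl

plus-other : (S : Side k) {v x : Fin k} → x ≢ v → plus S v x ≡ S x
plus-other S {v} {x} n rewrite eqb-≢ {a = v} {x} (n ∘ sym) with S x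
... | true = refl
... | false = refl

cut-single : (D : Wd k) → DO D → ∀ x → count x D ≢ 0 → cut (eqb x) D ≤ 4
cut-single D d x n with d x
... | inj₁ e = ⊥-elim (n e)
... | inj₂ e with locate2 x D e
...   | P , Q , R , refl , p , q , r = ≤-trans
        (≤-reflexive (≅-cut (rot≡ {W = [ x ] ++ Q ++ [ x ] ++ R ++ P} P (x ∷ Q ++ x ∷ R) refl (ls 4 (λ x q r p → (x & q & x & r) & p ⊜ x & q & x & r & p) refl [ x ] Q R P)) (eqb x)))
        (cut-bound4 (eqb x) [ x ] Q [ x ] (R ++ P) (eqb-refl x ∷ []) (mono Q q) (eqb-refl x ∷ []) (mono (R ++ P) (trans (count-++ x R P) (cong₂ _+_ r p))))
  where
  mono : ∀ w → count x w ≡ 0 → Mono (eqb x) false w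
  mono w c = in-Mono (eqb x) w λ b n → eqb-≢ {a = x} {b} λ { refl → n c }

-- The vertex v of the 4-regular graph formed by the chords, with an edge for
-- each pair of consecutive endpoints; ns lists its neighbours, and f counts the
-- edges of a cut that do not meet v.

record Star (D : Wd k) (v : Fin k) : Set where
  field
    ns : Wd k
    f : Side k → ℕ
    four : length ns ≡ 4
    eq : ∀ S → cut S D ≡ f S + jumps S (S v) ns
    f-ext : ∀ S T → (∀ x → x ≢ v → count x D ≢ 0 → S x ≡ T x) → f S ≡ f T
    f-sub : ∀ S T → f (S ∩ T) + f (S ∪ T) ≤ f S + f T
    f-not : ∀ S → f (not ∘ S) ≡ f S
    ns-in : ∀ y → count y ns ≢ 0 → y ≢ v × count y D ≢ 0

-- By `cut-duo` a pair of vertices has eight outgoing edges minus two for each edge between them, so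
-- the bound 6 means that they are joined. In this form adjacency is visibly symmetric and depends
-- only on the cuts of `D`.
record Adj (D : Wd k) (x y : Fin k) : Set where
  constructor adjacent
  field
    cut≤6 : cut (duo x y) D ≤ 6
open Adj

Adj-sym : {D : Wd k} {x y : Fin k} → Adj D x y → Adj D y x
Adj-sym {D = D} {x} {y} (adjacent a) = adjacent (subst (_≤ 6) (cut-ext (λ z → taut 2 (λ p q → p ∨ q) (λ p q → q ∨ p) tt (eqb x z) (eqb y z)) D) a)

twice≰1 : (x : Fin k) (u v w : Wd k) → ¬ count x (u ++ x ∷ v ++ x ∷ w) ≤ 1
twice≰1 x u v w le = case ≤-trans (ℕ.m≤n+m (suc (suc (count x w))) (count x u + count x v)) (subst (_≤ 1) eq le) of λ { (s≤s ()) }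
  where
  arith : ∀ u v w → u + suc (v + suc w) ≡ (u + v) + suc (suc w)
  arith = ℕRing.solve-∀
  eq : count x (u ++ x ∷ v ++ x ∷ w) ≡ (count x u + count x v) + suc (suc (count x w))
  eq = trans (count-++ x u (x ∷ v ++ x ∷ w)) (trans (cong (count x u +_) (trans (count-head x (v ++ x ∷ w)) (cong suc (trans (count-++ x v (x ∷ w)) (cong (count x v +_) (count-head x w)))))) (arith (count x u) (count x v) (count x w)))

module StarLemmas {D : Wd k} (dD : DO D) (PD : Prime D) (big : Big D) {v : Fin k} (σ : Star D v) (cv : count v D ≢ 0) where
  open Star σ

  ins outs : Side k → ℕ
  ins S = length (flt S ns)
  outs S = length (flt (not ∘ S) ns)

  ins+outs : ∀ S → ins S + outs S ≡ 4
  ins+outs S = trans (in+out S ns) four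

  cut-out : ∀ S → S v ≡ false → cut S D ≡ f S + ins S
  cut-out S e = trans (eq S) (cong (f S +_) (trans (cong (λ b → jumps S b ns) e) (jumps-in S ns)))

  cut-in : ∀ S → S v ≡ true → cut S D ≡ f S + outs S
  cut-in S e = trans (eq S) (cong (f S +_) (trans (cong (λ b → jumps S b ns) e) (jumps-out S ns)))

  ins-ext : ∀ S T → (∀ x → x ≢ v → count x D ≢ 0 → S x ≡ T x) → ins S ≡ ins T
  ins-ext S T h = cong length (flt-ext ns λ x n → h x (proj₁ (ns-in x n)) (proj₂ (ns-in x n)))

  outs-ext : ∀ S T → (∀ x → x ≢ v → count x D ≢ 0 → S x ≡ T x) → outs S ≡ outs T
  outs-ext S T h = cong length (flt-ext ns λ x n → cong not (h x (proj₁ (ns-in x n)) (proj₂ (ns-in x n))))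

  cut-minus : ∀ S → cut (minus S v) D ≡ f S + ins S
  cut-minus S = trans (cut-out (minus S v) (minus-self S v)) (cong₂ _+_ (f-ext (minus S v) S λ x n _ → minus-other S n) (ins-ext (minus S v) S λ x n _ → minus-other S n))

  cut-plus : ∀ S → cut (plus S v) D ≡ f S + outs S
  cut-plus S = trans (cut-in (plus S v) (plus-self S v)) (cong₂ _+_ (f-ext (plus S v) S λ x n _ → plus-other S n) (outs-ext (plus S v) S λ x n _ → plus-other S n))

  -- When `v` joins `S`, its `ins S` edges into `S` stop being cut and its remaining edges start to
  -- be; there are four in total.
  add-vertex : ∀ S → S v ≡ false → cut (plus S v) D + (ins S + ins S) ≡ cut S D + 4
  add-vertex S e = trans (cong (_+ (ins S + ins S)) (cut-plus S)) (trans (arith (f S) (outs S) (ins S)) (cong₂ _+_ (sym (cut-out S e)) (ins+outs S)))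
    where
    arith : ∀ f o i → (f + o) + (i + i) ≡ (f + i) + (i + o)
    arith = ℕRing.solve-∀

  -- 8 minus twice the number of edges between v and y
  cut-duo : ∀ y → y ≢ v → count y D ≢ 0 → cut (duo v y) D + (count y ns + count y ns) ≡ 8
  cut-duo y y≢v cy = trans (cong₂ _+_ (cut-ext (λ z → taut 2 (λ p q → p ∨ q) (λ p q → q ∨ p) tt (eqb v z) (eqb y z)) D) (cong₂ _+_ (sym (count-length y ns)) (sym (count-length y ns))))
    (trans (add-vertex (eqb y) (eqb-≢ y≢v)) (cong (_+ 4) (ℕ.≤-antisym (cut-single D dD y cy) (Prime.single PD y cy))))

  Two-duo : ∀ y → y ≢ v → count y D ≢ 0 → 6 ≤ cut (duo v y) D
  Two-duo y y≢v cy with big v y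
  ... | p , q , p≢q , (pv , py) , (qv , qy) , cp , cq = Prime.cuts PD (duo v y) (two v y (y≢v ∘ sym) (duo-l v y) (duo-r v y) cv cy) (two p q p≢q (duo-no pv py) (duo-no qv qy) cp cq)

  -- A multiple edge between `v` and `y` would leave at most four edges out of this pair.
  simple : ∀ y → count y ns ≤ 1
  simple y with nonzero-or y ns
  ... | inj₁ e = ≤-trans (≤-reflexive e) z≤n
  ... | inj₂ n = go (count y ns) (cut (duo v y) D) (Two-duo y (proj₁ (ns-in y n)) (proj₂ (ns-in y n))) (cut-duo y (proj₁ (ns-in y n)) (proj₂ (ns-in y n)))
    where
    go : ∀ m d → 6 ≤ d → d + (m + m) ≡ 8 → m ≤ 1
    go zero d _ _ = z≤n
    go (suc zero) d _ _ = s≤s z≤n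
    go (suc (suc m)) d le e = ⊥-elim (ℕ.<⇒≱ (≤-trans (ℕ.m≤m+n 9 _) (ℕ.+-mono-≤ le (ℕ.+-mono-≤ {2} (s≤s (s≤s z≤n)) (s≤s (s≤s z≤n))))) (≤-reflexive e))

  Adj⇒nbr : ∀ y → y ≢ v → count y D ≢ 0 → Adj D v y → count y ns ≢ 0
  Adj⇒nbr y y≢v cy adj e = ℕ.<⇒≱ (ℕ.m≤m+n 7 _) (≤-trans (≤-reflexive (trans (sym (cut-duo y y≢v cy)) (trans (cong (λ z → cut (duo v y) D + (z + z)) e) (ℕ.+-identityʳ _)))) (cut≤6 adj))

  nbr⇒Adj : ∀ y → count y ns ≢ 0 → Adj D v y
  nbr⇒Adj y n = adjacent (go (count y ns) (cut (duo v y) D) n (cut-duo y (proj₁ (ns-in y n)) (proj₂ (ns-in y n))))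
    where
    go : ∀ m d → m ≢ 0 → d + (m + m) ≡ 8 → d ≤ 6
    go zero d n e = ⊥-elim (n refl)
    go (suc m) d n e = ℕ.+-cancelʳ-≤ 2 d 6 (≤-trans (ℕ.+-monoʳ-≤ d (ℕ.+-mono-≤ {1} (s≤s z≤n) (s≤s z≤n))) (≤-reflexive e))

  -- the analogue of the bound 6 ≤ cut S for sets of chords other than v
  six : ∀ S x y z → x ≢ y → x ≢ v → y ≢ v → z ≢ v → count x D ≢ 0 → count y D ≢ 0 → count z D ≢ 0 →
    S x ≡ true → S y ≡ true → S z ≡ false → 6 ≤ f S + ins S
  six S x y z x≢y xv yv zv cx cy cz Sx Sy Sz = subst (6 ≤_) (cut-minus S)
    (Prime.cuts PD (minus S v) (two x y x≢y (trans (minus-other S xv) Sx) (trans (minus-other S yv) Sy) cx cy)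
      (two z v zv (trans (minus-other S zv) Sz) (minus-self S v) cz cv))

  Only : Side k → Fin k → Set
  Only S x = ∀ y → y ≢ v → count y D ≢ 0 → S y ≡ true → y ≡ x

  only? : ∀ S x → Only S x ⊎ ∃[ y ] (y ≢ v × count y D ≢ 0 × S y ≡ true × y ≢ x)
  only? S x with any? (λ y → ¬? (y ≟ᶠ v) ×-dec (¬? (count y D ℕ.≟ 0) ×-dec ((S y ≟ᵇ true) ×-dec ¬? (y ≟ᶠ x))))
  ... | yes (y , a , b , c , d) = inj₂ (y , a , b , c , d)
  ... | no n = inj₁ λ y a b c → case y ≟ᶠ x of λ { (yes e) → e ; (no d) → ⊥-elim (n (y , a , b , c , d)) }

  -- If `v` is removed and its edges are joined to new edges from `p` to `q` and from `r` to `s`,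
  -- the set `S` cuts neither of them and has a cut of only `f S` edges. It is the obstruction to
  -- primality of this splitting.
  record Bad (p q r s : Fin k) : Set where
    field
      S : Side k
      Sp : S p ≡ true
      Sq : S q ≡ true
      Sr : S r ≡ false
      Ss : S s ≡ false
      f≤4 : f S ≤ 4

  module Quad {p q r s : Fin k} (perm : ns ↭ p ∷ q ∷ r ∷ s ∷ []) where
    ins4 : ∀ S → ins S ≡ length (flt S (p ∷ q ∷ r ∷ s ∷ []))
    ins4 S = length-flt-↭ S perm
      where
      length-flt-↭ : ∀ S {u w : Wd k} → u ↭ w → length (flt S u) ≡ length (flt S w)
      length-flt-↭ S _↭_.refl = refl
      length-flt-↭ S (prep x p) with S x
      ... | true = cong suc (length-flt-↭ S p)
      ... | false = length-flt-↭ S p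
      length-flt-↭ S (swap x y p) with S x | S y
      ... | true | true = cong (2 +_) (length-flt-↭ S p)
      ... | true | false = cong suc (length-flt-↭ S p)
      ... | false | true = cong suc (length-flt-↭ S p)
      ... | false | false = length-flt-↭ S p
      length-flt-↭ S (↭trans p q) = trans (length-flt-↭ S p) (length-flt-↭ S q)

    in-ns : ∀ y → count y (p ∷ q ∷ r ∷ s ∷ []) ≢ 0 → count y ns ≢ 0
    in-ns y n e = n (trans (sym (count-↭ y perm)) e)
    p∈ : count p ns ≢ 0
    p∈ = in-ns p (head≢0 p (q ∷ r ∷ s ∷ []))
    q∈ : count q ns ≢ 0
    q∈ = in-ns q (cons≢0 q p (q ∷ r ∷ s ∷ []) (head≢0 q (r ∷ s ∷ [])))
    r∈ : count r ns ≢ 0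
    r∈ = in-ns r (cons≢0 r p (q ∷ r ∷ s ∷ []) (cons≢0 r q (r ∷ s ∷ []) (head≢0 r [ s ])))
    s∈ : count s ns ≢ 0
    s∈ = in-ns s (cons≢0 s p (q ∷ r ∷ s ∷ []) (cons≢0 s q (r ∷ s ∷ []) (cons≢0 s r [ s ] (head≢0 s []))))

    from-ns : ∀ y → count y ns ≢ 0 → (y ≡ p) ⊎ (y ≡ q) ⊎ (y ≡ r) ⊎ (y ≡ s)
    from-ns y n with y ≟ᶠ p | y ≟ᶠ q | y ≟ᶠ r | y ≟ᶠ s
    ... | yes e | _ | _ | _ = inj₁ e
    ... | no _ | yes e | _ | _ = inj₂ (inj₁ e)
    ... | no _ | no _ | yes e | _ = inj₂ (inj₂ (inj₁ e))
    ... | no _ | no _ | no _ | yes e = inj₂ (inj₂ (inj₂ e))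
    ... | no a | no b | no c | no d = ⊥-elim (n (trans (count-↭ y perm) (trans (count-other a (q ∷ r ∷ s ∷ [])) (trans (count-other b (r ∷ s ∷ [])) (trans (count-other c [ s ]) (count-other d []))))))

    once : ∀ y → count y (p ∷ q ∷ r ∷ s ∷ []) ≤ 1
    once y = subst (_≤ 1) (count-↭ y perm) (simple y)

    p≢q : p ≢ q
    p≢q refl = twice≰1 p [] [] (r ∷ s ∷ []) (once p)
    p≢r : p ≢ r
    p≢r refl = twice≰1 p [] [ q ] [ s ] (once p)
    p≢s : p ≢ s
    p≢s refl = twice≰1 p [] (q ∷ r ∷ []) [] (once p)
    q≢r : q ≢ r
    q≢r refl = twice≰1 q [ p ] [] [ s ] (once q)
    q≢s : q ≢ s
    q≢s refl = twice≰1 q [ p ] [ r ] [] (once q)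
    r≢s : r ≢ s
    r≢s refl = twice≰1 r (p ∷ q ∷ []) [] [] (once r)

    pv = proj₁ (ns-in p p∈)
    qv = proj₁ (ns-in q q∈)
    rv = proj₁ (ns-in r r∈)
    sv = proj₁ (ns-in s s∈)
    cp = proj₂ (ns-in p p∈)
    cq = proj₂ (ns-in q q∈)
    cr = proj₂ (ns-in r r∈)
    cs = proj₂ (ns-in s s∈)

    -- Apart from `v`, the set `S` is just the pair `x`, `y`, whose cut consists of `f S` edges and
    -- the two edges to `v`.
    adj : ∀ S x y → x ≢ v → y ≢ v → ins S ≡ 2 → f S ≤ 4 → S x ≡ true → S y ≡ true → (∀ z → z ≢ v → count z D ≢ 0 → S z ≡ true → (z ≡ x) ⊎ (z ≡ y)) → Adj D x y
    adj S x y xv yv i le Sx Sy only = adjacent (≤-trans (≤-reflexive (trans (cut-out (duo x y) (duo-no (xv ∘ sym) (yv ∘ sym)))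
        (cong₂ _+_ (f-ext (duo x y) S agree) (trans (ins-ext (duo x y) S agree) i)))) (ℕ.+-monoˡ-≤ 2 le))
      where
      agree : ∀ z → z ≢ v → count z D ≢ 0 → duo x y z ≡ S z
      agree z zv cz with S z in Sz
      ... | true with only z zv cz Sz
      ...   | inj₁ refl = duo-l x y
      ...   | inj₂ refl = duo-r x y
      agree z zv cz | false = duo-no {v = x} {y} {z} (λ { refl → true≢false (trans (sym Sx) Sz) }) (λ { refl → true≢false (trans (sym Sy) Sz) })

    one-in : ∀ S {i} → ins S ≡ 1 → 6 ≤ f S + ins S → i ≡ f S → 5 ≤ i
    one-in S e le refl = ℕ.+-cancelʳ-≤ 1 5 (f S) (≤-trans le (≤-reflexive (cong (f S +_) e)))

    ten≰ : ∀ {m n b} → 5 ≤ m → 5 ≤ n → m + n ≤ b → b ≤ 8 → ⊥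
    ten≰ a b c d = ℕ.<⇒≱ (ℕ.m≤m+n 9 _) (≤-trans (ℕ.+-mono-≤ a b) (≤-trans c d))

    -- The two sets divide the vertices into four corners, each with exactly one neighbour of `v`.
    -- By `six` a corner with a further vertex has `f` at least 5. Submodularity bounds the sum of
    -- `f` over two opposite corners by 8, so one of each opposite pair is a single vertex. The two
    -- single corners found in this way lie side by side and make up one of the sets or its
    -- complement; by `adj` they are adjacent vertices.
    pair-lemma : Bad p q r s → Bad p r q s → (Adj D p q ⊎ Adj D r s) ⊎ (Adj D p r ⊎ Adj D q s)
    pair-lemma bX bY = combine first second
      where
      X = Bad.S bX
      Y = Bad.S bY
      open Bad bX using () renaming (Sp to Xp; Sq to Xq; Sr to Xr; Ss to Xs; f≤4 to fX)
      open Bad bY using () renaming (Sp to Yp; Sq to Yr; Sr to Yq; Ss to Ys; f≤4 to fY)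
      I O U V : Side k
      I = X ∩ Y
      O = not ∘ (X ∪ Y)
      U = X ∩ (not ∘ Y)
      V = not ∘ (X ∪ (not ∘ Y))
      insI : ins I ≡ 1
      insI rewrite ins4 I | Xp | Xq | Xr | Xs | Yp | Yq = refl
      insO : ins O ≡ 1
      insO rewrite ins4 O | Xp | Xq | Xr | Xs | Yr | Ys = refl
      insU : ins U ≡ 1
      insU rewrite ins4 U | Xp | Xq | Xr | Xs | Yp | Yq = refl
      insV : ins V ≡ 1
      insV rewrite ins4 V | Xp | Xq | Xr | Xs | Yr | Ys = refl
      Ip : I p ≡ true
      Ip rewrite Xp | Yp = refl
      Iq : I q ≡ false
      Iq rewrite Xq | Yq = refl
      Os : O s ≡ true
      Os rewrite Xs | Ys = refl
      Oq : O q ≡ false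
      Oq rewrite Xq = refl
      Uq : U q ≡ true
      Uq rewrite Xq | Yq = refl
      Up : U p ≡ false
      Up rewrite Xp | Yp = refl
      Vr : V r ≡ true
      Vr rewrite Xr | Yr = refl
      Vp : V p ≡ false
      Vp rewrite Xp = refl
      first : Only I p ⊎ Only O s
      first with only? I p | only? O s
      ... | inj₁ o | _ = inj₁ o
      ... | inj₂ _ | inj₁ o = inj₂ o
      ... | inj₂ (y , yv , cy , Iy , y≢p) | inj₂ (z , zv , cz , Oz , z≢s) = ⊥-elim (ten≰
            (one-in I insI (six I p y q (y≢p ∘ sym) pv yv qv cp cy cq Ip Iy Iq) refl)
            (one-in O insO (six O s z q (z≢s ∘ sym) sv zv qv cs cz cq Os Oz Oq) (sym (f-not (X ∪ Y)))) (f-sub X Y) (ℕ.+-mono-≤ fX fY))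
      second : Only U q ⊎ Only V r
      second with only? U q | only? V r
      ... | inj₁ o | _ = inj₁ o
      ... | inj₂ _ | inj₁ o = inj₂ o
      ... | inj₂ (y , yv , cy , Uy , y≢q) | inj₂ (z , zv , cz , Vz , z≢r) = ⊥-elim (ten≰
            (one-in U insU (six U q y p (y≢q ∘ sym) qv yv pv cq cy cp Uq Uy Up) refl)
            (one-in V insV (six V r z p (z≢r ∘ sym) rv zv pv cr cz cp Vr Vz Vp) (sym (f-not (X ∪ (not ∘ Y))))) (f-sub X (not ∘ Y))
            (ℕ.+-mono-≤ fX (≤-trans (≤-reflexive (f-not Y)) fY)))
      insX : ins X ≡ 2
      insX rewrite ins4 X | Xp | Xq | Xr | Xs = refl
      insX' : ins (not ∘ X) ≡ 2
      insX' rewrite ins4 (not ∘ X) | Xp | Xq | Xr | Xs = refl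
      insY : ins Y ≡ 2
      insY rewrite ins4 Y | Yp | Yq | Yr | Ys = refl
      insY' : ins (not ∘ Y) ≡ 2
      insY' rewrite ins4 (not ∘ Y) | Yp | Yq | Yr | Ys = refl
      combine : Only I p ⊎ Only O s → Only U q ⊎ Only V r → (Adj D p q ⊎ Adj D r s) ⊎ (Adj D p r ⊎ Adj D q s)
      combine (inj₁ oI) (inj₁ oU) = inj₁ (inj₁ (adj X p q pv qv insX fX Xp Xq go))
        where
        go : ∀ z → z ≢ v → count z D ≢ 0 → X z ≡ true → (z ≡ p) ⊎ (z ≡ q)
        go z zv cz Xz with Y z in Yz
        ... | true = inj₁ (oI z zv cz (cong₂ _∧_ Xz Yz))
        ... | false = inj₂ (oU z zv cz (cong₂ (λ a b → a ∧ not b) Xz Yz))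
      combine (inj₁ oI) (inj₂ oV) = inj₂ (inj₁ (adj Y p r pv rv insY fY Yp Yr go))
        where
        go : ∀ z → z ≢ v → count z D ≢ 0 → Y z ≡ true → (z ≡ p) ⊎ (z ≡ r)
        go z zv cz Yz with X z in Xz
        ... | true = inj₁ (oI z zv cz (cong₂ _∧_ Xz Yz))
        ... | false = inj₂ (oV z zv cz (cong₂ (λ a b → not (a ∨ not b)) Xz Yz))
      combine (inj₂ oO) (inj₁ oU) = inj₂ (inj₂ (adj (not ∘ Y) q s qv sv insY' (≤-trans (≤-reflexive (f-not Y)) fY) (cong not Yq) (cong not Ys) go))
        where
        go : ∀ z → z ≢ v → count z D ≢ 0 → not (Y z) ≡ true → (z ≡ q) ⊎ (z ≡ s)
        go z zv cz Yz with X z in Xz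
        ... | true = inj₁ (oU z zv cz (cong₂ _∧_ Xz Yz))
        ... | false = inj₂ (oO z zv cz (trans (cong (λ a → not (a ∨ Y z)) Xz) Yz))
      combine (inj₂ oO) (inj₂ oV) = inj₁ (inj₂ (adj (not ∘ X) r s rv sv insX' (≤-trans (≤-reflexive (f-not X)) fX) (cong not Xr) (cong not Xs) go))
        where
        go : ∀ z → z ≢ v → count z D ≢ 0 → not (X z) ≡ true → (z ≡ r) ⊎ (z ≡ s)
        go z zv cz Xz with X z in Xz' | Y z in Yz
        ... | false | true = inj₁ (oV z zv cz (cong₂ (λ a b → not (a ∨ not b)) Xz' Yz))
        ... | false | false = inj₂ (oO z zv cz (cong₂ (λ a b → not (a ∨ b)) Xz' Yz))

-- Vertices at which all three splittings fail

uniq3 : {x y z : Fin k} → x ≢ y → x ≢ z → y ≢ z → Uniq (x ∷ y ∷ z ∷ [])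
uniq3 {z = z} xy xz yz = trans (count-other xy [ z ]) (count-other xz []) ∷ count-other yz [] ∷ refl ∷ []

all3 : {x y z : Fin k} (P : Fin k → Set) → P x → P y → P z → ∀ u → count u (x ∷ y ∷ z ∷ []) ≢ 0 → P u
all3 {x = x} {y} {z} P px py pz u n with u ≟ᶠ x | u ≟ᶠ y | u ≟ᶠ z
... | yes refl | _ | _ = px
... | no _ | yes refl | _ = py
... | no _ | no _ | yes refl = pz
... | no a | no b | no c = ⊥-elim (n refl)

module Chain {D : Wd k} (dD : DO D) (PD : Prime D) (big : Big D) (star : ∀ x → count x D ≢ 0 → Star D x) where

  -- Three of the four edges at `t`, those to `x`, `y` and `v`, leave the set `Z`. Removing `t` from
  -- `Z` therefore lowers its cut from at most six to at most four, and primality leaves only `w` in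
  -- the rest. So `Z` is the pair `t`, `w`, and its small cut makes the two adjacent.
  core : ∀ {v} (cv : count v D ≢ 0) {t x y w} → Star.ns (star v cv) ↭ t ∷ x ∷ y ∷ w ∷ [] → Adj D t x → Adj D t y →
    ∀ Z → Z t ≡ true → Z w ≡ true → Z x ≡ false → Z y ≡ false → Star.f (star v cv) Z ≤ 4 → Adj D t w
  core {v} cv {t} {x} {y} {w} perm atx aty Z Zt Zw Zx Zy fZ = Q.adj Z t w Q.pv Q.sv insZ fZ Zt Zw only
    where
    module V = StarLemmas dD PD big (star v cv) cv
    module Q = V.Quad perm
    module T = StarLemmas dD PD big (star t Q.cp) Q.cp
    Z0 Z' : Side k
    Z0 = minus Z v
    Z' = minus Z0 t
    insZ : V.ins Z ≡ 2
    insZ rewrite Q.ins4 Z | Zt | Zx | Zy | Zw = refl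
    cut0 : cut Z0 D ≤ 6
    cut0 = ≤-trans (≤-reflexive (trans (V.cut-minus Z) (cong (Star.f (star v cv) Z +_) insZ))) (ℕ.+-monoˡ-≤ 2 fZ)
    back : ∀ z → plus Z' t z ≡ Z0 z
    back z with z ≟ᶠ t
    ... | yes refl = trans (plus-self Z' t) (sym (trans (minus-other Z Q.pv) Zt))
    ... | no n = trans (plus-other Z' n) (minus-other Z0 n)
    e1 : cut Z0 D + (T.ins Z' + T.ins Z') ≡ cut Z' D + 4
    e1 = trans (cong (_+ (T.ins Z' + T.ins Z')) (sym (cut-ext back D))) (T.add-vertex Z' (minus-self Z0 t))
    atv : count v (Star.ns (star t Q.cp)) ≢ 0
    atv = T.Adj⇒nbr v (Q.pv ∘ sym) cv (Adj-sym {D = D} (V.nbr⇒Adj t Q.p∈))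
    three : 3 ≤ T.outs Z'
    three = pigeonhole (uniq3 Q.q≢r Q.qv Q.rv) (flt (not ∘ Z') (Star.ns (star t Q.cp)))
      (all3 (λ u → count u (flt (not ∘ Z') (Star.ns (star t Q.cp))) ≢ 0)
        (λ e → T.Adj⇒nbr x (Q.p≢q ∘ sym) Q.cq atx (trans (sym (count-flt-in (not ∘ Z') (cong not (trans (minus-other Z0 (Q.p≢q ∘ sym)) (trans (minus-other Z Q.qv) Zx))) (Star.ns (star t Q.cp)))) e))
        (λ e → T.Adj⇒nbr y (Q.p≢r ∘ sym) Q.cr aty (trans (sym (count-flt-in (not ∘ Z') (cong not (trans (minus-other Z0 (Q.p≢r ∘ sym)) (trans (minus-other Z Q.rv) Zy))) (Star.ns (star t Q.cp)))) e))
        (λ e → atv (trans (sym (count-flt-in (not ∘ Z') (cong not (trans (minus-other Z0 (Q.pv ∘ sym)) (minus-self Z v))) (Star.ns (star t Q.cp)))) e)))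
    i≤1 : T.ins Z' ≤ 1
    i≤1 = ℕ.+-cancelʳ-≤ 3 (T.ins Z') 1 (≤-trans (ℕ.+-monoʳ-≤ (T.ins Z') three) (≤-reflexive (T.ins+outs Z')))
    cut' : cut Z' D ≤ 4
    cut' = ℕ.+-cancelʳ-≤ 4 (cut Z' D) 4 (≤-trans (≤-reflexive (sym e1)) (ℕ.+-mono-≤ cut0 (ℕ.+-mono-≤ i≤1 i≤1)))
    only : ∀ z → z ≢ v → count z D ≢ 0 → Z z ≡ true → (z ≡ t) ⊎ (z ≡ w)
    only z zv cz Zz with z ≟ᶠ t | z ≟ᶠ w
    ... | yes e | _ = inj₁ e
    ... | no _ | yes e = inj₂ e
    ... | no z≢t | no z≢w = ⊥-elim (ℕ.<⇒≱ (ℕ.m≤m+n 5 _) (≤-trans (Prime.cuts PD Z'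
          (two w z (z≢w ∘ sym) (trans (minus-other Z0 (Q.p≢s ∘ sym)) (trans (minus-other Z Q.sv) Zw)) (trans (minus-other Z0 z≢t) (trans (minus-other Z zv) Zz)) Q.cs cz)
          (two x v Q.qv (trans (minus-other Z0 (Q.p≢q ∘ sym)) (trans (minus-other Z Q.qv) Zx)) (trans (minus-other Z0 (Q.pv ∘ sym)) (minus-self Z v)) Q.cq cv)) cut'))

  -- A neighbour `t` of `v` that is joined to the three other neighbours of `v`.
  record Hub {v : Fin k} (cv : count v D ≢ 0) : Set where
    field
      {t x y w} : Fin k
      perm : Star.ns (star v cv) ↭ t ∷ x ∷ y ∷ w ∷ []
      tx : Adj D t x
      ty : Adj D t y
      tw : Adj D t w

  module _ {v : Fin k} (cv : count v D ≢ 0) where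
    open StarLemmas dD PD big (star v cv) cv

    -- Pairs taken from two different pairings of the four neighbours share a vertex. This vertex
    -- becomes the centre of the hub, and its third edge comes from `core` applied to the bad set of
    -- the third pairing.
    two-small : ∀ {p q r s} → Star.ns (star v cv) ↭ p ∷ q ∷ r ∷ s ∷ [] → Adj D p q ⊎ Adj D r s → Adj D p r ⊎ Adj D q s → Bad p s q r → Hub cv
    two-small perm (inj₁ pq) (inj₁ pr) b = record { perm = perm ; tx = pq ; ty = pr ; tw = core cv perm pq pr S Sp Sq Sr Ss f≤4 }
      where open Bad b
    two-small {p} {q} {r} {s} perm (inj₁ pq) (inj₂ qs) b = record { perm = perm' ; tx = qp ; ty = qs
        ; tw = core cv perm' qp qs (not ∘ S) (cong not Sr) (cong not Ss) (cong not Sp) (cong not Sq) (≤-trans (≤-reflexive (Star.f-not (star v cv) S)) f≤4) }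
      where
      open Bad b
      perm' = ↭trans perm (swap p q (swap r s ↭-refl))
      qp = Adj-sym {D = D} pq
    two-small {p} {q} {r} {s} perm (inj₂ rs) (inj₁ pr) b = record { perm = perm' ; tx = rs ; ty = rp
        ; tw = core cv perm' rs rp (not ∘ S) (cong not Ss) (cong not Sr) (cong not Sq) (cong not Sp) (≤-trans (≤-reflexive (Star.f-not (star v cv) S)) f≤4) }
      where
      open Bad b
      perm' = ↭trans perm (++-comm (p ∷ q ∷ []) (r ∷ s ∷ []))
      rp = Adj-sym {D = D} pr
    two-small {p} {q} {r} {s} perm (inj₂ rs) (inj₂ qs) b = record { perm = perm' ; tx = sr ; ty = sq ; tw = core cv perm' sr sq S Sq Sp Ss Sr f≤4 }
      where
      open Bad b
      perm' = ↭trans perm (↭-sym (↭-reverse (p ∷ q ∷ r ∷ s ∷ [])))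
      sr = Adj-sym {D = D} rs
      sq = Adj-sym {D = D} qs

    flip-bad : ∀ {p q r s} → Bad p q r s → Bad p q s r
    flip-bad b = record { S = S ; Sp = Sp ; Sq = Sq ; Sr = Ss ; Ss = Sr ; f≤4 = f≤4 }
      where open Bad b

    -- Of any two pairings of the neighbours, `pair-lemma` finds an edge in at least one; hence at
    -- least two of the three pairings contain an edge.
    all-bad : ∀ {p q r s} → Star.ns (star v cv) ↭ p ∷ q ∷ r ∷ s ∷ [] → Bad p q r s → Bad p r q s → Bad p s q r → Hub cv
    all-bad {p} {q} {r} {s} perm bX bY bZ = go (Quad.pair-lemma perm bX bY)
      where
      perm1 = ↭trans perm (prep p (prep q (swap r s ↭-refl)))
      perm2 = ↭trans perm (prep p (↭trans (swap q r ↭-refl) (prep r (swap q s ↭-refl))))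
      flip2 : ∀ {x y : Fin k} {A : Set} → A ⊎ Adj D x y → A ⊎ Adj D y x
      flip2 (inj₁ a) = inj₁ a
      flip2 (inj₂ a) = inj₂ (Adj-sym {D = D} a)
      go : (Adj D p q ⊎ Adj D r s) ⊎ (Adj D p r ⊎ Adj D q s) → Hub cv
      go (inj₁ sx) with Quad.pair-lemma perm2 (flip-bad bY) (flip-bad bZ)
      ... | inj₁ sy = two-small perm sx (flip2 sy) bZ
      ... | inj₂ sz = two-small perm1 (flip2 sx) (flip2 sz) bY
      go (inj₂ sy) with Quad.pair-lemma perm1 (flip-bad bX) bZ
      ... | inj₁ sx = two-small perm (flip2 sx) sy bZ
      ... | inj₂ sz = two-small perm2 (flip2 sy) (flip2 sz) bX

  -- Four pairwise adjacent vertices have six edges among them, which leaves at most 16 - 12 = 4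
  -- outgoing ones. With `h` and `h'` outside, such a cut is forbidden.
  four-clique : ∀ {v t x g} (cv : count v D ≢ 0) (cg : count g D ≢ 0) → t ≢ x → t ≢ v → x ≢ v → g ≢ v → g ≢ t → g ≢ x →
    count t D ≢ 0 → Adj D t x → count t (Star.ns (star v cv)) ≢ 0 → count x (Star.ns (star v cv)) ≢ 0 →
    Adj D g v → Adj D g t → Adj D g x → count x D ≢ 0 →
    ∀ {h h'} → h ≢ h' → (h ≢ v × h ≢ t × h ≢ x × h ≢ g) → (h' ≢ v × h' ≢ t × h' ≢ x × h' ≢ g) → count h D ≢ 0 → count h' D ≢ 0 → ⊥
  four-clique {v} {t} {x} {g} cv cg t≢x tv xv gv gt gx ct tx t∈ x∈ agv agt agx cx {h} {h'} h≢h' (hv , ht , hx , hg) (hv' , ht' , hx' , hg') ch ch' =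
    ℕ.<⇒≱ (ℕ.m≤m+n 5 _) (≤-trans (Prime.cuts PD S3
      (two v t (tv ∘ sym) (trans (plus-other S2 (gv ∘ sym)) (plus-self S1 v)) (trans (plus-other S2 (gt ∘ sym)) (trans (plus-other S1 tv) (duo-l t x))) cv ct)
      (two h h' h≢h' (out hv ht hx hg) (out hv' ht' hx' hg') ch ch')) cut3)
    where
    module V = StarLemmas dD PD big (star v cv) cv
    module G = StarLemmas dD PD big (star g cg) cg
    S1 S2 S3 : Side k
    S1 = duo t x
    S2 = plus S1 v
    S3 = plus S2 g
    out : ∀ {h} → h ≢ v → h ≢ t → h ≢ x → h ≢ g → S3 h ≡ false
    out hv ht hx hg = trans (plus-other S2 hg) (trans (plus-other S1 hv) (duo-no ht hx))
    in1 : 2 ≤ V.ins S1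
    in1 = pigeonhole (count-other t≢x [] ∷ refl ∷ []) (flt S1 (Star.ns (star v cv))) mem
      where
      mem : ∀ u → count u (t ∷ x ∷ []) ≢ 0 → count u (flt S1 (Star.ns (star v cv))) ≢ 0
      mem u n e with u ≟ᶠ t | u ≟ᶠ x
      ... | yes refl | _ = t∈ (trans (sym (count-flt-in S1 (duo-l t x) (Star.ns (star v cv)))) e)
      ... | no _ | yes refl = x∈ (trans (sym (count-flt-in S1 (duo-r t x) (Star.ns (star v cv)))) e)
      ... | no _ | no _ = n refl
    cut2 : cut S2 D ≤ 6
    cut2 = ℕ.+-cancelʳ-≤ 4 (cut S2 D) 6 (≤-trans (ℕ.+-monoʳ-≤ (cut S2 D) (ℕ.+-mono-≤ in1 in1))
      (≤-trans (≤-reflexive (V.add-vertex S1 (duo-no (tv ∘ sym) (xv ∘ sym)))) (ℕ.+-monoˡ-≤ 4 (cut≤6 tx))))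
    in2 : 3 ≤ G.ins S2
    in2 = pigeonhole (uniq3 (tv ∘ sym) (xv ∘ sym) t≢x) (flt S2 (Star.ns (star g cg)))
      (all3 (λ u → count u (flt S2 (Star.ns (star g cg))) ≢ 0)
        (λ e → G.Adj⇒nbr v (gv ∘ sym) cv agv (trans (sym (count-flt-in S2 (plus-self S1 v) (Star.ns (star g cg)))) e))
        (λ e → G.Adj⇒nbr t (gt ∘ sym) ct agt (trans (sym (count-flt-in S2 (trans (plus-other S1 tv) (duo-l t x)) (Star.ns (star g cg)))) e))
        (λ e → G.Adj⇒nbr x (gx ∘ sym) cx agx (trans (sym (count-flt-in S2 (trans (plus-other S1 xv) (duo-r t x)) (Star.ns (star g cg)))) e)))
    cut3 : cut S3 D ≤ 4
    cut3 = ℕ.+-cancelʳ-≤ 6 (cut S3 D) 4 (≤-trans (ℕ.+-monoʳ-≤ (cut S3 D) (ℕ.+-mono-≤ in2 in2))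
      (≤-trans (≤-reflexive (G.add-vertex S2 (trans (plus-other S1 gv) (duo-no gt gx)))) (ℕ.+-monoˡ-≤ 4 cut2)))

  -- The second hub yields a vertex `g`, other than `v`, `t` and `x`, that is adjacent to `x` and to
  -- `v` or `t`. All edges at `v` and at `t` are known, so `g` is `y` or `w`, and `v`, `t`, `x`, `g`
  -- are pairwise adjacent. The other one of `y`, `w` and the vertex `z` lie outside, against
  -- `four-clique`.
  no-two-hubs : ∀ {v} {cv : count v D ≢ 0} (H : Hub cv) (cx : count (Hub.x H) D ≢ 0) → Hub cx →
    ∀ z → count z D ≢ 0 → z ≢ v → count z (Star.ns (star v cv)) ≡ 0 → ⊥
  no-two-hubs {v} {cv} H cx H' z cz zv zn = go
    where
    open Hub H
    module V = StarLemmas dD PD big (star v cv) cv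
    module Q = V.Quad perm
    module X = StarLemmas dD PD big (star x cx) cx
    module H' = Hub H'
    module Q' = X.Quad H'.perm
    module T = StarLemmas dD PD big (star t Q.cp) Q.cp
    z≢ : ∀ u → count u (Star.ns (star v cv)) ≢ 0 → z ≢ u
    z≢ u n refl = n zn
    clash : ∀ g g' → count g (Star.ns (star v cv)) ≢ 0 → count g' (Star.ns (star v cv)) ≢ 0 → g ≢ g' → g ≢ t → g ≢ x → g' ≢ t → g' ≢ x → Adj D t g → Adj D x g → ⊥
    clash g g' ng ng' g≢g' gt gx gt' gx' tg xg = four-clique cv (proj₂ (Star.ns-in (star v cv) g ng)) Q.p≢q Q.pv Q.qv (proj₁ (Star.ns-in (star v cv) g ng)) gt gx Q.cp tx Q.p∈ Q.q∈
      (Adj-sym {D = D} (V.nbr⇒Adj g ng)) (Adj-sym {D = D} tg) (Adj-sym {D = D} xg) cx {z} {g'} (z≢ g' ng')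
      (zv , z≢ t Q.p∈ , z≢ x Q.q∈ , z≢ g ng) (proj₁ (Star.ns-in (star v cv) g' ng') , gt' , gx' , (g≢g' ∘ sym)) cz (proj₂ (Star.ns-in (star v cv) g' ng'))
    yw : ∀ g → (g ≡ y) ⊎ (g ≡ w) → Adj D x g → ⊥
    yw _ (inj₁ refl) = clash y w Q.r∈ Q.s∈ Q.r≢s (Q.p≢r ∘ sym) (Q.q≢r ∘ sym) (Q.p≢s ∘ sym) (Q.q≢s ∘ sym) ty
    yw _ (inj₂ refl) = clash w y Q.s∈ Q.r∈ (Q.r≢s ∘ sym) (Q.p≢s ∘ sym) (Q.q≢s ∘ sym) (Q.p≢r ∘ sym) (Q.q≢r ∘ sym) tw
    viaV : ∀ g → count g D ≢ 0 → g ≢ v → g ≢ t → g ≢ x → Adj D v g → Adj D x g → ⊥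
    viaV g cg gv gt gx vg = yw g (pick (Q.from-ns g (V.Adj⇒nbr g gv cg vg)))
      where
      pick : (g ≡ t) ⊎ (g ≡ x) ⊎ (g ≡ y) ⊎ (g ≡ w) → (g ≡ y) ⊎ (g ≡ w)
      pick (inj₁ e) = ⊥-elim (gt e)
      pick (inj₂ (inj₁ e)) = ⊥-elim (gx e)
      pick (inj₂ (inj₂ e)) = e
    viaT : ∀ g → count g D ≢ 0 → g ≢ v → g ≢ t → g ≢ x → Adj D t g → Adj D x g → ⊥
    viaT g cg gv gt gx tg xg with g ≟ᶠ y | g ≟ᶠ w
    ... | yes e | _ = yw g (inj₁ e) xg
    ... | no _ | yes e = yw g (inj₂ e) xg
    ... | no gy | no gw = ℕ.<⇒≱ (ℕ.m≤m+n 5 _) (≤-trans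
          (pigeonhole {xs = g ∷ v ∷ x ∷ y ∷ w ∷ []} (trans (count-other gv (x ∷ y ∷ w ∷ [])) (trans (count-other gx (y ∷ w ∷ [])) (trans (count-other gy [ w ]) (count-other gw [])))
              ∷ trans (count-other (Q.qv ∘ sym) (y ∷ w ∷ [])) (trans (count-other (Q.rv ∘ sym) [ w ]) (count-other (Q.sv ∘ sym) []))
              ∷ uniq3 Q.q≢r Q.q≢s Q.r≢s) (Star.ns (star t Q.cp)) mem) (≤-reflexive (Star.four (star t Q.cp))))
      where
      mem : ∀ u → count u (g ∷ v ∷ x ∷ y ∷ w ∷ []) ≢ 0 → count u (Star.ns (star t Q.cp)) ≢ 0
      mem u n with u ≟ᶠ g | u ≟ᶠ v | u ≟ᶠ x | u ≟ᶠ y | u ≟ᶠ w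
      ... | yes refl | _ | _ | _ | _ = T.Adj⇒nbr g gt cg tg
      ... | no _ | yes refl | _ | _ | _ = T.Adj⇒nbr v (Q.pv ∘ sym) cv (Adj-sym {D = D} (V.nbr⇒Adj t Q.p∈))
      ... | no _ | no _ | yes refl | _ | _ = T.Adj⇒nbr x (Q.p≢q ∘ sym) cx tx
      ... | no _ | no _ | no _ | yes refl | _ = T.Adj⇒nbr y (Q.p≢r ∘ sym) Q.cr ty
      ... | no _ | no _ | no _ | no _ | yes refl = T.Adj⇒nbr w (Q.p≢s ∘ sym) Q.cs tw
      ... | no _ | no _ | no _ | no _ | no _ = ⊥-elim (n refl)
    v∈ : count v (Star.ns (star x cx)) ≢ 0
    v∈ = X.Adj⇒nbr v (Q.qv ∘ sym) cv (Adj-sym {D = D} (V.nbr⇒Adj x Q.q∈))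
    t∈ : count t (Star.ns (star x cx)) ≢ 0
    t∈ = X.Adj⇒nbr t Q.p≢q Q.cp (Adj-sym {D = D} tx)
    choose : ∀ u {p q : Fin k} → p ≢ q → (p ≢ u) ⊎ (q ≢ u)
    choose u {p} {q} n with p ≟ᶠ u
    ... | no m = inj₁ m
    ... | yes refl = inj₂ (n ∘ sym)
    go : ⊥
    go with H'.t ≟ᶠ v | H'.t ≟ᶠ t
    ... | yes refl | _ with choose t Q'.q≢r
    ...   | inj₁ n = viaV H'.x Q'.cq (Q'.p≢q ∘ sym) n Q'.qv H'.tx (X.nbr⇒Adj H'.x Q'.q∈)
    ...   | inj₂ n = viaV H'.y Q'.cr (Q'.p≢r ∘ sym) n Q'.rv H'.ty (X.nbr⇒Adj H'.y Q'.r∈)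
    go | no _ | yes refl with choose v Q'.q≢r
    ...   | inj₁ n = viaT H'.x Q'.cq n (Q'.p≢q ∘ sym) Q'.qv H'.tx (X.nbr⇒Adj H'.x Q'.q∈)
    ...   | inj₂ n = viaT H'.y Q'.cr n (Q'.p≢r ∘ sym) Q'.rv H'.ty (X.nbr⇒Adj H'.y Q'.r∈)
    go | no gv | no gt with Q'.from-ns v v∈
    ...   | inj₁ e = gv (sym e)
    ...   | inj₂ (inj₁ e) = viaV H'.t Q'.cp gv gt Q'.pv (Adj-sym {D = D} (subst (Adj D H'.t) (sym e) H'.tx)) (X.nbr⇒Adj H'.t Q'.p∈)
    ...   | inj₂ (inj₂ (inj₁ e)) = viaV H'.t Q'.cp gv gt Q'.pv (Adj-sym {D = D} (subst (Adj D H'.t) (sym e) H'.ty)) (X.nbr⇒Adj H'.t Q'.p∈)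
    ...   | inj₂ (inj₂ (inj₂ e)) = viaV H'.t Q'.cp gv gt Q'.pv (Adj-sym {D = D} (subst (Adj D H'.t) (sym e) H'.tw)) (X.nbr⇒Adj H'.t Q'.p∈)

-- Splitting a vertex of a prime word

tail0 : (x y : Fin k) (w : Wd k) → count x (y ∷ w) ≡ 0 → count x w ≡ 0
tail0 x y w e with x ≟ᶠ y
... | no _ = e

-- The word rotated to start at `v`. Both arcs of `v` are nonempty as there is no loop, and their
-- first and last letters are the four neighbours of `v`.
record XStar (D : Wd k) (v : Fin k) : Set where
  field
    a c : Fin k
    X Y : Wd k
    iso : D ≅ v ∷ a ∷ X ++ v ∷ c ∷ Y
    va : count v (a ∷ X) ≡ 0
    vc : count v (c ∷ Y) ≡ 0

lst-in : (a : Fin k) (X : Wd k) → count (lst a X) (a ∷ X) ≢ 0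
lst-in a [] = head≢0 a []
lst-in a (x ∷ X) = cons≢0 (lst x X) a (x ∷ X) (lst-in x X)

xstar : (D : Wd k) → DO D → Prime D → (v : Fin k) → count v D ≢ 0 → XStar D v
xstar {k} D d P v n with d v
... | inj₁ e = ⊥-elim (n e)
... | inj₂ e with locate2 v D e
...   | A , B , C , refl , p , q , r = go B (C ++ A) ro q (trans (count-++ v C A) (cong₂ _+_ r p))
  where
  ro : A ++ v ∷ B ++ v ∷ C ≅ v ∷ B ++ v ∷ (C ++ A)
  ro = rot≡ A (v ∷ B ++ v ∷ C) refl (ls 4 (λ v b c a → (v & b & v & c) & a ⊜ v & b & v & c & a) refl [ v ] B C A)
  go : ∀ X Y → A ++ v ∷ B ++ v ∷ C ≅ v ∷ X ++ v ∷ Y → count v X ≡ 0 → count v Y ≡ 0 → XStar (A ++ v ∷ B ++ v ∷ C) v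
  go [] Y i x y = ⊥-elim (no-loop _ Y P i y)
  go (a ∷ X) [] i x y = ⊥-elim (no-loop _ (a ∷ X) P (≅trans i (≅rot (v ∷ a ∷ X) [ v ])) x)
  go (a ∷ X) (c ∷ Y) i x y = record { a = a ; c = c ; X = X ; Y = Y ; iso = i ; va = x ; vc = y }

module _ {D : Wd k} {v : Fin k} (σ : XStar D v) where
  open XStar σ
  private
    b e : Fin k
    b = lst a X
    e = lst c Y

  arms : Wd k
  arms = a ∷ b ∷ c ∷ e ∷ []

  inner : Side k → ℕ
  inner S = lin S a X + lin S c Y

  presentX : ∀ x → count x (a ∷ X) ≢ 0 → x ≢ v × count x D ≢ 0
  presentX x n = (λ { refl → n va }) , λ z → n (proj₁ (zeros x (a ∷ X) (v ∷ c ∷ Y) (tail0 x v (a ∷ X ++ v ∷ c ∷ Y) (trans (sym (≅-Same iso x)) z))))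

  presentY : ∀ x → count x (c ∷ Y) ≢ 0 → x ≢ v × count x D ≢ 0
  presentY x n = (λ { refl → n vc }) , λ z → n (tail0 x v (c ∷ Y) (proj₂ (zeros x (a ∷ X) (v ∷ c ∷ Y) (tail0 x v (a ∷ X ++ v ∷ c ∷ Y) (trans (sym (≅-Same iso x)) z)))))

  toStar : Star D v
  toStar = record { ns = arms ; f = inner ; four = refl ; eq = eqn ; f-ext = ext ; f-sub = sub-f
    ; f-not = λ S → cong₂ _+_ (lin-not S a X) (lin-not S c Y) ; ns-in = nsin }
    where
    eqn : ∀ S → cut S D ≡ inner S + jumps S (S v) arms
    eqn S = trans (≅-cut iso S) (trans (path-split S (S v) (a ∷ X) v (c ∷ Y) (S v))
      (trans (cong₂ _+_ (cong (jump (S v) (S a) +_) (path-lin0 S a X (S v))) (cong (jump (S v) (S c) +_) (path-lin0 S c Y (S v))))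
      (trans (cong₂ (λ p q → (jump (S v) (S a) + (lin S a X + p)) + (jump (S v) (S c) + (lin S c Y + q))) (jump-sym (S b) (S v)) (jump-sym (S e) (S v)))
        (arith (jump (S v) (S a)) (lin S a X) (jump (S v) (S b)) (jump (S v) (S c)) (lin S c Y) (jump (S v) (S e))))))
      where
      arith : ∀ ja l1 jb jc l2 je → (ja + (l1 + jb)) + (jc + (l2 + je)) ≡ (l1 + l2) + (ja + (jb + (jc + (je + 0))))
      arith = ℕRing.solve-∀
    ext : ∀ S T → (∀ x → x ≢ v → count x D ≢ 0 → S x ≡ T x) → inner S ≡ inner T
    ext S T h = cong₂ _+_ (lin-ext a X λ x n → h x (proj₁ (presentX x n)) (proj₂ (presentX x n))) (lin-ext c Y λ x n → h x (proj₁ (presentY x n)) (proj₂ (presentY x n)))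
    sub-f : ∀ S T → inner (S ∩ T) + inner (S ∪ T) ≤ inner S + inner T
    sub-f S T = ≤-trans (≤-reflexive (shuffle (lin (S ∩ T) a X) _ (lin (S ∪ T) a X) _))
      (≤-trans (ℕ.+-mono-≤ (lin-sub S T a X) (lin-sub S T c Y)) (≤-reflexive (sym (shuffle (lin S a X) _ (lin T a X) _))))
    nsin : ∀ y → count y arms ≢ 0 → y ≢ v × count y D ≢ 0
    nsin y n with y ≟ᶠ a | y ≟ᶠ b | y ≟ᶠ c | y ≟ᶠ e
    ... | yes refl | _ | _ | _ = presentX a (head≢0 a X)
    ... | no _ | yes refl | _ | _ = presentX b (lst-in a X)
    ... | no _ | no _ | yes refl | _ = presentY c (head≢0 c Y)
    ... | no _ | no _ | no _ | yes refl = presentY e (lst-in c Y)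
    ... | no _ | no _ | no _ | no _ = ⊥-elim (n refl)

-- Sets of letters are functions; the assumption that `P` respects pointwise equality allows each
-- set to be replaced by the enumerated one with the same values.
findSet : (P : Side k → Set) → (∀ S T → (∀ x → S x ≡ T x) → P S → P T) → (∀ S → Dec (P S)) → Dec (∃ P)
findSet {zero} P resp P? with P? (λ ())
... | yes p = yes ((λ ()) , p)
... | no n = no λ { (S , p) → n (resp S (λ ()) (λ ()) p) }
findSet {suc k} P resp P? = combine (rec true) (rec false)
  where
  cons : Bool → Side k → Fin (suc k) → Bool
  cons b S zero = b
  cons b S (suc x) = S x
  cons-ext : ∀ b S T → (∀ x → S x ≡ T x) → ∀ x → cons b S x ≡ cons b T x
  cons-ext b S T h zero = refl
  cons-ext b S T h (suc x) = h x
  cons-eta : ∀ S x → S x ≡ cons (S zero) (S ∘ suc) x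
  cons-eta S zero = refl
  cons-eta S (suc x) = refl
  rec : ∀ b → Dec (∃ (P ∘ cons b))
  rec b = findSet (P ∘ cons b) (λ S T h → resp _ _ (cons-ext b S T h)) (λ S → P? (cons b S))
  combine : Dec (∃ (P ∘ cons true)) → Dec (∃ (P ∘ cons false)) → Dec (∃ P)
  combine (yes (S , p)) _ = yes (cons true S , p)
  combine (no _) (yes (S , p)) = yes (cons false S , p)
  combine (no n₁) (no n₂) = no λ { (S , p) → go S p }
    where
    go : ∀ S → P S → ⊥
    go S p with S zero in e
    ... | true = n₁ (S ∘ suc , resp S _ (λ x → trans (cons-eta S x) (cong (λ z → cons z (S ∘ suc) x) e)) p)
    ... | false = n₂ (S ∘ suc , resp S _ (λ x → trans (cons-eta S x) (cong (λ z → cons z (S ∘ suc) x) e)) p)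

two? : (S : Side k) (s : Bool) (W : Wd k) → Dec (Two S s W)
two? S s W with any? (λ x → any? (λ y → ¬? (x ≟ᶠ y) ×-dec ((S x ≟ᵇ s) ×-dec ((S y ≟ᵇ s) ×-dec (¬? (count x W ℕ.≟ 0) ×-dec ¬? (count y W ℕ.≟ 0))))))
... | yes (x , y , a , b , c , d , e) = yes (two x y a b c d e)
... | no n = no λ { (two x y a b c d e) → n (x , y , a , b , c , d , e) }

Two-ext : {S T : Side k} {s : Bool} {W : Wd k} → (∀ x → S x ≡ T x) → Two S s W → Two T s W
Two-ext h (two x y n a b c d) = two x y n (trans (sym (h x)) a) (trans (sym (h y)) b) c d

Split : Wd k → Side k → Set
Split W S = Two S true W × Two S false W × cut S W ≤ 4

split? : (W : Wd k) → Dec (∃ (Split W))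
split? W = findSet (Split W) (λ S T h (a , b , c) → Two-ext h a , Two-ext h b , subst (_≤ 4) (cut-ext h W) c)
  (λ S → two? S true W ×-dec (two? S false W ×-dec (cut S W ℕ.≤? 4)))

-- Cuts are even, so a cut that is not at most four has at least six edges.
no-split : (W : Wd k) → ¬ ∃ (Split W) → ∀ S → Two S true W → Two S false W → 6 ≤ cut S W
no-split W n S t f with 6 ℕ.≤? cut S W
... | yes le = le
... | no nle = ⊥-elim (n (S , t , f , ≤5⇒≤4 (cut S W) (cut-even S W) (ℕ.≰⇒> nle)))

jump≡0 : ∀ b c → jump b c ≡ 0 → b ≡ c
jump≡0 true true _ = refl
jump≡0 false false _ = refl

module Good {D : Wd k} (dD : DO D) (PD : Prime D) (big : Big D) {v : Fin k} (σ : Star D v) (cv : count v D ≢ 0) where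
  open Star σ
  open StarLemmas dD PD big σ cv

  -- Here `E` is `D` with `v` split into an edge from `p` to `q` and one from `r` to `s`. A set with
  -- at most four cut edges in `E` must have exactly four, all counted by `f`, so it cuts neither
  -- new edge. It does not have all four neighbours on one side either, since moving `v` to that
  -- side would give too small a cut in `D`.
  good-or-bad : (E : Wd k) {p q r s : Fin k} → ns ↭ p ∷ q ∷ r ∷ s ∷ [] → (∀ y → y ≢ v → count y E ≡ count y D) → count v E ≡ 0 →
    (∀ S → cut S E ≡ f S + (jump (S p) (S q) + jump (S r) (S s))) → Prime E ⊎ Bad p q r s
  good-or-bad E {p} {q} {r} {s} perm cE vE form with split? E
  ... | no n = inj₁ (record { single = single ; cuts = no-split E n })
    where
    open Quad perm
    single : ∀ x → count x E ≢ 0 → 4 ≤ cut (eqb x) E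
    single x n = ≤-trans (Prime.single PD x cx) (≤-trans (≤-reflexive (trans (cut-out (eqb x) (eqb-≢ xv)) (cong (f (eqb x) +_) (ins4 (eqb x)))))
      (≤-trans (ℕ.+-monoʳ-≤ (f (eqb x)) le) (≤-reflexive (sym (form (eqb x))))))
      where
      xv : x ≢ v
      xv refl = n vE
      cx : count x D ≢ 0
      cx z = n (trans (cE x xv) z)
      le : length (flt (eqb x) (p ∷ q ∷ r ∷ s ∷ [])) ≤ jump (eqb x p) (eqb x q) + jump (eqb x r) (eqb x s)
      le with x ≟ᶠ p | x ≟ᶠ q | x ≟ᶠ r | x ≟ᶠ s
      ... | yes refl | yes refl | _ | _ = ⊥-elim (p≢q refl)
      ... | _ | _ | yes refl | yes refl = ⊥-elim (r≢s refl)
      ... | yes refl | no _ | yes refl | no _ = ⊥-elim (p≢r refl)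
      ... | yes refl | no _ | no _ | yes refl = ⊥-elim (p≢s refl)
      ... | no _ | yes refl | yes refl | no _ = ⊥-elim (q≢r refl)
      ... | no _ | yes refl | no _ | yes refl = ⊥-elim (q≢s refl)
      ... | yes _ | no _ | no _ | no _ = s≤s z≤n
      ... | no _ | yes _ | no _ | no _ = s≤s z≤n
      ... | no _ | no _ | yes _ | no _ = s≤s z≤n
      ... | no _ | no _ | no _ | yes _ = s≤s z≤n
      ... | no _ | no _ | no _ | no _ = z≤n
  ... | yes (S , two x y x≢y Sx Sy cx cy , two z z' z≢z' Sz Sz' cz cz' , le) = inj₂ (classify (S p) (S q) (S r) (S s) refl refl refl refl (eqs-p , eqs-r))
    where
    open Quad perm
    xv : ∀ {x} → count x E ≢ 0 → x ≢ v
    xv n refl = n vE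
    inD : ∀ {x} → count x E ≢ 0 → count x D ≢ 0
    inD {x} n e = n (trans (cE x (xv n)) e)
    h1 : 6 ≤ f S + ins S
    h1 = six S x y z x≢y (xv cx) (xv cy) (xv cz) (inD cx) (inD cy) (inD cz) Sx Sy Sz
    h2 : 6 ≤ f S + outs S
    h2 = ≤-trans (six (not ∘ S) z z' x z≢z' (xv cz) (xv cz') (xv cx) (inD cz) (inD cz') (inD cx) (cong not Sz) (cong not Sz') (cong not Sx)) (≤-reflexive (cong (_+ outs S) (f-not S)))
    le' : f S + (jump (S p) (S q) + jump (S r) (S s)) ≤ 4
    le' = subst (_≤ 4) (form S) le
    double : ∀ f i o → 6 ≤ f + i → 6 ≤ f + o → i + o ≡ 4 → 4 ≤ f
    double f i o a b e with 4 ℕ.≤? f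
    ... | yes l = l
    ... | no n = ⊥-elim (ℕ.<⇒≱ {(f + i) + (f + o)} {12} (≤-trans (s≤s (≤-trans (≤-reflexive (trans (arith f i o) (cong ((f + f) +_) e))) (ℕ.+-monoˡ-≤ 4 (ℕ.+-mono-≤ f3 f3)))) (ℕ.m≤m+n 11 _)) (ℕ.+-mono-≤ a b))
      where
      f3 : f ≤ 3
      f3 = ℕ.≤-pred (ℕ.≰⇒> n)
      arith : ∀ f i o → (f + i) + (f + o) ≡ (f + f) + (i + o)
      arith = ℕRing.solve-∀
    -- Primality of `D` gives at least six edges with `v` on either side. The four edges at `v` are
    -- divided between the two counts, so twice `f S` is at least 12 - 4.
    f≥4 : 4 ≤ f S
    f≥4 = double (f S) (ins S) (outs S) h1 h2 (ins+outs S)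
    f≤ : f S ≤ 4
    f≤ = ≤-trans (ℕ.m≤m+n _ _) le'
    zero-jumps : jump (S p) (S q) + jump (S r) (S s) ≡ 0
    zero-jumps = ℕ.n≤0⇒n≡0 (ℕ.+-cancelˡ-≤ 4 _ 0 (≤-trans (ℕ.+-monoˡ-≤ _ f≥4) le'))
    eqs-p : S p ≡ S q
    eqs-p = jump≡0 _ _ (proj₁ (+≡0 zero-jumps))
    eqs-r : S r ≡ S s
    eqs-r = jump≡0 _ _ (proj₂ (+≡0 {jump (S p) (S q)} zero-jumps))
    six≰ : ∀ {n} → 6 ≤ f S + n → n ≡ 0 → ⊥
    six≰ h refl = ℕ.<⇒≱ (ℕ.m≤m+n 5 _) (≤-trans h (≤-trans (≤-reflexive (ℕ.+-identityʳ (f S))) f≤))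
    classify : ∀ bp bq br bs → S p ≡ bp → S q ≡ bq → S r ≡ br → S s ≡ bs → (S p ≡ S q) × (S r ≡ S s) → Bad p q r s
    classify true true false false ep eq er es _ = record { S = S ; Sp = ep ; Sq = eq ; Sr = er ; Ss = es ; f≤4 = f≤ }
    classify false false true true ep eq er es _ = record { S = not ∘ S ; Sp = cong not ep ; Sq = cong not eq ; Sr = cong not er ; Ss = cong not es
      ; f≤4 = ≤-trans (≤-reflexive (f-not S)) f≤ }
    classify true true true true ep eq er es _ = ⊥-elim (six≰ h2 o)
      where
      o : outs S ≡ 0
      o rewrite ins4 (not ∘ S) | ep | eq | er | es = refl
    classify false false false false ep eq er es _ = ⊥-elim (six≰ h1 o)
      where
      o : ins S ≡ 0
      o rewrite ins4 S | ep | eq | er | es = refl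
    classify true false _ _ ep eq er es (e , _) = ⊥-elim (true≢false (trans (sym ep) (trans e eq)))
    classify false true _ _ ep eq er es (e , _) = ⊥-elim (true≢false (trans (sym eq) (trans (sym e) ep)))
    classify true true true false ep eq er es (_ , e) = ⊥-elim (true≢false (trans (sym er) (trans e es)))
    classify true true false true ep eq er es (_ , e) = ⊥-elim (true≢false (trans (sym es) (trans (sym e) er)))
    classify false false true false ep eq er es (_ , e) = ⊥-elim (true≢false (trans (sym er) (trans e es)))
    classify false false false true ep eq er es (_ , e) = ⊥-elim (true≢false (trans (sym es) (trans (sym e) er)))

-- Uniqueness of prime words

Unique-below : ℕ → Set
Unique-below n = ∀ {k} (E E' : Wd k) → length E < n → DO E → Prime E → Big E → SG E E' → E ≅ E'

-- By induction the words without `v` agree up to rotation and reflection. This lifts to `T2` by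
-- `≅-flt`, after which both words are insertions of `v` into one prime word.
conclude : {v : Fin k} (T1 T2 : Wd k) → Prime (rm v T1) → Big (rm v T1) → DO T1 → count v T1 ≡ 2 → Prime T1 → Big T1 → SG T1 T2 →
  Unique-below (length T1) → T1 ≅ T2
conclude {v = v} T1 T2 PE bE d c P b g ih
  with proj₂ (≅-flt _ (ih (rm v T1) (rm v T2) (length-flt-< _ (cong not (eqb-refl v)) T1 (λ e → case trans (sym e) c of λ ())) (DO-flt _ T1 d) PE bE (SG-flt _ g))) T2 refl
... | T2' , iso , e = ≅trans (rigid-insertion T1 T2' PE d c P b (SG-trans g (≅-SG iso e2)) (sym e)) (≅sym iso)
  where
  e2 : Even T2
  e2 = DO⇒Even T2 (SG-DO g d)

pick-two : {a b c e : Fin k} → a ≢ b → a ≢ c → a ≢ e → b ≢ c → b ≢ e → c ≢ e → (P : Fin k → Set) → P a → P b → P c → P e →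
  ∀ x y → ∃[ p ] ∃[ q ] (p ≢ q × (p ≢ x × p ≢ y) × (q ≢ x × q ≢ y) × P p × P q)
pick-two {a = a} {b} {c} {e} ab ac ae bc be ce P pa pb pc pe x y
  with (a ≟ᶠ x) | (a ≟ᶠ y) | (b ≟ᶠ x) | (b ≟ᶠ y) | (c ≟ᶠ x) | (c ≟ᶠ y)
... | no ax | no ay | no bx | no by | _ | _ = a , b , ab , (ax , ay) , (bx , by) , pa , pb
... | no ax | no ay | yes refl | _ | _ | no cy = a , c , ac , (ax , ay) , (bc ∘ sym , cy) , pa , pc
... | no ax | no ay | yes refl | _ | _ | yes refl = a , e , ae , (ax , ay) , (be ∘ sym , ce ∘ sym) , pa , pe
... | no ax | no ay | no _ | yes refl | no cx | _ = a , c , ac , (ax , ay) , (cx , bc ∘ sym) , pa , pc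
... | no ax | no ay | no _ | yes refl | yes refl | _ = a , e , ae , (ax , ay) , (ce ∘ sym , be ∘ sym) , pa , pe
... | yes refl | _ | _ | yes refl | _ | _ = c , e , ce , (ac ∘ sym , bc ∘ sym) , (ae ∘ sym , be ∘ sym) , pc , pe
... | yes refl | _ | _ | no by | _ | no cy = b , c , bc , (ab ∘ sym , by) , (ac ∘ sym , cy) , pb , pc
... | yes refl | _ | _ | no by | _ | yes refl = b , e , be , (ab ∘ sym , by) , (ae ∘ sym , ce ∘ sym) , pb , pe
... | no _ | yes refl | yes refl | _ | _ | _ = c , e , ce , (bc ∘ sym , ac ∘ sym) , (be ∘ sym , ae ∘ sym) , pc , pe
... | no _ | yes refl | no bx | _ | no cx | _ = b , c , bc , (bx , ab ∘ sym) , (cx , ac ∘ sym) , pb , pc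
... | no _ | yes refl | no bx | _ | yes refl | _ = b , e , be , (bx , ab ∘ sym) , (ce ∘ sym , ae ∘ sym) , pb , pe

-- The alternatives `φ`, `ψ` and `χ` belong to the three ways of joining the four edges at `v`. They
-- arise by deleting `v` from the word itself, from its local complement at `v`, and from the word
-- complemented at a chord `w` crossing `v` and then at `v`. Local complementation can be undone, so
-- uniqueness of any of these words gives that of `D`.
module Splitting {D : Wd k} (dD : DO D) (PD : Prime D) (big : Big D) (D2 : Wd k) (g : SG D D2) (ih : Unique-below (length D))
  {v : Fin k} (cv : count v D ≢ 0) (σ : XStar D v) where

    eD : Even D
    eD = DO⇒Even D dD
    open XStar σ
    f : Side k → ℕ
    f = inner σ
    b e : Fin k
    b = lst a X
    e = lst c Y
    D0 : Wd k
    D0 = v ∷ a ∷ X ++ v ∷ c ∷ Y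
    Bad : (p q r s : Fin k) → Set
    Bad = StarLemmas.Bad dD PD big (toStar σ) cv
    iso⁻ : D0 ≅ D
    iso⁻ = ≅sym iso
    d₀ : DO D0
    d₀ = DO-resp D D0 (≅-Same iso) dD
    P0 : Prime D0
    P0 = Prime-≅ iso PD
    g0 : SG D0 D2
    g0 = SG-trans (SG-sym (≅-SG iso eD)) g
    c₀ : count v D0 ≡ 2
    c₀ with d₀ v
    ... | inj₂ z = z
    ... | inj₁ z = ⊥-elim (head≢0 v (a ∷ X ++ v ∷ c ∷ Y) z)
    c2 : count v D2 ≡ 2
    c2 = trans (sym (same g0 v)) c₀
    len0 : ∀ (T : Wd k) → length T ≡ length D → Unique-below (length T)
    len0 T e = subst Unique-below (sym e) ih
    -- everything that does not depend on which of the three splittings is used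
    finish : ∀ (T1 T2 : Wd k) → Same D0 T1 → length T1 ≡ length D → Prime T1 → Prime (rm v T1) → SG T1 T2 → T1 ≅ T2
    finish T1 T2 s l P PE g = conclude T1 T2 PE bE (DO-resp D0 T1 s d₀) (trans (sym (s v)) c₀) P b1 g (len0 T1 l)
      where
      present : ∀ y → count y D ≢ 0 → count y T1 ≢ 0
      present y n z = n (trans (≅-Same iso y) (trans (s y) z))
      b1 : Big T1
      b1 x y = let p , q , n , np , nq , cp , cq = big x y in p , q , n , np , nq , present p cp , present q cq
      inE : ∀ y → y ≢ v → count y D ≢ 0 → count y (rm v T1) ≢ 0
      inE y yv n z = present y n (trans (sym (count-flt-in _ (cong not (eqb-≢ {a = v} {y} (yv ∘ sym))) T1)) z)
      bE : Big (rm v T1)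
      bE = pick-two
        (StarLemmas.Quad.p≢q dD PD big (toStar σ) cv {a} {b} {c} {e} ↭-refl) (StarLemmas.Quad.p≢r dD PD big (toStar σ) cv {a} {b} {c} {e} ↭-refl)
        (StarLemmas.Quad.p≢s dD PD big (toStar σ) cv {a} {b} {c} {e} ↭-refl) (StarLemmas.Quad.q≢r dD PD big (toStar σ) cv {a} {b} {c} {e} ↭-refl)
        (StarLemmas.Quad.q≢s dD PD big (toStar σ) cv {a} {b} {c} {e} ↭-refl) (StarLemmas.Quad.r≢s dD PD big (toStar σ) cv {a} {b} {c} {e} ↭-refl)
        (λ y → count y (rm v T1) ≢ 0) (inX' a (head≢0 a X)) (inX' b (lst-in a X)) (inY' c (head≢0 c Y)) (inY' e (lst-in c Y))
        where
        inX' : ∀ y → count y (a ∷ X) ≢ 0 → count y (rm v T1) ≢ 0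
        inX' y n = let yv , cy = presentX σ y n in inE y yv cy
        inY' : ∀ y → count y (c ∷ Y) ≢ 0 → count y (rm v T1) ≢ 0
        inY' y n = let yv , cy = presentY σ y n in inE y yv cy
    countE : ∀ (T1 : Wd k) → Same D0 T1 → ∀ y → y ≢ v → count y (rm v T1) ≡ count y D
    countE T1 s y yv = trans (count-flt-in _ (cong not (eqb-≢ {a = v} {y} (yv ∘ sym))) T1) (trans (sym (s y)) (sym (≅-Same iso y)))
    outE : ∀ (T1 : Wd k) → count v (rm v T1) ≡ 0
    outE T1 = count-flt-out _ (cong not (eqb-refl v)) T1
    lenD0 : length D0 ≡ length D
    lenD0 = sym (∼-length (≅⇒∼ iso eD))
    lc-length : ∀ (w : Fin k) (T : Wd k) → count w T ≡ 2 → length (lc w T) ≡ length T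
    lc-length w T cw with locate2 w T cw
    ... | P , Q , R , refl , p , q , r rewrite lc-form w P Q R p q | length-++ P {w ∷ rev Q ++ w ∷ R} | length-++ (rev Q) {w ∷ R} | length-reverse Q
      | length-++ P {w ∷ Q ++ w ∷ R} | length-++ Q {w ∷ R} = refl

    φ : Prime (rm v D0) ⊎ Bad a e b c
    φ = Good.good-or-bad dD PD big (toStar σ) cv (rm v D0) (prep a (↭trans (prep b (swap c e ↭-refl)) (swap b e ↭-refl))) (countE D0 (λ _ → refl)) (outE D0) form
      where
      form : ∀ S → cut S (rm v D0) ≡ f S + (jump (S a) (S e) + jump (S b) (S c))
      form S = trans (cong (cut S) (rm-2 v [] (a ∷ X) (c ∷ Y) refl va vc)) (trans (path-lin S a X (c ∷ Y) (S a))
        (trans (cong (λ z → lin S a X + (jump (S b) (S c) + z)) (trans (path-lin0 S c Y (S a)) (cong (lin S c Y +_) (jump-sym (S e) (S a)))))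
          (arith (lin S a X) (jump (S b) (S c)) (lin S c Y) (jump (S a) (S e)))))
        where
        arith : ∀ l1 j l2 j' → l1 + (j + (l2 + j')) ≡ (l1 + l2) + (j' + j)
        arith = ℕRing.solve-∀

    Tψ : Wd k
    Tψ = lc v D0
    Tψ≡ : Tψ ≡ [] ++ v ∷ rev (a ∷ X) ++ v ∷ c ∷ Y
    Tψ≡ = lc-form v [] (a ∷ X) (c ∷ Y) refl va
    ψ : Prime (rm v Tψ) ⊎ Bad a c b e
    ψ = Good.good-or-bad dD PD big (toStar σ) cv (rm v Tψ) (prep a (swap b c ↭-refl)) (countE Tψ (lc-Same v D0 c₀)) (outE Tψ) form
      where
      form : ∀ S → cut S (rm v Tψ) ≡ f S + (jump (S a) (S c) + jump (S b) (S e))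
      form S = trans (cong (cut S) (trans (cong (rm v) Tψ≡) (rm-2 v [] (rev (a ∷ X)) (c ∷ Y) refl (count-rev0 v (a ∷ X) va) vc)))
        (trans (cut-rot S (rev (a ∷ X)) (c ∷ Y)) (trans (path-lin S c Y (rev (a ∷ X)) (S c))
        (trans (cong (lin S c Y +_) (trans (path-reverse S (S e) (a ∷ X) (S c)) (cong₂ _+_ (jump-sym (S c) (S a)) (path-lin0 S a X (S e)))))
          (arith (lin S a X) (jump (S a) (S c)) (lin S c Y) (jump (S b) (S e))))))
        where
        arith : ∀ l1 j l2 j' → l2 + (j + (l1 + j')) ≡ (l1 + l2) + (j + j')
        arith = ℕRing.solve-∀

    -- If no chord crossed `v`, its arc would be a closed segment, hence a share with an empty
    -- second strand, which is not trivial.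
    crossing : ∃[ w ] (par w (a ∷ X) ≡ true)
    crossing with even? (a ∷ X)
    ... | inj₂ p = p
    ... | inj₁ ev = ⊥-elim (absurd (trivial-share (a ∷ X) [ v ] [] (c ∷ Y ++ [ v ]) (Prime-≅ ro P0) (DO-resp D0 ((a ∷ X) ++ [ v ] ++ [] ++ (c ∷ Y ++ [ v ])) (≅-Same ro) d₀) (subst Even (sym (++-identityʳ (a ∷ X))) ev)))
      where
      ro : D0 ≅ (a ∷ X) ++ [ v ] ++ [] ++ (c ∷ Y ++ [ v ])
      ro = rot≡ [ v ] (a ∷ X ++ v ∷ c ∷ Y) refl (ls 3 (λ x v y → (x & v & y) & v ⊜ x & v & nil & y & v) refl (a ∷ X) [ v ] (c ∷ Y))
      absurd : Trivial (a ∷ X) [ v ] [] (c ∷ Y ++ [ v ]) → ⊥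
      absurd (oneG u _ q) = single Y (proj₂ (∷-injective q))
        where
        single : ∀ Y → Y ++ [ v ] ≡ [] → ⊥
        single [] ()
        single (_ ∷ _) ()
    part : ∀ (u : Fin k) (P Q : Wd k) → count u (P ++ Q) ≡ 0 → count u P ≡ 0 × count u Q ≡ 0
    part u P Q z = zeros u P Q z

    -- Joining `a` to `b` and `c` to `e` makes separate circuits of the two arcs of `v`, which are
    -- not a single word. Both circuits pass through `w`; complementing there first lets the walk
    -- change from one to the other at `w`, so that one word with the desired graph is left when `v`
    -- is deleted.
    module Crossed {w : Fin k} (w≢v : w ≢ v) (cw : count w D0 ≡ 2) (X1 X2 Y1 Y2 : Wd k) (eX : a ∷ X ≡ X1 ++ w ∷ X2) (eY : c ∷ Y ≡ Y1 ++ w ∷ Y2)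
      (wX1 : count w X1 ≡ 0) (wX2 : count w X2 ≡ 0) (y1 : count w Y1 ≡ 0) where
      vX = part v X1 (w ∷ X2) (trans (cong (count v) (sym eX)) va)
      vY = part v Y1 (w ∷ Y2) (trans (cong (count v) (sym eY)) vc)
      vX2 = tail0 v w X2 (proj₂ vX)
      vY2 = tail0 v w Y2 (proj₂ vY)
      Tω Tχ : Wd k
      Tω = lc w D0
      Tω≡ : Tω ≡ [] ++ v ∷ (X1 ++ w ∷ rev Y1) ++ v ∷ (rev X2 ++ w ∷ Y2)
      Tω≡ = trans (cong (lc w) (trans (cong₂ (λ s t → v ∷ s ++ v ∷ t) eX eY)
          (ls 6 (λ v x₁ w x₂ y1 y2 → v & (x₁ & w & x₂) & v & y1 & w & y2 ⊜ (v & x₁) & w & (x₂ & v & y1) & w & y2) refl [ v ] X1 [ w ] X2 Y1 Y2)))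
        (trans (lc-form w (v ∷ X1) (X2 ++ v ∷ Y1) Y2 (trans (count-other w≢v X1) wX1) (trans (count-++ w X2 (v ∷ Y1)) (cong₂ _+_ wX2 (trans (count-other w≢v Y1) y1))))
        (trans (cong (λ t → (v ∷ X1) ++ w ∷ t ++ w ∷ Y2) (reverse-mid X2 v Y1))
          (ls 6 (λ v x₁ w x₂ y1 y2 → (v & x₁) & w & (y1 & v & x₂) & w & y2 ⊜ v & (x₁ & w & y1) & v & x₂ & w & y2) refl [ v ] X1 [ w ] (rev X2) (rev Y1) Y2)))
      Tχ = lc v Tω
      zq : count v (X1 ++ w ∷ rev Y1) ≡ 0
      zq = trans (count-++ v X1 _) (cong₂ _+_ (proj₁ vX) (trans (count-other (w≢v ∘ sym) (rev Y1)) (count-rev0 v Y1 (proj₁ vY))))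
      zr : count v (rev X2 ++ w ∷ Y2) ≡ 0
      zr = trans (count-++ v (rev X2) _) (cong₂ _+_ (count-rev0 v X2 vX2) (trans (count-other (w≢v ∘ sym) Y2) vY2))
      cω : count v Tω ≡ 2
      cω = trans (sym (lc-Same w D0 cw v)) c₀
      Eχ≡ : rm v Tχ ≡ Y1 ++ w ∷ (rev X1 ++ rev X2) ++ w ∷ Y2
      Eχ≡ = trans (cong (rm v ∘ lc v) Tω≡) (trans (cong (rm v) (lc-form v [] (X1 ++ w ∷ rev Y1) (rev X2 ++ w ∷ Y2) refl zq)) (trans (rm-2 v [] (rev (X1 ++ w ∷ rev Y1)) (rev X2 ++ w ∷ Y2) refl (count-rev0 v (X1 ++ w ∷ rev Y1) zq) zr)
        (trans (cong (_++ rev X2 ++ w ∷ Y2) (trans (reverse-mid X1 w (rev Y1)) (cong (_++ w ∷ rev X1) (reverse-involutive Y1))))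
          (ls 5 (λ y1 w x₁ x₂ y2 → (y1 & w & x₁) & x₂ & w & y2 ⊜ y1 & w & (x₁ & x₂) & w & y2) refl Y1 [ w ] (rev X1) (rev X2) Y2))))
      χ : Prime (rm v Tχ) ⊎ Bad a b c e
      χ = Good.good-or-bad dD PD big (toStar σ) cv (rm v Tχ) ↭-refl (countE Tχ sχ) (outE Tχ) form
        where
        sχ : Same D0 Tχ
        sχ u = trans (lc-Same w D0 cw u) (lc-Same v Tω cω u)
        form : ∀ S → cut S (rm v Tχ) ≡ f S + (jump (S a) (S b) + jump (S c) (S e))
        form S = trans (cong (cut S) Eχ≡) (trans (cut-rot S Y1 (w ∷ (rev X1 ++ rev X2) ++ w ∷ Y2))
          (trans (cong (cut S) (ls 4 (λ w x y2 y1 → (w & x & w & y2) & y1 ⊜ w & x & w & y2 & y1) refl [ w ] (rev X1 ++ rev X2) Y2 Y1))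
          (trans (path-split S (S w) (rev X1 ++ rev X2) w (Y2 ++ Y1) (S w))
          (trans (cong₂ _+_ partX partY) (arith (lin S a X) (jump (S a) (S b)) (lin S c Y) (jump (S c) (S e)))))))
          where
          arith : ∀ l1 j l2 j' → (l1 + j) + (l2 + j') ≡ (l1 + l2) + (j + j')
          arith = ℕRing.solve-∀
          partX : path S (S w) (rev X1 ++ rev X2) (S w) ≡ lin S a X + jump (S a) (S b)
          partX = trans (cong (λ z → path S (S w) z (S w)) (sym (reverse-++ X2 X1))) (trans (path-reverse S (S w) (X2 ++ X1) (S w))
            (trans (sym (cut-rot S X1 (w ∷ X2))) (trans (cong (cut S) (sym eX)) (trans (path-lin0 S a X (S a)) (cong (lin S a X +_) (jump-sym (S b) (S a)))))))
          partY : path S (S w) (Y2 ++ Y1) (S w) ≡ lin S c Y + jump (S c) (S e)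
          partY = trans (sym (cut-rot S Y1 (w ∷ Y2))) (trans (cong (cut S) (sym eY)) (trans (path-lin0 S c Y (S c)) (cong (lin S c Y +_) (jump-sym (S e) (S c)))))

      c2w : count w D2 ≡ 2
      c2w = trans (sym (same g0 w)) cw
      gω : SG Tω (lc w D2)
      gω = lc-SG w cw g0
      result : (D ≅ D2) ⊎ Bad a b c e
      result with χ
      ... | inj₂ bχ = inj₂ bχ
      ... | inj₁ P = inj₁ (≅trans iso (lc-undo w {D0} {D2} cw c2w (lc-undo v {Tω} {lc w D2} cω (trans (sym (lc-Same w D2 c2w v)) c2)
              (finish Tχ (lc v (lc w D2)) (λ u → trans (lc-Same w D0 cw u) (lc-Same v Tω cω u)) (trans (lc-length v Tω cω) (trans (lc-length w D0 cw) lenD0))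
                (lc-Prime v cω (lc-Prime w cw P0)) P (lc-SG v cω gω)))))

    crossed : (D ≅ D2) ⊎ Bad a b c e
    crossed with crossing
    ... | w , pX with locate w (a ∷ X) (par⇒count w (a ∷ X) pX) | locate w (c ∷ Y) (par⇒count w (c ∷ Y) pY)
      where
      w≢v : w ≢ v
      w≢v z = par⇒count w (a ∷ X) pX (trans (cong (λ u → count u (a ∷ X)) z) va)
      pY : par w (c ∷ Y) ≡ true
      pY with DO⇒Even D0 d₀ w
      ... | z rewrite eqb-≢ w≢v | par-++ w (a ∷ X) (v ∷ c ∷ Y) | eqb-≢ w≢v | pX with par w (c ∷ Y)
      ...   | true = refl
    ...   | X1 , X2 , eX , wX1 , sX | Y1 , Y2 , eY , wY1 , sY = Crossed.result w≢v cw X1 X2 Y1 Y2 eX eY wX1 (ℕ.suc-injective (trans (sym sX) (proj₁ ones))) wY1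
      where
      w≢v : w ≢ v
      w≢v z = par⇒count w (a ∷ X) pX (trans (cong (λ u → count u (a ∷ X)) z) va)
      cw0 : count w D0 ≡ count w (a ∷ X) + count w (c ∷ Y)
      cw0 = trans (count-other w≢v (a ∷ X ++ v ∷ c ∷ Y)) (trans (count-++ w (a ∷ X) (v ∷ c ∷ Y)) (cong (count w (a ∷ X) +_) (count-other w≢v (c ∷ Y))))
      cw : count w D0 ≡ 2
      cw with d₀ w
      ... | inj₂ z = z
      ... | inj₁ z = ⊥-elim (par⇒count w (a ∷ X) pX (proj₁ (+≡0 (trans (sym cw0) z))))
      ones : count w (a ∷ X) ≡ 1 × count w (c ∷ Y) ≡ 1
      ones = halves (count w (a ∷ X)) (count w (c ∷ Y)) (trans (sym cw0) cw) (trans (sym (par-count w (a ∷ X))) pX)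
        where
        halves : ∀ m n → m + n ≡ 2 → odd m ≡ true → m ≡ 1 × n ≡ 1
        halves 1 n e _ = refl , ℕ.suc-injective e
        halves (suc (suc (suc m))) n () _

    fromφ : Prime (rm v D0) → D ≅ D2
    fromφ P = ≅trans iso (finish D0 D2 (λ _ → refl) lenD0 P0 P g0)

    fromψ : Prime (rm v Tψ) → D ≅ D2
    fromψ P = ≅trans iso (lc-undo v {D0} {D2} c₀ c2 iso')
      where
      iso' : lc v D0 ≅ lc v D2
      iso' = finish (lc v D0) (lc v D2) (lc-Same v D0 c₀) (trans (lc-length v D0 c₀) lenD0) (lc-Prime v {D0} c₀ P0) P (lc-SG v {D0} {D2} c₀ g0)

    outcome : (D ≅ D2) ⊎ (Bad a b c e × Bad a c b e × Bad a e b c)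
    outcome = case φ of λ where
      (inj₁ P) → inj₁ (fromφ P)
      (inj₂ bφ) → case ψ of λ where
        (inj₁ P) → inj₁ (fromψ P)
        (inj₂ bψ) → case crossed of λ where
          (inj₁ p) → inj₁ p
          (inj₂ bχ) → inj₂ (bχ , bψ , bφ)

-- The remaining case of uniqueness: the only letters are `v` and its neighbours, where `a`, `b` and
-- `c`, `e` are the first and last letters of the two arcs.
Five : Set
Five = ∀ {k} (v a b c e : Fin k) (s t D2 : Wd k) →
  DO (v ∷ a ∷ s ++ b ∷ v ∷ c ∷ t ++ [ e ]) → Prime (v ∷ a ∷ s ++ b ∷ v ∷ c ∷ t ++ [ e ]) → SG (v ∷ a ∷ s ++ b ∷ v ∷ c ∷ t ++ [ e ]) D2 →
  Uniq (v ∷ a ∷ b ∷ c ∷ e ∷ []) → (∀ x → count x (v ∷ a ∷ s ++ b ∷ v ∷ c ∷ t ++ [ e ]) ≢ 0 → count x (v ∷ a ∷ b ∷ c ∷ e ∷ []) ≢ 0) →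
  v ∷ a ∷ s ++ b ∷ v ∷ c ∷ t ++ [ e ] ≅ D2

snoc-last : (a : Fin k) (X : Wd k) → a ≢ lst a X → ∃[ s ] (X ≡ s ++ [ lst a X ])
snoc-last a [] n = ⊥-elim (n refl)
snoc-last a (x ∷ X) n = ends x X
  where
  ends : ∀ y X → ∃[ s ] (y ∷ X ≡ s ++ [ lst y X ])
  ends y [] = [] , refl
  ends y (z ∷ X) = let s , e = ends z X in y ∷ s , cong (y ∷_) e

-- The four neighbours are distinct because there are no multiple edges, so the first and last
-- letters of each arc can be displayed separately.
five-case : Five → {D : Wd k} (dD : DO D) (PD : Prime D) (big : Big D) (D2 : Wd k) → SG D D2 → (v : Fin k) (cv : count v D ≢ 0) (σ : XStar D v) →
  ¬ (∃ λ z → (count z D ≢ 0) × (z ≢ v) × (count z (arms σ) ≡ 0)) → D ≅ D2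
five-case {k} five {D} dD PD big D2 g v cv σ nothing = ≅trans iso' (five v a b c e (proj₁ sX) (proj₁ sY) D2
    (DO-resp D W (≅-Same iso') dD) (Prime-≅ iso' PD) (SG-trans (SG-sym (≅-SG iso' (DO⇒Even D dD))) g) uniq covered)
  where
  open XStar σ
  b e : Fin k
  b = lst a X
  e = lst c Y
  open StarLemmas.Quad dD PD big (toStar σ) cv {a} {b} {c} {e} ↭-refl using (p≢q; p≢r; p≢s; q≢r; q≢s; r≢s)
  sX = snoc-last a X p≢q
  sY = snoc-last c Y r≢s
  W = v ∷ a ∷ proj₁ sX ++ b ∷ v ∷ c ∷ proj₁ sY ++ [ e ]
  iso' : D ≅ W
  iso' = ≅trans iso (≅≡ (trans (cong₂ (λ p q → v ∷ a ∷ p ++ v ∷ c ∷ q) (proj₂ sX) (proj₂ sY))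
    (ls 6 (λ v a s b c t → (v & a) & (s & b) & v & c & t ⊜ (v & a) & s & b & v & c & t) refl [ v ] [ a ] (proj₁ sX) [ b ] [ c ] (proj₁ sY ++ [ e ]))))
  v0 : count v (arms σ) ≡ 0
  v0 with nonzero-or v (arms σ)
  ... | inj₁ z = z
  ... | inj₂ n = ⊥-elim (proj₁ (Star.ns-in (toStar σ) v n) refl)
  uniq : Uniq (v ∷ arms σ)
  uniq = v0 ∷ trans (count-other p≢q (c ∷ e ∷ [])) (trans (count-other p≢r [ e ]) (count-other p≢s [])) ∷ uniq3 q≢r q≢s r≢s
  covered : ∀ x → count x W ≢ 0 → count x (v ∷ arms σ) ≢ 0
  covered x n = case x ≟ᶠ v of λ where
    (yes x≡v) → subst (λ u → count u (v ∷ arms σ) ≢ 0) (sym x≡v) (head≢0 v (arms σ))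
    (no x≢v) → cons≢0 x v (arms σ) λ z → nothing (x , (λ q → n (trans (sym (≅-Same iso' x)) q)) , x≢v , z)

-- If all splittings fail at `v`, they are tried at the vertex `x` of the resulting hub. They cannot
-- fail at both as long as some letter is neither `v` nor a neighbour of `v`.
unique-step : Five → {D : Wd k} (dD : DO D) (PD : Prime D) (big : Big D) (D2 : Wd k) → SG D D2 → Unique-below (length D) →
  ∀ v → count v D ≢ 0 → D ≅ D2
unique-step {k} five {D} dD PD big D2 g ih v cv = main (any? λ z → ¬? (count z D ℕ.≟ 0) ×-dec (¬? (z ≟ᶠ v) ×-dec (count z (arms σ) ℕ.≟ 0)))
  where
  star : ∀ x → count x D ≢ 0 → Star D x
  star x cx = toStar (xstar D dD PD x cx)
  σ = xstar D dD PD v cv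
  hub : ∀ x (cx : count x D ≢ 0) → (D ≅ D2) ⊎ Chain.Hub dD PD big star cx
  hub x cx with Splitting.outcome dD PD big D2 g ih cx (xstar D dD PD x cx)
  ... | inj₁ p = inj₁ p
  ... | inj₂ (bχ , bψ , bφ) = inj₂ (Chain.all-bad dD PD big star cx ↭-refl bχ bψ bφ)
  second : Chain.Hub dD PD big star cv → ∀ z → count z D ≢ 0 → z ≢ v → count z (arms σ) ≡ 0 → D ≅ D2
  second H z cz z≢v nz = case hub (Chain.Hub.x H) cx of λ where
      (inj₁ p) → p
      (inj₂ H') → ⊥-elim (Chain.no-two-hubs dD PD big star H cx H' z cz z≢v nz)
    where
    cx : count (Chain.Hub.x H) D ≢ 0
    cx = StarLemmas.Quad.cq dD PD big (star v cv) cv (Chain.Hub.perm H)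
  main : Dec (∃ λ z → (count z D ≢ 0) × (z ≢ v) × (count z (arms σ) ≡ 0)) → D ≅ D2
  main (no nothing) = five-case five dD PD big D2 g v cv σ nothing
  main (yes (z , cz , z≢v , nz)) = case hub v cv of λ where
    (inj₁ p) → p
    (inj₂ H) → second H z cz z≢v nz

unique : Five → ∀ n → Unique-below n
unique five (suc n) [] E' lt dE PE bE g = ≅≡ (sym (empty-word E' λ a → sym (same g a)))
unique five (suc n) (x ∷ E) E' lt dE PE bE g = unique-step five dE PE bE E' g
  (λ F F' lt' → unique five n F F' (ℕ.<-≤-trans lt' (ℕ.≤-pred lt))) x (head≢0 x E)

-- Exhaustive search over words with five letters

module Search (ok : Fin 5 → Wd 5 → Bool) (P : Wd 5 → Bool) where

  all5 : (Fin 5 → Bool) → Bool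
  all5 f = f zero ∧ (f (suc zero) ∧ (f (suc (suc zero)) ∧ (f (suc (suc (suc zero))) ∧ f (suc (suc (suc (suc zero)))))))

  ∧-true : ∀ {a b} → a ∧ b ≡ true → a ≡ true × b ≡ true
  ∧-true {true} e = refl , e

  all5-sound : ∀ f → all5 f ≡ true → ∀ x → f x ≡ true
  all5-sound f e = go
    where
    e₀ = ∧-true e
    e1 = ∧-true (proj₂ e₀)
    e2 = ∧-true (proj₂ e1)
    e3 = ∧-true (proj₂ e2)
    go : ∀ x → f x ≡ true
    go zero = proj₁ e₀
    go (suc zero) = proj₁ e1
    go (suc (suc zero)) = proj₁ e2
    go (suc (suc (suc zero))) = proj₁ e3
    go (suc (suc (suc (suc zero)))) = proj₂ e3

  -- Words grow to the left, and a branch is abandoned as soon as `ok` rejects the next letter.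
  -- Soundness asks that `ok` accept every step in the construction of the word that is looked for.
  search : ℕ → Wd 5 → Bool
  search zero w = P w
  search (suc n) w = all5 λ x → if ok x w then search n (x ∷ w) else true

  search-sound : ∀ n w → search n w ≡ true → ∀ q → length q ≡ n →
    (∀ p x s → q ʳ++ w ≡ p ++ x ∷ s → length w ≤ length s → ok x s ≡ true) → P (q ʳ++ w) ≡ true
  search-sound zero w e [] _ _ = e
  search-sound (suc n) w e (x ∷ q) l good with ok x w in o | all5-sound (λ x → if ok x w then search n (x ∷ w) else true) e x
  ... | true | e' = search-sound n (x ∷ w) e' q (ℕ.suc-injective l) λ p y s eq le → good p y s eq (≤-trans (ℕ.n≤1+n _) le)
  ... | false | _ = ⊥-elim (true≢false (trans (sym (good (rev q) x w (ʳ++-defn q {x ∷ w}) ≤-refl)) o))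

before : Fin k → Wd k → Wd k
before x [] = []
before x (y ∷ w) = if eqb x y then [] else y ∷ before x w

before-form : (x : Fin k) (P Q : Wd k) → count x P ≡ 0 → before x (P ++ x ∷ Q) ≡ P
before-form x [] Q p rewrite eqb-refl x = refl
before-form x (y ∷ P) Q p with x ≟ᶠ y
... | no _ = cong (y ∷_) (before-form x P Q p)

same-word : Wd 5 → Wd 5 → Bool
same-word [] [] = true
same-word (x ∷ u) (y ∷ w) = eqb x y ∧ same-word u w
same-word _ _ = false

same-word-sound : ∀ u w → same-word u w ≡ true → u ≡ w
same-word-sound [] [] _ = refl
same-word-sound (x ∷ u) (y ∷ w) e with eqb x y in xy
... | true = cong₂ _∷_ (eqb-≡ xy) (same-word-sound u w e)

dihedral : ℕ → Wd 5 → Wd 5 → Bool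
dihedral zero u w = false
dihedral (suc n) [] w = false
dihedral (suc n) (x ∷ u) w = same-word (x ∷ u) w ∨ (same-word (rev (x ∷ u)) w ∨ dihedral n (u ++ [ x ]) w)

dihedral-sound : ∀ n u w → dihedral n u w ≡ true → u ≅ w
dihedral-sound (suc n) (x ∷ u) w e with same-word (x ∷ u) w in e1
... | true = ≅≡ (same-word-sound (x ∷ u) w e1)
... | false with same-word (rev (x ∷ u)) w in e2
...   | true = ≅trans (≅rev (x ∷ u)) (≅≡ (same-word-sound (rev (x ∷ u)) w e2))
...   | false = ≅trans (≅rot [ x ] u) (dihedral-sound n (u ++ [ x ]) w e)

-- When `x` is placed for the second time, the letters met an odd number of times since its first
-- placement must be those that cross `x` in `W`. A third occurrence is rejected.
fits : Wd 5 → Fin 5 → Wd 5 → Bool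
fits W x w = if count x w ≡ᵇ 0 then true else (count x w ≡ᵇ 1) ∧ Search.all5 (λ _ _ → true) (λ _ → true) (λ y → eqb x y ∨ not (par y (before x w) xor ord x y W))

fresh : Fin 5 → Wd 5 → Bool
fresh x w = not (eqb zero x) ∧ (count x w ≡ᵇ 0)

four5 : Fin 5
four5 = suc (suc (suc (suc zero)))

-- The letter `zero` is the vertex `v`, the letters 1 to 4 are the ends of its two arcs, and the
-- second ends of these four letters are distributed over `s` and `t`.
word5 : Wd 5 → Wd 5 → Wd 5
word5 s t = zero ∷ suc zero ∷ s ++ suc (suc zero) ∷ zero ∷ suc (suc (suc zero)) ∷ t ++ four5 ∷ []

pairs5 : Wd 5 → Bool
pairs5 W = Search.all5 (λ _ _ → true) (λ _ → true) λ x → Search.all5 (λ _ _ → true) (λ _ → true) λ y → eqb x y ∨ (6 ≤ᵇ cut (duo x y) W)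

-- Of primality only the cuts of pairs are tested. The competing word is rotated to end in `four5`,
-- which leaves nine places; a word of length ten has ten rotations, each compared along with its
-- reversal.
check5 : Wd 5 → Wd 5 → Bool
check5 s t = if pairs5 (word5 s t) then Search.search (fits (word5 s t)) (dihedral 10 (word5 s t)) 9 (four5 ∷ []) else true

splits : (Wd 5 → Wd 5 → Bool) → Wd 5 → Wd 5 → Bool
splits f s [] = f s []
splits f s (x ∷ t) = f s (x ∷ t) ∧ splits f (s ++ [ x ]) t

-- The orders of the four letters of `s ++ t` are enumerated, and `splits` tries every cut into `s`
-- and `t`. The proof is by evaluation.
exhaustive : Search.search fresh (splits check5 []) 4 [] ≡ true
exhaustive = refl

∧-true : ∀ {a b} → a ∧ b ≡ true → a ≡ true × b ≡ true
∧-true {true} e = refl , e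

splits-sound : ∀ f s t → splits f s t ≡ true → ∀ t1 t2 → t ≡ t1 ++ t2 → f (s ++ t1) t2 ≡ true
splits-sound f s [] e [] [] refl = subst (λ z → f z [] ≡ true) (sym (++-identityʳ s)) e
splits-sound f s (x ∷ t) e [] _ refl = subst (λ z → f z (x ∷ t) ≡ true) (sym (++-identityʳ s)) (proj₁ (∧-true e))
splits-sound f s (x ∷ t) e (.x ∷ t1) t2 refl = subst (λ z → f z t2 ≡ true) (++-assoc s [ x ] t1)
  (splits-sound f (s ++ [ x ]) t (proj₂ (∧-true {f s (x ∷ t)} e)) t1 t2 refl)

≅-map : ∀ {m n} (h : Fin m → Fin n) {u v : Wd m} → u ≅ v → map h u ≅ map h v
≅-map h ≅refl = ≅refl
≅-map h (≅sym p) = ≅sym (≅-map h p)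
≅-map h (≅trans p q) = ≅trans (≅-map h p) (≅-map h q)
≅-map h (≅rot U V) = ≅trans (≅≡ (map-++ h U V)) (≅trans (≅rot (map h U) (map h V)) (≅≡ (sym (map-++ h V U))))
≅-map h (≅rev w) = ≅trans (≅rev (map h w)) (≅≡ (sym (reverse-map h w)))

lookup-in : (xs : Wd k) (i : Fin (length xs)) → count (lookup xs i) xs ≢ 0
lookup-in (x ∷ xs) zero = head≢0 x xs
lookup-in (x ∷ xs) (suc i) = cons≢0 (lookup xs i) x xs (lookup-in xs i)

lookup-inj : {xs : Wd k} → Uniq xs → (i j : Fin (length xs)) → lookup xs i ≡ lookup xs j → i ≡ j
lookup-inj (n ∷ u) zero zero e = refl
lookup-inj {xs = x ∷ xs} (n ∷ u) zero (suc j) refl = ⊥-elim (lookup-in xs j n)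
lookup-inj {xs = x ∷ xs} (n ∷ u) (suc i) zero refl = ⊥-elim (lookup-in xs i n)
lookup-inj (n ∷ u) (suc i) (suc j) e = cong suc (lookup-inj u i j e)

in-lookup : (xs : Wd k) (z : Fin k) → count z xs ≢ 0 → ∃[ i ] (lookup xs i ≡ z)
in-lookup [] z n = ⊥-elim (n refl)
in-lookup (x ∷ xs) z n with z ≟ᶠ x
... | yes e = zero , sym e
... | no _ = let i , e = in-lookup xs z n in suc i , e

tail≤ : (z x : Fin k) (w : Wd k) → count z w ≤ count z (x ∷ w)
tail≤ z x w with eqb z x
... | true = ℕ.n≤1+n _
... | false = ≤-refl

count≤1⇒Uniq : (w : Wd k) → (∀ z → count z w ≤ 1) → Uniq w
count≤1⇒Uniq [] h = []
count≤1⇒Uniq (x ∷ w) h = ℕ.n≤0⇒n≡0 (ℕ.≤-pred (≤-trans (≤-reflexive (sym (count-head x w))) (h x)))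
  ∷ count≤1⇒Uniq w λ z → ≤-trans (tail≤ z x w) (h z)

Same-length : (u v : Wd k) → Same u v → length u ≡ length v
Same-length [] v s = cong length (sym (empty-word v λ a → sym (s a)))
Same-length (x ∷ u) v s with locate x v (λ e → head≢0 x u (trans (s x) e))
... | P , Q , refl , _ , _ = trans (cong suc (trans (Same-length u (P ++ Q) rest) (length-++ P))) (trans (sym (ℕ.+-suc (length P) (length Q))) (sym (length-++ P)))
  where
  rest : Same u (P ++ Q)
  rest a with s a
  ... | e rewrite count-++ a P (x ∷ Q) | count-++ a P Q with eqb a x
  ...   | true = ℕ.suc-injective (trans e (ℕ.+-suc (count a P) (count a Q)))
  ...   | false = e

cut-map : ∀ {m n} (h : Fin m → Fin n) (S : Fin n → Bool) (w : Wd m) → cut S (map h w) ≡ cut (S ∘ h) w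
cut-map h S [] = refl
cut-map h S (x ∷ w) = path-map (S (h x)) w (S (h x))
  where
  path-map : ∀ b w c → path S b (map h w) c ≡ path (S ∘ h) b w c
  path-map b [] c = refl
  path-map b (x ∷ w) c = cong (jump b (S (h x)) +_) (path-map (S (h x)) w c)

-- Carries words over five arbitrary labels to `Fin 5` and back. `code` inverts `name` only on the
-- letters of `al`, whence the hypothesis `Over` on words.
module Relabel {al : Wd k} (uniq : Uniq al) (len : length al ≡ 5) where
  name : Fin 5 → Fin k
  name i = lookup al (subst Fin (sym len) i)

  name-inj : ∀ i j → name i ≡ name j → i ≡ j
  name-inj i j e = subst-inj (sym len) (lookup-inj uniq _ _ e)
    where
    subst-inj : ∀ {m n} (p : m ≡ n) {i j : Fin m} → subst Fin p i ≡ subst Fin p j → i ≡ j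
    subst-inj refl e = e

  name-in : ∀ i → count (name i) al ≢ 0
  name-in i = lookup-in al (subst Fin (sym len) i)

  code : Fin k → Fin 5
  code z with any? (λ i → name i ≟ᶠ z)
  ... | yes (i , _) = i
  ... | no _ = zero

  name-code : ∀ z → count z al ≢ 0 → name (code z) ≡ z
  name-code z n with any? (λ i → name i ≟ᶠ z)
  ... | yes (_ , e) = e
  ... | no nope = ⊥-elim (nope (subst Fin len (proj₁ (in-lookup al z n)) , trans (cong (lookup al) (back len (proj₁ (in-lookup al z n)))) (proj₂ (in-lookup al z n))))
    where
    back : ∀ {m n} (p : m ≡ n) (i : Fin m) → subst Fin (sym p) (subst Fin p i) ≡ i
    back refl i = refl

  code-name : ∀ i → code (name i) ≡ i
  code-name i = name-inj (code (name i)) i (name-code (name i) (name-in i))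

  eqb-code : ∀ x z → count z al ≢ 0 → eqb x (code z) ≡ eqb (name x) z
  eqb-code x z n with x ≟ᶠ code z | name x ≟ᶠ z
  ... | yes _ | yes _ = refl
  ... | no _ | no _ = refl
  ... | yes refl | no q = ⊥-elim (q (name-code z n))
  ... | no p | yes refl = ⊥-elim (p (sym (code-name x)))

  Over : Wd k → Set
  Over w = All (λ z → count z al ≢ 0) w

  par-code : ∀ x w → Over w → par x (map code w) ≡ par (name x) w
  par-code x [] [] = refl
  par-code x (z ∷ w) (o ∷ os) = cong₂ _xor_ (eqb-code x z o) (par-code x w os)

  count-code : ∀ x w → Over w → count x (map code w) ≡ count (name x) w
  count-code x [] [] = refl
  count-code x (z ∷ w) (o ∷ os) = trans (cong (λ b → if b then suc (count x (map code w)) else count x (map code w)) (eqb-code x z o))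
    (cong (λ n → if eqb (name x) z then suc n else n) (count-code x w os))

  ord-code : ∀ x y w → Over w → ord x y (map code w) ≡ ord (name x) (name y) w
  ord-code x y [] [] = refl
  ord-code x y (z ∷ w) (o ∷ os) = cong₂ _xor_ (cong₂ _∧_ (eqb-code x z o) (par-code y w os)) (ord-code x y w os)

  decode : ∀ w → Over w → map name (map code w) ≡ w
  decode [] [] = refl
  decode (z ∷ w) (o ∷ os) = cong₂ _∷_ (name-code z o) (decode w os)

  over : ∀ w → (∀ x → count x w ≢ 0 → count x al ≢ 0) → Over w
  over [] h = []
  over (x ∷ w) h = h x (head≢0 x w) ∷ over w λ y n → h y (cons≢0 y x w n)

all5-complete : ∀ (f : Fin 5 → Bool) → (∀ x → f x ≡ true) → Search.all5 (λ _ _ → true) (λ _ → true) f ≡ true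
all5-complete f h rewrite h zero | h (suc zero) | h (suc (suc zero)) | h (suc (suc (suc zero))) | h four5 = refl

pairs5-complete : ∀ W → (∀ x y → (eqb x y ∨ (6 ≤ᵇ cut (duo x y) W)) ≡ true) → pairs5 W ≡ true
pairs5-complete W h = all5-complete (λ x → Search.all5 (λ _ _ → true) (λ _ → true) λ y → eqb x y ∨ (6 ≤ᵇ cut (duo x y) W))
  λ x → all5-complete (λ y → eqb x y ∨ (6 ≤ᵇ cut (duo x y) W)) (h x)

fits-complete : ∀ W x r1 r2 → count x r1 ≡ 0 → count x (r1 ++ x ∷ r2) ≡ 1 → (∀ y → x ≢ y → par y r1 ≡ ord x y W) → fits W x (r1 ++ x ∷ r2) ≡ true
fits-complete W x r1 r2 z c h = trans (cong (λ n → if n ≡ᵇ 0 then true else (n ≡ᵇ 1) ∧ each (before x (r1 ++ x ∷ r2))) c)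
  (trans (cong each (before-form x r1 r2 z)) (all5-complete (λ y → eqb x y ∨ not (par y r1 xor ord x y W)) ok))
  where
  each : Wd 5 → Bool
  each w = Search.all5 (λ _ _ → true) (λ _ → true) (λ y → eqb x y ∨ not (par y w xor ord x y W))
  ok : ∀ y → (eqb x y ∨ not (par y r1 xor ord x y W)) ≡ true
  ok y = case x ≟ᶠ y of λ where
    (yes refl) → cong (_∨ not (par y r1 xor ord x y W)) (eqb-refl x)
    (no n) → trans (cong₂ (λ e p → e ∨ not (p xor ord x y W)) (eqb-≢ n) (h y n)) (taut 1 (λ o → not (o xor o)) (λ _ → true) tt (ord x y W))

fits-new : ∀ W x r → count x r ≡ 0 → fits W x r ≡ true
fits-new W x r z = cong (λ n → if n ≡ᵇ 0 then true else (n ≡ᵇ 1) ∧ Search.all5 (λ _ _ → true) (λ _ → true) (λ y → eqb x y ∨ not (par y (before x r) xor ord x y W))) z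

≤⇒≤ᵇ≡ : ∀ {m n} → m ≤ n → (m ≤ᵇ n) ≡ true
≤⇒≤ᵇ≡ {m} {n} le with m ≤ᵇ n | ℕ.≤⇒≤ᵇ le
... | true | _ = refl

if-true : ∀ (b : Bool) {x : Bool} → b ≡ true → (if b then x else true) ≡ true → x ≡ true
if-true true _ e = e

five5 : ∀ (s t P : Wd 5) → length (s ++ t) ≡ 4 → (∀ p x r → s ++ t ≡ p ++ x ∷ r → fresh x r ≡ true) → pairs5 (word5 s t) ≡ true →
  length P ≡ 9 → (∀ p x r → P ++ four5 ∷ [] ≡ p ++ x ∷ r → fits (word5 s t) x r ≡ true) →
  word5 s t ≅ P ++ four5 ∷ []
five5 s t P l f p l9 g = dihedral-sound 10 (word5 s t) _ (subst (λ z → dihedral 10 (word5 s t) z ≡ true) rr found)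
  where
  checked : check5 s t ≡ true
  checked = splits-sound check5 [] (s ++ t) (subst (λ z → splits check5 [] z ≡ true) ss
      (Search.search-sound fresh (splits check5 []) 4 [] exhaustive (rev (s ++ t)) (trans (length-reverse (s ++ t)) l) λ p x r e _ → f p x r (trans (sym ss) e)))
    s t refl
    where
    ss : rev (s ++ t) ʳ++ [] ≡ s ++ t
    ss = trans (ʳ++-defn (rev (s ++ t))) (trans (++-identityʳ _) (reverse-involutive (s ++ t)))
  rr : rev P ʳ++ (four5 ∷ []) ≡ P ++ four5 ∷ []
  rr = trans (ʳ++-defn (rev P)) (cong (_++ four5 ∷ []) (reverse-involutive P))
  found : dihedral 10 (word5 s t) (rev P ʳ++ (four5 ∷ [])) ≡ true
  found = Search.search-sound (fits (word5 s t)) (dihedral 10 (word5 s t)) 9 (four5 ∷ []) (if-true (pairs5 (word5 s t)) p checked)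
    (rev P) (trans (length-reverse P) l9) λ p x r e _ → g p x r (trans (sym rr) e)

five : Five
five {k} v a b c e s t D2 dW PW g uniq covered = conclusion
  where
  al : Wd k
  al = v ∷ a ∷ b ∷ c ∷ e ∷ []
  W u : Wd k
  W = v ∷ a ∷ s ++ b ∷ v ∷ c ∷ t ++ [ e ]
  u = s ++ t
  open Relabel uniq refl
  countW : ∀ z → count z W ≡ count z al + count z (v ∷ u)
  countW z = trans (count7 z) (trans (arith (count z [ v ]) (count z [ a ]) (count z s) (count z [ b ]) (count z [ c ]) (count z t) (count z [ e ]))
      (cong₂ _+_ (sym (count-al z)) (sym (trans (count-++ z [ v ] (s ++ t)) (cong (count z [ v ] +_) (count-++ z s t))))))
    where
    count7 : ∀ z → count z W ≡ count z [ v ] + (count z [ a ] + (count z s + (count z [ b ] + (count z [ v ] + (count z [ c ] + (count z t + count z [ e ]))))))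
    count7 z = pre v (a ∷ s ++ b ∷ v ∷ c ∷ t ++ [ e ]) (pre a (s ++ b ∷ v ∷ c ∷ t ++ [ e ]) (trans (count-++ z s (b ∷ v ∷ c ∷ t ++ [ e ])) (cong (count z s +_)
      (pre b (v ∷ c ∷ t ++ [ e ]) (pre v (c ∷ t ++ [ e ]) (pre c (t ++ [ e ]) (count-++ z t [ e ])))))))
      where
      pre : ∀ x (w : Wd k) {n} → count z w ≡ n → count z (x ∷ w) ≡ count z [ x ] + n
      pre x w q = trans (count-++ z [ x ] w) (cong (count z [ x ] +_) q)
    count-al : ∀ z → count z al ≡ count z [ v ] + (count z [ a ] + (count z [ b ] + (count z [ c ] + count z [ e ])))
    count-al z = trans (count-++ z [ v ] (a ∷ b ∷ c ∷ e ∷ [])) (cong (count z [ v ] +_) (trans (count-++ z [ a ] (b ∷ c ∷ e ∷ [])) (cong (count z [ a ] +_)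
      (trans (count-++ z [ b ] (c ∷ e ∷ [])) (cong (count z [ b ] +_) (count-++ z [ c ] [ e ]))))))
    arith : ∀ v a s b c t e → v + (a + (s + (b + (v + (c + (t + e)))))) ≡ (v + (a + (b + (c + e)))) + (v + (s + t))
    arith = ℕRing.solve-∀
  two-of : ∀ z → count z al ≢ 0 → count z W ≡ 2
  two-of z n with dW z
  ... | inj₂ q = q
  ... | inj₁ q = ⊥-elim (n (proj₁ (+≡0 (trans (sym (countW z)) q))))
  al≤1 : ∀ z → count z al ≤ 1
  al≤1 z = uniq≤1 uniq
    where
    uniq≤1 : ∀ {xs} → Uniq xs → count z xs ≤ 1
    uniq≤1 [] = z≤n
    uniq≤1 {x ∷ xs} (n ∷ us) with z ≟ᶠ x
    ... | yes refl = s≤s (≤-reflexive n)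
    ... | no _ = uniq≤1 us
  -- Each label has two ends, and `al` accounts for one of them. Thus `v` does not occur in
  -- `s ++ t`, and each of its neighbours occurs there once.
  vu : ∀ z → count z al ≢ 0 → count z (v ∷ u) ≡ 1
  vu z n = other-one n (al≤1 z) (trans (sym (countW z)) (two-of z n))
    where
    other-one : ∀ {m n} → m ≢ 0 → m ≤ 1 → m + n ≡ 2 → n ≡ 1
    other-one {zero} n _ _ = ⊥-elim (n refl)
    other-one {suc zero} _ _ q = ℕ.suc-injective q
    other-one {suc (suc _)} _ (s≤s ()) _
  u-v : count v u ≡ 0
  u-v = ℕ.suc-injective (trans (sym (count-head v u)) (vu v (head≢0 v (a ∷ b ∷ c ∷ e ∷ []))))
  in-u : ∀ z → count z (a ∷ b ∷ c ∷ e ∷ []) ≢ 0 → count z u ≡ 1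
  in-u z n = trans (sym (count-other z≢v u)) (vu z (cons≢0 z v (a ∷ b ∷ c ∷ e ∷ []) n))
    where
    z≢v : z ≢ v
    z≢v refl = n (case uniq of λ { (q ∷ _) → q })
  u-al : ∀ z → count z u ≢ 0 → count z al ≢ 0
  u-al z n = covered z λ q → n (proj₂ (zeros z [ v ] u (proj₂ (+≡0 {count z al} (trans (sym (countW z)) q)))))
  u≤1 : ∀ z → count z u ≤ 1
  u≤1 z with nonzero-or z u
  ... | inj₁ q = ≤-trans (≤-reflexive q) z≤n
  ... | inj₂ n = ≤-trans (tail≤ z v u) (≤-reflexive (vu z (u-al z n)))
  len-u : length u ≡ 4
  len-u = ℕ.≤-antisym
    (pigeonhole (count≤1⇒Uniq u u≤1) (a ∷ b ∷ c ∷ e ∷ []) λ z n q → u-al z n (trans (count-other {a = z} {v} (λ { refl → n u-v }) (a ∷ b ∷ c ∷ e ∷ [])) q))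
    (pigeonhole (utail uniq) u λ z n q → case trans (sym q) (in-u z n) of λ ())
    where
    utail : ∀ {x xs} → Uniq (x ∷ xs) → Uniq xs
    utail (_ ∷ us) = us
  overW : Over W
  overW = over W covered
  over-u : Over u
  over-u = over u u-al
  W1 : Wd 5
  W1 = word5 (map code s) (map code t)
  W1≡ : map code W ≡ W1
  W1≡ = cong₂ _∷_ (code-name zero) (cong₂ _∷_ (code-name (suc zero)) (trans (map-++ code s _) (cong (map code s ++_)
    (cong₂ _∷_ (code-name (suc (suc zero))) (cong₂ _∷_ (code-name zero) (cong₂ _∷_ (code-name (suc (suc (suc zero)))) (trans (map-++ code t [ e ]) (cong (λ z → map code t ++ [ z ]) (code-name four5)))))))))
  freshly : ∀ p x r → map code s ++ map code t ≡ p ++ x ∷ r → fresh x r ≡ true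
  freshly p x r eq = cong₂ (λ y z → not y ∧ (z ≡ᵇ 0)) x≢0 (proj₂ cx)
    where
    total : count x p + suc (count x r) ≡ count (name x) u
    total = trans (cong (count x p +_) (sym (count-head x r))) (trans (sym (count-++ x p (x ∷ r))) (trans (cong (count x) (sym (trans (map-++ code s t) eq))) (count-code x u over-u)))
    cx : count x p ≡ 0 × count x r ≡ 0
    cx = +≡0 (ℕ.n≤0⇒n≡0 (ℕ.≤-pred (≤-trans (≤-reflexive (trans (sym (ℕ.+-suc (count x p) (count x r))) total)) (u≤1 (name x)))))
    x≢0 : eqb zero x ≡ false
    x≢0 = eqb-≢ {a = zero} {x} λ { refl → case trans (sym (ℕ.+-suc (count zero p) (count zero r))) (trans total u-v) of λ () }
  pairs-true : pairs5 W1 ≡ true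
  pairs-true = pairs5-complete W1 ok
    where
    inW : ∀ i → count (name i) W ≢ 0
    inW i q = case trans (sym q) (two-of (name i) (name-in i)) of λ ()
    ok : ∀ x y → (eqb x y ∨ (6 ≤ᵇ cut (duo x y) W1)) ≡ true
    ok x y = case bool-cases (eqb x y) of λ where
        (inj₁ xy) → cong (_∨ (6 ≤ᵇ cut (duo x y) W1)) xy
        (inj₂ xy) → trans (cong (_∨ (6 ≤ᵇ cut (duo x y) W1)) xy) (≤⇒≤ᵇ≡ (subst (6 ≤_) (trans (sym (cut-map code (duo x y) W)) (cong (cut (duo x y)) W1≡)) (bound xy)))
      where
      bound : eqb x y ≡ false → 6 ≤ cut (duo x y ∘ code) W
      bound xy = case pick-two {a = zero} {suc zero} {suc (suc zero)} {suc (suc (suc zero))} (λ ()) (λ ()) (λ ()) (λ ()) (λ ()) (λ ()) (λ _ → ⊤) tt tt tt tt x y of λ where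
        (p , q , p≢q , (px , py) , (qx , qy) , _) → Prime.cuts PW (duo x y ∘ code)
            (two (name x) (name y) (λ n → true≢false (trans (sym (subst (λ z → eqb x z ≡ true) (name-inj x y n) (eqb-refl x))) xy))
              (trans (cong (duo x y) (code-name x)) (duo-l x y)) (trans (cong (duo x y) (code-name y)) (duo-r x y)) (inW x) (inW y))
            (two (name p) (name q) (p≢q ∘ name-inj p q) (trans (cong (duo x y) (code-name p)) (duo-no px py)) (trans (cong (duo x y) (code-name q)) (duo-no qx qy)) (inW p) (inW q))
  e∈ : count e D2 ≢ 0
  e∈ q = case trans (sym (two-of e (name-in four5))) (trans (same g e) q) of λ ()
  conclusion : W ≅ D2
  conclusion with locate e D2 e∈
  ... | P , Q , eqD , _ = ≅trans (≅trans (≅≡ (sym (decode W overW))) (≅trans (≅-map name iso) (≅≡ (decode D3 over3)))) (≅sym ro)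
    where
    D3 P' : Wd k
    P' = Q ++ P
    D3 = P' ++ [ e ]
    ro : D2 ≅ D3
    ro = rot≡ (P ++ [ e ]) Q (trans eqD (sym (++-assoc P [ e ] Q))) (sym (++-assoc Q P [ e ]))
    g3 : SG W D3
    g3 = SG-trans g (≅-SG ro (DO⇒Even D2 (SG-DO g dW)))
    d3 : DO D3
    d3 = SG-DO g3 dW
    over3 : Over D3
    over3 = over D3 λ x n → covered x λ q → n (trans (sym (same g3 x)) q)
    W2≡ : map code D3 ≡ map code P' ++ four5 ∷ []
    W2≡ = trans (map-++ code P' [ e ]) (cong (λ z → map code P' ++ [ z ]) (code-name four5))
    len3 : length (map code P') ≡ 9
    len3 = trans (length-map code P') (ℕ.suc-injective (trans (ℕ.+-comm 1 (length P')) (trans (sym (length-++ P')) (trans (sym (Same-length W D3 (same g3))) lenW))))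
      where
      lenW : length W ≡ 10
      lenW = trans (cong (2 +_) (trans (length-++ s) (cong (length s +_) (cong (3 +_) (length-++ t)))))
        (trans (arith (length s) (length t)) (cong (6 +_) (trans (sym (length-++ s)) len-u)))
        where
        arith : ∀ s t → 2 + (s + (3 + (t + 1))) ≡ 6 + (s + t)
        arith = ℕRing.solve-∀
    fitting : ∀ p x r → map code P' ++ four5 ∷ [] ≡ p ++ x ∷ r → fits W1 x r ≡ true
    fitting p x r eq = go (d3 (name x))
        where
        eq' : map code D3 ≡ p ++ x ∷ r
        eq' = trans W2≡ eq
        total : count x p + suc (count x r) ≡ count (name x) D3
        total = trans (cong (count x p +_) (sym (count-head x r))) (trans (sym (count-++ x p (x ∷ r))) (trans (cong (count x) (sym eq')) (count-code x D3 over3)))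
        crossing : ∀ r1 r2 → r ≡ r1 ++ x ∷ r2 → count x p ≡ 0 → count x r1 ≡ 0 → count x r2 ≡ 0 → ∀ y → x ≢ y → par y r1 ≡ ord x y W1
        crossing r1 r2 er p0 r10 r20 y x≢y = trans (sym (ord-2 x (x≢y ∘ sym) p r1 r2 p0 r10 r20)) (trans (cong (ord x y) (sym (trans eq' (cong (λ z → p ++ x ∷ z) er))))
          (trans (ord-code x y D3 over3) (trans (sym (ords g3 (name x) (name y))) (trans (sym (ord-code x y W overW)) (cong (ord x y) W1≡)))))
        go : (count (name x) D3 ≡ 0) ⊎ (count (name x) D3 ≡ 2) → fits W1 x r ≡ true
        go (inj₁ q) = case trans (sym (ℕ.+-suc (count x p) (count x r))) (trans total q) of λ ()
        go (inj₂ q) with nonzero-or x r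
        ... | inj₁ z = fits-new W1 x r z
        ... | inj₂ n with locate x r n
        ...   | r1 , r2 , er , r10 , cr = subst (λ z → fits W1 x z ≡ true) (sym er) final
          where
          sums : count x p + count x r ≡ 1
          sums = ℕ.suc-injective (trans (sym (ℕ.+-suc (count x p) (count x r))) (trans total q))
          cr1 : count x p ≡ 0 × count x r2 ≡ 0
          cr1 = +≡0 (ℕ.suc-injective (trans (sym (ℕ.+-suc (count x p) (count x r2))) (trans (cong (count x p +_) (sym cr)) sums)))
          c1 : count x (r1 ++ x ∷ r2) ≡ 1
          c1 = trans (cong (count x) (sym er)) (trans cr (cong suc (proj₂ cr1)))
          final : fits W1 x (r1 ++ x ∷ r2) ≡ true
          final = fits-complete W1 x r1 r2 r10 c1 (crossing r1 r2 er (proj₁ cr1) r10 (proj₂ cr1))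
    iso : map code W ≅ map code D3
    iso = ≅trans (≅≡ W1≡) (≅trans (five5 (map code s) (map code t) (map code P') (trans (cong length (sym (map-++ code s t))) (trans (length-map code u) len-u)) freshly pairs-true len3 fitting) (≅≡ (sym W2≡)))

-- Places for a further chord in a prime word

All-count : {P : Fin k → Set} {w : Wd k} → All P w → ∀ x → count x w ≢ 0 → P x
All-count {w = []} [] x n = ⊥-elim (n refl)
All-count {w = y ∷ w} (p ∷ ps) x n with x ≟ᶠ y
... | yes refl = p
... | no _ = All-count ps x n

tiny : {W : Wd k} {a b c : Fin k} → Big W → All (λ x → x ≡ a ⊎ (x ≡ b ⊎ x ≡ c)) W → ⊥
tiny {W = W} {a} {b} {c} big few with big a b
... | p , q , p≢q , (pa , pb) , (qa , qb) , cp , cq = p≢q (trans (is-c p cp pa pb) (sym (is-c q cq qa qb)))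
  where
  is-c : ∀ x → count x W ≢ 0 → x ≢ a → x ≢ b → x ≡ c
  is-c x n xa xb with All-count few x n
  ... | inj₁ e = ⊥-elim (xa e)
  ... | inj₂ (inj₁ e) = ⊥-elim (xb e)
  ... | inj₂ (inj₂ e) = e

cons-nil : {b : Fin k} (P : Wd k) {Q : Wd k} → P ++ b ∷ Q ≢ []
cons-nil [] ()
cons-nil (_ ∷ _) ()

-- The possible places of a further chord whose arc contains the letters of Q (or of Q and P2), crossing either
-- no letter other than b or exactly those that b crosses.

module Gap {b : Fin k} {W : Wd k} (PW : Prime W) (big : Big W) (dW : DO W) where

  share : ∀ X G X' G' → W ≅ X ++ G ++ X' ++ G' → Even (X ++ X') → Trivial X G X' G'
  share X G X' G' iso e = trivial-share X G X' G' (Prime-≅ iso PW) (DO-resp W (X ++ G ++ X' ++ G') (≅-Same iso) dW) e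

  -- If only `b` may be crossed, `Q` is a closed segment; otherwise `P` and `R` are the strands of a
  -- share. Both are trivial by primality. Should `P` and `R` be the ends of one letter `a`, then
  -- `a` and `b` together form a share, and its triviality leaves at most three letters in the word.
  same-side : ∀ (P Q R A : Wd k) (β : Bool) → W ≡ (P ++ Q ++ R) ++ b ∷ A ++ [ b ] → count b (P ++ Q ++ R) ≡ 0 →
    (∀ x → x ≢ b → par x Q ≡ β ∧ par x (P ++ Q ++ R)) → Q ≡ [] ⊎ (P ≡ [] × R ≡ [])
  same-side P Q R A false eW z h = go (share Q (R ++ b ∷ A ++ b ∷ P) [] [] iso even)
    where
    iso : W ≅ Q ++ (R ++ b ∷ A ++ b ∷ P) ++ [] ++ []
    iso = rot≡ P (Q ++ R ++ b ∷ A ++ [ b ]) (trans eW (ls 5 (λ p q r b a → (p & q & r) & b & a & b ⊜ p & q & r & b & a & b) refl P Q R [ b ] A))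
      (ls 5 (λ p q r b a → (q & r & b & a & b) & p ⊜ q & (r & b & a & b & p) & nil) refl P Q R [ b ] A)
    even : Even (Q ++ [])
    even x = trans (cong (par x) (++-identityʳ Q)) (case x ≟ᶠ b of λ where
      (yes refl) → trans (par-count x Q) (cong odd (proj₁ (zeros x Q R (proj₂ (zeros x P (Q ++ R) z)))))
      (no n) → h x n)
    go : Trivial Q (R ++ b ∷ A ++ b ∷ P) [] [] → _
    go (noX q _) = inj₁ q
    go (noG g _) = ⊥-elim (cons-nil R g)
  same-side P Q R A true eW z h = go (share P Q R (b ∷ A ++ [ b ]) iso even)
    where
    iso : W ≅ P ++ Q ++ R ++ b ∷ A ++ [ b ]
    iso = ≅≡ (trans eW (ls 4 (λ p q r a → (p & q & r) & a ⊜ p & q & r & a) refl P Q R (b ∷ A ++ [ b ])))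
    even : Even (P ++ R)
    even x = trans (par-++ x P R) (case x ≟ᶠ b of λ where
      (yes refl) → cong₂ _xor_ (trans (par-count x P) (cong odd (proj₁ zz))) (trans (par-count x R) (cong odd (proj₂ (zeros x Q R (proj₂ zz)))))
      (no n) → cancel (par x P) (par x Q) (par x R) (trans (h x n) (trans (par-++ x P (Q ++ R)) (cong (par x P xor_) (par-++ x Q R)))))
      where
      zz = zeros b P (Q ++ R) z
      cancel : ∀ p q r → q ≡ p xor (q xor r) → p xor r ≡ false
      cancel p q r e = trans (taut 3 (λ p q r → p xor r) (λ p q r → q xor (p xor (q xor r))) tt p q r) (trans (cong (q xor_) (sym e)) (taut 1 (λ q → q xor q) (λ _ → false) tt q))
    go : Trivial P Q R (b ∷ A ++ [ b ]) → _
    go (noX p r) = inj₂ (p , r)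
    go (oneG a _ g) = ⊥-elim (cons-nil A (proj₂ (∷-injective g)))
    go (oneX a refl refl) = ⊥-elim (end (share (b ∷ a ∷ []) Q (a ∷ b ∷ []) A
        (rot≡ ((a ∷ Q ++ [ a ]) ++ b ∷ A) [ b ] (trans eW (sym (++-assoc (a ∷ Q ++ [ a ]) (b ∷ A) [ b ])))
          (ls 4 (λ b a q c → b & (a & q & a) & b & c ⊜ (b & a) & q & (a & b) & c) refl [ b ] [ a ] Q A))
        λ x → taut 2 (λ a b → b xor (a xor (a xor (b xor false)))) (λ _ _ → false) tt (eqb x a) (eqb x b)))
      where
      end : Trivial (b ∷ a ∷ []) Q (a ∷ b ∷ []) A → ⊥
      end (noG refl refl) = tiny {a = a} {b} {b} big (subst (All _) (sym eW) (inj₁ refl ∷ inj₁ refl ∷ inj₂ (inj₁ refl) ∷ inj₂ (inj₁ refl) ∷ []))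
      end (oneG c refl refl) = tiny {a = a} {b} {c} big (subst (All _) (sym eW)
        (inj₁ refl ∷ inj₂ (inj₂ refl) ∷ inj₁ refl ∷ inj₂ (inj₁ refl) ∷ inj₂ (inj₂ refl) ∷ inj₂ (inj₁ refl) ∷ []))

  -- The arc now runs across one end of `b` and contains `Q` and `P2`. According to `β`, the words
  -- `Q` and `P2`, or `P` and `P2`, are the strands of a share; it is trivial, and a single letter
  -- `a` in it again forms a share with `b`, which `Big` excludes.
  two-sides : ∀ (P Q P2 Q2 : Wd k) (β : Bool) → W ≡ (P ++ Q) ++ b ∷ (P2 ++ Q2) ++ [ b ] → count b (P ++ Q) ≡ 0 → count b (P2 ++ Q2) ≡ 0 →
    (∀ x → x ≢ b → par x (Q ++ P2) ≡ β ∧ par x (P ++ Q)) → P ≡ [] ⊎ Q ≡ []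
  two-sides P Q P2 Q2 false eW z z2 h = go (share Q [ b ] P2 (Q2 ++ b ∷ P) iso even)
    where
    iso : W ≅ Q ++ [ b ] ++ P2 ++ Q2 ++ b ∷ P
    iso = rot≡ P (Q ++ b ∷ (P2 ++ Q2) ++ [ b ]) (trans eW (++-assoc P Q _))
      (ls 5 (λ p q b r s → (q & b & (r & s) & b) & p ⊜ q & b & r & s & b & p) refl P Q [ b ] P2 Q2)
    even : Even (Q ++ P2)
    even x = case x ≟ᶠ b of λ where
      (yes refl) → trans (par-count x (Q ++ P2)) (cong odd (trans (count-++ x Q P2) (cong₂ _+_ (proj₂ (zeros x P Q z)) (proj₁ (zeros x P2 Q2 z2)))))
      (no n) → h x n
    go : Trivial Q [ b ] P2 (Q2 ++ b ∷ P) → _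
    go (noX q _) = inj₂ q
    go (oneG u _ g) with snoc-nil Q2 (b ∷ P) g
    ... | inj₂ (_ , e) = inj₁ (proj₂ (∷-injective e))
    go (oneX a refl refl) = ⊥-elim (end (share (a ∷ b ∷ a ∷ []) Q2 [ b ] P
        (rot≡ P (a ∷ b ∷ (a ∷ Q2) ++ [ b ]) (trans eW (++-assoc P [ a ] _)) (ls 4 (λ p a b q → (a & b & (a & q) & b) & p ⊜ (a & b & a) & q & b & p) refl P [ a ] [ b ] Q2))
        λ x → taut 2 (λ a b → a xor (b xor (a xor (b xor false)))) (λ _ _ → false) tt (eqb x a) (eqb x b)))
      where
      end : Trivial (a ∷ b ∷ a ∷ []) Q2 [ b ] P → ⊥
      end (noG refl refl) = tiny {a = a} {b} {b} big (subst (All _) (sym eW) (inj₁ refl ∷ inj₂ (inj₁ refl) ∷ inj₁ refl ∷ inj₂ (inj₁ refl) ∷ []))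
      end (oneG c refl refl) = tiny {a = a} {b} {c} big (subst (All _) (sym eW)
        (inj₂ (inj₂ refl) ∷ inj₁ refl ∷ inj₂ (inj₁ refl) ∷ inj₁ refl ∷ inj₂ (inj₂ refl) ∷ inj₂ (inj₁ refl) ∷ []))
  two-sides P Q P2 Q2 true eW z z2 h = go (share P (Q ++ [ b ]) P2 (Q2 ++ [ b ]) iso even)
    where
    iso : W ≅ P ++ (Q ++ [ b ]) ++ P2 ++ Q2 ++ [ b ]
    iso = ≅≡ (trans eW (ls 5 (λ p q b r s → (p & q) & b & (r & s) & b ⊜ p & (q & b) & r & s & b) refl P Q [ b ] P2 Q2))
    even : Even (P ++ P2)
    even x = trans (par-++ x P P2) (case x ≟ᶠ b of λ where
      (yes refl) → cong₂ _xor_ (trans (par-count x P) (cong odd (proj₁ (zeros x P Q z)))) (trans (par-count x P2) (cong odd (proj₁ (zeros x P2 Q2 z2))))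
      (no n) → cancel (par x P) (par x Q) (par x P2) (trans (sym (par-++ x Q P2)) (trans (h x n) (par-++ x P Q))))
      where
      cancel : ∀ p q r → q xor r ≡ p xor q → p xor r ≡ false
      cancel p q r e = trans (taut 3 (λ p q r → p xor r) (λ p q r → (p xor q) xor (q xor r)) tt p q r) (trans (cong ((p xor q) xor_) e) (taut 2 (λ p q → (p xor q) xor (p xor q)) (λ _ _ → false) tt p q))
    go : Trivial P (Q ++ [ b ]) P2 (Q2 ++ [ b ]) → _
    go (noX p _) = inj₁ p
    go (noG g _) = ⊥-elim (cons-nil Q g)
    go (oneG u g _) with snoc-nil Q [ b ] g
    ... | inj₂ (e , _) = inj₂ e
    go (oneX a refl refl) = ⊥-elim (end (share (b ∷ a ∷ []) Q (b ∷ a ∷ []) Q2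
        (rot≡ ((a ∷ Q) ++ b ∷ a ∷ Q2) [ b ] (trans eW (sym (++-assoc (a ∷ Q) (b ∷ a ∷ Q2) [ b ])))
          (ls 4 (λ b a q c → b & (a & q) & b & a & c ⊜ (b & a) & q & (b & a) & c) refl [ b ] [ a ] Q Q2))
        λ x → taut 2 (λ a b → b xor (a xor (b xor (a xor false)))) (λ _ _ → false) tt (eqb x a) (eqb x b)))
      where
      end : Trivial (b ∷ a ∷ []) Q (b ∷ a ∷ []) Q2 → ⊥
      end (noG refl refl) = tiny {a = a} {b} {b} big (subst (All _) (sym eW) (inj₁ refl ∷ inj₂ (inj₁ refl) ∷ inj₁ refl ∷ inj₂ (inj₁ refl) ∷ []))
      end (oneG c refl refl) = tiny {a = a} {b} {c} big (subst (All _) (sym eW)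
        (inj₁ refl ∷ inj₂ (inj₂ refl) ∷ inj₂ (inj₁ refl) ∷ inj₁ refl ∷ inj₂ (inj₂ refl) ∷ inj₂ (inj₁ refl) ∷ []))

-- Crossings and small cuts across a share

-- A chord inside a share and one outside cross exactly when each of them connects the two strands
-- on its side, so the part of the adjacency matrix between the two sides has rank at most one.
share-ord : (S : Side k) (A B A' B' : Wd k) → Mono S true A → Mono S false B → Mono S true A' → Mono S false B' →
  Even (A ++ B ++ A' ++ B') → ∀ x y → S x ≡ true → S y ≡ false → ord x y (A ++ B ++ A' ++ B') ≡ par x A ∧ par y B
share-ord S A B A' B' mA mB mA' mB' ev x y Sx Sy = core (zero-par x B x∉B) (agree (par x A) (par x A') ex) (agree (par y B) (par y B') ey)
  where
  zero-par : ∀ z w → count z w ≡ 0 → par z w ≡ false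
  zero-par z w e = trans (par-count z w) (cong odd e)
  off : ∀ {s} z w → Mono S s w → S z ≡ not s → count z w ≡ 0
  off z w m e = Mono-out S w m z λ q → not≢ (trans (sym e) q)
  y∉A = off y A mA Sy
  y∉A' = off y A' mA' Sy
  x∉B = off x B mB Sx
  x∉B' = off x B' mB' Sx
  par4 : ∀ z → par z A xor (par z B xor (par z A' xor par z B')) ≡ false
  par4 z = trans (sym (trans (par-++ z A (B ++ A' ++ B')) (cong (par z A xor_) (trans (par-++ z B (A' ++ B')) (cong (par z B xor_) (par-++ z A' B')))))) (ev z)
  ex : par x A xor par x A' ≡ false
  ex = trans (cong (par x A xor_) (taut 1 (λ t → t) (λ t → t xor false) tt (par x A'))) (subst₂ (λ s t → par x A xor (s xor (par x A' xor t)) ≡ false) (zero-par x B x∉B) (zero-par x B' x∉B') (par4 x))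
  ey : par y B xor par y B' ≡ false
  ey = subst₂ (λ s t → s xor (par y B xor (t xor par y B')) ≡ false) (zero-par y A y∉A) (zero-par y A' y∉A') (par4 y)
  agree : ∀ s t → s xor t ≡ false → s ≡ t
  agree false false _ = refl
  agree true true _ = refl
  core : par x B ≡ false → par x A ≡ par x A' → par y B ≡ par y B' → ord x y (A ++ B ++ A' ++ B') ≡ par x A ∧ par y B
  core pB pA' pB' rewrite ord-++ x y A (B ++ A' ++ B') | ord-++ x y B (A' ++ B') | ord-++ x y A' B'
    | ord-0ʳ {a = x} A y∉A | ord-0ʳ {a = x} A' y∉A' | ord-0ˡ {b = y} B x∉B | ord-0ˡ {b = y} B' x∉B' | par-++ y B (A' ++ B') | par-++ y A' B'
    | zero-par y A' y∉A' | pB | sym pA' | sym pB'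
    = taut 2 (λ a b → ((a ∧ b) xor false) xor (a ∧ (b xor b))) (λ a b → a ∧ b) tt (par x A) (par y B)

share-nc : (S : Side k) (A B A' B' : Wd k) → Mono S true A → Mono S false B → Mono S true A' → Mono S false B' →
  Even (A ++ B ++ A' ++ B') → Even A ⊎ Even B → NonCrossing S (A ++ B ++ A' ++ B')
share-nc S A B A' B' mA mB mA' mB' ev e x y n = go (S x) (S y) refl refl
  where
  zero-ord : ∀ x y → S x ≡ true → S y ≡ false → ord x y (A ++ B ++ A' ++ B') ≡ false
  zero-ord x y Sx Sy = trans (share-ord S A B A' B' mA mB mA' mB' ev x y Sx Sy) (half e)
    where
    half : Even A ⊎ Even B → par x A ∧ par y B ≡ false
    half (inj₁ eA) = cong (_∧ par y B) (eA x)
    half (inj₂ eB) = trans (cong (par x A ∧_) (eB y)) (taut 1 (λ a → a ∧ false) (λ _ → false) tt (par x A))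
  go : ∀ s t → S x ≡ s → S y ≡ t → ord x y (A ++ B ++ A' ++ B') ≡ false
  go true true Sx Sy = ⊥-elim (n (trans Sx (sym Sy)))
  go false false Sx Sy = ⊥-elim (n (trans Sx (sym Sy)))
  go true false Sx Sy = zero-ord x y Sx Sy
  go false true Sx Sy = trans (ord-swap (λ q → n (cong S (sym q))) (A ++ B ++ A' ++ B')) (cong₂ _xor_ (zero-ord y x Sy Sx) (cong (_∧ par x (A ++ B ++ A' ++ B')) (ev y)))

Connected : Wd k → Set
Connected D = ∀ S a b → S a ≡ true → S b ≡ false → count a D ≢ 0 → count b D ≢ 0 → NonCrossing S D → ⊥

Connected-resp : {u v : Wd k} → SG u v → Connected u → Connected v
Connected-resp g c S a b Sa Sb ca cb nc = c S a b Sa Sb (λ e → ca (trans (sym (same g a)) e)) (λ e → cb (trans (sym (same g b)) e)) (NonCrossing-resp (SG-sym g) nc)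

Even-half : (S : Side k) (A B : Wd k) {s : Bool} → Mono S s A → Mono S (not s) B → Even (A ++ B) → Even A
Even-half S A B {true} mA mB e = Even-split S A B mA mB e
Even-half S A B {false} mA mB e = Even-++⁻ʳ B A (Even-++-comm A B e) (Even-split S B A mB mA (Even-++-comm A B e))

four-runs : (S : Side k) (a b a' b' : Fin k) (A B A' B' : Wd k) → Mono S true (a ∷ A) → Mono S false (b ∷ B) → Mono S true (a' ∷ A') → Mono S false (b' ∷ B') →
  cut S ((a ∷ A) ++ (b ∷ B) ++ (a' ∷ A') ++ b' ∷ B') ≡ 4
four-runs S a b a' b' A B A' B' (Sa ∷ mA) (Sb ∷ mB) (Sa' ∷ mA') (Sb' ∷ mB') rewrite Sa
  | path-run S A ((b ∷ B) ++ (a' ∷ A') ++ b' ∷ B') true mA | Sb | path-run S B ((a' ∷ A') ++ b' ∷ B') true mB | Sa' | path-run S A' (b' ∷ B') true mA' | Sb'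
  | trans (cong (λ w → path S false w true) (sym (++-identityʳ B'))) (path-run S B' [] true mB') = refl

-- Four nonempty alternating runs would give four changes of side. With one of them empty, a side
-- fills a closed segment, and no chord leads out of it.
cut≤2⇒NonCrossing : (S : Side k) (W : Wd k) → Even W → cut S W ≤ 2 → NonCrossing S W
cut≤2⇒NonCrossing S W ev le with shares S W (≤-trans le (ℕ.m≤m+n 2 2))
... | A , B , A' , B' , iso , mA , mB , mA' , mB' = NonCrossing-resp (SG-sym (≅-SG iso ev)) (go A B A' B' mA mB mA' mB' (Same-Even W (A ++ B ++ A' ++ B') (≅-Same iso) ev) (subst (_≤ 2) (≅-cut iso S) le))
  where
  go : ∀ A B A' B' → Mono S true A → Mono S false B → Mono S true A' → Mono S false B' → Even (A ++ B ++ A' ++ B') → cut S (A ++ B ++ A' ++ B') ≤ 2 → NonCrossing S (A ++ B ++ A' ++ B')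
  go [] B A' B' mA mB mA' mB' ev le = share-nc S [] B A' B' mA mB mA' mB' ev (inj₁ λ _ → refl)
  go (a ∷ A) [] A' B' mA mB mA' mB' ev le = share-nc S (a ∷ A) [] A' B' mA mB mA' mB' ev (inj₂ λ _ → refl)
  go (a ∷ A) (b ∷ B) [] B' mA mB mA' mB' ev le = share-nc S (a ∷ A) (b ∷ B) [] B' mA mB mA' mB' ev (inj₁ (Even-split S (a ∷ A) ((b ∷ B) ++ B') mA (All.++⁺ mB mB') ev))
  go (a ∷ A) (b ∷ B) (a' ∷ A') [] mA mB mA' mB' ev le = share-nc S (a ∷ A) (b ∷ B) (a' ∷ A') [] mA mB mA' mB' ev (inj₂ (Even-half S (b ∷ B) ((a' ∷ A') ++ a ∷ A) mB (All.++⁺ mA' mA)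
    (subst Even (trans (cong (_++ a ∷ A) (cong (λ z → (b ∷ B) ++ z) (++-identityʳ (a' ∷ A')))) (++-assoc (b ∷ B) (a' ∷ A') (a ∷ A))) (Even-++-comm (a ∷ A) ((b ∷ B) ++ (a' ∷ A') ++ []) ev))))
  go (a ∷ A) (b ∷ B) (a' ∷ A') (b' ∷ B') mA mB mA' mB' ev le = case subst (_≤ 2) (four-runs S a b a' b' A B A' B' mA mB mA' mB') le of λ { (s≤s (s≤s ())) }

-- Cuts are even, and a cut of at most two edges would disconnect the intersection graph.
Connected-cut : (W : Wd k) → Even W → Connected W → ∀ S a b → S a ≡ true → S b ≡ false → count a W ≢ 0 → count b W ≢ 0 → 4 ≤ cut S W
Connected-cut W ev conn S a b Sa Sb ca cb with 4 ℕ.≤? cut S W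
... | yes le = le
... | no nle = ⊥-elim (conn S a b Sa Sb ca cb (cut≤2⇒NonCrossing S W ev (≤3⇒≤2 (cut S W) (cut-even S W) (ℕ.≰⇒> nle))))
  where
  ≤3⇒≤2 : ∀ n → odd n ≡ false → n < 4 → n ≤ 2
  ≤3⇒≤2 0 _ _ = z≤n
  ≤3⇒≤2 2 _ _ = ≤-refl
  ≤3⇒≤2 (suc (suc (suc (suc n)))) _ (s≤s (s≤s (s≤s (s≤s ()))))

closed-segment : (X T Z : Wd k) → DO (X ++ T ++ Z) → Even T → NonCrossing (inX T) (X ++ T ++ Z)
closed-segment X T Z d e = NonCrossing-resp (SG-sym (≅-SG iso (DO⇒Even (X ++ T ++ Z) d))) (share-nc (inX T) T (Z ++ X) [] [] (in-Mono (inX T) T (inX-true T))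
    (in-Mono (inX T) (Z ++ X) λ a n → inX-false T a (out a n)) [] [] (DO⇒Even (T ++ (Z ++ X) ++ [] ++ []) d') (inj₁ e))
  where
  iso : X ++ T ++ Z ≅ T ++ (Z ++ X) ++ [] ++ []
  iso = rot≡ X (T ++ Z) refl (trans (++-assoc T Z X) (cong (T ++_) (sym (++-identityʳ (Z ++ X)))))
  d' : DO (T ++ (Z ++ X) ++ [] ++ [])
  d' = DO-resp (X ++ T ++ Z) (T ++ (Z ++ X) ++ [] ++ []) (≅-Same iso) d
  out : ∀ a → count a (Z ++ X) ≢ 0 → count a T ≡ 0
  out a n with even-DO T ((Z ++ X) ++ [] ++ []) d' e a
  ... | inj₁ z = z
  ... | inj₂ z = ⊥-elim (n (trans (cong (count a) (sym (++-identityʳ (Z ++ X)))) z))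

chord-zeros : (b : Fin k) (P Q R : Wd k) → DO (P ++ b ∷ Q ++ b ∷ R) → count b P ≡ 0 × (count b Q ≡ 0 × count b R ≡ 0)
chord-zeros b P Q R d = proj₁ zs , +≡0 (proj₂ zs)
  where
  total : count b (P ++ b ∷ Q ++ b ∷ R) ≡ 2 + (count b P + (count b Q + count b R))
  total = trans (count-++ b P (b ∷ Q ++ b ∷ R)) (trans (cong (count b P +_) (trans (count-head b (Q ++ b ∷ R)) (cong suc (trans (count-++ b Q (b ∷ R)) (cong (count b Q +_) (count-head b R))))))
    (arith (count b P) (count b Q) (count b R)))
    where
    arith : ∀ p q r → p + suc (q + suc r) ≡ 2 + (p + (q + r))
    arith = ℕRing.solve-∀
  zs : count b P ≡ 0 × count b Q + count b R ≡ 0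
  zs with d b
  ... | inj₁ z = case trans (sym total) z of λ ()
  ... | inj₂ z = +≡0 (ℕ.suc-injective (ℕ.suc-injective (trans (sym total) z)))

chord-ord : (b : Fin k) (P Q R : Wd k) → DO (P ++ b ∷ Q ++ b ∷ R) → ∀ x → x ≢ b → ord b x (P ++ b ∷ Q ++ b ∷ R) ≡ par x Q
chord-ord b P Q R d x n = let zP , zQ , zR = chord-zeros b P Q R d in ord-2 b n P Q R zP zQ zR

-- The strands of a minimal share stay contiguous

data Runs (S : Side k) (U : Wd k) : Set where
  block : ∀ B M B' → U ≡ B ++ M ++ B' → Mono S false B → Mono S true M → Mono S false B' → Runs S U
  gap : ∀ U1 x T y U2 → U ≡ (U1 ++ [ x ]) ++ T ++ y ∷ U2 → S x ≡ true → S y ≡ true → T ≢ [] → Mono S false T → Runs S U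

runs : (S : Side k) (U : Wd k) → Runs S U
runs S U with run S false U
... | B , _ , refl , mB , inj₁ refl = block B [] [] refl mB [] []
... | B , _ , refl , mB , inj₂ (x , R , refl , Sx) = go R x [] refl Sx []
  where
  go : ∀ R' x₁ M → M ++ x₁ ∷ R' ≡ x ∷ R → S x₁ ≡ true → Mono S true M → Runs S (B ++ x ∷ R)
  go [] x₁ M e S1 mM = block B (M ++ [ x₁ ]) [] (cong (B ++_) (trans (sym e) (sym (++-identityʳ (M ++ [ x₁ ]))))) mB (All.++⁺ mM (S1 ∷ [])) []
  go (z ∷ R') x₁ M e S1 mM with S z in Sz
  ... | true = go R' z (M ++ [ x₁ ]) (trans (++-assoc M [ x₁ ] (z ∷ R')) e) Sz (All.++⁺ mM (S1 ∷ []))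
  ... | false with run S false R'
  ...   | T , _ , refl , mT , inj₁ refl = block B (M ++ [ x₁ ]) (z ∷ T) (cong (B ++_) (trans (sym e) (trans (cong (λ w → M ++ x₁ ∷ z ∷ w) (++-identityʳ T)) (sym (++-assoc M [ x₁ ] (z ∷ T)))))) mB (All.++⁺ mM (S1 ∷ [])) (Sz ∷ mT)
  ...   | T , _ , refl , mT , inj₂ (y , U2 , refl , Sy) = gap (B ++ M) x₁ (z ∷ T) y U2
    (trans (cong (B ++_) (sym e)) (ls 5 (λ b m x t u → b & m & x & t & u ⊜ ((b & m) & x) & t & u) refl B M [ x₁ ] (z ∷ T) (y ∷ U2))) S1 Sy (λ ()) (Sz ∷ mT)

last-in : {x c : Fin k} (U P : Wd k) {Q : Wd k} → U ++ [ x ] ≡ P ++ c ∷ Q → x ≢ c → count x Q ≢ 0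
last-in [] [] e n = ⊥-elim (n (proj₁ (∷-injective e)))
last-in [] (_ ∷ P) e n = ⊥-elim (cons-nil P (sym (proj₂ (∷-injective e))))
last-in {x = x} (_ ∷ U) [] e n z = last≢0 U (trans (cong (count x) (proj₂ (∷-injective e))) z)
  where
  last≢0 : ∀ U → count x (U ++ [ x ]) ≢ 0
  last≢0 U z = head≢0 x [] (proj₂ (zeros x U [ x ] z))
last-in (_ ∷ U) (_ ∷ P) e n = last-in U P (proj₂ (∷-injective e)) n

flt≢[] : (S : Side k) {x : Fin k} (w : Wd k) → S x ≡ true → count x w ≢ 0 → flt S w ≢ []
flt≢[] S {x} w Sx n e = n (trans (sym (count-flt-in S Sx w)) (cong (count x) e))

some : (w : Wd k) → w ≢ [] → ∃[ x ] (count x w ≢ 0)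
some [] n = ⊥-elim (n refl)
some (x ∷ w) n = x , head≢0 x w

-- A run of foreign letters strictly inside the block would be closed, because each of its letters returns to it.

tight : (S : Side k) (b : Fin k) (U V : Wd k) → S b ≡ true → count b U ≡ 0 → count b V ≡ 0 →
  DO (U ++ b ∷ V ++ [ b ]) → Connected (U ++ b ∷ V ++ [ b ]) →
  Prime (flt S U ++ b ∷ flt S V ++ [ b ]) → Big (flt S U ++ b ∷ flt S V ++ [ b ]) → DO (flt S U ++ b ∷ flt S V ++ [ b ]) →
  (∀ c → S c ≡ false → ∃[ β ] (∀ x → S x ≡ true → x ≢ b → ord c x (U ++ b ∷ V ++ [ b ]) ≡ β ∧ par x (flt S U))) →
  ∃[ B ] ∃[ B' ] (U ≡ B ++ flt S U ++ B' × Mono S false B × Mono S false B')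
tight {k} S b U V Sb bU bV dD conn PW big dW h with runs S U
... | block B M B' e mB mM mB' = B , B' , trans e (cong (λ z → B ++ z ++ B') (sym fM)) , mB , mB'
  where
  fM : flt S U ≡ M
  fM = trans (cong (flt S) e) (trans (flt-++ S B (M ++ B')) (trans (cong₂ _++_ (flt-none S B (Mono-in S B mB)) (trans (flt-++ S M B') (cong₂ _++_ (flt-all S M (Mono-in S M mM)) (flt-none S B' (Mono-in S B' mB'))))) (++-identityʳ M)))
... | gap U1 x T y U2 e Sx Sy T≢ mT = ⊥-elim (absurd (even? T))
  where
  X Y D : Wd k
  X = U1 ++ [ x ]
  Y = y ∷ U2
  D = U ++ b ∷ V ++ [ b ]
  bXTY : count b X ≡ 0 × (count b T ≡ 0 × count b Y ≡ 0)
  bXTY with zeros b X (T ++ Y) (trans (cong (count b) (sym e)) bU)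
  ... | p , q = p , zeros b T Y q
  eD : D ≡ X ++ T ++ Y ++ b ∷ V ++ [ b ]
  eD = trans (cong (_++ b ∷ V ++ [ b ]) e) (ls 4 (λ x t y r → (x & t & y) & r ⊜ x & t & y & r) refl X T Y (b ∷ V ++ [ b ]))
  fT : flt S T ≡ []
  fT = flt-none S T (Mono-in S T mT)
  fU : flt S U ≡ flt S X ++ flt S Y
  fU = trans (cong (flt S) e) (trans (flt-++ S X (T ++ Y)) (cong (flt S X ++_) (trans (flt-++ S T Y) (cong (_++ flt S Y) fT))))
  fX≢ : flt S X ≢ []
  fX≢ = flt≢[] S X Sx λ z → head≢0 x [] (proj₂ (zeros x U1 [ x ] z))
  fY≢ : flt S Y ≢ []
  fY≢ = flt≢[] S Y Sy (head≢0 y U2)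
  absurd : Even T ⊎ ∃[ c ] (par c T ≡ true) → ⊥
  absurd (inj₁ ev) = conn (inX T) t b (inX-true T t t∈) (inX-false T b (proj₁ (proj₂ bXTY))) (λ z → t∈ (proj₁ (zeros t T (Y ++ b ∷ V ++ [ b ]) (proj₂ (zeros t X (T ++ Y ++ b ∷ V ++ [ b ]) (trans (cong (count t) (sym eD)) z))))))
      (λ z → head≢0 b (V ++ [ b ]) (proj₂ (zeros b U (b ∷ V ++ [ b ]) z)))
      (subst (NonCrossing (inX T)) (sym eD) (closed-segment X T (Y ++ b ∷ V ++ [ b ]) (subst DO eD dD) ev))
    where
    t = proj₁ (some T T≢)
    t∈ = proj₂ (some T T≢)
  absurd (inj₂ (c , pc)) = places (locate c T (par⇒count c T pc)) (h c Sc)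
    where
    Sc : S c ≡ false
    Sc = Mono-in S T mT c (par⇒count c T pc)
    on : ∀ {z} → S z ≡ true → z ≢ c
    on Sz refl = true≢false (trans (sym Sz) Sc)
    places : ∃[ T1 ] ∃[ T2 ] (T ≡ T1 ++ c ∷ T2 × count c T1 ≡ 0 × count c T ≡ suc (count c T2)) → ∃[ β ] (∀ x → S x ≡ true → x ≢ b → ord c x D ≡ β ∧ par x (flt S U)) → ⊥
    places (T1 , T2 , eT , _) (β , hβ) = go (nonzero-or c X) (nonzero-or c Y) (nonzero-or c V)
      where
      mTT : Mono S false T1 × Mono S false (c ∷ T2)
      mTT = All.++⁻ T1 (subst (Mono S false) eT mT)
      quiet : ∀ {z} w → Mono S false w → S z ≡ true → par z w ≡ false
      quiet {z} w m Sz = trans (par-count z w) (cong odd (Mono-out S w m z λ q → true≢false (trans (sym Sz) q)))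
      quiet1 : ∀ {z} → S z ≡ true → par z T1 ≡ false
      quiet1 = quiet T1 (proj₁ mTT)
      quiet2 : ∀ {z} → S z ≡ true → par z T2 ≡ false
      quiet2 Sz with proj₂ mTT
      ... | _ ∷ m = quiet T2 m Sz
      arc : ∀ P Q R → D ≡ P ++ c ∷ Q ++ c ∷ R → ∀ z → S z ≡ true → z ≢ b → par z Q ≡ β ∧ par z (flt S U)
      arc P Q R q z Sz n = trans (sym (chord-ord c P Q R (subst DO q dD) z (on Sz))) (trans (cong (ord c z) (sym q)) (hβ z Sz n))
      kept : ∀ Q F → F ≡ flt S U → (∀ z → S z ≡ true → z ≢ b → par z Q ≡ β ∧ par z (flt S U)) → ∀ z → z ≢ b → par z (flt S Q) ≡ β ∧ par z F
      kept Q F refl a z n with bool-cases (S z)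
      ... | inj₁ Sz = trans (par-flt S Sz Q) (a z Sz n)
      ... | inj₂ Sz = trans (par-flt-out S Sz Q) (trans (taut 1 (λ _ → false) (λ β → β ∧ false) tt β) (cong (β ∧_) (sym (par-flt-out S Sz U))))
      W≡ : ∀ F → F ≡ flt S U → flt S U ++ b ∷ flt S V ++ [ b ] ≡ F ++ b ∷ flt S V ++ [ b ]
      W≡ F q = cong (_++ b ∷ flt S V ++ [ b ]) (sym q)
      bF : ∀ F → F ≡ flt S U → count b F ≡ 0
      bF F q = trans (cong (count b) q) (trans (count-flt-in S Sb U) bU)
      flt-c : ∀ Q → flt S (c ∷ Q) ≡ flt S Q
      flt-c Q = cong (λ s → if s then c ∷ flt S Q else flt S Q) Sc
      -- The other end of `c` is looked for in `X`, `Y` and `V`. In each of these cases the arc of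
      -- `c`, restricted to `S`, is a place that `Gap` excludes because letters of `S` lie on both
      -- sides of `T`; and if the end is nowhere, `c` has odd parity in the whole word.
      go : (count c X ≡ 0) ⊎ (count c X ≢ 0) → (count c Y ≡ 0) ⊎ (count c Y ≢ 0) → (count c V ≡ 0) ⊎ (count c V ≢ 0) → ⊥
      go (inj₂ n) _ _ with locate c X n
      ... | P , Q , eX , _ with Gap.same-side PW big dW (flt S P) (flt S Q) (flt S Y) (flt S V) β (W≡ _ F≡) (bF _ F≡) (kept Q _ F≡ a)
        where
        F≡ : flt S P ++ flt S Q ++ flt S Y ≡ flt S U
        F≡ = trans (sym (++-assoc (flt S P) (flt S Q) (flt S Y))) (trans (cong (_++ flt S Y) (trans (cong (flt S P ++_) (sym (flt-c Q))) (trans (sym (flt-++ S P (c ∷ Q))) (cong (flt S) (sym eX))))) (sym fU))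
        a : ∀ z → S z ≡ true → z ≢ b → par z Q ≡ β ∧ par z (flt S U)
        a z Sz n = trans (trans (taut 1 (λ q → q) (λ q → q xor false) tt (par z Q)) (trans (cong (par z Q xor_) (sym (quiet1 Sz))) (sym (par-++ z Q T1))))
          (arc P (Q ++ T1) (T2 ++ Y ++ b ∷ V ++ [ b ]) (trans eD (trans (cong₂ (λ u v → u ++ v ++ Y ++ b ∷ V ++ [ b ]) eX eT)
            (ls 6 (λ p c q t t' r → (p & c & q) & (t & c & t') & r ⊜ p & c & (q & t) & c & t' & r) refl P [ c ] Q T1 T2 (Y ++ b ∷ V ++ [ b ])))) z Sz n)
      ...   | inj₁ q = flt≢[] S Q Sx (last-in U1 P eX (on Sx)) q
      ...   | inj₂ (_ , q) = fY≢ q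
      go (inj₁ _) (inj₂ n) _ with locate c Y n
      ... | Q , R , eY , _ with Gap.same-side PW big dW (flt S X) (flt S Q) (flt S R) (flt S V) β (W≡ _ F≡) (bF _ F≡) (kept Q _ F≡ a)
        where
        F≡ : flt S X ++ flt S Q ++ flt S R ≡ flt S U
        F≡ = trans (cong (flt S X ++_) (trans (cong (flt S Q ++_) (sym (flt-c R))) (trans (sym (flt-++ S Q (c ∷ R))) (cong (flt S) (sym eY))))) (sym fU)
        a : ∀ z → S z ≡ true → z ≢ b → par z Q ≡ β ∧ par z (flt S U)
        a z Sz n = trans (trans (cong (_xor par z Q) (sym (quiet2 Sz))) (sym (par-++ z T2 Q)))
          (arc (X ++ T1) (T2 ++ Q) (R ++ b ∷ V ++ [ b ]) (trans eD (trans (cong₂ (λ u v → X ++ u ++ v ++ b ∷ V ++ [ b ]) eT eY)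
            (ls 7 (λ x t c t' q r v → x & (t & c & t') & (q & c & r) & v ⊜ (x & t) & c & (t' & q) & c & r & v) refl X T1 [ c ] T2 Q R (b ∷ V ++ [ b ])))) z Sz n)
      ...   | inj₁ q = flt≢[] S Q Sy (head-in Q (sym eY) (on Sy)) q
      ...   | inj₂ (q , _) = fX≢ q
      go (inj₁ _) (inj₁ _) (inj₂ n) with locate c V n
      ... | P2 , Q2 , eV , _ with Gap.two-sides PW big dW (flt S X) (flt S Y) (flt S P2) (flt S Q2) β (trans (W≡ _ (sym fU)) (cong (λ v → (flt S X ++ flt S Y) ++ b ∷ v ++ [ b ]) fV)) (bF _ (sym fU))
          (trans (cong (count b) (sym fV)) (trans (count-flt-in S Sb V) bV)) (λ z n → trans (cong (par z) (sym (flt-++ S Y P2))) (kept (Y ++ P2) (flt S X ++ flt S Y) (sym fU) a z n))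
        where
        fV : flt S V ≡ flt S P2 ++ flt S Q2
        fV = trans (cong (flt S) eV) (trans (flt-++ S P2 (c ∷ Q2)) (cong (flt S P2 ++_) (flt-c Q2)))
        a : ∀ z → S z ≡ true → z ≢ b → par z (Y ++ P2) ≡ β ∧ par z (flt S U)
        a z Sz n = trans (sym (trans (par-++ z T2 (Y ++ b ∷ P2)) (trans (cong₂ _xor_ (quiet2 Sz) (trans (par-++ z Y (b ∷ P2)) (cong (par z Y xor_) (par-other n P2)))) (sym (par-++ z Y P2)))))
          (arc (X ++ T1) (T2 ++ Y ++ b ∷ P2) (Q2 ++ [ b ]) (trans eD (trans (cong₂ (λ u v → X ++ u ++ Y ++ b ∷ v ++ [ b ]) eT eV)
            (ls 8 (λ x t c t' y b p q → x & (t & c & t') & y & b & (p & c & q) & b ⊜ (x & t) & c & (t' & y & b & p) & c & q & b) refl X T1 [ c ] T2 Y [ b ] P2 Q2))) z Sz n)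
      ...   | inj₁ q = fX≢ q
      ...   | inj₂ q = fY≢ q
      go (inj₁ zX) (inj₁ zY) (inj₁ zV) = true≢false (trans (sym pc) (trans (sym total) (DO⇒Even D dD c)))
        where
        zero-par : ∀ w → count c w ≡ 0 → par c w ≡ false
        zero-par w z = trans (par-count c w) (cong odd z)
        c≢b : c ≢ b
        c≢b = on Sb ∘ sym
        total : par c D ≡ par c T
        total = trans (cong (par c) eD) (trans (par-++ c X _) (trans (cong₂ _xor_ (zero-par X zX) (trans (par-++ c T _) (cong (par c T xor_)
          (trans (par-++ c Y _) (cong₂ _xor_ (zero-par Y zY) (trans (par-other c≢b (V ++ [ b ])) (trans (par-++ c V [ b ]) (cong₂ _xor_ (zero-par V zV) (par-other c≢b []))))))))) (taut 1 (λ t → t xor false) (λ t → t) tt (par c T))))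

-- Contraction of a minimal share

flt-one : (S : Side k) (b : Fin k) (w : Wd k) → S b ≡ true → count b w ≡ 1 → (∀ x → count x w ≢ 0 → x ≢ b → S x ≡ false) → flt S w ≡ [ b ]
flt-one S b w Sb c h with locate b w (λ z → case trans (sym z) c of λ ())
... | P , Q , refl , p , q = trans (flt-++ S P (b ∷ Q)) (cong₂ _++_ (flt-none S P λ x n → h x (λ z → n (proj₁ (zeros x P (b ∷ Q) z))) λ { refl → n p })
    (trans (cong (λ s → if s then b ∷ flt S Q else flt S Q) Sb) (cong (b ∷_) (flt-none S Q λ x n → h x (λ z → cons≢0 x b Q n (proj₂ (zeros x P (b ∷ Q) z))) λ { refl → n q0 }))))
  where
  q0 : count b Q ≡ 0
  q0 = ℕ.suc-injective (trans (sym q) c)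

flt-flt : (S S' : Side k) (w : Wd k) → flt (λ x → S' x ∧ S x) w ≡ flt S' (flt S w)
flt-flt S S' [] = refl
flt-flt S S' (x ∷ w) with S x | S' x in e
... | true | true rewrite e = cong (x ∷_) (flt-flt S S' w)
... | true | false rewrite e = flt-flt S S' w
... | false | true = flt-flt S S' w
... | false | false = flt-flt S S' w

path-ext-on : {S S' : Side k} (b : Bool) (w : Wd k) (c : Bool) → (∀ x → count x w ≢ 0 → S x ≡ S' x) → path S b w c ≡ path S' b w c
path-ext-on b [] c h = refl
path-ext-on {S = S} {S'} b (x ∷ w) c h = trans (cong (λ t → jump b t + path S t w c) (h x (head≢0 x w))) (cong (jump b (S' x) +_) (path-ext-on (S' x) w c λ y n → h y (cons≢0 y x w n)))

cut-ext-on : {S S' : Side k} (w : Wd k) → (∀ x → count x w ≢ 0 → S x ≡ S' x) → cut S w ≡ cut S' w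
cut-ext-on [] h = refl
cut-ext-on {S = S} {S'} (x ∷ w) h = trans (cong (λ t → path S t w t) (h x (head≢0 x w))) (path-ext-on (S' x) w (S' x) λ y n → h y (cons≢0 y x w n))

path-collapse : (S : Side k) (s : Bool) (u B : Wd k) {b : Fin k} (v : Wd k) (c : Bool) → B ≢ [] → Mono S false B → S b ≡ false →
  path S s (u ++ B ++ v) c ≡ path S s (u ++ b ∷ v) c
path-collapse S s [] [] v c n _ _ = ⊥-elim (n refl)
path-collapse S s [] (y ∷ B) v c n (Sy ∷ m) Sb rewrite Sy | Sb | path-run S B v c m = refl
path-collapse S s (x ∷ u) B v c n m Sb = cong (jump s (S x) +_) (path-collapse S (S x) u B v c n m Sb)

-- A nonempty run on one side contributes as much to a cut as a single letter of that side, so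
-- shrinking the two foreign runs to the ends of a chord `b` changes no cut that keeps them on the
-- side of `b`.
cut-collapse : (S : Side k) (A B A' B' : Wd k) {b : Fin k} → A ≢ [] → B ≢ [] → B' ≢ [] → Mono S false B → Mono S false B' → S b ≡ false →
  cut S (A ++ B ++ A' ++ B') ≡ cut S (A ++ b ∷ A' ++ [ b ])
cut-collapse S [] B A' B' n _ _ _ _ _ = ⊥-elim (n refl)
cut-collapse S (x ∷ A) B A' B' {b} _ n n' m m' Sb = trans (path-collapse S (S x) A B (A' ++ B') (S x) n m Sb)
  (trans (cong (λ w → path S (S x) w (S x)) (ls 4 (λ a b c d → a & b & c & d ⊜ (a & b & c) & d & nil) refl A [ b ] A' B'))
  (trans (path-collapse S (S x) (A ++ b ∷ A') B' [] (S x) n' m' Sb) (cong (λ w → path S (S x) w (S x)) (++-assoc A (b ∷ A') [ b ]))))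

first-occurrence : (b : Fin k) (P P' : Wd k) {Q Q' : Wd k} → P ++ b ∷ Q ≡ P' ++ b ∷ Q' → count b P ≡ 0 → count b P' ≡ 0 → P ≡ P' × Q ≡ Q'
first-occurrence b [] [] e _ _ = refl , proj₂ (∷-injective e)
first-occurrence b [] (y ∷ P') e _ z with ∷-injective e
... | refl , _ = ⊥-elim (head≢0 b P' z)
first-occurrence b (y ∷ P) [] e z _ with ∷-injective e
... | refl , _ = ⊥-elim (head≢0 b P z)
first-occurrence b (y ∷ P) (y' ∷ P') e z z' with ∷-injective e
... | refl , e' with first-occurrence b P P' e' (tail0 b y P z) (tail0 b y P' z')
...   | p , q = cong (y ∷_) p , q

ends : ∀ {m n} → odd m ≡ true → (m + n ≡ 0) ⊎ (m + n ≡ 2) → m ≡ 1 × n ≡ 1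
ends {suc zero} _ (inj₂ e) = refl , ℕ.suc-injective e
ends {suc (suc zero)} () _
ends {suc (suc (suc m))} _ (inj₂ ())

Same-flt : (S : Side k) {u v : Wd k} → Same u v → Same (flt S u) (flt S v)
Same-flt S {u} {v} h a with bool-cases (S a)
... | inj₁ Sa = trans (count-flt-in S Sa u) (trans (h a) (sym (count-flt-in S Sa v)))
... | inj₂ Sa = trans (count-flt-out S Sa u) (sym (count-flt-out S Sa v))

Two-not : {S : Side k} {s : Bool} {W : Wd k} → Two S s W → Two (not ∘ S) (not s) W
Two-not (two x y n Sx Sy cx cy) = two x y n (cong not Sx) (cong not Sy) cx cy

Mutable-below : ℕ → Set
Mutable-below n = ∀ {k} (D1 D2 : Wd k) → length D1 < n → DO D1 → SG D1 D2 → D1 ∼ D2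

-- Induction step for a diagram with a share A, A' that is minimal among the nontrivial ones: closing this share
-- by one chord b gives a prime diagram, so that the share sits in D2 as in D1 and can be contracted to a chord.

module Minimal-share (S : Side k) (A B A' B' : Wd k) (mA : Mono S true A) (mB : Mono S false B) (mA' : Mono S true A') (mB' : Mono S false B')
  (dE : DO (A ++ B ++ A' ++ B')) (conn : Connected (A ++ B ++ A' ++ B')) (nodel : ∀ u v t → ¬ Del u v t (A ++ B ++ A' ++ B'))
  (tT : Two S true (A ++ B ++ A' ++ B')) (tF : Two S false (A ++ B ++ A' ++ B'))
  (minimal : ∀ S' → length (flt S' (A ++ B ++ A' ++ B')) < length (flt S (A ++ B ++ A' ++ B')) → ¬ Split (A ++ B ++ A' ++ B') S')
  (D2 : Wd k) (g : SG (A ++ B ++ A' ++ B') D2) (ih : Mutable-below (length (A ++ B ++ A' ++ B'))) where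

  E : Wd k
  E = A ++ B ++ A' ++ B'
  ev : Even E
  ev = DO⇒Even E dE
  count4 : ∀ z → count z E ≡ count z A + (count z B + (count z A' + count z B'))
  count4 z = trans (count-++ z A (B ++ A' ++ B')) (cong (count z A +_) (trans (count-++ z B (A' ++ B')) (cong (count z B +_) (count-++ z A' B'))))
  off : ∀ {s} z w → Mono S s w → S z ≡ not s → count z w ≡ 0
  off z w m e = Mono-out S w m z λ q → not≢ (trans (sym e) q)
  crossA : ∃[ a ] (par a A ≡ true)
  crossA with even? A
  ... | inj₂ p = p
  ... | inj₁ e = ⊥-elim (conn S (Two.x tT) (Two.x tF) (Two.Sx tT) (Two.Sx tF) (Two.cx tT) (Two.cx tF) (share-nc S A B A' B' mA mB mA' mB' ev (inj₁ e)))
  crossB : ∃[ b ] (par b B ≡ true)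
  crossB with even? B
  ... | inj₂ p = p
  ... | inj₁ e = ⊥-elim (conn S (Two.x tT) (Two.x tF) (Two.Sx tT) (Two.Sx tF) (Two.cx tT) (Two.cx tF) (share-nc S A B A' B' mA mB mA' mB' ev (inj₂ e)))
  a b : Fin k
  a = proj₁ crossA
  b = proj₁ crossB
  Sa : S a ≡ true
  Sa = Mono-in S A mA a (par⇒count a A (proj₂ crossA))
  Sb : S b ≡ false
  Sb = Mono-in S B mB b (par⇒count b B (proj₂ crossB))
  endsA : count a A ≡ 1 × count a A' ≡ 1
  endsA = ends (trans (sym (par-count a A)) (proj₂ crossA)) (subst (λ n → (n ≡ 0) ⊎ (n ≡ 2)) eq (dE a))
    where
    eq : count a E ≡ count a A + count a A'
    eq = trans (count4 a) (trans (cong₂ (λ m n → count a A + (m + (count a A' + n))) (off a B mB Sa) (off a B' mB' Sa)) (cong (count a A +_) (ℕ.+-identityʳ _)))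
  endsB : count b B ≡ 1 × count b B' ≡ 1
  endsB = ends (trans (sym (par-count b B)) (proj₂ crossB)) (subst (λ n → (n ≡ 0) ⊎ (n ≡ 2)) eq (dE b))
    where
    eq : count b E ≡ count b B + count b B'
    eq = trans (count4 b) (cong₂ (λ m n → m + (count b B + (n + count b B'))) (off b A mA Sb) (off b A' mA' Sb))
  nonempty : ∀ {x : Fin k} (w : Wd k) → count x w ≡ 1 → w ≢ []
  nonempty .[] () refl
  A≢ : A ≢ []
  A≢ = nonempty A (proj₁ endsA)
  B≢ : B ≢ []
  B≢ = nonempty B (proj₁ endsB)
  B'≢ : B' ≢ []
  B'≢ = nonempty B' (proj₂ endsB)
  ca : count a E ≢ 0
  ca z = case trans (sym (proj₁ endsA)) (proj₁ (+≡0 (trans (sym (count4 a)) z))) of λ ()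
  cb : count b E ≢ 0
  cb z = case trans (sym (proj₁ endsB)) (proj₁ (+≡0 (proj₂ (+≡0 {count b A} (trans (sym (count4 b)) z))))) of λ ()

  -- Besides the chords of the share a single foreign chord `b` connecting `B` and `B'` is kept; it
  -- closes the share up to the word `W`.
  S0 : Side k
  S0 z = S z ∨ eqb b z
  S0b : S0 b ≡ true
  S0b = trans (cong (S b ∨_) (eqb-refl b)) (taut 1 (λ s → s ∨ true) (λ _ → true) tt (S b))
  S0-S : ∀ z → S0 z ≡ true → z ≢ b → S z ≡ true
  S0-S z e n = trans (taut 1 (λ s → s) (λ s → s ∨ false) tt (S z)) (trans (cong (S z ∨_) (sym (eqb-≢ (n ∘ sym)))) e)
  S-S0 : ∀ z → S z ≡ true → S0 z ≡ true
  S-S0 z e = cong (_∨ eqb b z) e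
  S0-out : ∀ z → S z ≡ false → z ≢ b → S0 z ≡ false
  S0-out z e n = cong₂ _∨_ e (eqb-≢ (n ∘ sym))
  S0-S' : ∀ z → S0 z ≡ false → S z ≡ false
  S0-S' z e with S z
  ... | false = refl
  W : Wd k
  W = A ++ b ∷ A' ++ [ b ]
  fltE : flt S0 E ≡ W
  fltE = trans (flt-++ S0 A (B ++ A' ++ B')) (cong₂ _++_ (fA A mA) (trans (flt-++ S0 B (A' ++ B')) (cong₂ _++_ (fB B mB (proj₁ endsB)) (trans (flt-++ S0 A' B') (cong₂ _++_ (fA A' mA') (fB B' mB' (proj₂ endsB)))))))
    where
    fA : ∀ w → Mono S true w → flt S0 w ≡ w
    fA w m = flt-all S0 w λ z n → S-S0 z (Mono-in S w m z n)
    fB : ∀ w → Mono S false w → count b w ≡ 1 → flt S0 w ≡ [ b ]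
    fB w m c = flt-one S0 b w S0b c λ z n zb → S0-out z (Mono-in S w m z n) zb
  inW : ∀ z → count z W ≢ 0 → S0 z ≡ true × count z E ≢ 0
  inW z n with bool-cases (S0 z)
  ... | inj₁ e = e , λ c → n (trans (cong (count z) (sym fltE)) (trans (count-flt-in S0 e E) c))
  ... | inj₂ e = ⊥-elim (n (trans (cong (count z) (sym fltE)) (count-flt-out S0 e E)))
  toW : ∀ z → S0 z ≡ true → count z E ≢ 0 → count z W ≢ 0
  toW z e n c = n (trans (sym (count-flt-in S0 e E)) (trans (cong (count z) fltE) c))
  dW : DO W
  dW = subst DO fltE (DO-flt S0 E dE)
  cutW : ∀ S' → (∀ z → S z ≡ false → S' z ≡ false) → cut S' E ≡ cut S' W
  cutW S' h = cut-collapse S' A B A' B' A≢ B≢ B'≢ (in-Mono S' B λ z n → h z (Mono-in S B mB z n)) (in-Mono S' B' λ z n → h z (Mono-in S B' mB' z n)) (h b Sb)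
  -- A small nontrivial cut of `W` with `b` outside is also one of the whole word, and it encloses a
  -- share strictly inside the chosen one, against minimality.
  cuts0 : ∀ S' → S' b ≡ false → Two S' true W → Two S' false W → 6 ≤ cut S' W
  cuts0 S' S'b t f with 6 ℕ.≤? cut S' W
  ... | yes le = le
  ... | no nle = ⊥-elim (minimal S″ shorter (t″ , f″ , subst (_≤ 4) (trans (cut-ext-on W agree) (sym (cutW S″ λ z Sz → trans (cong (S' z ∧_) Sz) (taut 1 (λ s → s ∧ false) (λ _ → false) tt (S' z))))) (≤5⇒≤4 (cut S' W) (cut-even S' W) (ℕ.≰⇒> nle))))
    where
    S″ : Side k
    S″ z = S' z ∧ S z
    agree : ∀ z → count z W ≢ 0 → S' z ≡ S″ z
    agree z n with z ≟ᶠ b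
    ... | yes refl = trans S'b (sym (cong (_∧ S b) S'b))
    ... | no zb = trans (taut 1 (λ s → s) (λ s → s ∧ true) tt (S' z)) (cong (S' z ∧_) (sym (S0-S z (proj₁ (inW z n)) zb)))
    t″ : Two S″ true E
    t″ = case t of λ { (two x y n Sx Sy cx cy) → two x y n (trans (sym (agree x cx)) Sx) (trans (sym (agree y cy)) Sy) (proj₂ (inW x cx)) (proj₂ (inW y cy)) }
    f″ : Two S″ false E
    f″ = case tF of λ { (two x y n Sx Sy cx cy) → two x y n (out x Sx) (out y Sy) cx cy }
      where
      out : ∀ z → S z ≡ false → S″ z ≡ false
      out z Sz = trans (cong (S' z ∧_) Sz) (taut 1 (λ s → s ∧ false) (λ _ → false) tt (S' z))
    lost : ∃[ z ] (S' z ≡ false × S z ≡ true × count z E ≢ 0)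
    lost = case f of λ { (two x y n Sx Sy cx cy) → case x ≟ᶠ b of λ where
      (no xb) → x , Sx , S0-S x (proj₁ (inW x cx)) xb , proj₂ (inW x cx)
      (yes xb) → y , Sy , S0-S y (proj₁ (inW y cy)) (λ yb → n (trans xb (sym yb))) , proj₂ (inW y cy) }
    shorter : length (flt S″ E) < length (flt S E)
    shorter = case lost of λ { (z , S'z , Sz , cz) → subst (λ w → length w < length (flt S E)) (sym (flt-flt S S' E))
      (length-flt-< S' S'z (flt S E) λ c → cz (trans (sym (count-flt-in S Sz E)) c)) }
  PW : Prime W
  PW = record { single = single ; cuts = cuts }
    where
    single : ∀ x → count x W ≢ 0 → 4 ≤ cut (eqb x) W
    single x n with x ≟ᶠ b
    ... | yes refl = subst (4 ≤_) (trans (cutW S λ _ q → q) (trans (sym (cut-not S W)) (cut-ext-on W λ z m → sym (agree z m)))) (Connected-cut E ev conn S a b Sa Sb ca cb)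
      where
      agree : ∀ z → count z W ≢ 0 → eqb b z ≡ not (S z)
      agree z m with z ≟ᶠ b
      ... | yes refl = trans (eqb-refl z) (cong not (sym Sb))
      ... | no zb = trans (eqb-≢ (zb ∘ sym)) (cong not (sym (S0-S z (proj₁ (inW z m)) zb)))
    ... | no xb = subst (4 ≤_) (cutW (eqb x) λ z Sz → eqb-≢ {a = x} {z} λ { refl → true≢false (trans (sym Sx) Sz) }) (Connected-cut E ev conn (eqb x) x b (eqb-refl x) (eqb-≢ xb) (proj₂ (inW x n)) cb)
      where
      Sx : S x ≡ true
      Sx = S0-S x (proj₁ (inW x n)) xb
    cuts : ∀ S' → Two S' true W → Two S' false W → 6 ≤ cut S' W
    cuts S' t f with bool-cases (S' b)
    ... | inj₂ e = cuts0 S' e t f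
    ... | inj₁ e = subst (6 ≤_) (cut-not S' W) (cuts0 (not ∘ S') (cong not e) (Two-not f) (Two-not t))

  -- With only two chords in the share, the rank-one pattern of `share-ord` shows that outside of it
  -- `v` crosses either nothing or exactly what `u` crosses. By `nodel` this cannot happen, so the
  -- share has a third chord and `W` is large enough for the uniqueness of prime words.
  pair-del : ∀ u v → u ≢ v → S u ≡ true → S v ≡ true → count u E ≢ 0 → count v E ≢ 0 → (∀ z → z ≢ u → z ≢ v → S z ≡ true → count z E ≡ 0) →
    (par u A ≡ true) ⊎ (par v A ≡ false) → Del u v (par v A) E
  pair-del u v n Su Sv cu cv rest h = record { u≢v = n ; cu = full u cu ; cv = full v cv ; twin = twin }
    where
    full : ∀ z → count z E ≢ 0 → count z E ≡ 2
    full z m with dE z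
    ... | inj₁ q = ⊥-elim (m q)
    ... | inj₂ q = q
    simp : ∀ p q r → (p ≡ true) ⊎ (q ≡ false) → q ∧ r ≡ q ∧ (p ∧ r)
    simp p q r (inj₁ refl) = refl
    simp p q r (inj₂ refl) = refl
    twin : ∀ z → z ≢ u → z ≢ v → ord v z E ≡ par v A ∧ ord u z E
    twin z zu zv with bool-cases (S z)
    ... | inj₁ Sz = trans (ord-0ʳ {a = v} E (rest z zu zv Sz)) (trans (taut 1 (λ _ → false) (λ p → p ∧ false) tt (par v A)) (cong (par v A ∧_) (sym (ord-0ʳ {a = u} E (rest z zu zv Sz)))))
    ... | inj₂ Sz = trans (share-ord S A B A' B' mA mB mA' mB' ev v z Sv Sz) (trans (simp (par u A) (par v A) (par z B) h) (cong (par v A ∧_) (sym (share-ord S A B A' B' mA mB mA' mB' ev u z Su Sz))))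

  third : ∃[ z ] (z ≢ Two.x tT × z ≢ Two.y tT × S z ≡ true × count z E ≢ 0)
  third with any? (λ z → ¬? (z ≟ᶠ Two.x tT) ×-dec (¬? (z ≟ᶠ Two.y tT) ×-dec ((S z ≟ᵇ true) ×-dec ¬? (count z E ℕ.≟ 0))))
  ... | yes p = p
  ... | no n = ⊥-elim (go tT λ z zx zy Sz → case nonzero-or z E of λ { (inj₁ q) → q ; (inj₂ q) → ⊥-elim (n (z , zx , zy , Sz , q)) })
    where
    go : (t : Two S true E) → (∀ z → z ≢ Two.x t → z ≢ Two.y t → S z ≡ true → count z E ≡ 0) → ⊥
    go (two x y n Sx Sy cx cy) rest with bool-cases (par x A)
    ... | inj₁ p = nodel x y _ (pair-del x y n Sx Sy cx cy rest (inj₁ p))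
    ... | inj₂ p = nodel y x _ (pair-del y x (n ∘ sym) Sy Sx cy cx (λ z zy zx → rest z zx zy) (inj₂ p))
  bW : Big W
  bW = pick-two (b≢ (Two.Sx tT)) (b≢ (Two.Sy tT)) (b≢ Sz) (Two.x≢y tT) (zx ∘ sym) (zy ∘ sym) (λ z → count z W ≢ 0) (toW b S0b cb) (toW (Two.x tT) (S-S0 (Two.x tT) (Two.Sx tT)) (Two.cx tT)) (toW (Two.y tT) (S-S0 (Two.y tT) (Two.Sy tT)) (Two.cy tT)) (toW (proj₁ third) (S-S0 (proj₁ third) Sz) cz)
    where
    zx = proj₁ (proj₂ third)
    zy = proj₁ (proj₂ (proj₂ third))
    Sz = proj₁ (proj₂ (proj₂ (proj₂ third)))
    cz = proj₂ (proj₂ (proj₂ (proj₂ third)))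
    b≢ : ∀ {z} → S z ≡ true → b ≢ z
    b≢ q refl = true≢false (trans (sym q) Sb)

  iso : W ≅ flt S0 D2
  iso = unique five (suc (length W)) W (flt S0 D2) ≤-refl dW PW bW (subst (λ w → SG w (flt S0 D2)) fltE (SG-flt S0 g))

  Even-pair : Even (A ++ A')
  Even-pair = Even-split S (A ++ A') (B ++ B') (All.++⁺ mA mA') (All.++⁺ mB mB') (Same-Even E ((A ++ A') ++ B ++ B') (Same4 A B A' B') ev)

  -- Both words contain the share with the same strands `A` and `A'`. Contracted to its chord `a`,
  -- they are shorter and still have equal graphs, so they are mutants by induction; substituting
  -- the strands for the ends of `a` restores the original words.
  aligned : ∀ C C' → Mono S false C → Mono S false C' → SG E (A ++ C ++ A' ++ C') → E ∼ A ++ C ++ A' ++ C'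
  aligned C C' mC mC' g6 = subst₂ _∼_ (sub-2 a A A' [] B B' refl (off a B mB Sa) (off a B' mB' Sa)) (sub-2 a A A' [] C C' refl (off a C mC Sa) (off a C' mC' Sa))
      (sub-∼ a A A' Even-pair contracted (DO⇒Even (a ∷ B ++ a ∷ B') d1) (d1 a))
    where
    S1 : Side k
    S1 z = not (S z) ∨ eqb a z
    S1a : S1 a ≡ true
    S1a = trans (cong (not (S a) ∨_) (eqb-refl a)) (taut 1 (λ s → s ∨ true) (λ _ → true) tt (not (S a)))
    out : ∀ z → S z ≡ true → z ≢ a → S1 z ≡ false
    out z Sz n = cong₂ _∨_ (cong not Sz) (eqb-≢ (n ∘ sym))
    f1 : ∀ C C' → Mono S false C → Mono S false C' → flt S1 (A ++ C ++ A' ++ C') ≡ a ∷ C ++ a ∷ C'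
    f1 C C' mC mC' = trans (flt-++ S1 A (C ++ A' ++ C')) (cong₂ _++_ (fA A mA (proj₁ endsA)) (trans (flt-++ S1 C (A' ++ C')) (cong₂ _++_ (fC C mC) (trans (flt-++ S1 A' C') (cong₂ _++_ (fA A' mA' (proj₂ endsA)) (fC C' mC'))))))
      where
      fC : ∀ w → Mono S false w → flt S1 w ≡ w
      fC w m = flt-all S1 w λ z n → cong (_∨ eqb a z) (cong not (Mono-in S w m z n))
      fA : ∀ w → Mono S true w → count a w ≡ 1 → flt S1 w ≡ [ a ]
      fA w m c = flt-one S1 a w S1a c λ z n za → out z (Mono-in S w m z n) za
    d1 : DO (a ∷ B ++ a ∷ B')
    d1 = subst DO (f1 B B' mB mB') (DO-flt S1 E dE)
    other : ∃[ z ] (z ≢ a × S z ≡ true × count z E ≢ 0)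
    other = case tT of λ { (two x y n Sx Sy cx cy) → case x ≟ᶠ a of λ where
      (no xa) → x , xa , Sx , cx
      (yes xa) → y , (λ ya → n (trans xa (sym ya))) , Sy , cy }
    contracted : a ∷ B ++ a ∷ B' ∼ a ∷ C ++ a ∷ C'
    contracted = ih (a ∷ B ++ a ∷ B') (a ∷ C ++ a ∷ C') (subst (λ w → length w < length E) (f1 B B' mB mB') (length-flt-< S1 (out (proj₁ other) (proj₁ (proj₂ (proj₂ other))) (proj₁ (proj₂ other))) E (proj₂ (proj₂ (proj₂ other))))) d1
      (subst₂ SG (f1 B B' mB mB') (f1 C C' mC mC') (SG-flt S1 g6))

  ord-share : ∀ c x → S0 c ≡ false → S0 x ≡ true → x ≢ b → ord c x E ≡ par c B ∧ par x A
  ord-share c x Sc Sx n = trans (ord-swap {a = x} {c} (λ { refl → true≢false (trans (sym Sx) Sc) }) E)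
    (trans (cong₂ _xor_ (share-ord S A B A' B' mA mB mA' mB' ev x c (S0-S x Sx n) (S0-S' c Sc)) (cong (_∧ par c E) (ev x)))
      (taut 2 (λ p q → (p ∧ q) xor false) (λ p q → q ∧ p) tt (par x A) (par c B)))

  -- After a rotation or reflection the restriction of `D2` is `W` itself. Applied to each of the
  -- two arcs of `b`, `tight` shows that `A` and `A'` occur in it without interruption, which is the
  -- form `aligned` asks for.
  module Placed (D3 : Wd k) (iso3 : D2 ≅ D3) (f₃ : flt S0 D3 ≡ W) (P Q R : Wd k) (e3 : D3 ≡ P ++ b ∷ Q ++ b ∷ R)
    (zP : count b P ≡ 0) (zQ : count b Q ≡ 0) (zR : count b R ≡ 0) where
    U D4 D5 : Wd k
    U = R ++ P
    D4 = U ++ b ∷ Q ++ [ b ]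
    D5 = Q ++ b ∷ U ++ [ b ]
    zU : count b U ≡ 0
    zU = trans (count-++ b R P) (cong₂ _+_ zR zP)
    fs : flt S0 P ≡ A × flt S0 Q ++ b ∷ flt S0 R ≡ A' ++ [ b ]
    fs = first-occurrence b (flt S0 P) A (trans (sym fe) f₃) (trans (count-flt-in S0 S0b P) zP) (off b A mA Sb)
      where
      cons : ∀ w → flt S0 (b ∷ w) ≡ b ∷ flt S0 w
      cons w = cong (λ s → if s then b ∷ flt S0 w else flt S0 w) S0b
      fe : flt S0 D3 ≡ flt S0 P ++ b ∷ flt S0 Q ++ b ∷ flt S0 R
      fe = trans (cong (flt S0) e3) (trans (flt-++ S0 P (b ∷ Q ++ b ∷ R)) (cong (flt S0 P ++_) (trans (cons (Q ++ b ∷ R)) (cong (b ∷_) (trans (flt-++ S0 Q (b ∷ R)) (cong (flt S0 Q ++_) (cons R)))))))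
    fs' : flt S0 Q ≡ A' × flt S0 R ≡ []
    fs' = first-occurrence b (flt S0 Q) A' (proj₂ fs) (trans (count-flt-in S0 S0b Q) zQ) (off b A' mA' Sb)
    fU : flt S0 U ≡ A
    fU = trans (flt-++ S0 R P) (cong₂ _++_ (proj₂ fs') (proj₁ fs))
    W4 : flt S0 U ++ b ∷ flt S0 Q ++ [ b ] ≡ W
    W4 = cong₂ (λ u v → u ++ b ∷ v ++ [ b ]) fU (proj₁ fs')
    W5 : W ≅ flt S0 Q ++ b ∷ flt S0 U ++ [ b ]
    W5 = rot≡ (A ++ [ b ]) (A' ++ [ b ]) (sym (++-assoc A [ b ] (A' ++ [ b ]))) (trans (ls 3 (λ a b c → (c & b) & a & b ⊜ c & b & a & b) refl A [ b ] A') (sym (cong₂ (λ u v → u ++ b ∷ v ++ [ b ]) (proj₁ fs') fU)))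
    iso4 : D2 ≅ D4
    iso4 = ≅trans iso3 (rot≡ (P ++ b ∷ Q ++ [ b ]) R (trans e3 (ls 4 (λ p b q r → p & b & q & b & r ⊜ (p & b & q & b) & r) refl P [ b ] Q R)) (sym (++-assoc R P (b ∷ Q ++ [ b ]))))
    iso5 : D4 ≅ D5
    iso5 = rot≡ (U ++ [ b ]) (Q ++ [ b ]) (sym (++-assoc U [ b ] (Q ++ [ b ]))) (ls 3 (λ a b c → (c & b) & a & b ⊜ c & b & a & b) refl U [ b ] Q)
    e2 : Even D2
    e2 = DO⇒Even D2 (SG-DO g dE)
    g4 : SG E D4
    g4 = SG-trans g (≅-SG iso4 e2)
    d4 : DO D4
    d4 = SG-DO g4 dE
    g5 : SG E D5
    g5 = SG-trans g4 (≅-SG iso5 (DO⇒Even D4 d4))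
    d5 : DO D5
    d5 = SG-DO g5 dE
    conn4 : Connected D4
    conn4 = Connected-resp g4 conn
    conn5 : Connected D5
    conn5 = Connected-resp g5 conn
    h4 : ∀ c → S0 c ≡ false → ∃[ β ] (∀ x → S0 x ≡ true → x ≢ b → ord c x D4 ≡ β ∧ par x (flt S0 U))
    h4 c Sc = par c B , λ x Sx n → trans (sym (ords g4 c x)) (trans (ord-share c x Sc Sx n) (cong (λ w → par c B ∧ par x w) (sym fU)))
    h5 : ∀ c → S0 c ≡ false → ∃[ β ] (∀ x → S0 x ≡ true → x ≢ b → ord c x D5 ≡ β ∧ par x (flt S0 Q))
    h5 c Sc = par c B , λ x Sx n → trans (sym (ords g5 c x)) (trans (ord-share c x Sc Sx n) (cong (par c B ∧_) (sym (trans (cong (par x) (proj₁ fs')) (par-pair x A A' Even-pair)))))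
    finish : ∃[ X ] ∃[ X' ] (U ≡ X ++ flt S0 U ++ X' × Mono S0 false X × Mono S0 false X') → ∃[ Y ] ∃[ Y' ] (Q ≡ Y ++ flt S0 Q ++ Y' × Mono S0 false Y × Mono S0 false Y') → E ∼ D2
    finish (X , X' , eU , mX , mX') (Y , Y' , eQ , mY , mY') = ∼trans (aligned (X' ++ b ∷ Y) (Y' ++ b ∷ X) (All.++⁺ (weak X' mX') (Sb ∷ weak Y mY)) (All.++⁺ (weak Y' mY') (Sb ∷ weak X mX)) (SG-trans g (≅-SG iso6 e2)))
        (∼sym (≅⇒∼ iso6 e2))
      where
      weak : ∀ w → Mono S0 false w → Mono S false w
      weak w m = in-Mono S w λ z n → S0-S' z (Mono-in S0 w m z n)
      iso6 : D2 ≅ A ++ (X' ++ b ∷ Y) ++ A' ++ Y' ++ b ∷ X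
      iso6 = ≅trans iso4 (rot≡ X (A ++ X' ++ b ∷ (Y ++ A' ++ Y') ++ [ b ])
        (trans (cong₂ (λ u v → u ++ b ∷ v ++ [ b ]) (trans eU (cong (λ w → X ++ w ++ X') fU)) (trans eQ (cong (λ w → Y ++ w ++ Y') (proj₁ fs'))))
          (ls 7 (λ x a x' b y a' y' → (x & a & x') & b & (y & a' & y') & b ⊜ x & a & x' & b & (y & a' & y') & b) refl X A X' [ b ] Y A' Y'))
        (ls 7 (λ x a x' b y a' y' → (a & x' & b & (y & a' & y') & b) & x ⊜ a & (x' & b & y) & a' & y' & b & x) refl X A X' [ b ] Y A' Y'))
    result : E ∼ D2
    result = finish (tight S0 b U Q S0b zU zQ d4 conn4 (subst Prime (sym W4) PW) (subst Big (sym W4) bW) (subst DO (sym W4) dW) h4)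
      (tight S0 b Q U S0b zQ zU d5 conn5 (Prime-≅ W5 PW) (λ x y → let p , q , n , np , nq , cp , cq = bW x y in p , q , n , np , nq , (λ z → cp (trans (≅-Same W5 p) z)) , λ z → cq (trans (≅-Same W5 q) z))
        (DO-resp W (flt S0 Q ++ b ∷ flt S0 U ++ [ b ]) (≅-Same W5) dW) h5)

  step : E ∼ D2
  step = case proj₂ (≅-flt S0 iso) D2 refl of λ { (D3 , iso3 , f₃) → case locate2 b D3 (trans (sym (≅-Same iso3 b)) (trans (sym (same g b)) cb2)) of λ
      { (P , Q , R , e3 , zP , zQ , zR) → Placed.result D3 iso3 f₃ P Q R e3 zP zQ zR } }
    where
    cb2 : count b E ≡ 2
    cb2 with dE b
    ... | inj₁ q = ⊥-elim (cb q)
    ... | inj₂ q = q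

-- Words with the same graph are mutants: the induction

All-≡ : {a : Fin k} {u v : Wd k} → All (_≡ a) u → All (_≡ a) v → length u ≡ length v → u ≡ v
All-≡ [] [] _ = refl
All-≡ (refl ∷ p) (refl ∷ q) e = cong (_ ∷_) (All-≡ p q (ℕ.suc-injective e))

module _ (D : Wd k) where

  del-at? : ∀ u v t → Dec (Del u v t D)
  del-at? u v t with ¬? (u ≟ᶠ v) ×-dec (count u D ℕ.≟ 2) ×-dec (count v D ℕ.≟ 2) ×-dec all? (λ a → ¬? (a ≟ᶠ u) →-dec (¬? (a ≟ᶠ v) →-dec (ord v a D ≟ᵇ (t ∧ ord u a D))))
  ... | yes (p , q , r , s) = yes record { u≢v = p ; cu = q ; cv = r ; twin = s }
  ... | no n = no λ d → n (Del.u≢v d , Del.cu d , Del.cv d , Del.twin d)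

  del? : Dec (∃[ u ] ∃[ v ] ∃[ t ] Del u v t D)
  del? with any? (λ u → any? (λ v → del-at? u v true)) | any? (λ u → any? (λ v → del-at? u v false))
  ... | yes (u , v , d) | _ = yes (u , v , true , d)
  ... | no _ | yes (u , v , d) = yes (u , v , false , d)
  ... | no n | no m = no λ { (u , v , true , d) → n (u , v , d) ; (u , v , false , d) → m (u , v , d) }

  Disconnected : Side k → Set
  Disconnected S = (∃[ a ] (S a ≡ true × count a D ≢ 0)) × (∃[ a ] (S a ≡ false × count a D ≢ 0)) × NonCrossing S D

  disconnected? : Dec (∃ Disconnected)
  disconnected? = findSet Disconnected ext λ S → any? (λ a → (S a ≟ᵇ true) ×-dec ¬? (count a D ℕ.≟ 0)) ×-dec (any? (λ a → (S a ≟ᵇ false) ×-dec ¬? (count a D ℕ.≟ 0))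
      ×-dec all? (λ a → all? (λ b → ¬? (S a ≟ᵇ S b) →-dec (ord a b D ≟ᵇ false))))
    where
    ext : ∀ S T → (∀ x → S x ≡ T x) → Disconnected S → Disconnected T
    ext S T h ((a , Sa , ca) , (b , Sb , cb) , nc) = (a , trans (sym (h a)) Sa , ca) , (b , trans (sym (h b)) Sb , cb) , λ x y n → nc x y λ e → n (trans (sym (h x)) (trans e (h y)))

  Smaller : Side k → Side k → Set
  Smaller S S″ = Split D S″ × length (flt S″ D) < length (flt S D)

  smaller? : ∀ S → Dec (∃ (Smaller S))
  smaller? S = findSet (Smaller S) ext dec
    where
    ext : ∀ S1 S2 → (∀ x → S1 x ≡ S2 x) → Smaller S S1 → Smaller S S2
    ext S1 S2 h ((a , b , c) , l) = (Two-ext h a , Two-ext h b , subst (_≤ 4) (cut-ext h D) c) , subst (λ w → length w < length (flt S D)) (flt-ext D λ x _ → h x) l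
    dec : ∀ S″ → Dec (Smaller S S″)
    dec S″ = (two? S″ true D ×-dec (two? S″ false D ×-dec (cut S″ D ℕ.≤? 4))) ×-dec (length (flt S″ D) ℕ.<? length (flt S D))

  minimal-split : ∀ n S → length (flt S D) ≤ n → Split D S → ∃[ S' ] (Split D S' × (∀ S″ → length (flt S″ D) < length (flt S' D) → ¬ Split D S″))
  minimal-split n S le sp with smaller? S
  ... | no none-smaller = S , sp , λ S″ l sp″ → none-smaller (S″ , sp″ , l)
  minimal-split zero S le sp | yes (S″ , sp″ , l) = ⊥-elim (ℕ.n≮0 (≤-trans l le))
  minimal-split (suc n) S le sp | yes (S″ , sp″ , l) = minimal-split n S″ (ℕ.≤-pred (≤-trans l le)) sp″

  -- At most three letters always allow a deletion. With letters `x`, `y`, `z`: if `x` crosses `z`,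
  -- then `y` is a twin of `x` or crosses at most `x`, according to whether it crosses `z`; if not,
  -- then `x` crosses at most `y`.
  four-letters : DO D → ¬ (∃[ u ] ∃[ v ] ∃[ t ] Del u v t D) → ∀ x y → x ≢ y → count x D ≢ 0 → count y D ≢ 0 → Big D
  four-letters dD nodel x y xy cx cy with any? (λ z → ¬? (z ≟ᶠ x) ×-dec (¬? (z ≟ᶠ y) ×-dec ¬? (count z D ℕ.≟ 0)))
  ... | no n = ⊥-elim (nodel (x , y , false , record { u≢v = xy ; cu = full x cx ; cv = full y cy ; twin = λ a ax ay → ord-0ʳ {a = y} D (absent a ax ay) }))
    where
    full : ∀ z → count z D ≢ 0 → count z D ≡ 2
    full z m = case dD z of λ { (inj₁ q) → ⊥-elim (m q) ; (inj₂ q) → q }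
    absent : ∀ a → a ≢ x → a ≢ y → count a D ≡ 0
    absent a ax ay = case nonzero-or a D of λ { (inj₁ q) → q ; (inj₂ q) → ⊥-elim (n (a , ax , ay , q)) }
  ... | yes (z , zx , zy , cz) with any? (λ w → ¬? (w ≟ᶠ x) ×-dec (¬? (w ≟ᶠ y) ×-dec (¬? (w ≟ᶠ z) ×-dec ¬? (count w D ℕ.≟ 0))))
  ...   | yes (w , wx , wy , wz , cw) = pick-two xy (zx ∘ sym) (wx ∘ sym) (zy ∘ sym) (wy ∘ sym) (wz ∘ sym) (λ p → count p D ≢ 0) cx cy cz cw
  ...   | no n = ⊥-elim (triangle (bool-cases (ord x z D)))
    where
    full : ∀ z → count z D ≢ 0 → count z D ≡ 2
    full z m = case dD z of λ { (inj₁ q) → ⊥-elim (m q) ; (inj₂ q) → q }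
    absent : ∀ a → a ≢ x → a ≢ y → a ≢ z → count a D ≡ 0
    absent a ax ay az = case nonzero-or a D of λ { (inj₁ q) → q ; (inj₂ q) → ⊥-elim (n (a , ax , ay , az , q)) }
    triangle : (ord x z D ≡ true) ⊎ (ord x z D ≡ false) → ⊥
    triangle (inj₁ o) = nodel (x , y , ord y z D , record { u≢v = xy ; cu = full x cx ; cv = full y cy ; twin = λ a ax ay → case a ≟ᶠ z of λ where
      (yes refl) → trans (taut 1 (λ t → t) (λ t → t ∧ true) tt (ord y a D)) (cong (ord y a D ∧_) (sym o))
      (no az) → trans (ord-0ʳ {a = y} D (absent a ax ay az)) (trans (taut 1 (λ _ → false) (λ t → t ∧ false) tt (ord y z D)) (cong (ord y z D ∧_) (sym (ord-0ʳ {a = x} D (absent a ax ay az))))) })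
    triangle (inj₂ o) = nodel (y , x , false , record { u≢v = xy ∘ sym ; cu = full y cy ; cv = full x cx ; twin = λ a ay ax → case a ≟ᶠ z of λ where
      (yes refl) → o
      (no az) → ord-0ʳ {a = x} D (absent a ax ay az) })

mutation-step : (D1 D2 : Wd k) → DO D1 → SG D1 D2 → Mutable-below (length D1) → D1 ∼ D2
mutation-step {k} D1 D2 dD g ih = by-shape (shape D1)
  where
  ev : Even D1
  ev = DO⇒Even D1 dD
  module Prepared (x y : Fin k) (xy : x ≢ y) (cx : count x D1 ≢ 0) (cy : count y D1 ≢ 0) (nodel : ¬ (∃[ u ] ∃[ v ] ∃[ t ] Del u v t D1)) (nodis : ¬ ∃ (Disconnected D1)) where
    conn : Connected D1
    conn S a b Sa Sb ca cb nc = nodis (S , (a , Sa , ca) , (b , Sb , cb) , nc)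
    big : Big D1
    big = four-letters D1 dD nodel x y xy cx cy
    prime : ¬ ∃ (Split D1) → D1 ∼ D2
    prime ns = ≅⇒∼ (unique five (suc (length D1)) D1 D2 ≤-refl dD (record { single = single ; cuts = no-split D1 ns }) big g) ev
      where
      single : ∀ z → count z D1 ≢ 0 → 4 ≤ cut (eqb z) D1
      single z cz = case big z z of λ { (p , _ , _ , (pz , _) , _ , cp , _) → Connected-cut D1 ev conn (eqb z) z p (eqb-refl z) (eqb-≢ {a = z} {p} (pz ∘ sym)) cz cp }
    split : ∃[ S ] (Split D1 S × (∀ S″ → length (flt S″ D1) < length (flt S D1) → ¬ Split D1 S″)) → D1 ∼ D2
    split (S , (tT , tF , le) , minimal) = case shares S D1 le of λ { (A , B , A' , B' , iso , mA , mB , mA' , mB') → go A B A' B' iso mA mB mA' mB' }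
      where
      go : ∀ A B A' B' → D1 ≅ A ++ B ++ A' ++ B' → Mono S true A → Mono S false B → Mono S true A' → Mono S false B' → D1 ∼ D2
      go A B A' B' iso mA mB mA' mB' = ∼trans (≅⇒∼ iso ev) (Minimal-share.step S A B A' B' mA mB mA' mB' (SG-DO gE dD) (Connected-resp gE conn)
          (λ u v t d → nodel (u , v , t , Del-resp (SG-sym gE) d)) (Two-resp (same gE) tT) (Two-resp (same gE) tF) min' D2 (SG-trans (SG-sym gE) g)
          (subst Mutable-below (∼-length (≅⇒∼ iso ev)) ih))
        where
        E : Wd k
        E = A ++ B ++ A' ++ B'
        gE : SG D1 E
        gE = ≅-SG iso ev
        len : ∀ S' → length (flt S' E) ≡ length (flt S' D1)
        len S' = Same-length (flt S' E) (flt S' D1) (Same-flt S' {E} {D1} λ a → sym (same gE a))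
        min' : ∀ S' → length (flt S' E) < length (flt S E) → ¬ Split E S'
        min' S' l (a , b , c) = minimal S' (subst₂ _<_ (len S') (len S) l) (Two-resp (same (SG-sym gE)) a , Two-resp (same (SG-sym gE)) b , subst (_≤ 4) (sym (≅-cut iso S')) c)
    result : D1 ∼ D2
    result = case split? D1 of λ where
      (yes (S , sp)) → split (minimal-split D1 (length (flt S D1)) S ≤-refl sp)
      (no ns) → prime ns
  several : ∀ x y → x ≢ y → count x D1 ≢ 0 → count y D1 ≢ 0 → D1 ∼ D2
  several x y xy cx cy = case del? D1 of λ where
    (yes (u , v , t , d)) → delete-step D1 D2 ev g d (ih (rm v D1) (rm v D2) (length-flt-< _ (cong not (eqb-refl v)) D1 (λ e → case trans (sym e) (Del.cv d) of λ ())) (DO-flt _ D1 dD) (SG-flt _ g))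
    (no nodel) → case disconnected? D1 of λ where
      (yes (S , t , f , nc)) → split-step S D1 D2 dD g nc t f (λ u v l d g' → ih u v l d g')
      (no nodis) → Prepared.result x y xy cx cy nodel nodis
  by-shape : Shape D1 → D1 ∼ D2
  by-shape (none refl) = ∼≡ (sym (empty-word D2 λ a → sym (same g a)))
  by-shape (one a all n) = ∼≡ (All-≡ all (in-Only D2 λ b c → sym (only b λ z → c (trans (sym (same g b)) z))) (Same-length D1 D2 (same g)))
    where
    only : ∀ b → count b D1 ≢ 0 → a ≡ b
    only b c = sym (All-count all b c)
    in-Only : ∀ w → (∀ b → count b w ≢ 0 → b ≡ a) → All (_≡ a) w
    in-Only [] h = []
    in-Only (x ∷ w) h = h x (head≢0 x w) ∷ in-Only w λ b c → h b (cons≢0 b x w c)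
  by-shape (more x y xy cx cy) = several x y xy cx cy

mutable : ∀ n → Mutable-below n
mutable (suc n) D1 D2 (s≤s le) d g = mutation-step D1 D2 d g λ u v l → mutable n u v (≤-trans l le)

same-graph⇒∼ : (D1 D2 : Wd k) → DO D1 → SG D1 D2 → D1 ∼ D2
same-graph⇒∼ D1 D2 = mutable (suc (length D1)) D1 D2 ≤-refl

-- Coefficients and the ideal of relations

private
  module QS = +-*-Solver

ℚᵢ-≡ : ∀ {a b c d} → a ≡ c → b ≡ d → (a +i b) ≡ (c +i d)
ℚᵢ-≡ = cong₂ _+i_

-- Makes the ring solver available for the coefficients of `Elem`.
ℚᵢ-ring : CommutativeRing 0ℓ 0ℓ
ℚᵢ-ring = record
  { Carrier = ℚᵢ ; _≈_ = _≡_ ; _+_ = _+ᵢ_ ; _*_ = _*ᵢ_ ; -_ = -ᵢ_ ; 0# = 0ᵢ ; 1# = 1ᵢ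
  ; isCommutativeRing = record
    { isRing = record
      { +-isAbelianGroup = record
        { isGroup = record
          { isMonoid = record
            { isSemigroup = record { isMagma = record { isEquivalence = isEquivalence ; ∙-cong = cong₂ _+ᵢ_ } ; assoc = λ (a +i b) (c +i d) (e +i f) → ℚᵢ-≡ (ℚ.+-assoc a c e) (ℚ.+-assoc b d f) }
            ; identity = (λ (a +i b) → ℚᵢ-≡ (ℚ.+-identityˡ a) (ℚ.+-identityˡ b)) , λ (a +i b) → ℚᵢ-≡ (ℚ.+-identityʳ a) (ℚ.+-identityʳ b) }
          ; inverse = (λ (a +i b) → ℚᵢ-≡ (ℚ.+-inverseˡ a) (ℚ.+-inverseˡ b)) , λ (a +i b) → ℚᵢ-≡ (ℚ.+-inverseʳ a) (ℚ.+-inverseʳ b)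
          ; ⁻¹-cong = cong -ᵢ_ }
        ; comm = λ (a +i b) (c +i d) → ℚᵢ-≡ (ℚ.+-comm a c) (ℚ.+-comm b d) }
      ; *-cong = cong₂ _*ᵢ_
      ; *-assoc = λ (a +i b) (c +i d) (e +i f) → ℚᵢ-≡
          (QS.solve 6 (λ a b c d e f → (a QS.:* c QS.:- b QS.:* d) QS.:* e QS.:- (a QS.:* d QS.:+ b QS.:* c) QS.:* f QS.:= a QS.:* (c QS.:* e QS.:- d QS.:* f) QS.:- b QS.:* (c QS.:* f QS.:+ d QS.:* e)) refl a b c d e f)
          (QS.solve 6 (λ a b c d e f → (a QS.:* c QS.:- b QS.:* d) QS.:* f QS.:+ (a QS.:* d QS.:+ b QS.:* c) QS.:* e QS.:= a QS.:* (c QS.:* f QS.:+ d QS.:* e) QS.:+ b QS.:* (c QS.:* e QS.:- d QS.:* f)) refl a b c d e f)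
      ; *-identity = (λ x → trans (*-comm 1ᵢ x) (*-one x)) , *-one
      ; distrib = distribˡ , λ x y z → trans (*-comm (y +ᵢ z) x) (trans (distribˡ x y z) (cong₂ _+ᵢ_ (*-comm x y) (*-comm x z))) }
    ; *-comm = *-comm } }
  where
  *-comm : ∀ x y → x *ᵢ y ≡ y *ᵢ x
  *-comm (a +i b) (c +i d) = ℚᵢ-≡ (QS.solve 4 (λ a b c d → a QS.:* c QS.:- b QS.:* d QS.:= c QS.:* a QS.:- d QS.:* b) refl a b c d) (QS.solve 4 (λ a b c d → a QS.:* d QS.:+ b QS.:* c QS.:= c QS.:* b QS.:+ d QS.:* a) refl a b c d)
  *-one : ∀ x → x *ᵢ 1ᵢ ≡ x
  *-one (a +i b) = ℚᵢ-≡ (QS.solve 2 (λ a b → a QS.:* QS.con 1ℚ QS.:- b QS.:* QS.con 0ℚ QS.:= a) refl a b) (QS.solve 2 (λ a b → a QS.:* QS.con 0ℚ QS.:+ b QS.:* QS.con 1ℚ QS.:= b) refl a b)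
  distribˡ : ∀ x y z → x *ᵢ (y +ᵢ z) ≡ (x *ᵢ y) +ᵢ (x *ᵢ z)
  distribˡ (a +i b) (c +i d) (e +i f) = ℚᵢ-≡
    (QS.solve 6 (λ a b c d e f → a QS.:* (c QS.:+ e) QS.:- b QS.:* (d QS.:+ f) QS.:= (a QS.:* c QS.:- b QS.:* d) QS.:+ (a QS.:* e QS.:- b QS.:* f)) refl a b c d e f)
    (QS.solve 6 (λ a b c d e f → a QS.:* (d QS.:+ f) QS.:+ b QS.:* (c QS.:+ e) QS.:= (a QS.:* d QS.:+ b QS.:* c) QS.:+ (a QS.:* f QS.:+ b QS.:* e)) refl a b c d e f)

_≟ᵢ_ : (x y : ℚᵢ) → Dec (x ≡ y)
(a +i b) ≟ᵢ (c +i d) = map′ (λ (p , q) → ℚᵢ-≡ p q) (λ { refl → refl , refl }) ((a ℚ.≟ c) ×-dec (b ℚ.≟ d))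

module RS = RingSimple (ACR.fromCommutativeRing ℚᵢ-ring) _≟ᵢ_
open RS using (con; _:+_; _:*_; :-_; _:-_; _:=_) renaming (solve to rs)

coeff-++ : ∀ L M w → coeff (L ++ M) w ≡ coeff L w +ᵢ coeff M w
coeff-++ [] M w = rs 1 (λ x → x := con 0ᵢ :+ x) refl (coeff M w)
coeff-++ ((κ , u) ∷ L) M w with ≡-dec _≟ᶠ_ u w
... | yes _ = trans (cong (κ +ᵢ_) (coeff-++ L M w)) (rs 3 (λ x y z → x :+ (y :+ z) := (x :+ y) :+ z) refl κ (coeff L w) (coeff M w))
... | no _ = coeff-++ L M w

ind : Word → Word → ℚᵢ
ind u w = if does (≡-dec _≟ᶠ_ u w) then 1ᵢ else 0ᵢ

coeff-∷ : ∀ κ u L w → coeff ((κ , u) ∷ L) w ≡ (κ *ᵢ ind u w) +ᵢ coeff L w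
coeff-∷ κ u L w with ≡-dec _≟ᶠ_ u w
... | yes _ = cong (_+ᵢ coeff L w) (rs 1 (λ k → k := k :* con 1ᵢ) refl κ)
... | no _ = rs 2 (λ k l → l := k :* con 0ᵢ :+ l) refl κ (coeff L w)

-- Elements of the tensor algebra as coefficient functions; the null ones vanish in U(sl₂).

record Null (f : Word → ℚᵢ) : Set where
  constructor null
  field
    gens : List (ℚᵢ × Word × Fin 3 × Word)
    coeffs : ∀ w → f w ≡ coeff (idealElem gens) w

Null-resp : ∀ {f g} → (∀ w → f w ≡ g w) → Null f → Null g
Null-resp e (null gs h) = null gs λ w → trans (sym (e w)) (h w)

Null-+ : ∀ {f g} → Null f → Null g → Null (λ w → f w +ᵢ g w)
Null-+ (null gs g) (null hs h) = null (gs ++ hs) λ w → trans (cong₂ _+ᵢ_ (g w) (h w)) (trans (sym (coeff-++ (idealElem gs) (idealElem hs) w)) (cong (λ z → coeff z w) (sym (concatMap-++ sandwich gs hs))))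

Null-0 : Null (λ _ → 0ᵢ)
Null-0 = null [] λ _ → refl

Null-* : ∀ a {f} → Null f → Null (λ w → a *ᵢ f w)
Null-* a (null gs g) = null (map s gs) λ w → trans (cong (a *ᵢ_) (g w)) (sym (ideal-scale gs w))
  where
  s : ℚᵢ × Word × Fin 3 × Word → ℚᵢ × Word × Fin 3 × Word
  s (κ , r) = a *ᵢ κ , r
  scaled : ∀ κ u v (L : Elem) w → coeff (map (λ { (c , x) → ((a *ᵢ κ) *ᵢ c , u ++ x ++ v) }) L) w ≡ a *ᵢ coeff (map (λ { (c , x) → (κ *ᵢ c , u ++ x ++ v) }) L) w
  scaled κ u v [] w = rs 1 (λ a → con 0ᵢ := a :* con 0ᵢ) refl a
  scaled κ u v ((c , x) ∷ L) w with ≡-dec _≟ᶠ_ (u ++ x ++ v) w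
  ... | yes _ = trans (cong (((a *ᵢ κ) *ᵢ c) +ᵢ_) (scaled κ u v L w)) (rs 4 (λ a k c z → ((a :* k) :* c) :+ (a :* z) := a :* ((k :* c) :+ z)) refl a κ c (coeff (map (λ { (c , x) → (κ *ᵢ c , u ++ x ++ v) }) L) w))
  ... | no _ = scaled κ u v L w
  ideal-scale : ∀ gs w → coeff (idealElem (map s gs)) w ≡ a *ᵢ coeff (idealElem gs) w
  ideal-scale [] w = rs 1 (λ a → con 0ᵢ := a :* con 0ᵢ) refl a
  ideal-scale ((κ , u , j , v) ∷ gs) w = trans (coeff-++ (sandwich (s (κ , u , j , v))) (idealElem (map s gs)) w) (trans (cong₂ _+ᵢ_ (scaled κ u v (rel j) w) (ideal-scale gs w))
    (trans (rs 3 (λ a x y → a :* x :+ a :* y := a :* (x :+ y)) refl a (coeff (sandwich (κ , u , j , v)) w) (coeff (idealElem gs) w)) (cong (a *ᵢ_) (sym (coeff-++ (sandwich (κ , u , j , v)) (idealElem gs) w)))))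

Null⇒≈U : ∀ L M → Null (λ w → coeff L w +ᵢ (-ᵢ coeff M w)) → L ≈U M
Null⇒≈U L M (null gs g) = gs , λ w → trans (rs 2 (λ l m → l := m :+ (l :- m)) refl (coeff L w) (coeff M w)) (cong (coeff M w +ᵢ_) (g w))

-- Structure constants and relations between words

S3 : (Fin 3 → ℚᵢ) → ℚᵢ
S3 f = f x₁ +ᵢ (f x₂ +ᵢ f x₃)

ε : Fin 3 → Fin 3 → Fin 3 → ℚᵢ
ε zero (suc zero) (suc (suc zero)) = 1ᵢ
ε (suc zero) (suc (suc zero)) zero = 1ᵢ
ε (suc (suc zero)) zero (suc zero) = 1ᵢ
ε (suc zero) zero (suc (suc zero)) = -ᵢ 1ᵢ
ε (suc (suc zero)) (suc zero) zero = -ᵢ 1ᵢ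
ε zero (suc (suc zero)) (suc zero) = -ᵢ 1ᵢ
ε _ _ _ = 0ᵢ

δ : Fin 3 → Fin 3 → ℚᵢ
δ i j = if eqb i j then 1ᵢ else 0ᵢ

ε-cyclic : ∀ i j l → ε i j l ≡ ε j l i
ε-cyclic = from-yes (all? λ i → all? λ j → all? λ l → ε i j l ≟ᵢ ε j l i)

ε-anti : ∀ i j l → ε j i l ≡ -ᵢ ε i j l
ε-anti = from-yes (all? λ i → all? λ j → all? λ l → ε j i l ≟ᵢ (-ᵢ ε i j l))

-- The contraction identity for two ε tensors, checked for all 81 values of the indices. The factor
-- `iᵢ` comes from the structure constants, which are `iᵢ *ᵢ ε`.
ε-ε : ∀ q r z c → S3 (λ p → ε p q r *ᵢ (iᵢ *ᵢ ε p z c)) ≡ iᵢ *ᵢ ((δ q z *ᵢ δ r c) +ᵢ (-ᵢ (δ r z *ᵢ δ q c)))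
ε-ε = from-yes (all? λ q → all? λ r → all? λ z → all? λ c → S3 (λ p → ε p q r *ᵢ (iᵢ *ᵢ ε p z c)) ≟ᵢ (iᵢ *ᵢ ((δ q z *ᵢ δ r c) +ᵢ (-ᵢ (δ r z *ᵢ δ q c)))))

ε-ε2 : ∀ r c → S3 (λ p → S3 λ q → ε p q r *ᵢ (iᵢ *ᵢ ε p q c)) ≡ (1ᵢ +ᵢ 1ᵢ) *ᵢ (iᵢ *ᵢ δ r c)
ε-ε2 = from-yes (all? λ r → all? λ c → S3 (λ p → S3 λ q → ε p q r *ᵢ (iᵢ *ᵢ ε p q c)) ≟ᵢ ((1ᵢ +ᵢ 1ᵢ) *ᵢ (iᵢ *ᵢ δ r c)))

S3-δ : ∀ r (t : Fin 3 → ℚᵢ) → S3 (λ c → δ r c *ᵢ t c) ≡ t r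
S3-δ zero t = rs 3 (λ a b c → con 1ᵢ :* a :+ (con 0ᵢ :* b :+ con 0ᵢ :* c) := a) refl (t x₁) (t x₂) (t x₃)
S3-δ (suc zero) t = rs 3 (λ a b c → con 0ᵢ :* a :+ (con 1ᵢ :* b :+ con 0ᵢ :* c) := b) refl (t x₁) (t x₂) (t x₃)
S3-δ (suc (suc zero)) t = rs 3 (λ a b c → con 0ᵢ :* a :+ (con 0ᵢ :* b :+ con 1ᵢ :* c) := c) refl (t x₁) (t x₂) (t x₃)

S3-cong : ∀ {f g : Fin 3 → ℚᵢ} → (∀ c → f c ≡ g c) → S3 f ≡ S3 g
S3-cong h = cong₂ _+ᵢ_ (h x₁) (cong₂ _+ᵢ_ (h x₂) (h x₃))

S3-+ : ∀ f g → S3 (λ c → f c +ᵢ g c) ≡ S3 f +ᵢ S3 g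
S3-+ f g = rs 6 (λ a b c d e h → (a :+ d) :+ ((b :+ e) :+ (c :+ h)) := (a :+ (b :+ c)) :+ (d :+ (e :+ h))) refl (f x₁) (f x₂) (f x₃) (g x₁) (g x₂) (g x₃)

S3-* : ∀ a f → S3 (λ c → a *ᵢ f c) ≡ a *ᵢ S3 f
S3-* a f = rs 4 (λ a x y z → a :* x :+ (a :* y :+ a :* z) := a :* (x :+ (y :+ z))) refl a (f x₁) (f x₂) (f x₃)

S3-neg : ∀ f → S3 (λ c → -ᵢ f c) ≡ -ᵢ S3 f
S3-neg f = rs 3 (λ x y z → :- x :+ (:- y :+ :- z) := :- (x :+ (y :+ z))) refl (f x₁) (f x₂) (f x₃)

S3-swap : ∀ (f : Fin 3 → Fin 3 → ℚᵢ) → S3 (λ p → S3 λ q → f p q) ≡ S3 (λ q → S3 λ p → f p q)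
S3-swap f = trans (S3-+ (λ p → f p x₁) (λ p → f p x₂ +ᵢ f p x₃)) (cong (S3 (λ p → f p x₁) +ᵢ_) (S3-+ (λ p → f p x₂) (λ p → f p x₃)))

Null-S3 : ∀ {f : Fin 3 → Word → ℚᵢ} → (∀ c → Null (f c)) → Null (λ w → S3 λ c → f c w)
Null-S3 h = Null-+ (h x₁) (Null-+ (h x₂) (h x₃))

-- The commutation relation for the letters `i`, `j`, with structure constants `iᵢ *ᵢ ε i j c`, in
-- the context of `P` and `R`.
bracket : Word → Word → Fin 3 → Fin 3 → Word → ℚᵢ
bracket P R i j w = ind (P ++ i ∷ j ∷ R) w +ᵢ (-ᵢ (ind (P ++ j ∷ i ∷ R) w +ᵢ S3 λ c → (iᵢ *ᵢ ε i j c) *ᵢ ind (P ++ c ∷ R) w))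

-- Three of the nine relations are the generators of the ideal, three follow from the antisymmetry
-- of ε, and the diagonal ones are zero.
Null-bracket : ∀ P R i j → Null (bracket P R i j)
Null-bracket P R = go
  where
  go : ∀ i j → Null (bracket P R i j)
  flip : ∀ i j → Null (bracket P R i j) → Null (bracket P R j i)
  flip i j = Null-resp (λ w → trans (rs 3 (λ a b s → con (-ᵢ 1ᵢ) :* (a :- (b :+ s)) := b :- (a :+ :- s)) refl (ind (P ++ i ∷ j ∷ R) w) (ind (P ++ j ∷ i ∷ R) w) (S3 (κ i j w)))
      (cong (λ s → ind (P ++ j ∷ i ∷ R) w +ᵢ (-ᵢ (ind (P ++ i ∷ j ∷ R) w +ᵢ s))) (trans (sym (S3-neg (κ i j w))) (S3-cong (anti w))))) ∘ Null-* (-ᵢ 1ᵢ)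
    where
    κ : ∀ i j w c → ℚᵢ
    κ i j w c = (iᵢ *ᵢ ε i j c) *ᵢ ind (P ++ c ∷ R) w
    anti : ∀ w c → -ᵢ κ i j w c ≡ κ j i w c
    anti w c = trans (rs 3 (λ a e u → :- ((a :* e) :* u) := (a :* (:- e)) :* u) refl iᵢ (ε i j c) (ind (P ++ c ∷ R) w)) (cong (λ e → (iᵢ *ᵢ e) *ᵢ ind (P ++ c ∷ R) w) (sym (ε-anti i j c)))
  three : ∀ a b c u v t w → coeff ((a , u) ∷ (b , v) ∷ (c , t) ∷ []) w ≡ (a *ᵢ ind u w) +ᵢ ((b *ᵢ ind v w) +ᵢ ((c *ᵢ ind t w) +ᵢ 0ᵢ))
  three a b c u v t w = trans (coeff-∷ a u ((b , v) ∷ (c , t) ∷ []) w) (cong ((a *ᵢ ind u w) +ᵢ_) (trans (coeff-∷ b v ((c , t) ∷ []) w) (cong ((b *ᵢ ind v w) +ᵢ_) (coeff-∷ c t [] w))))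
  go zero (suc zero) = null ((1ᵢ , P , zero , R) ∷ []) λ w → trans (rs 5 (λ a b x y z → a :- (b :+ (con 0ᵢ :* x :+ (con 0ᵢ :* y :+ con iᵢ :* z))) := con 1ᵢ :* a :+ (con (-ᵢ 1ᵢ) :* b :+ (con (-ᵢ iᵢ) :* z :+ con 0ᵢ))) refl
    (ind (P ++ x₁ ∷ x₂ ∷ R) w) (ind (P ++ x₂ ∷ x₁ ∷ R) w) (ind (P ++ x₁ ∷ R) w) (ind (P ++ x₂ ∷ R) w) (ind (P ++ x₃ ∷ R) w)) (sym (three 1ᵢ (-ᵢ 1ᵢ) (-ᵢ iᵢ) (P ++ x₁ ∷ x₂ ∷ R) (P ++ x₂ ∷ x₁ ∷ R) (P ++ x₃ ∷ R) w))
  go (suc zero) (suc (suc zero)) = null ((1ᵢ , P , suc zero , R) ∷ []) λ w → trans (rs 5 (λ a b x y z → a :- (b :+ (con iᵢ :* x :+ (con 0ᵢ :* y :+ con 0ᵢ :* z))) := con 1ᵢ :* a :+ (con (-ᵢ 1ᵢ) :* b :+ (con (-ᵢ iᵢ) :* x :+ con 0ᵢ))) refl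
    (ind (P ++ x₂ ∷ x₃ ∷ R) w) (ind (P ++ x₃ ∷ x₂ ∷ R) w) (ind (P ++ x₁ ∷ R) w) (ind (P ++ x₂ ∷ R) w) (ind (P ++ x₃ ∷ R) w)) (sym (three 1ᵢ (-ᵢ 1ᵢ) (-ᵢ iᵢ) (P ++ x₂ ∷ x₃ ∷ R) (P ++ x₃ ∷ x₂ ∷ R) (P ++ x₁ ∷ R) w))
  go (suc (suc zero)) zero = null ((1ᵢ , P , suc (suc zero) , R) ∷ []) λ w → trans (rs 5 (λ a b x y z → a :- (b :+ (con 0ᵢ :* x :+ (con iᵢ :* y :+ con 0ᵢ :* z))) := con 1ᵢ :* a :+ (con (-ᵢ 1ᵢ) :* b :+ (con (-ᵢ iᵢ) :* y :+ con 0ᵢ))) refl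
    (ind (P ++ x₃ ∷ x₁ ∷ R) w) (ind (P ++ x₁ ∷ x₃ ∷ R) w) (ind (P ++ x₁ ∷ R) w) (ind (P ++ x₂ ∷ R) w) (ind (P ++ x₃ ∷ R) w)) (sym (three 1ᵢ (-ᵢ 1ᵢ) (-ᵢ iᵢ) (P ++ x₃ ∷ x₁ ∷ R) (P ++ x₁ ∷ x₃ ∷ R) (P ++ x₂ ∷ R) w))
  go (suc zero) zero = flip zero (suc zero) (go zero (suc zero))
  go (suc (suc zero)) (suc zero) = flip (suc zero) (suc (suc zero)) (go (suc zero) (suc (suc zero)))
  go zero (suc (suc zero)) = flip (suc (suc zero)) zero (go (suc (suc zero)) zero)
  go zero zero = null [] λ w → rs 4 (λ a x y z → a :- (a :+ (con 0ᵢ :* x :+ (con 0ᵢ :* y :+ con 0ᵢ :* z))) := con 0ᵢ) refl (ind (P ++ x₁ ∷ x₁ ∷ R) w) (ind (P ++ x₁ ∷ R) w) (ind (P ++ x₂ ∷ R) w) (ind (P ++ x₃ ∷ R) w)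
  go (suc zero) (suc zero) = null [] λ w → rs 4 (λ a x y z → a :- (a :+ (con 0ᵢ :* x :+ (con 0ᵢ :* y :+ con 0ᵢ :* z))) := con 0ᵢ) refl (ind (P ++ x₂ ∷ x₂ ∷ R) w) (ind (P ++ x₁ ∷ R) w) (ind (P ++ x₂ ∷ R) w) (ind (P ++ x₃ ∷ R) w)
  go (suc (suc zero)) (suc (suc zero)) = null [] λ w → rs 4 (λ a x y z → a :- (a :+ (con 0ᵢ :* x :+ (con 0ᵢ :* y :+ con 0ᵢ :* z))) := con 0ᵢ) refl (ind (P ++ x₃ ∷ x₃ ∷ R) w) (ind (P ++ x₁ ∷ R) w) (ind (P ++ x₂ ∷ R) w) (ind (P ++ x₃ ∷ R) w)

½ᵢ : ℚᵢ
½ᵢ = Data.Rational.½ +i 0ℚ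
  where import Data.Rational

-- Antisymmetry of ε turns the sum over `p` and `q` into half a sum of commutators. The second ε,
-- from the structure constants, is contracted over two indices and gives twice a delta, which
-- absorbs the factor one half.
contract-word : ∀ P R r → Null (λ w → S3 (λ p → S3 λ q → ε p q r *ᵢ ind (P ++ p ∷ q ∷ R) w) +ᵢ (-ᵢ (iᵢ *ᵢ ind (P ++ r ∷ R) w)))
contract-word P R r = Null-resp eq (Null-* ½ᵢ (Null-S3 λ p → Null-S3 λ q → Null-* (ε p q r) (Null-bracket P R p q)))
  where
  eq : ∀ w → ½ᵢ *ᵢ S3 (λ p → S3 λ q → ε p q r *ᵢ bracket P R p q w) ≡ S3 (λ p → S3 λ q → ε p q r *ᵢ ind (P ++ p ∷ q ∷ R) w) +ᵢ (-ᵢ (iᵢ *ᵢ ind (P ++ r ∷ R) w))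
  eq w = trans (cong (½ᵢ *ᵢ_) sumN) half
    where
    t : Fin 3 → Fin 3 → ℚᵢ
    t p q = ind (P ++ p ∷ q ∷ R) w
    u : Fin 3 → ℚᵢ
    u c = ind (P ++ c ∷ R) w
    A : ℚᵢ
    A = S3 λ p → S3 λ q → ε p q r *ᵢ t p q
    C : Fin 3 → Fin 3 → ℚᵢ
    C p q = S3 λ c → (iᵢ *ᵢ ε p q c) *ᵢ u c
    E1 E2 E3 : Fin 3 → Fin 3 → ℚᵢ
    E1 p q = ε p q r *ᵢ t p q
    E2 p q = ε q p r *ᵢ t q p
    E3 p q = ε p q r *ᵢ C p q
    F : Fin 3 → Fin 3 → Fin 3 → ℚᵢ
    F p q c = ε p q r *ᵢ (iᵢ *ᵢ ε p q c)
    sumN : S3 (λ p → S3 λ q → ε p q r *ᵢ bracket P R p q w) ≡ (A +ᵢ A) +ᵢ (-ᵢ ((1ᵢ +ᵢ 1ᵢ) *ᵢ (iᵢ *ᵢ u r)))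
    sumN = begin
      S3 (λ p → S3 λ q → ε p q r *ᵢ (t p q +ᵢ (-ᵢ (t q p +ᵢ C p q))))
        ≡⟨ S3-cong (λ p → S3-cong λ q → trans (rs 4 (λ e x y s → e :* (x :- (y :+ s)) := e :* x :+ (:- (e :* y) :+ :- (e :* s))) refl (ε p q r) (t p q) (t q p) (C p q))
             (cong (λ z → E1 p q +ᵢ (z +ᵢ (-ᵢ E3 p q))) (trans (rs 2 (λ e y → :- (e :* y) := (:- e) :* y) refl (ε p q r) (t q p)) (cong (_*ᵢ t q p) (sym (ε-anti p q r)))))) ⟩
      S3 (λ p → S3 λ q → E1 p q +ᵢ (E2 p q +ᵢ (-ᵢ E3 p q)))
        ≡⟨ S3-cong (λ p → trans (S3-+ (E1 p) (λ q → E2 p q +ᵢ (-ᵢ E3 p q))) (cong (S3 (E1 p) +ᵢ_) (trans (S3-+ (E2 p) (λ q → -ᵢ E3 p q)) (cong (S3 (E2 p) +ᵢ_) (S3-neg (E3 p)))))) ⟩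
      S3 (λ p → S3 (E1 p) +ᵢ (S3 (E2 p) +ᵢ (-ᵢ S3 (E3 p))))
        ≡⟨ trans (S3-+ (λ p → S3 (E1 p)) (λ p → S3 (E2 p) +ᵢ (-ᵢ S3 (E3 p)))) (cong (A +ᵢ_) (trans (S3-+ (λ p → S3 (E2 p)) (λ p → -ᵢ S3 (E3 p))) (cong₂ _+ᵢ_ (S3-swap E2) (S3-neg (λ p → S3 (E3 p)))))) ⟩
      A +ᵢ (A +ᵢ (-ᵢ S3 λ p → S3 (E3 p)))
        ≡⟨ cong (λ z → A +ᵢ (A +ᵢ (-ᵢ z))) last ⟩
      A +ᵢ (A +ᵢ (-ᵢ ((1ᵢ +ᵢ 1ᵢ) *ᵢ (iᵢ *ᵢ u r)))) ≡⟨ rs 2 (λ a b → a :+ (a :+ b) := (a :+ a) :+ b) refl A (-ᵢ ((1ᵢ +ᵢ 1ᵢ) *ᵢ (iᵢ *ᵢ u r))) ⟩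
      (A +ᵢ A) +ᵢ (-ᵢ ((1ᵢ +ᵢ 1ᵢ) *ᵢ (iᵢ *ᵢ u r))) ∎
      where
      open ≡-Reasoning
      last : S3 (λ p → S3 (E3 p)) ≡ (1ᵢ +ᵢ 1ᵢ) *ᵢ (iᵢ *ᵢ u r)
      last = begin
        S3 (λ p → S3 (E3 p))
          ≡⟨ S3-cong (λ p → trans (S3-cong λ q → trans (sym (S3-* (ε p q r) (λ c → (iᵢ *ᵢ ε p q c) *ᵢ u c))) (S3-cong λ c → rs 3 (λ e f x → e :* (f :* x) := x :* (e :* f)) refl (ε p q r) (iᵢ *ᵢ ε p q c) (u c))) (S3-swap (λ q c → u c *ᵢ F p q c))) ⟩
        S3 (λ p → S3 λ c → S3 λ q → u c *ᵢ F p q c) ≡⟨ S3-swap (λ p c → S3 λ q → u c *ᵢ F p q c) ⟩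
        S3 (λ c → S3 λ p → S3 λ q → u c *ᵢ F p q c)
          ≡⟨ S3-cong (λ c → trans (S3-cong λ p → S3-* (u c) (λ q → F p q c)) (trans (S3-* (u c) (λ p → S3 λ q → F p q c)) (trans (cong (u c *ᵢ_) (ε-ε2 r c)) (rs 2 (λ x d → x :* (con (1ᵢ +ᵢ 1ᵢ) :* (con iᵢ :* d)) := (con (1ᵢ +ᵢ 1ᵢ) :* con iᵢ) :* (d :* x)) refl (u c) (δ r c))))) ⟩
        S3 (λ c → ((1ᵢ +ᵢ 1ᵢ) *ᵢ iᵢ) *ᵢ (δ r c *ᵢ u c)) ≡⟨ trans (S3-* ((1ᵢ +ᵢ 1ᵢ) *ᵢ iᵢ) (λ c → δ r c *ᵢ u c)) (cong (((1ᵢ +ᵢ 1ᵢ) *ᵢ iᵢ) *ᵢ_) (S3-δ r u)) ⟩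
        ((1ᵢ +ᵢ 1ᵢ) *ᵢ iᵢ) *ᵢ u r ≡⟨ rs 1 (λ x → (con (1ᵢ +ᵢ 1ᵢ) :* con iᵢ) :* x := con (1ᵢ +ᵢ 1ᵢ) :* (con iᵢ :* x)) refl (u r) ⟩
        (1ᵢ +ᵢ 1ᵢ) *ᵢ (iᵢ *ᵢ u r) ∎
    half : ½ᵢ *ᵢ ((A +ᵢ A) +ᵢ (-ᵢ ((1ᵢ +ᵢ 1ᵢ) *ᵢ (iᵢ *ᵢ u r)))) ≡ A +ᵢ (-ᵢ (iᵢ *ᵢ u r))
    half = rs 2 (λ a b → con ½ᵢ :* ((a :+ a) :+ :- (con (1ᵢ +ᵢ 1ᵢ) :* (con iᵢ :* b))) := a :+ :- (con iᵢ :* b)) refl A (u r)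

-- Commuting the leg with the letter `z` produces a second ε, and `ε-ε` resolves the product of the
-- two: `z` is matched with `q` or, with the opposite sign, with `r`.
move-word : ∀ P R q r z → Null (λ w → S3 (λ p → ε p q r *ᵢ ind (P ++ p ∷ z ∷ R) w) +ᵢ
  (-ᵢ (S3 (λ p → ε p q r *ᵢ ind (P ++ z ∷ p ∷ R) w) +ᵢ (iᵢ *ᵢ ((δ q z *ᵢ ind (P ++ r ∷ R) w) +ᵢ (-ᵢ (δ r z *ᵢ ind (P ++ q ∷ R) w)))))))
move-word P R q r z = Null-resp eq (Null-S3 λ p → Null-* (ε p q r) (Null-bracket P R p z))
  where
  eq : ∀ w → S3 (λ p → ε p q r *ᵢ bracket P R p z w) ≡ S3 (λ p → ε p q r *ᵢ ind (P ++ p ∷ z ∷ R) w) +ᵢ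
    (-ᵢ (S3 (λ p → ε p q r *ᵢ ind (P ++ z ∷ p ∷ R) w) +ᵢ (iᵢ *ᵢ ((δ q z *ᵢ ind (P ++ r ∷ R) w) +ᵢ (-ᵢ (δ r z *ᵢ ind (P ++ q ∷ R) w))))))
  eq w = lhs
    where
    t t' u : Fin 3 → ℚᵢ
    t p = ind (P ++ p ∷ z ∷ R) w
    t' p = ind (P ++ z ∷ p ∷ R) w
    u c = ind (P ++ c ∷ R) w
    C : Fin 3 → ℚᵢ
    C p = S3 λ c → (iᵢ *ᵢ ε p z c) *ᵢ u c
    F : Fin 3 → Fin 3 → ℚᵢ
    F p c = ε p q r *ᵢ (iᵢ *ᵢ ε p z c)
    open ≡-Reasoning
    last : S3 (λ p → ε p q r *ᵢ C p) ≡ iᵢ *ᵢ ((δ q z *ᵢ u r) +ᵢ (-ᵢ (δ r z *ᵢ u q)))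
    last = begin
      S3 (λ p → ε p q r *ᵢ C p)
        ≡⟨ trans (S3-cong λ p → trans (sym (S3-* (ε p q r) (λ c → (iᵢ *ᵢ ε p z c) *ᵢ u c))) (S3-cong λ c → rs 3 (λ e f x → e :* (f :* x) := x :* (e :* f)) refl (ε p q r) (iᵢ *ᵢ ε p z c) (u c))) (S3-swap (λ p c → u c *ᵢ F p c)) ⟩
      S3 (λ c → S3 λ p → u c *ᵢ F p c)
        ≡⟨ S3-cong (λ c → trans (S3-* (u c) (λ p → F p c)) (trans (cong (u c *ᵢ_) (ε-ε q r z c)) (rs 5 (λ x a b c d → x :* (con iᵢ :* (a :* b :+ :- (c :* d))) := con iᵢ :* (a :* (b :* x) :+ (:- c) :* (d :* x))) refl (u c) (δ q z) (δ r c) (δ r z) (δ q c)))) ⟩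
      S3 (λ c → iᵢ *ᵢ ((δ q z *ᵢ (δ r c *ᵢ u c)) +ᵢ ((-ᵢ δ r z) *ᵢ (δ q c *ᵢ u c))))
        ≡⟨ S3-* iᵢ (λ c → (δ q z *ᵢ (δ r c *ᵢ u c)) +ᵢ ((-ᵢ δ r z) *ᵢ (δ q c *ᵢ u c))) ⟩
      iᵢ *ᵢ S3 (λ c → (δ q z *ᵢ (δ r c *ᵢ u c)) +ᵢ ((-ᵢ δ r z) *ᵢ (δ q c *ᵢ u c)))
        ≡⟨ cong (iᵢ *ᵢ_) (trans (S3-+ (λ c → δ q z *ᵢ (δ r c *ᵢ u c)) (λ c → (-ᵢ δ r z) *ᵢ (δ q c *ᵢ u c))) (cong₂ _+ᵢ_ (trans (S3-* (δ q z) (λ c → δ r c *ᵢ u c)) (cong (δ q z *ᵢ_) (S3-δ r u)))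
             (trans (S3-* (-ᵢ δ r z) (λ c → δ q c *ᵢ u c)) (trans (cong ((-ᵢ δ r z) *ᵢ_) (S3-δ q u)) (rs 2 (λ a b → (:- a) :* b := :- (a :* b)) refl (δ r z) (u q)))))) ⟩
      iᵢ *ᵢ ((δ q z *ᵢ u r) +ᵢ (-ᵢ (δ r z *ᵢ u q))) ∎
    middle : ℚᵢ
    middle = S3 (λ p → ε p q r *ᵢ t p) +ᵢ (-ᵢ (S3 (λ p → ε p q r *ᵢ t' p) +ᵢ (iᵢ *ᵢ ((δ q z *ᵢ u r) +ᵢ (-ᵢ (δ r z *ᵢ u q))))))
    lhs : S3 (λ p → ε p q r *ᵢ bracket P R p z w) ≡ middle
    lhs = begin
      S3 (λ p → ε p q r *ᵢ (t p +ᵢ (-ᵢ (t' p +ᵢ C p))))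
        ≡⟨ S3-cong (λ p → rs 4 (λ e x y s → e :* (x :- (y :+ s)) := e :* x :+ :- (e :* y :+ e :* s)) refl (ε p q r) (t p) (t' p) (C p)) ⟩
      S3 (λ p → (ε p q r *ᵢ t p) +ᵢ (-ᵢ ((ε p q r *ᵢ t' p) +ᵢ (ε p q r *ᵢ C p))))
        ≡⟨ S3-+ (λ p → ε p q r *ᵢ t p) (λ p → -ᵢ ((ε p q r *ᵢ t' p) +ᵢ (ε p q r *ᵢ C p))) ⟩
      S3 (λ p → ε p q r *ᵢ t p) +ᵢ S3 (λ p → -ᵢ ((ε p q r *ᵢ t' p) +ᵢ (ε p q r *ᵢ C p)))
        ≡⟨ cong (S3 (λ p → ε p q r *ᵢ t p) +ᵢ_) (trans (S3-neg (λ p → (ε p q r *ᵢ t' p) +ᵢ (ε p q r *ᵢ C p))) (cong -ᵢ_ (trans (S3-+ (λ p → ε p q r *ᵢ t' p) (λ p → ε p q r *ᵢ C p)) (cong (S3 (λ p → ε p q r *ᵢ t' p) +ᵢ_) last)))) ⟩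
      middle ∎

-- Sums over assignments of values to labels

sumL : {A : Set} → List A → (A → ℚᵢ) → ℚᵢ
sumL [] f = 0ᵢ
sumL (a ∷ as) f = f a +ᵢ sumL as f

sumL-cong : {A : Set} (as : List A) {f g : A → ℚᵢ} → (∀ a → f a ≡ g a) → sumL as f ≡ sumL as g
sumL-cong [] h = refl
sumL-cong (a ∷ as) h = cong₂ _+ᵢ_ (h a) (sumL-cong as h)

sumL-+ : {A : Set} (as : List A) (f g : A → ℚᵢ) → sumL as (λ a → f a +ᵢ g a) ≡ sumL as f +ᵢ sumL as g
sumL-+ [] f g = refl
sumL-+ (a ∷ as) f g = trans (cong ((f a +ᵢ g a) +ᵢ_) (sumL-+ as f g)) (rs 4 (λ x y s t → (x :+ y) :+ (s :+ t) := (x :+ s) :+ (y :+ t)) refl (f a) (g a) (sumL as f) (sumL as g))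

sumL-* : {A : Set} (as : List A) (c : ℚᵢ) (f : A → ℚᵢ) → sumL as (λ a → c *ᵢ f a) ≡ c *ᵢ sumL as f
sumL-* [] c f = rs 1 (λ c → con 0ᵢ := c :* con 0ᵢ) refl c
sumL-* (a ∷ as) c f = trans (cong ((c *ᵢ f a) +ᵢ_) (sumL-* as c f)) (rs 3 (λ c x s → c :* x :+ c :* s := c :* (x :+ s)) refl c (f a) (sumL as f))

Env : ℕ → Set
Env K = Fin K → Fin 3

tot : (Env k → ℚᵢ) → ℚᵢ
tot {k} = sumL (assignments k)

tot-suc : (f : Env (suc k) → ℚᵢ) → tot f ≡ tot λ φ → S3 λ c → f (extend c φ)
tot-suc {k} f = go (assignments k)
  where
  go : ∀ as → sumL (concatMap (λ φ → extend x₁ φ ∷ extend x₂ φ ∷ extend x₃ φ ∷ []) as) f ≡ sumL as λ φ → S3 λ c → f (extend c φ)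
  go [] = refl
  go (φ ∷ as) = trans (cong (λ z → f (extend x₁ φ) +ᵢ (f (extend x₂ φ) +ᵢ (f (extend x₃ φ) +ᵢ z))) (go as))
    (rs 4 (λ x y z s → x :+ (y :+ (z :+ s)) := (x :+ (y :+ z)) :+ s) refl (f (extend x₁ φ)) (f (extend x₂ φ)) (f (extend x₃ φ)) (sumL as λ φ → S3 λ c → f (extend c φ)))

tot-cong : {f g : Env k → ℚᵢ} → (∀ φ → f φ ≡ g φ) → tot f ≡ tot g
tot-cong {k} = sumL-cong (assignments k)

tot-* : (c : ℚᵢ) (f : Env k → ℚᵢ) → tot (λ φ → c *ᵢ f φ) ≡ c *ᵢ tot f
tot-* {k} = sumL-* (assignments k)

tot-+ : (f g : Env k → ℚᵢ) → tot (λ φ → f φ +ᵢ g φ) ≡ tot f +ᵢ tot g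
tot-+ {k} = sumL-+ (assignments k)

tot-neg : (f : Env k → ℚᵢ) → tot (λ φ → -ᵢ f φ) ≡ -ᵢ tot f
tot-neg f = trans (tot-cong λ φ → rs 1 (λ x → :- x := con (-ᵢ 1ᵢ) :* x) refl (f φ)) (trans (tot-* (-ᵢ 1ᵢ) f) (rs 1 (λ x → con (-ᵢ 1ᵢ) :* x := :- x) refl (tot f)))

tot-− : (f g : Env k → ℚᵢ) → tot (λ φ → f φ +ᵢ (-ᵢ g φ)) ≡ tot f +ᵢ (-ᵢ tot g)
tot-− f g = trans (tot-+ f (λ φ → -ᵢ g φ)) (cong (tot f +ᵢ_) (tot-neg g))

Null-tot : {F : Env k → Word → ℚᵢ} → (∀ φ → Null (F φ)) → Null (λ w → tot λ φ → F φ w)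
Null-tot {k} {F} h = go (assignments k)
  where
  go : ∀ as → Null (λ w → sumL as λ φ → F φ w)
  go [] = Null-0
  go (φ ∷ as) = Null-+ (h φ) (go as)

3ᵢ : ℚᵢ
3ᵢ = 1ᵢ +ᵢ (1ᵢ +ᵢ 1ᵢ)

upd : Env k → Fin k → Fin 3 → Env k
upd φ l c x = if eqb l x then c else φ x

upd-hit : (φ : Env k) (l : Fin k) (c : Fin 3) → upd φ l c l ≡ c
upd-hit φ l c = cong (λ b → if b then c else φ l) (eqb-refl l)

upd-miss : (φ : Env k) {l : Fin k} (c : Fin 3) {x : Fin k} → l ≢ x → upd φ l c x ≡ φ x
upd-miss φ {l} c {x} n = cong (λ b → if b then c else φ x) (eqb-≢ {a = l} {x} n)

map-upd : (φ : Env k) (l : Fin k) (c : Fin 3) (w : Wd k) → count l w ≡ 0 → map (upd φ l c) w ≡ map φ w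
map-upd φ l c [] z = refl
map-upd φ l c (x ∷ w) z with l ≟ᶠ x
... | no n = cong (_ ∷_) (map-upd φ l c w z)

-- Assignments are functions, and updating them in different orders gives only pointwise equal ones;
-- a summand has to take the same value on these.
Ext : (Env k → ℚᵢ) → Set
Ext f = ∀ φ ψ → (∀ x → φ x ≡ ψ x) → f φ ≡ f ψ

avg : Fin k → (Env k → ℚᵢ) → Env k → ℚᵢ
avg l f φ = S3 λ c → f (upd φ l c)

upd-ext : {φ ψ : Env k} (l : Fin k) (c : Fin 3) → (∀ x → φ x ≡ ψ x) → ∀ x → upd φ l c x ≡ upd ψ l c x
upd-ext l c h x = cong (λ z → if eqb l x then c else z) (h x)

avg-ext : (l : Fin k) {f : Env k → ℚᵢ} → Ext f → Ext (avg l f)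
avg-ext l e φ ψ h = S3-cong λ c → e (upd φ l c) (upd ψ l c) (upd-ext l c h)

-- The value of `l` chosen by the outer sum is overwritten by `avg`, hence the factor 3. Read
-- backwards, this turns an idle label into a new summation index.
tot-avg : (l : Fin k) (f : Env k → ℚᵢ) → Ext f → tot (avg l f) ≡ 3ᵢ *ᵢ tot f
tot-avg {suc k} zero f e = trans (tot-suc (avg zero f)) (trans (tot-cong λ φ → trans (S3-cong λ c → S3-cong λ d → e (upd (extend c φ) zero d) (extend d φ) λ { zero → refl ; (suc x) → refl })
    (rs 1 (λ x → x :+ (x :+ x) := con 3ᵢ :* x) refl (S3 λ d → f (extend d φ)))) (trans (tot-* 3ᵢ (λ φ → S3 λ d → f (extend d φ))) (cong (3ᵢ *ᵢ_) (sym (tot-suc f)))))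
tot-avg {suc k} (suc l) f e = trans (tot-suc (avg (suc l) f)) (trans (tot-cong λ φ → trans (S3-cong λ c → S3-cong λ d → e (upd (extend c φ) (suc l) d) (extend c (upd φ l d)) (shift c φ d)) (S3-swap λ c d → f (extend c (upd φ l d))))
    (trans (tot-avg l g g-ext) (cong (3ᵢ *ᵢ_) (sym (tot-suc f)))))
  where
  g : Env k → ℚᵢ
  g φ = S3 λ c → f (extend c φ)
  shift : ∀ c φ d x → upd (extend c φ) (suc l) d x ≡ extend c (upd φ l d) x
  shift c φ d zero = refl
  shift c φ d (suc x) with l ≟ᶠ x
  ... | yes _ = refl
  ... | no _ = refl
  g-ext : Ext g
  g-ext φ ψ h = S3-cong λ c → e (extend c φ) (extend c ψ) λ { zero → refl ; (suc x) → h x }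

-- Weights of words with a trivalent vertex

-- The weight of a word of labels, and the same with a trivalent vertex joining the letters p, q, r.

I : Wd k → Word → ℚᵢ
I u w = tot λ φ → ind (map φ u) w

J : Fin k → Fin k → Fin k → Wd k → Word → ℚᵢ
J p q r u w = tot λ φ → ε (φ p) (φ q) (φ r) *ᵢ ind (map φ u) w

coeff-wsl2 : (D : Wd k) → ∀ w → coeff (wsl2 D) w ≡ I D w
coeff-wsl2 {k} D w = go (assignments k)
  where
  go : ∀ as → coeff (map (λ φ → 1ᵢ , map φ D) as) w ≡ sumL as λ φ → ind (map φ D) w
  go [] = refl
  go (φ ∷ as) = trans (coeff-∷ 1ᵢ (map φ D) (map (λ φ → 1ᵢ , map φ D) as) w) (cong₂ _+ᵢ_ (rs 1 (λ x → con 1ᵢ :* x := x) refl (ind (map φ D) w)) (go as))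

J-ext : (p q r : Fin k) (u : Wd k) (w : Word) → Ext λ φ → ε (φ p) (φ q) (φ r) *ᵢ ind (map φ u) w
J-ext p q r u w φ ψ h = cong₂ _*ᵢ_ (trans (cong₂ (λ x y → ε x y (φ r)) (h p) (h q)) (cong (ε (ψ p) (ψ q)) (h r))) (cong (λ v → ind v w) (map-cong h u))

J-anti : (p q r : Fin k) (u : Wd k) → ∀ w → J q p r u w ≡ -ᵢ J p q r u w
J-anti p q r u w = trans (tot-cong λ φ → trans (cong (_*ᵢ ind (map φ u) w) (ε-anti (φ p) (φ q) (φ r))) (rs 2 (λ a b → (:- a) :* b := :- (a :* b)) refl (ε (φ p) (φ q) (φ r)) (ind (map φ u) w))) (tot-neg λ φ → ε (φ p) (φ q) (φ r) *ᵢ ind (map φ u) w)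

J-cyclic : (p q r : Fin k) (u : Wd k) → ∀ w → J p q r u w ≡ J q r p u w
J-cyclic p q r u w = tot-cong λ φ → cong (_*ᵢ ind (map φ u) w) (ε-cyclic (φ p) (φ q) (φ r))

swap-letters : (a b e : Fin k) (P R : Wd k) → count e P ≡ 0 → count e R ≡ 0 → e ≢ a → e ≢ b →
  Null λ w → I (P ++ a ∷ b ∷ R) w +ᵢ (-ᵢ (I (P ++ b ∷ a ∷ R) w +ᵢ (iᵢ *ᵢ (3ᵢ *ᵢ J e a b (P ++ e ∷ R) w))))
swap-letters a b e P R eP eR ea eb = Null-resp eq (Null-tot λ φ → Null-bracket (map φ P) (map φ R) (φ a) (φ b))
  where
  eq : ∀ w → tot (λ φ → bracket (map φ P) (map φ R) (φ a) (φ b) w) ≡ I (P ++ a ∷ b ∷ R) w +ᵢ (-ᵢ (I (P ++ b ∷ a ∷ R) w +ᵢ (iᵢ *ᵢ (3ᵢ *ᵢ J e a b (P ++ e ∷ R) w))))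
  eq w = trans (tot-− f (λ φ → g φ +ᵢ h φ)) (cong₂ (λ x y → x +ᵢ (-ᵢ y)) (tot-cong λ φ → cong (λ v → ind v w) (sym (map-++ φ P (a ∷ b ∷ R))))
      (trans (tot-+ g h) (cong₂ _+ᵢ_ (tot-cong λ φ → cong (λ v → ind v w) (sym (map-++ φ P (b ∷ a ∷ R)))) (trans (tot-cong hj) (trans (tot-* iᵢ (avg e j)) (cong (iᵢ *ᵢ_) (tot-avg e j (J-ext e a b (P ++ e ∷ R) w))))))))
    where
    f g h j : Env _ → ℚᵢ
    f φ = ind (map φ P ++ φ a ∷ φ b ∷ map φ R) w
    g φ = ind (map φ P ++ φ b ∷ φ a ∷ map φ R) w
    h φ = S3 λ c → (iᵢ *ᵢ ε (φ a) (φ b) c) *ᵢ ind (map φ P ++ c ∷ map φ R) w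
    j φ = ε (φ e) (φ a) (φ b) *ᵢ ind (map φ (P ++ e ∷ R)) w
    hj : ∀ φ → h φ ≡ iᵢ *ᵢ avg e j φ
    hj φ = trans (S3-cong λ c → trans (rs 3 (λ i e x → (i :* e) :* x := i :* (e :* x)) refl iᵢ (ε (φ a) (φ b) c) (ind (map φ P ++ c ∷ map φ R) w)) (cong (iᵢ *ᵢ_) (sym (at c)))) (S3-* iᵢ (λ c → j (upd φ e c)))
      where
      at : ∀ c → j (upd φ e c) ≡ ε (φ a) (φ b) c *ᵢ ind (map φ P ++ c ∷ map φ R) w
      at c = cong₂ _*ᵢ_ (trans (cong3 ε (upd-hit φ e c) (upd-miss φ c ea) (upd-miss φ c eb)) (ε-cyclic c (φ a) (φ b)))
        (cong (λ v → ind v w) (trans (map-++ (upd φ e c) P (e ∷ R)) (cong3 (λ u x v → u ++ x ∷ v) (map-upd φ e c P eP) (upd-hit φ e c) (map-upd φ e c R eR))))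

-- `contract-word` summed over all assignments. In the word without the vertex both `p` and `q` are
-- idle, hence the two factors 3.
contract : (p q r : Fin k) (P R : Wd k) → count p P ≡ 0 → count p R ≡ 0 → count q P ≡ 0 → count q R ≡ 0 → p ≢ q → p ≢ r → q ≢ r →
  Null λ w → (3ᵢ *ᵢ (3ᵢ *ᵢ J p q r (P ++ p ∷ q ∷ R) w)) +ᵢ (-ᵢ (iᵢ *ᵢ I (P ++ r ∷ R) w))
contract p q r P R pP pR qP qR pq pr qr = Null-resp eq (Null-tot λ φ → contract-word (map φ P) (map φ R) (φ r))
  where
  eq : ∀ w → tot (λ φ → S3 (λ c → S3 λ d → ε c d (φ r) *ᵢ ind (map φ P ++ c ∷ d ∷ map φ R) w) +ᵢ (-ᵢ (iᵢ *ᵢ ind (map φ P ++ φ r ∷ map φ R) w))) ≡ (3ᵢ *ᵢ (3ᵢ *ᵢ J p q r (P ++ p ∷ q ∷ R) w)) +ᵢ (-ᵢ (iᵢ *ᵢ I (P ++ r ∷ R) w))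
  eq w = trans (tot-− (λ φ → S3 λ c → S3 λ d → s φ c d) (λ φ → iᵢ *ᵢ ind (map φ P ++ φ r ∷ map φ R) w)) (cong₂ (λ x y → x +ᵢ (-ᵢ y))
      (trans (tot-cong λ φ → S3-cong λ c → S3-cong λ d → sym (at φ c d)) (trans (tot-avg p (avg q j) (avg-ext q ej)) (cong (3ᵢ *ᵢ_) (tot-avg q j ej))))
      (trans (tot-cong λ φ → cong (λ v → iᵢ *ᵢ ind v w) (sym (map-++ φ P (r ∷ R)))) (tot-* iᵢ (λ φ → ind (map φ (P ++ r ∷ R)) w))))
    where
    s : Env _ → Fin 3 → Fin 3 → ℚᵢ
    s φ c d = ε c d (φ r) *ᵢ ind (map φ P ++ c ∷ d ∷ map φ R) w
    j : Env _ → ℚᵢ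
    j φ = ε (φ p) (φ q) (φ r) *ᵢ ind (map φ (P ++ p ∷ q ∷ R)) w
    ej : Ext j
    ej = J-ext p q r (P ++ p ∷ q ∷ R) w
    at : ∀ φ c d → j (upd (upd φ p c) q d) ≡ s φ c d
    at φ c d = cong₂ _*ᵢ_ (cong3 ε vp vq (trans (upd-miss (upd φ p c) d qr) (upd-miss φ c pr)))
        (cong (λ v → ind v w) (trans (map-++ (upd (upd φ p c) q d) P (p ∷ q ∷ R)) (cong₂ _++_ (two-upd P qP pP) (cong3 (λ x y v → x ∷ y ∷ v) vp vq (two-upd R qR pR)))))
      where
      vp : upd (upd φ p c) q d p ≡ c
      vp = trans (upd-miss (upd φ p c) d (pq ∘ sym)) (upd-hit φ p c)
      vq : upd (upd φ p c) q d q ≡ d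
      vq = upd-hit (upd φ p c) q d
      two-upd : ∀ v → count q v ≡ 0 → count p v ≡ 0 → map (upd (upd φ p c) q d) v ≡ map φ v
      two-upd v zq zp = trans (map-upd (upd φ p c) q d v zq) (map-upd φ p c v zp)

ren : Fin k → Fin k → Fin k → Fin k
ren z q x = if eqb z x then q else x

ren-map : (φ : Env k) (z q : Fin k) (u : Wd k) → map (upd φ z (φ q)) u ≡ map φ (map (ren z q) u)
ren-map φ z q [] = refl
ren-map φ z q (x ∷ u) = cong₂ _∷_ (push (eqb z x)) (ren-map φ z q u)
  where
  push : ∀ b → (if b then φ q else φ x) ≡ φ (if b then q else x)
  push true = refl
  push false = refl

-- Each delta in `move-word` identifies the label `z` with the leg `q` or `r`, which is the renaming
-- `ren z q` or `ren z r`: the remaining end of `z` fuses with that leg to a chord, and the other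
-- leg takes the place of `p`. In these terms `p` and `z` are idle, hence the two factors 3.
move-leg : (p q r z : Fin k) (P R : Wd k) → count p P ≡ 0 → count p R ≡ 0 → p ≢ q → p ≢ r → p ≢ z → z ≢ q → z ≢ r →
  Null λ w → (3ᵢ *ᵢ (3ᵢ *ᵢ J p q r (P ++ p ∷ z ∷ R) w)) +ᵢ (-ᵢ ((3ᵢ *ᵢ (3ᵢ *ᵢ J p q r (P ++ z ∷ p ∷ R) w)) +ᵢ
    (iᵢ *ᵢ (I (map (ren z q) (P ++ r ∷ R)) w +ᵢ (-ᵢ I (map (ren z r) (P ++ q ∷ R)) w)))))
move-leg {k} p q r z P R pP pR pq pr pz zq zr = Null-resp eq (Null-tot λ φ → Null-S3 λ d → move-word (map (upd φ z d) P) (map (upd φ z d) R) (φ q) (φ r) d)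
  where
  A B : Env _ → Fin 3 → Fin 3 → Word → ℚᵢ
  A φ d c w = ε c (φ q) (φ r) *ᵢ ind (map (upd φ z d) P ++ c ∷ d ∷ map (upd φ z d) R) w
  B φ d c w = ε c (φ q) (φ r) *ᵢ ind (map (upd φ z d) P ++ d ∷ c ∷ map (upd φ z d) R) w
  G : Env _ → Fin 3 → Fin 3 → Word → ℚᵢ
  G φ x d w = ind (map (upd φ z d) P ++ x ∷ map (upd φ z d) R) w
  eq : ∀ w → tot (λ φ → S3 λ d → S3 (λ c → A φ d c w) +ᵢ (-ᵢ (S3 (λ c → B φ d c w) +ᵢ (iᵢ *ᵢ ((δ (φ q) d *ᵢ G φ (φ r) d w) +ᵢ (-ᵢ (δ (φ r) d *ᵢ G φ (φ q) d w))))))) ≡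
    (3ᵢ *ᵢ (3ᵢ *ᵢ J p q r (P ++ p ∷ z ∷ R) w)) +ᵢ (-ᵢ ((3ᵢ *ᵢ (3ᵢ *ᵢ J p q r (P ++ z ∷ p ∷ R) w)) +ᵢ (iᵢ *ᵢ (I (map (ren z q) (P ++ r ∷ R)) w +ᵢ (-ᵢ I (map (ren z r) (P ++ q ∷ R)) w)))))
  eq w = trans (tot-cong inside) (trans (tot-− SA (λ φ → SB φ +ᵢ (iᵢ *ᵢ (V1 φ +ᵢ (-ᵢ V2 φ))))) (cong₂ (λ x y → x +ᵢ (-ᵢ y)) (legs (p ∷ z ∷ []) atA)
      (trans (tot-+ SB (λ φ → iᵢ *ᵢ (V1 φ +ᵢ (-ᵢ V2 φ)))) (cong₂ _+ᵢ_ (legs (z ∷ p ∷ []) atB) (trans (tot-* iᵢ (λ φ → V1 φ +ᵢ (-ᵢ V2 φ))) (cong (iᵢ *ᵢ_) (tot-− V1 V2)))))))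
    where
    SA SB V1 V2 : Env _ → ℚᵢ
    SA φ = S3 λ d → S3 λ c → A φ d c w
    SB φ = S3 λ d → S3 λ c → B φ d c w
    V1 φ = ind (map φ (map (ren z q) (P ++ r ∷ R))) w
    V2 φ = ind (map φ (map (ren z r) (P ++ q ∷ R))) w
    word : ∀ φ x y → z ≢ y → G φ (φ y) (φ x) w ≡ ind (map φ (map (ren z x) (P ++ y ∷ R))) w
    word φ x y zy = cong (λ v → ind v w) (trans (cong (λ t → map (upd φ z (φ x)) P ++ t ∷ map (upd φ z (φ x)) R) (sym (upd-miss φ (φ x) zy))) (trans (sym (map-++ (upd φ z (φ x)) P (y ∷ R))) (ren-map φ z x (P ++ y ∷ R))))
    inside : ∀ φ → S3 (λ d → S3 (λ c → A φ d c w) +ᵢ (-ᵢ (S3 (λ c → B φ d c w) +ᵢ (iᵢ *ᵢ ((δ (φ q) d *ᵢ G φ (φ r) d w) +ᵢ (-ᵢ (δ (φ r) d *ᵢ G φ (φ q) d w))))))) ≡ SA φ +ᵢ (-ᵢ (SB φ +ᵢ (iᵢ *ᵢ (V1 φ +ᵢ (-ᵢ V2 φ)))))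
    inside φ = trans (S3-+ a1 (λ d → -ᵢ (b1 d +ᵢ (iᵢ *ᵢ (g1 d +ᵢ (-ᵢ g2 d)))))) (cong (SA φ +ᵢ_) (trans (S3-neg (λ d → b1 d +ᵢ (iᵢ *ᵢ (g1 d +ᵢ (-ᵢ g2 d))))) (cong -ᵢ_
        (trans (S3-+ b1 (λ d → iᵢ *ᵢ (g1 d +ᵢ (-ᵢ g2 d)))) (cong (SB φ +ᵢ_) (trans (S3-* iᵢ (λ d → g1 d +ᵢ (-ᵢ g2 d))) (cong (iᵢ *ᵢ_) (trans (S3-+ g1 (λ d → -ᵢ g2 d))
          (cong₂ _+ᵢ_ (trans (S3-δ (φ q) (λ d → G φ (φ r) d w)) (word φ q r zr)) (trans (S3-neg g2) (cong -ᵢ_ (trans (S3-δ (φ r) (λ d → G φ (φ q) d w)) (word φ r q zq)))))))))))))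
      where
      a1 b1 g1 g2 : Fin 3 → ℚᵢ
      a1 d = S3 λ c → A φ d c w
      b1 d = S3 λ c → B φ d c w
      g1 d = δ (φ q) d *ᵢ G φ (φ r) d w
      g2 d = δ (φ r) d *ᵢ G φ (φ q) d w
    module _ (φ : Env k) (d c : Fin 3) where
      ψ : Env _
      ψ = upd (upd φ z d) p c
      vp : ψ p ≡ c
      vp = upd-hit (upd φ z d) p c
      vz : ψ z ≡ d
      vz = trans (upd-miss (upd φ z d) c pz) (upd-hit φ z d)
      vε : ε (ψ p) (ψ q) (ψ r) ≡ ε c (φ q) (φ r)
      vε = cong3 ε vp (trans (upd-miss (upd φ z d) c pq) (upd-miss φ d zq)) (trans (upd-miss (upd φ z d) c pr) (upd-miss φ d zr))
      atA : ε (ψ p) (ψ q) (ψ r) *ᵢ ind (map ψ (P ++ (p ∷ z ∷ []) ++ R)) w ≡ A φ d c w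
      atA = cong₂ _*ᵢ_ vε (cong (λ v → ind v w) (trans (map-++ ψ P (p ∷ z ∷ R)) (cong₂ _++_ (map-upd (upd φ z d) p c P pP) (cong3 (λ x y v → x ∷ y ∷ v) vp vz (map-upd (upd φ z d) p c R pR)))))
      atB : ε (ψ p) (ψ q) (ψ r) *ᵢ ind (map ψ (P ++ (z ∷ p ∷ []) ++ R)) w ≡ B φ d c w
      atB = cong₂ _*ᵢ_ vε (cong (λ v → ind v w) (trans (map-++ ψ P (z ∷ p ∷ R)) (cong₂ _++_ (map-upd (upd φ z d) p c P pP) (cong3 (λ x y v → x ∷ y ∷ v) vz vp (map-upd (upd φ z d) p c R pR)))))
    legs : ∀ (m : List (Fin _)) {C : Env _ → Fin 3 → Fin 3 → ℚᵢ} →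
      (∀ φ d c → ε (ψ φ d c p) (ψ φ d c q) (ψ φ d c r) *ᵢ ind (map (ψ φ d c) (P ++ m ++ R)) w ≡ C φ d c) →
      tot (λ φ → S3 λ d → S3 λ c → C φ d c) ≡ 3ᵢ *ᵢ (3ᵢ *ᵢ J p q r (P ++ m ++ R) w)
    legs m at = trans (tot-cong λ φ → S3-cong λ d → S3-cong λ c → sym (at φ d c)) (trans (tot-avg z (avg p (λ φ → ε (φ p) (φ q) (φ r) *ᵢ ind (map φ (P ++ m ++ R)) w)) (avg-ext p (J-ext p q r (P ++ m ++ R) w)))
      (cong (3ᵢ *ᵢ_) (tot-avg p (λ φ → ε (φ p) (φ q) (φ r) *ᵢ ind (map φ (P ++ m ++ R)) w) (J-ext p q r (P ++ m ++ R) w))))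

-- Reversing a share does not change the weight

module CS {A : Set} = CMSolver (++-commutativeMonoid {A = A})
open CS using () renaming (solve to cs; _⊕_ to _⊗_; _⊜_ to _≜_)

pair-out : (p : Fin k) (w : Wd k) → DO (p ∷ p ∷ w) → count p w ≡ 0
pair-out p w d with d p
... | inj₁ z = ⊥-elim (head≢0' (p ∷ w) z)
  where
  head≢0' : ∀ w → count p (p ∷ w) ≢ 0
  head≢0' w e = case trans (sym e) (count-head p w) of λ ()
... | inj₂ z = ℕ.suc-injective (ℕ.suc-injective (trans (sym (trans (count-head p (p ∷ w)) (cong suc (count-head p w)))) z))

DO-drop2 : (p : Fin k) (w : Wd k) → DO (p ∷ p ∷ w) → DO w
DO-drop2 p w d x with x ≟ᶠ p
... | yes refl = inj₁ (pair-out x w d)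
... | no n = subst (λ c → (c ≡ 0) ⊎ (c ≡ 2)) (trans (count-other n (p ∷ w)) (count-other n w)) (d x)

DO-add2 : (p : Fin k) (w : Wd k) → count p w ≡ 0 → DO w → DO (p ∷ p ∷ w)
DO-add2 p w z d x with x ≟ᶠ p
... | yes refl = inj₂ (cong (2 +_) z)
... | no n = d x

DO-↭ : {u v : Wd k} → u ↭ v → DO u → DO v
DO-↭ {u = u} {v} p = DO-resp u v λ a → count-↭ a p

no-triple : (p : Fin k) (w : Wd k) → ¬ DO (p ∷ p ∷ p ∷ w)
no-triple p w d = case trans (sym (pair-out p (p ∷ w) d)) (count-head p w) of λ ()

once-more : {p x : Fin k} (w : Wd k) → p ≢ x → count p (x ∷ w) ≡ 0 → count p w ≡ 0
once-more w n z = trans (sym (count-other n w)) z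

count-ren : (z q x : Fin k) (w : Wd k) → z ≢ q → x ≢ q → count x (map (ren z q) w) ≢ 0 → x ≢ z × count x (map (ren z q) w) ≡ count x w
count-ren z q x w zq xq n = x≢z , go w x≢z
  where
  gone : ∀ w → count z (map (ren z q) w) ≡ 0
  gone [] = refl
  gone (y ∷ w) with z ≟ᶠ y
  ... | yes _ = trans (count-other zq (map (ren z q) w)) (gone w)
  ... | no n = trans (count-other n (map (ren z q) w)) (gone w)
  x≢z : x ≢ z
  x≢z refl = n (gone w)
  go : ∀ w → x ≢ z → count x (map (ren z q) w) ≡ count x w
  go [] xz = refl
  go (y ∷ w) xz with z ≟ᶠ y
  ... | yes refl = trans (count-other xq (map (ren z q) w)) (trans (go w xz) (sym (count-other xz w)))
  ... | no _ = cong (λ c → if eqb x y then suc c else c) (go w xz)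

count-ren-target : (z q : Fin k) (w : Wd k) → z ≢ q → count q (map (ren z q) w) ≡ count z w + count q w
count-ren-target z q [] zq = refl
count-ren-target z q (y ∷ w) zq with z ≟ᶠ y
... | yes refl = trans (count-head q (map (ren z q) w)) (cong suc (trans (count-ren-target z q w zq) (cong (count z w +_) (sym (count-other (zq ∘ sym) w)))))
... | no _ with q ≟ᶠ y
...   | yes refl = trans (cong suc (count-ren-target z q w zq)) (sym (ℕ.+-suc (count z w) (count q w)))
...   | no _ = count-ren-target z q w zq

-- The hypothesis counts one end of `z` and one of `q` outside `w`, so each of them has one end in
-- `w`; the renaming makes these the two ends of one chord.
DO-ren : (z q : Fin k) (w : Wd k) → z ≢ q → DO (z ∷ q ∷ w) → DO (map (ren z q) w)
DO-ren z q w zq d x with x ≟ᶠ q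
... | yes refl = inj₂ (trans (count-ren-target z x w zq) (cong₂ _+_ (is-one z zc) (is-one x xc)))
  where
  zc : count z (z ∷ x ∷ w) ≡ suc (count z w)
  zc = trans (count-head z (x ∷ w)) (cong suc (count-other zq w))
  xc : count x (z ∷ x ∷ w) ≡ suc (count x w)
  xc = trans (count-other (zq ∘ sym) (x ∷ w)) (count-head x w)
  is-one : ∀ y → count y (z ∷ x ∷ w) ≡ suc (count y w) → count y w ≡ 1
  is-one y e with d y
  ... | inj₁ q = case trans (sym e) q of λ ()
  ... | inj₂ q = ℕ.suc-injective (trans (sym e) q)
... | no xq with nonzero-or x (map (ren z q) w)
...   | inj₁ e = inj₁ e
...   | inj₂ n = let xz , e = count-ren z q x w zq xq n in subst (λ c → (c ≡ 0) ⊎ (c ≡ 2)) (trans (trans (count-other xz (q ∷ w)) (count-other xq w)) (sym e)) (d x)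

map-ren-0 : (z q : Fin k) (w : Wd k) → count z w ≡ 0 → map (ren z q) w ≡ w
map-ren-0 z q [] e = refl
map-ren-0 z q (y ∷ w) e with z ≟ᶠ y
... | no _ = cong (y ∷_) (map-ren-0 z q w e)

module Strands (X Y Z : Wd k) where

  -- The flag `s` records whether `A` is the first or the second strand, so that an argument about
  -- letters of `A` also covers those of the other strand.
  T2 : Bool → Wd k → Wd k → Wd k
  T2 true A B = X ++ A ++ Y ++ B ++ Z
  T2 false A B = X ++ B ++ Y ++ A ++ Z

  Lf Rt : Bool → Wd k → Wd k → Wd k
  Lf true U B = X ++ U
  Lf false U B = X ++ B ++ Y ++ U
  Rt true V B = V ++ Y ++ B ++ Z
  Rt false V B = V ++ Z

  focus : ∀ s U m V B → T2 s (U ++ m ++ V) B ≡ Lf s U B ++ m ++ Rt s V B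
  focus true U m V B = ls 5 (λ x u m v r → x & (u & m & v) & r ⊜ (x & u) & m & v & r) refl X U m V (Y ++ B ++ Z)
  focus false U m V B = ls 7 (λ x b y u m v z → x & b & y & (u & m & v) & z ⊜ (x & b & y & u) & m & v & z) refl X B Y U m V Z

  Off : Fin k → Set
  Off x = count x X ≡ 0 × count x Y ≡ 0 × count x Z ≡ 0

  count-T2 : ∀ s A B x → Off x → count x (T2 s A B) ≡ count x (A ++ B)
  count-T2 true A B x (a , b , c) = trans (count5 x X A Y B Z) (trans (cong3 (λ m n o → m + (count x A + (n + (count x B + o)))) a b c) (trans (cong (count x A +_) (ℕ.+-identityʳ (count x B))) (sym (count-++ x A B))))
  count-T2 false A B x (a , b , c) = trans (count5 x X B Y A Z) (trans (cong3 (λ m n o → m + (count x B + (n + (count x A + o)))) a b c) (trans (trans (cong (count x B +_) (ℕ.+-identityʳ (count x A))) (ℕ.+-comm (count x B) (count x A))) (sym (count-++ x A B))))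

  count-rev : ∀ (A B : Wd k) (x : Fin k) → count x (rev A ++ rev B) ≡ count x (A ++ B)
  count-rev A B x = trans (count-++ x (rev A) (rev B)) (trans (cong₂ _+_ (count-reverse x A) (count-reverse x B)) (sym (count-++ x A B)))

  map-T2 : ∀ s z q A B → Off z → map (ren z q) (T2 s A B) ≡ T2 s (map (ren z q) A) (map (ren z q) B)
  map-T2 true z q A B (a , b , c) = five-parts z q X A Y B Z a b c
    where
    five-parts : ∀ (z q : Fin k) (X A Y B Z : Wd k) → count z X ≡ 0 → count z Y ≡ 0 → count z Z ≡ 0 → map (ren z q) (X ++ A ++ Y ++ B ++ Z) ≡ X ++ map (ren z q) A ++ Y ++ map (ren z q) B ++ Z
    five-parts z q X A Y B Z a b c = trans (map-++ (ren z q) X _) (cong₂ _++_ (map-ren-0 z q X a) (trans (map-++ (ren z q) A _) (cong (map (ren z q) A ++_) (trans (map-++ (ren z q) Y _) (cong₂ _++_ (map-ren-0 z q Y b) (trans (map-++ (ren z q) B Z) (cong (map (ren z q) B ++_) (map-ren-0 z q Z c))))))))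
  map-T2 false z q A B o = map-T2 true z q B A o

  Inner : Wd k → Set
  Inner w = ∀ x → count x w ≢ 0 → Off x

  Inner-↭ : {u v : Wd k} → u ↭ v → Inner u → Inner v
  Inner-↭ p i x n = i x λ e → n (trans (sym (count-↭ x p)) e)

  Inner-sub : ∀ u w → Inner (u ++ w) → Inner w
  Inner-sub u w i x n = i x λ e → n (proj₂ (zeros x u w e))

  Inner-ren : ∀ z q w → z ≢ q → Inner (z ∷ q ∷ w) → Inner (map (ren z q) w)
  Inner-ren z q w zq i x n with x ≟ᶠ q
  ... | yes refl = i x λ e → case trans (sym e) (trans (count-other (zq ∘ sym) (x ∷ w)) (count-head x w)) of λ ()
  ... | no xq = let xz , e = count-ren z q x w zq xq n in i x λ c → n (trans e (trans (sym (trans (count-other xz (q ∷ w)) (count-other xq w))) c))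

  -- By the field `twos` each of the three labels occurs just once on the strands; its other end is
  -- counted as the end at the vertex.
  record Legs (p q r : Fin k) (A B : Wd k) : Set where
    constructor legs
    field
      p≢q : p ≢ q
      p≢r : p ≢ r
      q≢r : q ≢ r
      twos : DO (p ∷ q ∷ r ∷ A ++ B)
      inside : Inner (p ∷ q ∷ r ∷ A ++ B)

  Reversible : ℕ → Set
  Reversible n = ∀ s A B e → length (A ++ B) < n → DO (A ++ B) → Inner (A ++ B) → Off e → count e (A ++ B) ≡ 0 →
    Null λ w → I (T2 s A B) w +ᵢ (-ᵢ I (T2 s (rev A) (rev B)) w)

  record Anti (p q r : Fin k) (s : Bool) (A B : Wd k) : Set where
    constructor anti
    field
      cancels : Null λ w → J p q r (T2 s A B) w +ᵢ J p q r (T2 s (rev A) (rev B)) w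

  ninth : ℚᵢ
  ninth = (ℤ.+ 1 Data.Rational./ 9) +i 0ℚ
    where
    import Data.Rational
    import Data.Integer as ℤ

  focus-rev : ∀ s U m V B → T2 s (rev (U ++ m ++ V)) (rev B) ≡ Lf s (rev V) (rev B) ++ rev m ++ Rt s (rev U) (rev B)
  focus-rev s U m V B = trans (cong (λ A → T2 s A (rev B)) (reverse3 U m V)) (focus s (rev V) (rev m) (rev U) (rev B))

  sides : ∀ s (U : Wd k) (r : Fin k) (V B : Wd k) (p : Fin k) → Off p → count p ((U ++ r ∷ V) ++ B) ≡ 0 → (count p (Lf s U B) ≡ 0 × count p (Rt s V B) ≡ 0) × (count p (Lf s (rev V) (rev B)) ≡ 0 × count p (Rt s (rev U) (rev B)) ≡ 0)
  sides s U r V B p o z = around (Lf s U B) (Rt s V B) (trans (cong (count p) (sym (focus s U [ r ] V B))) (trans (count-T2 s (U ++ r ∷ V) B p o) z)) ,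
      around (Lf s (rev V) (rev B)) (Rt s (rev U) (rev B)) (trans (cong (count p) (sym (focus-rev s U [ r ] V B))) (trans (count-T2 s (rev (U ++ r ∷ V)) (rev B) p o) zʳ))
    where
    zʳ : count p (rev (U ++ r ∷ V) ++ rev B) ≡ 0
    zʳ = trans (count-rev (U ++ r ∷ V) B p) z
    around : ∀ (L R : Wd k) → count p (L ++ r ∷ R) ≡ 0 → count p L ≡ 0 × count p R ≡ 0
    around L R e with zeros p L (r ∷ R) e
    ... | a , b = a , proj₂ (zeros p [ r ] R b)

  length-mid : ∀ (U m V : Wd k) B → length ((U ++ m ++ V) ++ B) ≡ length m + length ((U ++ V) ++ B)
  length-mid U m V B = trans (length-++ (U ++ m ++ V)) (trans (cong (_+ length B) (trans (length-++ U) (cong (length U +_) (length-++ m))))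
    (trans (arith (length U) (length m) (length V) (length B)) (cong (length m +_) (sym (trans (length-++ (U ++ V)) (cong (_+ length B) (length-++ U)))))))
    where
    arith : ∀ u m v b → (u + (m + v)) + b ≡ m + ((u + v) + b)
    arith = ℕRing.solve-∀

  shorter : ∀ {n} (U m V : Wd k) (x : Fin k) B → length m ≡ 2 → length ((U ++ m ++ V) ++ B) ≤ n → length ((U ++ x ∷ V) ++ B) < n
  shorter {n} U m V x B e le = subst (_≤ n) (trans (length-mid U m V B) (trans (cong (_+ length ((U ++ V) ++ B)) e) (cong suc (sym (length-mid U [ x ] V B))))) le

  module Vertex (n : ℕ) (ih : Reversible n) where

    -- Two adjacent legs contract to a single letter, which leaves a shorter share covered by `ih`.
    -- Reversal exchanges the two legs and thereby changes the sign of ε.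
    adjacent-legs : ∀ s U V B p q r → Legs p q r (U ++ p ∷ q ∷ V) B → length ((U ++ p ∷ q ∷ V) ++ B) ≤ n → Anti p q r s (U ++ p ∷ q ∷ V) B
    adjacent-legs s U V B p q r (legs pq pr qr d i) le = anti (Null-resp (λ w → ring (cong (λ u → J p q r u w) (focus s U (p ∷ q ∷ []) V B)) (trans (cong (λ u → J p q r u w) (focus-rev s U (p ∷ q ∷ []) V B)) (J-anti q p r (L' ++ q ∷ p ∷ R') w)) (cong (λ u → I u w) (focus s U [ r ] V B)) (cong (λ u → I u w) (focus-rev s U [ r ] V B))) (Null-* ninth (Null-+ (Null-+ forth (Null-* (-ᵢ 1ᵢ) back)) (Null-* iᵢ rec))))
      where
      w1 : Wd k
      w1 = (U ++ r ∷ V) ++ B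
      π : p ∷ q ∷ r ∷ (U ++ p ∷ q ∷ V) ++ B ↭ p ∷ p ∷ q ∷ q ∷ w1
      π = cs 6 (λ p q r u v b → p ⊗ q ⊗ r ⊗ (u ⊗ p ⊗ q ⊗ v) ⊗ b ≜ p ⊗ p ⊗ q ⊗ q ⊗ (u ⊗ r ⊗ v) ⊗ b) ↭-refl [ p ] [ q ] [ r ] U V B
      d2 : DO (q ∷ q ∷ w1)
      d2 = DO-drop2 p (q ∷ q ∷ w1) (DO-↭ π d)
      zp : count p w1 ≡ 0
      zp = once-more w1 pq (once-more (q ∷ w1) pq (pair-out p (q ∷ q ∷ w1) (DO-↭ π d)))
      zq : count q w1 ≡ 0
      zq = pair-out q w1 d2
      oP : Off p
      oP = i p λ e → case trans (sym e) (count-head p (q ∷ r ∷ (U ++ p ∷ q ∷ V) ++ B)) of λ ()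
      oQ : Off q
      oQ = i q λ e → case trans (sym e) (trans (count-other (pq ∘ sym) (q ∷ r ∷ (U ++ p ∷ q ∷ V) ++ B)) (count-head q (r ∷ (U ++ p ∷ q ∷ V) ++ B))) of λ ()
      L R L' R' : Wd k
      L = Lf s U B
      R = Rt s V B
      L' = Lf s (rev V) (rev B)
      R' = Rt s (rev U) (rev B)
      sp = sides s U r V B p oP zp
      sq = sides s U r V B q oQ zq
      forth = contract p q r L R (proj₁ (proj₁ sp)) (proj₂ (proj₁ sp)) (proj₁ (proj₁ sq)) (proj₂ (proj₁ sq)) pq pr qr
      back = contract q p r L' R' (proj₁ (proj₂ sq)) (proj₂ (proj₂ sq)) (proj₁ (proj₂ sp)) (proj₂ (proj₂ sp)) (pq ∘ sym) qr pr
      -- The label `p` has disappeared from the contracted share and can be its spare label.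
      rec = ih s (U ++ r ∷ V) B p (shorter U (p ∷ q ∷ []) V r B refl le) (DO-drop2 q w1 d2) (Inner-sub (p ∷ p ∷ q ∷ q ∷ []) w1 (Inner-↭ π i)) oP zp
      ring : ∀ {j j1 j' j1' a a1 b b1} → j ≡ j1 → j' ≡ -ᵢ j1' → a ≡ a1 → b ≡ b1 →
        ninth *ᵢ ((((3ᵢ *ᵢ (3ᵢ *ᵢ j1)) +ᵢ (-ᵢ (iᵢ *ᵢ a1))) +ᵢ ((-ᵢ 1ᵢ) *ᵢ ((3ᵢ *ᵢ (3ᵢ *ᵢ j1')) +ᵢ (-ᵢ (iᵢ *ᵢ b1))))) +ᵢ (iᵢ *ᵢ (a +ᵢ (-ᵢ b)))) ≡ j +ᵢ j'
      ring {j} {_} {_} {j'} {a} {_} {b} refl refl refl refl = rs 4 (λ j j' a b → con ninth :* (((con 3ᵢ :* (con 3ᵢ :* j) :+ :- (con iᵢ :* a)) :+ con (-ᵢ 1ᵢ) :* (con 3ᵢ :* (con 3ᵢ :* j') :+ :- (con iᵢ :* b))) :+ con iᵢ :* (a :+ :- b)) := j :+ :- j') refl j j' a b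

    -- In the reversed word the leg passes `z` in the opposite direction. The correction terms of
    -- `move-leg`, which have no vertex, therefore enter with opposite signs, and by `ih` they agree
    -- for the shorter share and its reversal.
    move-step : ∀ s U N B p q r z → Legs p q r (U ++ p ∷ z ∷ N) B → z ≢ p → z ≢ q → z ≢ r → length ((U ++ p ∷ z ∷ N) ++ B) ≤ n →
      Anti p q r s (U ++ z ∷ p ∷ N) B → Anti p q r s (U ++ p ∷ z ∷ N) B
    move-step s U N B p q r z (legs pq pr qr d i) zp zq zr le (anti shifted) =
      anti (Null-resp (λ w → ring (cong (λ u → J p q r u w) (focus s U (p ∷ z ∷ []) N B)) (cong (λ u → J p q r u w) (focus-rev s U (p ∷ z ∷ []) N B)) (cong (λ u → J p q r u w) (focus s U (z ∷ p ∷ []) N B)) (cong (λ u → J p q r u w) (focus-rev s U (z ∷ p ∷ []) N B)) (I (map (ren z q) (L ++ r ∷ R)) w) (I (map (ren z r) (L ++ q ∷ R)) w) (I (map (ren z q) (L' ++ r ∷ R')) w) (I (map (ren z r) (L' ++ q ∷ R')) w)) (Null-* ninth (Null-+ (Null-+ forth (Null-* (-ᵢ 1ᵢ) back)) (Null-+ (Null-* (3ᵢ *ᵢ 3ᵢ) shifted) (Null-* iᵢ (Null-+ (rec q r πq zq pq) (Null-* (-ᵢ 1ᵢ) (rec r q πr zr pr))))))))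
      where
      πq : p ∷ q ∷ r ∷ (U ++ p ∷ z ∷ N) ++ B ↭ p ∷ p ∷ z ∷ q ∷ (U ++ r ∷ N) ++ B
      πq = cs 7 (λ p q r z u v b → p ⊗ q ⊗ r ⊗ (u ⊗ p ⊗ z ⊗ v) ⊗ b ≜ p ⊗ p ⊗ z ⊗ q ⊗ (u ⊗ r ⊗ v) ⊗ b) ↭-refl [ p ] [ q ] [ r ] [ z ] U N B
      πr : p ∷ q ∷ r ∷ (U ++ p ∷ z ∷ N) ++ B ↭ p ∷ p ∷ z ∷ r ∷ (U ++ q ∷ N) ++ B
      πr = cs 7 (λ p q r z u v b → p ⊗ q ⊗ r ⊗ (u ⊗ p ⊗ z ⊗ v) ⊗ b ≜ p ⊗ p ⊗ z ⊗ r ⊗ (u ⊗ q ⊗ v) ⊗ b) ↭-refl [ p ] [ q ] [ r ] [ z ] U N B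
      oP : Off p
      oP = i p λ e → case trans (sym e) (count-head p (q ∷ r ∷ (U ++ p ∷ z ∷ N) ++ B)) of λ ()
      oZ : Off z
      oZ = Inner-sub (p ∷ p ∷ []) (z ∷ q ∷ (U ++ r ∷ N) ++ B) (Inner-↭ πq i) z λ e → case trans (sym e) (count-head z (q ∷ (U ++ r ∷ N) ++ B)) of λ ()
      L R L' R' : Wd k
      L = Lf s U B
      R = Rt s N B
      L' = Lf s (rev N) (rev B)
      R' = Rt s (rev U) (rev B)
      zeroP : ∀ x y → p ∷ q ∷ r ∷ (U ++ p ∷ z ∷ N) ++ B ↭ p ∷ p ∷ z ∷ x ∷ (U ++ y ∷ N) ++ B → p ≢ x → count p ((U ++ y ∷ N) ++ B) ≡ 0
      zeroP x y π px = once-more ((U ++ y ∷ N) ++ B) px (once-more (x ∷ (U ++ y ∷ N) ++ B) (zp ∘ sym) (pair-out p (z ∷ x ∷ (U ++ y ∷ N) ++ B) (DO-↭ π d)))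
      sp = sides s U r N B p oP (zeroP q r πq pq)
      forth = move-leg p q r z L R (proj₁ (proj₁ sp)) (proj₂ (proj₁ sp)) pq pr (zp ∘ sym) zq zr
      back = move-leg p q r z L' R' (proj₁ (proj₂ sp)) (proj₂ (proj₂ sp)) pq pr (zp ∘ sym) zq zr
      rec : ∀ x y → p ∷ q ∷ r ∷ (U ++ p ∷ z ∷ N) ++ B ↭ p ∷ p ∷ z ∷ x ∷ (U ++ y ∷ N) ++ B → z ≢ x → p ≢ x →
        Null λ w → I (map (ren z x) (L ++ y ∷ R)) w +ᵢ (-ᵢ I (map (ren z x) (L' ++ y ∷ R')) w)
      rec x y π zx px = Null-resp (λ w → cong₂ (λ u v → I u w +ᵢ (-ᵢ I v w)) fwd bwd) (ih s A1 B1 p len (subst DO split (DO-ren z x w1 zx (DO-drop2 p (z ∷ x ∷ w1) (DO-↭ π d)))) (subst Inner split (Inner-ren z x w1 zx (Inner-sub (p ∷ p ∷ []) (z ∷ x ∷ w1) (Inner-↭ π i)))) oP spare)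
        where
        w1 A1 B1 : Wd k
        w1 = (U ++ y ∷ N) ++ B
        A1 = map (ren z x) (U ++ y ∷ N)
        B1 = map (ren z x) B
        split : map (ren z x) w1 ≡ A1 ++ B1
        split = map-++ (ren z x) (U ++ y ∷ N) B
        len : length (A1 ++ B1) < n
        len = subst (_< n) (trans (sym (length-map (ren z x) w1)) (cong length split)) (shorter U (p ∷ z ∷ []) N y B refl le)
        spare : count p (A1 ++ B1) ≡ 0
        spare with nonzero-or p (map (ren z x) w1)
        ... | inj₁ e = trans (cong (count p) (sym split)) e
        ... | inj₂ m = ⊥-elim (m (trans (proj₂ (count-ren z x p w1 zx px m)) (zeroP x y π px)))
        fwd : T2 s A1 B1 ≡ map (ren z x) (L ++ y ∷ R)
        fwd = trans (sym (map-T2 s z x (U ++ y ∷ N) B oZ)) (cong (map (ren z x)) (focus s U [ y ] N B))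
        bwd : T2 s (rev A1) (rev B1) ≡ map (ren z x) (L' ++ y ∷ R')
        bwd = trans (cong₂ (T2 s) (sym (reverse-map (ren z x) (U ++ y ∷ N))) (sym (reverse-map (ren z x) B))) (trans (sym (map-T2 s z x (rev (U ++ y ∷ N)) (rev B) oZ)) (cong (map (ren z x)) (focus-rev s U [ y ] N B)))
      ring : ∀ {j j1 j' j1' l l1 l' l1'} → j ≡ j1 → j' ≡ j1' → l ≡ l1 → l' ≡ l1' → ∀ a b a' b' →
        ninth *ᵢ ((((3ᵢ *ᵢ (3ᵢ *ᵢ j1)) +ᵢ (-ᵢ ((3ᵢ *ᵢ (3ᵢ *ᵢ l1)) +ᵢ (iᵢ *ᵢ (a +ᵢ (-ᵢ b)))))) +ᵢ ((-ᵢ 1ᵢ) *ᵢ ((3ᵢ *ᵢ (3ᵢ *ᵢ l1')) +ᵢ (-ᵢ ((3ᵢ *ᵢ (3ᵢ *ᵢ j1')) +ᵢ (iᵢ *ᵢ (a' +ᵢ (-ᵢ b'))))))))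
          +ᵢ (((3ᵢ *ᵢ 3ᵢ) *ᵢ (l +ᵢ l')) +ᵢ (iᵢ *ᵢ ((a +ᵢ (-ᵢ a')) +ᵢ ((-ᵢ 1ᵢ) *ᵢ (b +ᵢ (-ᵢ b'))))))) ≡ j +ᵢ j'
      ring {j} {_} {j'} {_} {l} {_} {l'} refl refl refl refl a b a' b' = rs 8 (λ j j' l l' a b a' b' →
        con ninth :* (((con 3ᵢ :* (con 3ᵢ :* j) :+ :- (con 3ᵢ :* (con 3ᵢ :* l) :+ con iᵢ :* (a :+ :- b))) :+ con (-ᵢ 1ᵢ) :* (con 3ᵢ :* (con 3ᵢ :* l') :+ :- (con 3ᵢ :* (con 3ᵢ :* j') :+ con iᵢ :* (a' :+ :- b'))))
          :+ ((con 3ᵢ :* con 3ᵢ) :* (l :+ l') :+ con iᵢ :* ((a :+ :- a') :+ con (-ᵢ 1ᵢ) :* (b :+ :- b')))) := j :+ j') refl j j' l l' a b a' b'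

    Anti-cyclic : ∀ {p q r s A B} → Anti q r p s A B → Anti p q r s A B
    Anti-cyclic {p} {q} {r} {s} {A} {B} (anti h) = anti (Null-resp (λ w → sym (cong₂ _+ᵢ_ (J-cyclic p q r (T2 s A B) w) (J-cyclic p q r (T2 s (rev A) (rev B)) w))) h)

    Anti-swap : ∀ {p q r s A B} → Anti q p r s A B → Anti p q r s A B
    Anti-swap {p} {q} {r} {s} {A} {B} (anti h) = anti (Null-resp (λ w → ring {a' = J q p r (T2 s A B) w} {b' = J q p r (T2 s (rev A) (rev B)) w} (J-anti q p r (T2 s A B) w) (J-anti q p r (T2 s (rev A) (rev B)) w)) (Null-* (-ᵢ 1ᵢ) h))
      where
      ring : ∀ {a a' b b'} → a ≡ -ᵢ a' → b ≡ -ᵢ b' → (-ᵢ 1ᵢ) *ᵢ (a' +ᵢ b') ≡ a +ᵢ b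
      ring {a' = a} {b' = b} refl refl = rs 2 (λ a b → con (-ᵢ 1ᵢ) :* (a :+ b) := (:- a) :+ (:- b)) refl a b

    -- The leg `p` is moved towards `q` across the letters of `M`. If the third leg `r` is met on
    -- the way, then `p` and `r` are adjacent, and the symmetries of ε reduce this to
    -- `adjacent-legs`.
    core : ∀ s M U V B p q r → Legs p q r (U ++ p ∷ M ++ q ∷ V) B → length ((U ++ p ∷ M ++ q ∷ V) ++ B) ≤ n → Anti p q r s (U ++ p ∷ M ++ q ∷ V) B
    core s [] U V B p q r lg le = adjacent-legs s U V B p q r lg le
    core s (z ∷ M) U V B p q r lg@(legs pq pr qr d i) le with z ≟ᶠ r
    ... | yes refl = Anti-cyclic (Anti-cyclic (Anti-swap (adjacent-legs s U (M ++ q ∷ V) B p z q (legs pr pq (qr ∘ sym) (DO-↭ π d) (Inner-↭ π i)) le)))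
      where
      π : p ∷ q ∷ z ∷ (U ++ p ∷ z ∷ M ++ q ∷ V) ++ B ↭ p ∷ z ∷ q ∷ (U ++ p ∷ z ∷ M ++ q ∷ V) ++ B
      π = prep p (swap q z ↭-refl)
    ... | no zr = move-step s U (M ++ q ∷ V) B p q r z lg zp zq zr le (subst (λ A → Anti p q r s A B) eqA
        (core s M (U ++ [ z ]) V B p q r (subst (λ A → Legs p q r A B) (sym eqA) (legs pq pr qr (DO-↭ π d) (Inner-↭ π i))) (subst (_≤ n) (trans (length-mid U (p ∷ z ∷ []) (M ++ q ∷ V) B) (trans (sym (length-mid U (z ∷ p ∷ []) (M ++ q ∷ V) B)) (cong (λ A → length (A ++ B)) (sym eqA)))) le)))
      where
      eqA : (U ++ [ z ]) ++ p ∷ M ++ q ∷ V ≡ U ++ z ∷ p ∷ M ++ q ∷ V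
      eqA = ++-assoc U [ z ] (p ∷ M ++ q ∷ V)
      π : p ∷ q ∷ r ∷ (U ++ p ∷ z ∷ M ++ q ∷ V) ++ B ↭ p ∷ q ∷ r ∷ (U ++ z ∷ p ∷ M ++ q ∷ V) ++ B
      π = cs 7 (λ p q r z u v b → p ⊗ q ⊗ r ⊗ (u ⊗ p ⊗ z ⊗ v) ⊗ b ≜ p ⊗ q ⊗ r ⊗ (u ⊗ z ⊗ p ⊗ v) ⊗ b) ↭-refl [ p ] [ q ] [ r ] [ z ] U (M ++ q ∷ V) B
      zp : z ≢ p
      zp refl = no-triple z (q ∷ r ∷ (U ++ M ++ q ∷ V) ++ B) (DO-↭ (cs 6 (λ z q r u v b → z ⊗ q ⊗ r ⊗ (u ⊗ z ⊗ z ⊗ v) ⊗ b ≜ z ⊗ z ⊗ z ⊗ q ⊗ r ⊗ (u ⊗ v) ⊗ b) ↭-refl [ z ] [ q ] [ r ] U (M ++ q ∷ V) B) d)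
      zq : z ≢ q
      zq refl = no-triple z (p ∷ r ∷ (U ++ p ∷ M ++ V) ++ B) (DO-↭ (cs 7 (λ p z r u m v b → p ⊗ z ⊗ r ⊗ (u ⊗ p ⊗ z ⊗ m ⊗ z ⊗ v) ⊗ b ≜ z ⊗ z ⊗ z ⊗ p ⊗ r ⊗ (u ⊗ p ⊗ m ⊗ v) ⊗ b) ↭-refl [ p ] [ z ] [ r ] U M V B) d)

    both-on : ∀ s A B p q r → Legs p q r A B → length (A ++ B) ≤ n → count p A ≢ 0 → count q A ≢ 0 → Anti p q r s A B
    both-on s A B p q r lg le cp cq with locate p A cp
    ... | P , Q , refl , _ , _ with nonzero-or q P
    ...   | inj₂ m with locate q P m
    ...     | P1 , P2 , refl , _ , _ = subst (λ A → Anti p q r s A B) (sym e) (Anti-swap (core s P2 P1 Q B q p r (flip (subst (λ A → Legs p q r A B) e lg)) (subst (λ A → length (A ++ B) ≤ n) e le)))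
      where
      e : (P1 ++ q ∷ P2) ++ p ∷ Q ≡ P1 ++ q ∷ P2 ++ p ∷ Q
      e = ++-assoc P1 (q ∷ P2) (p ∷ Q)
      flip : ∀ {A : Wd k} → Legs p q r A B → Legs q p r A B
      flip {A} (legs pq pr qr d i) = legs (pq ∘ sym) qr pr (DO-↭ π d) (Inner-↭ π i)
        where
        π : p ∷ q ∷ r ∷ A ++ B ↭ q ∷ p ∷ r ∷ A ++ B
        π = swap p q ↭-refl
    both-on s A B p q r lg le cp cq | P , Q , refl , _ , _ | inj₁ z with locate q Q (λ e → cq (trans (count-++ q P (p ∷ Q)) (cong₂ _+_ z (trans (count-other (Legs.p≢q lg ∘ sym) Q) e))))
    ...     | Q1 , Q2 , refl , _ , _ = core s Q1 P Q2 B p q r lg le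

    swap-strands : ∀ {p q r A B} s → Anti p q r (not s) B A → Anti p q r s A B
    swap-strands true (anti h) = anti h
    swap-strands false (anti h) = anti h

    Legs-strands : ∀ {p q r A B} → Legs p q r A B → Legs p q r B A
    Legs-strands {p} {q} {r} {A} {B} (legs pq pr qr d i) = legs pq pr qr (DO-↭ π d) (Inner-↭ π i)
      where
      π : p ∷ q ∷ r ∷ A ++ B ↭ p ∷ q ∷ r ∷ B ++ A
      π = prep p (prep q (prep r (++-comm A B)))

    Legs-cyclic : ∀ {p q r A B} → Legs p q r A B → Legs q r p A B
    Legs-cyclic {p} {q} {r} {A} {B} (legs pq pr qr d i) = legs qr (pq ∘ sym) (pr ∘ sym) (DO-↭ π d) (Inner-↭ π i)
      where
      π : p ∷ q ∷ r ∷ A ++ B ↭ q ∷ r ∷ p ∷ A ++ B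
      π = ↭trans (swap p q ↭-refl) (prep q (swap p r ↭-refl))

    legs-first : ∀ {p q r A B} → Legs p q r A B → (count p A ≢ 0) ⊎ (count p B ≢ 0)
    legs-first {p} {q} {r} {A} {B} (legs pq pr qr d i) with nonzero-or p A | nonzero-or p B
    ... | inj₂ m | _ = inj₁ m
    ... | inj₁ _ | inj₂ m = inj₂ m
    ... | inj₁ z | inj₁ z' = ⊥-elim (case d p of λ { (inj₁ e) → case trans (sym is-one) e of λ () ; (inj₂ e) → case trans (sym is-one) e of λ () })
      where
      is-one : count p (p ∷ q ∷ r ∷ A ++ B) ≡ 1
      is-one = trans (count-head p (q ∷ r ∷ A ++ B)) (cong suc (trans (count-other pq (r ∷ A ++ B)) (trans (count-other pr (A ++ B)) (trans (count-++ p A B) (cong₂ _+_ z z')))))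

    -- two of the three legs lie on the same strand
    vertex : ∀ s A B p q r → Legs p q r A B → length (A ++ B) ≤ n → Anti p q r s A B
    vertex s A B p q r lg le = pigeon (legs-first lg) (legs-first (Legs-cyclic lg)) (legs-first (Legs-cyclic (Legs-cyclic lg)))
      where
      le' : length (B ++ A) ≤ n
      le' = subst (_≤ n) (trans (length-++ A) (trans (ℕ.+-comm (length A) (length B)) (sym (length-++ B)))) le
      lg' : Legs p q r B A
      lg' = Legs-strands lg
      pigeon : (count p A ≢ 0) ⊎ (count p B ≢ 0) → (count q A ≢ 0) ⊎ (count q B ≢ 0) → (count r A ≢ 0) ⊎ (count r B ≢ 0) → Anti p q r s A B
      pigeon (inj₁ a) (inj₁ b) _ = both-on s A B p q r lg le a b
      pigeon (inj₁ a) (inj₂ _) (inj₁ c) = Anti-cyclic (Anti-cyclic (both-on s A B r p q (Legs-cyclic (Legs-cyclic lg)) le c a))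
      pigeon (inj₁ _) (inj₂ b) (inj₂ c) = swap-strands s (Anti-cyclic (both-on (not s) B A q r p (Legs-cyclic lg') le' b c))
      pigeon (inj₂ a) (inj₂ b) _ = swap-strands s (both-on (not s) B A p q r lg' le' a b)
      pigeon (inj₂ a) (inj₁ _) (inj₂ c) = swap-strands s (Anti-cyclic (Anti-cyclic (both-on (not s) B A r p q (Legs-cyclic (Legs-cyclic lg')) le' c a)))
      pigeon (inj₂ _) (inj₁ b) (inj₁ c) = Anti-cyclic (both-on s A B q r p (Legs-cyclic lg) le b c)

  module Induction (n : ℕ) (ih : Reversible n) {e : Fin k} (oE : Off e) where

    open Vertex n ih

    defect : Bool → Wd k → Wd k → Word → ℚᵢ
    defect s A B w = I (T2 s A B) w +ᵢ (-ᵢ I (T2 s (rev A) (rev B)) w)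

    record Closed (A B : Wd k) : Set where
      constructor closed
      field
        len : length (A ++ B) ≤ n
        twos : DO (A ++ B)
        inside : Inner (A ++ B)
        spare : count e (A ++ B) ≡ 0

    Closed-↭ : ∀ {A B A' B'} → A ++ B ↭ A' ++ B' → Closed A B → Closed A' B'
    Closed-↭ π (closed l d i z) = closed (subst (_≤ n) (↭-length π) l) (DO-↭ π d) (Inner-↭ π i) (trans (sym (count-↭ e π)) z)

    record Equal (s : Bool) (A B A' B' : Wd k) : Set where
      constructor equal
      field
        isNull : Null λ w → defect s A B w +ᵢ (-ᵢ defect s A' B' w)

    Equal-refl : ∀ {s A B} → Equal s A B A B
    Equal-refl {s} {A} {B} = equal (Null-resp (λ w → rs 1 (λ x → con 0ᵢ := x :+ :- x) refl (defect s A B w)) Null-0)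

    Equal-trans : ∀ {s A B A' B' A″ B″} → Equal s A B A' B' → Equal s A' B' A″ B″ → Equal s A B A″ B″
    Equal-trans {s} {A} {B} {A'} {B'} {A″} {B″} (equal f) (equal g) = equal (Null-resp (λ w → rs 3 (λ x y z → (x :+ :- y) :+ (y :+ :- z) := x :+ :- z) refl (defect s A B w) (defect s A' B' w) (defect s A″ B″ w)) (Null-+ f g))

    -- By `swap-letters` the word and its reversal both change by a multiple of a vertex term with
    -- the new leg `e`. The two vertex terms are reversals of each other, and their sum vanishes by
    -- `vertex`.
    exchange : ∀ s P a b Q B → Closed (P ++ a ∷ b ∷ Q) B → Equal s (P ++ a ∷ b ∷ Q) B (P ++ b ∷ a ∷ Q) B
    exchange s P a b Q B (closed l d i z) with a ≟ᶠ b
    ... | yes refl = Equal-refl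
    ... | no ab = equal (Null-resp (λ w → ring (cong (λ u → I u w) (focus s P (a ∷ b ∷ []) Q B)) (cong (λ u → I u w) (focus s P (b ∷ a ∷ []) Q B)) (cong (λ u → J e a b u w) (focus s P [ e ] Q B)) (cong (λ u → I u w) (focus-rev s P (b ∷ a ∷ []) Q B)) (cong (λ u → I u w) (focus-rev s P (a ∷ b ∷ []) Q B)) (cong (λ u → J e a b u w) (focus-rev s P [ e ] Q B))) (Null-+ (Null-+ forth back) (Null-* (iᵢ *ᵢ 3ᵢ) (Anti.cancels (vertex s (P ++ e ∷ Q) B e a b lg (≤-trans (ℕ.<⇒≤ (shorter P (a ∷ b ∷ []) Q e B refl ≤-refl)) l))))))
      where
      w0 : Wd k
      w0 = (P ++ a ∷ b ∷ Q) ++ B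
      absent : ∀ x w → w ↭ x ∷ (P ++ b ∷ Q) ++ B ⊎ w ↭ x ∷ (P ++ a ∷ Q) ++ B → count e w ≡ 0 → e ≢ x
      absent x w (inj₁ π) z refl = case trans (sym (trans (sym (count-↭ e π)) z)) (count-head e ((P ++ b ∷ Q) ++ B)) of λ ()
      absent x w (inj₂ π) z refl = case trans (sym (trans (sym (count-↭ e π)) z)) (count-head e ((P ++ a ∷ Q) ++ B)) of λ ()
      πa : w0 ↭ a ∷ (P ++ b ∷ Q) ++ B
      πa = cs 5 (λ p a b q r → (p ⊗ a ⊗ b ⊗ q) ⊗ r ≜ a ⊗ (p ⊗ b ⊗ q) ⊗ r) ↭-refl P [ a ] [ b ] Q B
      πb : w0 ↭ b ∷ (P ++ a ∷ Q) ++ B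
      πb = cs 5 (λ p a b q r → (p ⊗ a ⊗ b ⊗ q) ⊗ r ≜ b ⊗ (p ⊗ a ⊗ q) ⊗ r) ↭-refl P [ a ] [ b ] Q B
      ea : e ≢ a
      ea = absent a w0 (inj₁ πa) z
      eb : e ≢ b
      eb = absent b w0 (inj₂ πb) z
      sp = sides s P b Q B e oE (once-more ((P ++ b ∷ Q) ++ B) ea (trans (sym (count-↭ e πa)) z))
      π : e ∷ e ∷ w0 ↭ e ∷ a ∷ b ∷ (P ++ e ∷ Q) ++ B
      π = cs 6 (λ e p a b q r → e ⊗ e ⊗ (p ⊗ a ⊗ b ⊗ q) ⊗ r ≜ e ⊗ a ⊗ b ⊗ (p ⊗ e ⊗ q) ⊗ r) ↭-refl [ e ] P [ a ] [ b ] Q B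
      lg : Legs e a b (P ++ e ∷ Q) B
      lg = legs ea eb ab (DO-↭ π (DO-add2 e w0 z d)) (Inner-↭ π inside)
        where
        inside : Inner (e ∷ e ∷ w0)
        inside x m with x ≟ᶠ e
        ... | yes refl = oE
        ... | no _ = i x m
      L R L' R' : Wd k
      L = Lf s P B
      R = Rt s Q B
      L' = Lf s (rev Q) (rev B)
      R' = Rt s (rev P) (rev B)
      forth = swap-letters a b e L R (proj₁ (proj₁ sp)) (proj₂ (proj₁ sp)) ea eb
      back = swap-letters a b e L' R' (proj₁ (proj₂ sp)) (proj₂ (proj₂ sp)) ea eb
      ring : ∀ {x x₁ y y1 j j1 x' x1' y' y1' j' j1'} → x ≡ x₁ → y ≡ y1 → j ≡ j1 → x' ≡ x1' → y' ≡ y1' → j' ≡ j1' →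
        ((x₁ +ᵢ (-ᵢ (y1 +ᵢ (iᵢ *ᵢ (3ᵢ *ᵢ j1))))) +ᵢ (x1' +ᵢ (-ᵢ (y1' +ᵢ (iᵢ *ᵢ (3ᵢ *ᵢ j1')))))) +ᵢ ((iᵢ *ᵢ 3ᵢ) *ᵢ (j +ᵢ j')) ≡ (x +ᵢ (-ᵢ y')) +ᵢ (-ᵢ (y +ᵢ (-ᵢ x')))
      ring {x} {_} {y} {_} {j} {_} {x'} {_} {y'} {_} {j'} refl refl refl refl refl refl = rs 6 (λ x y j x' y' j' →
        ((x :+ :- (y :+ con iᵢ :* (con 3ᵢ :* j))) :+ (x' :+ :- (y' :+ con iᵢ :* (con 3ᵢ :* j')))) :+ (con iᵢ :* con 3ᵢ) :* (j :+ j') := (x :+ :- y') :+ :- (y :+ :- x')) refl x y j x' y' j'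

    permute : ∀ s P {A A'} B → A ↭ A' → Closed (P ++ A) B → Equal s (P ++ A) B (P ++ A') B
    permute s P B refl c = Equal-refl
    permute s P {.x ∷ A} {.x ∷ A'} B (prep x π) c = subst₂ (λ u v → Equal s u B v B) (++-assoc P [ x ] A) (++-assoc P [ x ] A') (permute s (P ++ [ x ]) B π (subst (λ u → Closed u B) (sym (++-assoc P [ x ] A)) c))
    permute s P {.x ∷ .y ∷ A} {.y ∷ .x ∷ A'} B (swap x y π) c = Equal-trans (exchange s P x y A B c)
      (subst₂ (λ u v → Equal s u B v B) (++-assoc P (y ∷ x ∷ []) A) (++-assoc P (y ∷ x ∷ []) A') (permute s (P ++ y ∷ x ∷ []) B π (subst (λ u → Closed u B) (sym (++-assoc P (y ∷ x ∷ []) A)) (Closed-↭ swapped c))))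
      where
      swapped : (P ++ x ∷ y ∷ A) ++ B ↭ (P ++ y ∷ x ∷ A) ++ B
      swapped = cs 5 (λ p x y a b → (p ⊗ x ⊗ y ⊗ a) ⊗ b ≜ (p ⊗ y ⊗ x ⊗ a) ⊗ b) ↭-refl P [ x ] [ y ] A B
    permute s P {A} B (↭trans {ys = A1} π ρ) c = Equal-trans (permute s P B π c) (permute s P B ρ (Closed-↭ (++⁺ʳ B (++⁺ˡ P π)) c))

    other-strand : ∀ {A B A' B'} s → Equal (not s) B A B' A' → Equal s A B A' B'
    other-strand true (equal h) = equal h
    other-strand false (equal h) = equal h

    reversible : ∀ s A B → Closed A B → Null (defect s A B)
    reversible s A B c = Null-resp eq (Null-* ½ᵢ (Equal.isNull total))
      where
      total : Equal s A B (rev A) (rev B)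
      total = Equal-trans (permute s [] B (↭-sym (↭-reverse A)) c) (other-strand s (permute (not s) [] (rev A) (↭-sym (↭-reverse B)) (Closed-↭ (↭trans (++⁺ʳ B (↭-sym (↭-reverse A))) (++-comm (rev A) B)) c)))
      eq : ∀ w → ½ᵢ *ᵢ (defect s A B w +ᵢ (-ᵢ defect s (rev A) (rev B) w)) ≡ defect s A B w
      eq w = trans (cong (λ u → ½ᵢ *ᵢ (defect s A B w +ᵢ (-ᵢ (I (T2 s (rev A) (rev B)) w +ᵢ (-ᵢ I u w))))) (cong₂ (T2 s) (reverse-involutive A) (reverse-involutive B)))
        (rs 2 (λ x y → con ½ᵢ :* ((x :+ :- y) :+ :- (y :+ :- x)) := x :+ :- y) refl (I (T2 s A B) w) (I (T2 s (rev A) (rev B)) w))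

  -- Exchanging letters leads to a vertex on a shorter share, and the sign rule for vertices uses
  -- reversibility only of still shorter shares; this makes the induction on the length possible.
  all-reversible : ∀ n → Reversible n
  all-reversible zero s A B e () d i o z
  all-reversible (suc n) s A B e (s≤s l) d i o z = Induction.reversible n (all-reversible n) o s A B (Induction.closed l d i z)

third-part : ℚᵢ
third-part = (ℤ.+ 1 Data.Rational./ 3) +i 0ℚ
  where
  import Data.Rational
  import Data.Integer as ℤ

count-suc : (x : Fin k) (w : Wd k) → count (suc x) (map suc w) ≡ count x w
count-suc x [] = refl
count-suc x (y ∷ w) with x ≟ᶠ y
... | yes _ = cong suc (count-suc x w)
... | no _ = count-suc x w

count-zero : (w : Wd k) → count zero (map suc w) ≡ 0
count-zero [] = refl
count-zero (y ∷ w) = count-zero w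

I-suc : (u : Wd k) → ∀ w → I (map suc u) w ≡ 3ᵢ *ᵢ I u w
I-suc u w = trans (tot-suc (λ φ → ind (map φ (map suc u)) w)) (trans (tot-cong λ φ → trans (S3-cong λ c → cong (λ v → ind v w) (sym (map-∘ {g = extend c φ} {f = suc} u))) (rs 1 (λ x → x :+ (x :+ x) := con 3ᵢ :* x) refl (ind (map φ u) w)))
  (tot-* 3ᵢ (λ φ → ind (map φ u) w)))

-- All labels are shifted by `suc`, so that `zero` becomes the spare label. The shift multiplies the
-- weights by 3, which `third-part` undoes.
reversal-sound : (X A Y B Z : Wd k) → DO (X ++ A ++ Y ++ B ++ Z) → Even (A ++ B) →
  Null λ w → I (X ++ A ++ Y ++ B ++ Z) w +ᵢ (-ᵢ I (X ++ rev A ++ Y ++ rev B ++ Z) w)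
reversal-sound {k} X A Y B Z d ev = Null-resp eq (Null-* third-part (Strands.all-reversible X' Y' Z' (suc (length (A' ++ B'))) true A' B' zero ≤-refl dAB inside (count-zero X , count-zero Y , count-zero Z) (trans (count-++ zero A' B') (cong₂ _+_ (count-zero A) (count-zero B)))))
  where
  X' A' Y' B' Z' : Wd (suc k)
  X' = map suc X
  A' = map suc A
  Y' = map suc Y
  B' = map suc B
  Z' = map suc Z
  countAB : ∀ x → count (suc x) (A' ++ B') ≡ count x A + count x B
  countAB x = trans (count-++ (suc x) A' B') (cong₂ _+_ (count-suc x A) (count-suc x B))
  parts : ∀ x → (count x A + count x B ≡ 0) ⊎ (count x A + count x B ≡ 2 × (count x X ≡ 0 × count x Y ≡ 0 × count x Z ≡ 0))
  parts x with d x
  ... | inj₁ z = let _ , r = +≡0 {count x X} (trans (sym (count5 x X A Y B Z)) z) ; a , r1 = +≡0 {count x A} r ; _ , r2 = +≡0 {count x Y} r1 ; b , _ = +≡0 {count x B} r2 in inj₁ (cong₂ _+_ a b)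
  ... | inj₂ z with dist (count x X) (count x A) (count x Y) (count x B) (count x Z) (trans (sym (count5 x X A Y B Z)) z)
      (trans (sym (par-count x B)) (trans (par-pair x A B ev) (par-count x A)))
  ...   | none a b = inj₁ (cong₂ _+_ a b)
  ...   | left a b p q r = inj₂ (cong₂ _+_ a b , p , q , r)
  ...   | right a b p q r = inj₂ (cong₂ _+_ a b , p , q , r)
  ...   | both a b p q r = inj₂ (cong₂ _+_ a b , p , q , r)
  dAB : DO (A' ++ B')
  dAB zero = inj₁ (trans (count-++ zero A' B') (cong₂ _+_ (count-zero A) (count-zero B)))
  dAB (suc x) with parts x
  ... | inj₁ e = inj₁ (trans (countAB x) e)
  ... | inj₂ (e , _) = inj₂ (trans (countAB x) e)
  inside : Strands.Inner X' Y' Z' (A' ++ B')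
  inside zero n = ⊥-elim (n (trans (count-++ zero A' B') (cong₂ _+_ (count-zero A) (count-zero B))))
  inside (suc x) n with parts x
  ... | inj₁ e = ⊥-elim (n (trans (countAB x) e))
  ... | inj₂ (_ , a , b , c) = trans (count-suc x X) a , trans (count-suc x Y) b , trans (count-suc x Z) c
  joined : ∀ A B → X' ++ map suc A ++ Y' ++ map suc B ++ Z' ≡ map suc (X ++ A ++ Y ++ B ++ Z)
  joined A B = sym (trans (map-++ suc X _) (cong (X' ++_) (trans (map-++ suc A _) (cong (map suc A ++_) (trans (map-++ suc Y _) (cong (Y' ++_) (map-++ suc B Z)))))))
  eq : ∀ w → third-part *ᵢ (I (X' ++ A' ++ Y' ++ B' ++ Z') w +ᵢ (-ᵢ I (X' ++ rev A' ++ Y' ++ rev B' ++ Z') w)) ≡ I (X ++ A ++ Y ++ B ++ Z) w +ᵢ (-ᵢ I (X ++ rev A ++ Y ++ rev B ++ Z) w)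
  eq w = ring {I (X ++ A ++ Y ++ B ++ Z) w} {I (X ++ rev A ++ Y ++ rev B ++ Z) w} (trans (cong (λ u → I u w) (joined A B)) (I-suc (X ++ A ++ Y ++ B ++ Z) w))
      (trans (cong (λ u → I u w) (trans (cong₂ (λ a b → X' ++ a ++ Y' ++ b ++ Z') (sym (reverse-map suc A)) (sym (reverse-map suc B))) (joined (rev A) (rev B)))) (I-suc (X ++ rev A ++ Y ++ rev B ++ Z) w))
    where
    ring : ∀ {a b a1 b1} → a1 ≡ 3ᵢ *ᵢ a → b1 ≡ 3ᵢ *ᵢ b → third-part *ᵢ (a1 +ᵢ (-ᵢ b1)) ≡ a +ᵢ (-ᵢ b)
    ring {a} {b} refl refl = rs 2 (λ a b → con third-part :* (con 3ᵢ :* a :+ :- (con 3ᵢ :* b)) := a :+ :- b) refl a b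

∼-sound : {u v : Wd k} → DO u → u ∼ v → Null λ w → I u w +ᵢ (-ᵢ I v w)
∼-sound {u = u} d ∼refl = Null-resp (λ w → rs 1 (λ x → con 0ᵢ := x :+ :- x) refl (I u w)) Null-0
∼-sound {u = u} {v} d (∼sym p) = Null-resp (λ w → rs 2 (λ x y → con (-ᵢ 1ᵢ) :* (y :+ :- x) := x :+ :- y) refl (I u w) (I v w)) (Null-* (-ᵢ 1ᵢ) (∼-sound (SG-DO (SG-sym (∼-SG p)) d) p))
∼-sound {u = u} {v} d (∼trans {v = m} p q) = Null-resp (λ w → rs 3 (λ x y z → (x :+ :- y) :+ (y :+ :- z) := x :+ :- z) refl (I u w) (I m w) (I v w)) (Null-+ (∼-sound d p) (∼-sound (SG-DO (∼-SG p) d) q))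
∼-sound d (∼rev X A Y B Z e) = reversal-sound X A Y B Z d e

-- Renaming the labels of a word

-- Replaces the fixed order of `assignments` by successive sums over labels in an arbitrary order,
-- so that the effect of a renaming can be followed label by label.
nest : Wd k → (Env k → ℚᵢ) → Env k → ℚᵢ
nest [] f = f
nest (l ∷ as) f = avg l (nest as f)

nest-ext : (as : Wd k) {f : Env k → ℚᵢ} → Ext f → Ext (nest as f)
nest-ext [] e = e
nest-ext (l ∷ as) e = avg-ext l (nest-ext as e)

3^ : ℕ → ℚᵢ
3^ zero = 1ᵢ
3^ (suc n) = 3ᵢ *ᵢ 3^ n

tot-nest : (as : Wd k) (f : Env k → ℚᵢ) → Ext f → tot (nest as f) ≡ 3^ (length as) *ᵢ tot f
tot-nest [] f e = rs 1 (λ x → x := con 1ᵢ :* x) refl (tot f)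
tot-nest (l ∷ as) f e = trans (tot-avg l (nest as f) (nest-ext as e)) (trans (cong (3ᵢ *ᵢ_) (tot-nest as f e)) (rs 3 (λ a b c → a :* (b :* c) := (a :* b) :* c) refl 3ᵢ (3^ (length as)) (tot f)))

tot-const : ∀ k (x : ℚᵢ) → tot {k} (λ _ → x) ≡ 3^ k *ᵢ x
tot-const zero x = rs 1 (λ x → x :+ con 0ᵢ := con 1ᵢ :* x) refl x
tot-const (suc k) x = trans (tot-suc {k} (λ _ → x)) (trans (tot-const k (S3 λ _ → x)) (rs 2 (λ a x → a :* (x :+ (x :+ x)) := (con 3ᵢ :* a) :* x) refl (3^ k) x))

3^-cancel : ∀ n x y → 3^ n *ᵢ x ≡ 3^ n *ᵢ y → x ≡ y
3^-cancel zero x y e = trans (rs 1 (λ x → x := con 1ᵢ :* x) refl x) (trans e (rs 1 (λ x → con 1ᵢ :* x := x) refl y))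
3^-cancel (suc n) x y e = 3^-cancel n x y (trans (sym (out x)) (trans (cong (third-part *ᵢ_) e) (out y)))
  where
  out : ∀ x → third-part *ᵢ ((3ᵢ *ᵢ 3^ n) *ᵢ x) ≡ 3^ n *ᵢ x
  out x = rs 2 (λ a x → con third-part :* ((con 3ᵢ :* a) :* x) := a :* x) refl (3^ n) x

nest-base : (as : Wd k) (f : Env k → ℚᵢ) → Ext f → ∀ φ ψ → (∀ x → x ∈ as ⊎ φ x ≡ ψ x) → nest as f φ ≡ nest as f ψ
nest-base [] f e φ ψ h = e φ ψ λ x → case h x of λ { (inj₂ q) → q }
nest-base (l ∷ as) f e φ ψ h = S3-cong λ c → nest-base as f e (upd φ l c) (upd ψ l c) (agree c)
  where
  agree : ∀ c x → x ∈ as ⊎ upd φ l c x ≡ upd ψ l c x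
  agree c x with l ≟ᶠ x
  ... | yes _ = inj₂ refl
  ... | no n with h x
  ...   | inj₂ q = inj₂ q
  ...   | inj₁ (here q) = ⊥-elim (n (sym q))
  ...   | inj₁ (there m) = inj₁ m

-- When every label has been summed over, the initial assignment is forgotten and `nest as f` is
-- constant. Comparing its total with the one obtained from repeated `tot-avg` leaves a common power
-- of 3, which is cancelled.
tot-as-nest : (as : Wd k) → length as ≡ k → (∀ x → x ∈ as) → (f : Env k → ℚᵢ) → Ext f → ∀ φ → tot f ≡ nest as f φ
tot-as-nest {k} as len all f e φ = 3^-cancel k (tot f) (nest as f φ) (trans (cong (λ n → 3^ n *ᵢ tot f) (sym len)) (trans (sym (tot-nest as f e)) (trans (tot-cong λ ψ → nest-base as f e ψ φ λ x → inj₁ (all x)) (tot-const k (nest as f φ)))))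

module Reindex (π π⁻¹ : Fin k → Fin k) (inv : ∀ x → π (π⁻¹ x) ≡ x) (inv' : ∀ x → π⁻¹ (π x) ≡ x) where

  nest-reindex : (as : Wd k) (f : Env k → ℚᵢ) → Ext f → ∀ φ → nest as (λ φ → f (φ ∘ π)) φ ≡ nest (map π⁻¹ as) f (φ ∘ π)
  nest-reindex [] f e φ = refl
  nest-reindex (l ∷ as) f e φ = S3-cong λ c → trans (nest-reindex as f e (upd φ l c)) (nest-ext (map π⁻¹ as) e (upd φ l c ∘ π) (upd (φ ∘ π) (π⁻¹ l) c) (shift c))
    where
    shift : ∀ c x → upd φ l c (π x) ≡ upd (φ ∘ π) (π⁻¹ l) c x
    shift c x with l ≟ᶠ π x | π⁻¹ l ≟ᶠ x
    ... | yes _ | yes _ = refl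
    ... | no _ | no _ = refl
    ... | yes refl | no n = ⊥-elim (n (inv' x))
    ... | no n | yes refl = ⊥-elim (n (sym (inv l)))

  tot-reindex : (f : Env k → ℚᵢ) → Ext f → tot (λ φ → f (φ ∘ π)) ≡ tot f
  tot-reindex f e = trans (tot-as-nest (allFin k) (length-tabulate (λ x → x)) ∈-allFin (λ φ → f (φ ∘ π)) (λ φ ψ h → e (φ ∘ π) (ψ ∘ π) (h ∘ π)) φ0)
    (trans (nest-reindex (allFin k) f e φ0) (sym (tot-as-nest (map π⁻¹ (allFin k)) (trans (length-map π⁻¹ (allFin k)) (length-tabulate (λ x → x))) (λ x → subst (_∈ map π⁻¹ (allFin k)) (inv' x) (∈-map π⁻¹ (∈-allFin (π x)))) f e (φ0 ∘ π))))
    where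
    φ0 : Env k
    φ0 _ = x₁
    ∈-map : ∀ (g : Fin k → Fin k) {x as} → x ∈ as → g x ∈ map g as
    ∈-map g (here refl) = here refl
    ∈-map g (there m) = there (∈-map g m)

  I-relabel : (u : Wd k) → ∀ w → I (map π u) w ≡ I u w
  I-relabel u w = trans (tot-cong λ φ → cong (λ v → ind v w) (sym (map-∘ {g = φ} {f = π} u))) (tot-reindex (λ φ → ind (map φ u) w) λ φ ψ h → cong (λ v → ind v w) (map-cong h u))

-- Intersection and colour in terms of parities

module Matching {m n} (h : Fin m → Fin n) where

  Match : Fin n → Fin m → Set
  Match x x' = ∀ b → eqb x (h b) ≡ eqb x' b

  count-match : ∀ {x x'} → Match x x' → ∀ u → count x (map h u) ≡ count x' u
  count-match M [] = refl
  count-match {x} {x'} M (b ∷ u) = trans (cong (λ t → if t then suc (count x (map h u)) else count x (map h u)) (M b)) (cong (λ c → if eqb x' b then suc c else c) (count-match M u))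

  par-match : ∀ {x x'} → Match x x' → ∀ u → par x (map h u) ≡ par x' u
  par-match M [] = refl
  par-match M (b ∷ u) = cong₂ _xor_ (M b) (par-match M u)

  ord-match : ∀ {x x' y y'} → Match x x' → Match y y' → ∀ u → ord x y (map h u) ≡ ord x' y' u
  ord-match M M' [] = refl
  ord-match M M' (b ∷ u) = cong₂ _xor_ (cong₂ _∧_ (M b) (par-match M' u)) (ord-match M M' u)

  count-miss : ∀ {x} → (∀ b → x ≢ h b) → ∀ u → count x (map h u) ≡ 0
  count-miss n [] = refl
  count-miss {x} n (b ∷ u) = trans (count-other (n b) (map h u)) (count-miss n u)

  match-inj : (∀ {a b} → h a ≡ h b → a ≡ b) → ∀ a → Match (h a) a
  match-inj inj a b with h a ≟ᶠ h b | a ≟ᶠ b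
  ... | yes _ | yes _ = refl
  ... | no _ | no _ = refl
  ... | yes p | no q = ⊥-elim (q (inj p))
  ... | no p | yes refl = ⊥-elim (p refl)

-- Turns positions into factorisations: applied repeatedly, it displays the four letters of a
-- pattern in the word. The map `shift` carries the later positions along.
after : {A : Set} (w : List A) (p : Fin (length w)) → ∃[ P ] ∃[ Q ] (w ≡ P ++ lookup w p ∷ Q ×
  Σ[ shift ∈ (∀ q → p <ᶠ q → Fin (length Q)) ] ((∀ q l → lookup Q (shift q l) ≡ lookup w q) × (∀ q r l l' → q <ᶠ r → shift q l <ᶠ shift r l')))
after (x ∷ w) zero = [] , w , refl , (λ { (suc q) _ → q }) , (λ { (suc q) _ → refl }) , λ { (suc q) (suc r) _ _ (s≤s l) → l }
after (x ∷ w) (suc p) with after w p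
... | P , Q , e , shift , look , mono = x ∷ P , Q , cong (x ∷_) e , (λ { (suc q) (s≤s l) → shift q l }) , (λ { (suc q) (s≤s l) → look q l }) , λ { (suc q) (suc r) (s≤s l) (s≤s l') (s≤s m) → mono q r l l' m }

before-after : {A : Set} (P : List A) (x : A) (Q : List A) → Σ[ p ∈ Fin (length (P ++ x ∷ Q)) ] (lookup (P ++ x ∷ Q) p ≡ x ×
  Σ[ emb ∈ (Fin (length Q) → Fin (length (P ++ x ∷ Q))) ] ((∀ i → p <ᶠ emb i) × (∀ i → lookup (P ++ x ∷ Q) (emb i) ≡ lookup Q i) × (∀ i j → i <ᶠ j → emb i <ᶠ emb j)))
before-after [] x Q = zero , refl , suc , (λ i → s≤s z≤n) , (λ i → refl) , λ i j l → s≤s l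
before-after (y ∷ P) x Q with before-after P x Q
... | p , e , emb , lt , look , mono = suc p , e , suc ∘ emb , (λ i → s≤s (lt i)) , look , λ i j l → s≤s (mono i j l)

pattern-word : {a b : Fin k} (w0 w1 w2 w3 w4 : Wd k) → Pattern (w0 ++ a ∷ w1 ++ b ∷ w2 ++ a ∷ w3 ++ b ∷ w4) a b
pattern-word {a = a} {b} w0 w1 w2 w3 w4
  with before-after w0 a (w1 ++ b ∷ w2 ++ a ∷ w3 ++ b ∷ w4) | before-after w1 b (w2 ++ a ∷ w3 ++ b ∷ w4) | before-after w2 a (w3 ++ b ∷ w4) | before-after w3 b w4
... | p , e , f , lt , look , mono | p1 , e1 , f1 , lt1 , look1 , mono1 | p2 , e2 , f2 , lt2 , look2 , mono2 | p3 , e3 , f₃ , _ =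
  p , f p1 , f (f1 p2) , f (f1 (f2 p3)) , lt p1 , mono p1 (f1 p2) (lt1 p2) , mono (f1 p2) (f1 (f2 p3)) (mono1 p2 (f2 p3) (lt2 p3)) ,
  e , trans (look p1) e1 , trans (look (f1 p2)) (trans (look1 p2) e2) , trans (look (f1 (f2 p3))) (trans (look1 (f2 p3)) (trans (look2 p3) e3))

word-pattern : {a b : Fin k} (w : Wd k) → Pattern w a b → ∃[ w0 ] ∃[ w1 ] ∃[ w2 ] ∃[ w3 ] ∃[ w4 ] (w ≡ w0 ++ a ∷ w1 ++ b ∷ w2 ++ a ∷ w3 ++ b ∷ w4)
word-pattern w (p , q , r , s , pq , qr , rs' , refl , refl , er , es) with after w p
... | w0 , Q , e , sh , look , mono with after Q (sh q pq)
...   | w1 , Q1 , e1 , sh1 , look1 , mono1 with after Q1 (sh1 (sh r pr) qr')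
  where
  pr : p <ᶠ r
  pr = ℕ.<-trans pq qr
  qr' : sh q pq <ᶠ sh r pr
  qr' = mono q r pq pr qr
...     | w2 , Q2 , e2 , sh2 , look2 , mono2 with after Q2 (sh2 (sh1 (sh s ps) qs') rs″)
  where
  pr : p <ᶠ r
  pr = ℕ.<-trans pq qr
  ps : p <ᶠ s
  ps = ℕ.<-trans pr rs'
  qs' : sh q pq <ᶠ sh s ps
  qs' = mono q s pq ps (ℕ.<-trans qr rs')
  rs″ : sh1 (sh r pr) (mono q r pq pr qr) <ᶠ sh1 (sh s ps) qs'
  rs″ = mono1 (sh r pr) (sh s ps) (mono q r pq pr qr) qs' (mono r s pr ps rs')
...       | w3 , w4 , e3 , _ = w0 , w1 , w2 , w3 , w4 , trans e (cong (λ z → w0 ++ lookup w p ∷ z) (trans e1 (trans (cong (λ x → w1 ++ x ∷ Q1) (look q pq)) (cong (λ z → w1 ++ lookup w q ∷ z)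
    (trans e2 (trans (cong (λ x → w2 ++ x ∷ Q2) (trans (look1 _ _) (trans (look r _) er))) (cong (λ z → w2 ++ lookup w p ∷ z) (trans e3 (cong (λ x → w3 ++ x ∷ w4) (trans (look2 _ _) (trans (look1 _ _) (trans (look s _) es))))))))))))

pattern⇒ord : {a b : Fin k} (w : Wd k) → DO w → a ≢ b → Pattern w a b → ord a b w ≡ true
pattern⇒ord {a = a} {b} w d n P with word-pattern w P
... | w0 , w1 , w2 , w3 , w4 , refl = trans (trans (cong (ord a b) e) (chord-ord a w0 (w1 ++ b ∷ w2) (w3 ++ b ∷ w4) (subst DO e d) b (n ∘ sym)))
    (trans (par-++ b w1 (b ∷ w2)) (trans (cong₂ _xor_ (zero-par w1 z1) (trans (par-head b w2) (cong not (zero-par w2 z2)))) refl))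
  where
  e : w0 ++ a ∷ w1 ++ b ∷ w2 ++ a ∷ w3 ++ b ∷ w4 ≡ w0 ++ a ∷ (w1 ++ b ∷ w2) ++ a ∷ w3 ++ b ∷ w4
  e = cong (λ z → w0 ++ a ∷ z) (sym (++-assoc w1 (b ∷ w2) (a ∷ w3 ++ b ∷ w4)))
  e' : w0 ++ a ∷ w1 ++ b ∷ w2 ++ a ∷ w3 ++ b ∷ w4 ≡ (w0 ++ a ∷ w1) ++ b ∷ (w2 ++ a ∷ w3) ++ b ∷ w4
  e' = ls 7 (λ w0 a w1 b w2 w3 w4 → w0 & a & w1 & b & w2 & a & w3 & b & w4 ⊜ (w0 & a & w1) & b & (w2 & a & w3) & b & w4) refl w0 [ a ] w1 [ b ] w2 w3 w4
  zs = chord-zeros b (w0 ++ a ∷ w1) (w2 ++ a ∷ w3) w4 (subst DO e' d)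
  z1 : count b w1 ≡ 0
  z1 = trans (sym (count-other (n ∘ sym) w1)) (proj₂ (zeros b w0 (a ∷ w1) (proj₁ zs)))
  z2 : count b w2 ≡ 0
  z2 = proj₁ (zeros b w2 (a ∷ w3) (proj₁ (proj₂ zs)))
  zero-par : ∀ v → count b v ≡ 0 → par b v ≡ false
  zero-par v z = trans (par-count b v) (cong odd z)

-- One end of `b` lies between the ends of `a`. The other lies before or after both, and this
-- decides which of the two patterns occurs.
ord⇒pattern : {a b : Fin k} (w : Wd k) → DO w → a ≢ b → count a w ≡ 2 → ord a b w ≡ true → Pattern w a b ⊎ Pattern w b a
ord⇒pattern {a = a} {b} w d n c o with locate2 a w c
... | P , Q , R , refl , _ , _ , _ with locate b Q (par⇒count b Q pQ) | bool-cases (par b P)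
  where
  pQ : par b Q ≡ true
  pQ = trans (sym (chord-ord a P Q R d b (n ∘ sym))) o
...   | Q1 , Q2 , refl , _ | inj₁ pP with locate b P (par⇒count b P pP)
...     | P1 , P2 , refl , _ = inj₂ (subst (λ w → Pattern w b a) (ls 7 (λ p b p' a q q' r → p & b & p' & a & q & b & q' & a & r ⊜ (p & b & p') & a & (q & b & q') & a & r) refl P1 [ b ] P2 [ a ] Q1 Q2 R) (pattern-word P1 P2 Q1 Q2 R))
ord⇒pattern {a = a} {b} w d n c o | P , Q , R , refl , _ , _ , _ | Q1 , Q2 , refl , _ | inj₂ pP with locate b R (par⇒count b R pR)
  where
  pR : par b R ≡ true
  pR = solve-for (par b R) (trans (sym (trans (par5 b P [ a ] (Q1 ++ b ∷ Q2) [ a ] R) (cong₂ (λ x y → x xor ((eqb b a xor false) xor (y xor ((eqb b a xor false) xor par b R)))) pP pQ))) (DO⇒Even w d b))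
    where
    pQ : par b (Q1 ++ b ∷ Q2) ≡ true
    pQ = trans (sym (chord-ord a P (Q1 ++ b ∷ Q2) R d b (n ∘ sym))) o
    solve-for : ∀ r → false xor ((eqb b a xor false) xor (true xor ((eqb b a xor false) xor r))) ≡ false → r ≡ true
    solve-for r e = trans (taut 2 (λ x r → r) (λ x r → not (false xor ((x xor false) xor (true xor ((x xor false) xor r))))) tt (eqb b a) r) (cong not e)
... | R1 , R2 , refl , _ = inj₁ (subst (λ w → Pattern w a b) (ls 7 (λ p a q b q' r r' → p & a & q & b & q' & a & r & b & r' ⊜ p & a & (q & b & q') & a & r & b & r') refl P [ a ] Q1 [ b ] Q2 R1 R2) (pattern-word P Q1 Q2 R1 R2))

module _ {n} (I : Share n) where

  closure-DO : DO (closure I)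
  closure-DO a = inj₂ (twice I a)

  intersect⇒ord : ∀ {a b} → a ≢ b → Intersect I a b → ord a b (closure I) ≡ true
  intersect⇒ord n (inj₁ P) = pattern⇒ord (closure I) closure-DO n P
  intersect⇒ord {a} {b} n (inj₂ P) = trans (ord-swap {a = b} {a} (n ∘ sym) (closure I)) (cong₂ _xor_ (pattern⇒ord (closure I) closure-DO (n ∘ sym) P) (cong (_∧ par a (closure I)) (DO⇒Even (closure I) closure-DO b)))

  ord⇒intersect : ∀ {a b} → a ≢ b → ord a b (closure I) ≡ true → Intersect I a b
  ord⇒intersect {a} n o = ord⇒pattern (closure I) closure-DO n (twice I a) o

  bridge : Bool → Colour
  bridge true = black
  bridge false = white

  ∈⇒count : ∀ {a : Fin n} {w} → a ∈ w → count a w ≢ 0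
  ∈⇒count {a} {_ ∷ w} (here refl) z = case trans (sym z) (count-head a w) of λ ()
  ∈⇒count {a} {b ∷ w} (there m) z = ∈⇒count m (proj₂ (zeros a [ b ] w z))

  count⇒∈ : ∀ (a : Fin n) w → count a w ≢ 0 → a ∈ w
  count⇒∈ a [] z = ⊥-elim (z refl)
  count⇒∈ a (b ∷ w) z with a ≟ᶠ b
  ... | yes refl = here refl
  ... | no _ = there (count⇒∈ a w z)

  ∉⇒count : ∀ (a : Fin n) w → ¬ a ∈ w → count a w ≡ 0
  ∉⇒count a w n with nonzero-or a w
  ... | inj₁ z = z
  ... | inj₂ z = ⊥-elim (n (count⇒∈ a w z))

  -- A bridge has one end on the first strand, while an arch has none or two.
  colour-par : ∀ a → colour I a ≡ bridge (par a (strand₁ I))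
  colour-par a with a ∈? strand₁ I | a ∈? strand₂ I
  ... | yes p | yes q = sym (cong bridge (trans (par-count a (strand₁ I)) (cong odd (proj₁ is-one))))
    where
    split : ∀ {x y} → x ≢ 0 → y ≢ 0 → x + y ≡ 2 → x ≡ 1 × y ≡ 1
    split {zero} n _ _ = ⊥-elim (n refl)
    split {suc zero} {y} _ _ e = refl , ℕ.suc-injective e
    split {suc (suc zero)} {zero} _ n _ = ⊥-elim (n refl)
    split {suc (suc zero)} {suc _} _ _ ()
    split {suc (suc (suc _))} _ _ ()
    is-one : count a (strand₁ I) ≡ 1 × count a (strand₂ I) ≡ 1
    is-one = split (∈⇒count p) (∈⇒count q) (trans (sym (count-++ a (strand₁ I) (strand₂ I))) (twice I a))
  ... | no p | _ = sym (cong bridge (trans (par-count a (strand₁ I)) (cong odd (∉⇒count a (strand₁ I) p))))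
  ... | yes _ | no q = sym (cong bridge (trans (par-count a (strand₁ I)) (cong odd (trans (sym (ℕ.+-identityʳ (count a (strand₁ I)))) (trans (cong (count a (strand₁ I) +_) (sym (∉⇒count a (strand₂ I) q))) (trans (sym (count-++ a (strand₁ I) (strand₂ I))) (twice I a)))))))

-- A share closed up by one marker chord, whose colour information becomes adjacency to the marker.

module Marked (n m : ℕ) where

  inl : Fin n → Fin (suc (n + m))
  inl a = suc (a ↑ˡ m)

  inr : Fin m → Fin (suc (n + m))
  inr b = suc (n ↑ʳ b)

  mark : Wd n → Wd n → Wd (suc (n + m))
  mark s s' = map inl s ++ zero ∷ map inl s' ++ [ zero ]

  disjoint : ∀ a b → inl a ≢ inr b
  disjoint a b e with trans (sym (splitAt-↑ˡ n a m)) (trans (cong (splitAt n) (suc-injective e)) (splitAt-↑ʳ n m b))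
  ... | ()

  data Kind : Fin (suc (n + m)) → Set where
    marker : Kind zero
    isLeft : ∀ a → Kind (inl a)
    isRight : ∀ b → Kind (inr b)

  kind : ∀ x → Kind x
  kind zero = marker
  kind (suc y) with splitAt n y in e
  ... | inj₁ a = subst (Kind ∘ suc) (splitAt⁻¹-↑ˡ e) (isLeft a)
  ... | inj₂ b = subst (Kind ∘ suc) (splitAt⁻¹-↑ʳ {i = y} e) (isRight b)

  module ML = Matching inl
  module MR = Matching inr

  matchL : ∀ a → ML.Match (inl a) a
  matchL = ML.match-inj λ e → ↑ˡ-injective m _ _ (suc-injective e)

  matchR : ∀ b → MR.Match (inr b) b
  matchR = MR.match-inj λ e → ↑ʳ-injective n _ _ (suc-injective e)

  count-mark : ∀ s s' x → x ≢ zero → count x (mark s s') ≡ count x (map inl (s ++ s'))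
  count-mark s s' x nz = trans (count-++ x (map inl s) (zero ∷ map inl s' ++ [ zero ])) (trans (cong (count x (map inl s) +_) (trans (count-other nz (map inl s' ++ [ zero ])) (trans (count-++ x (map inl s') [ zero ]) (trans (cong (count x (map inl s') +_) (count-other nz [])) (ℕ.+-identityʳ _)))))
    (trans (sym (count-++ x (map inl s) (map inl s'))) (cong (count x) (sym (map-++ inl s s')))))

  no-zero : ∀ s → count zero (map inl s) ≡ 0
  no-zero s = ML.count-miss (λ _ ()) s

  count-marker : ∀ s s' → count zero (mark s s') ≡ 2
  count-marker s s' = trans (count-++ zero (map inl s) (zero ∷ map inl s' ++ [ zero ])) (cong₂ _+_ (no-zero s) (cong suc (trans (count-++ zero (map inl s') [ zero ]) (cong (_+ 1) (no-zero s')))))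

  count-inl : ∀ w x → Kind x → x ≢ zero → (∃[ a ] (x ≡ inl a × count x (map inl w) ≡ count a w)) ⊎ (count x (map inl w) ≡ 0)
  count-inl w .zero marker n = ⊥-elim (n refl)
  count-inl w .(inl a) (isLeft a) n = inj₁ (a , refl , ML.count-match (matchL a) w)
  count-inl w .(inr b) (isRight b) n = inj₂ (ML.count-miss (λ a e → disjoint a b (sym e)) w)

  DO-mark : ∀ s s' → (∀ a → count a (s ++ s') ≡ 2) → DO (mark s s')
  DO-mark s s' tw zero = inj₂ (count-marker s s')
  DO-mark s s' tw (suc y) with count-inl (s ++ s') (suc y) (kind (suc y)) (λ ())
  ... | inj₁ (a , _ , e) = inj₂ (trans (count-mark s s' (suc y) λ ()) (trans e (tw a)))
  ... | inj₂ e = inj₁ (trans (count-mark s s' (suc y) λ ()) e)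

  ord-marker : ∀ s s' x → x ≢ zero → ord zero x (mark s s') ≡ par x (map inl s')
  ord-marker s s' x n = ord-2 zero n (map inl s) (map inl s') [] (no-zero s) (no-zero s') refl

  ord-mark : ∀ s s' x y → x ≢ zero → y ≢ zero → ord x y (mark s s') ≡ ord x y (map inl (s ++ s'))
  ord-mark s s' x y nx ny = trans (skip (map inl s) (map inl s' ++ [ zero ])) (trans (cong (ord x y) (sym (++-assoc (map inl s) (map inl s') [ zero ])))
      (trans (skip (map inl s ++ map inl s') []) (cong (ord x y) (trans (++-identityʳ _) (sym (map-++ inl s s'))))))
    where
    skip : ∀ P Q → ord x y (P ++ zero ∷ Q) ≡ ord x y (P ++ Q)
    skip P Q = trans (ord-++ x y P (zero ∷ Q)) (trans (cong₂ (λ o p → (ord x y P xor o) xor (par x P ∧ p)) (cong (λ t → (t ∧ par y Q) xor ord x y Q) (eqb-≢ nx)) (par-other ny Q)) (sym (ord-++ x y P Q)))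

  -- Inserting the marker does not affect the order of the other letters, and a chord crosses the
  -- marker when its parity on the second strand is odd; for chords with two ends this is the same
  -- parity as on the first strand.
  SG-mark : ∀ s s' t t' → (∀ a → count a (s ++ s') ≡ 2) → (∀ a → count a (t ++ t') ≡ 2) → (∀ a → par a s ≡ par a t) → (∀ a b → ord a b (s ++ s') ≡ ord a b (t ++ t')) → SG (mark s s') (mark t t')
  SG-mark s s' t t' cs' ct po oo = record { same = sm ; ords = os }
    where
    dS = DO-mark s s' cs'
    dT = DO-mark t t' ct
    pars : ∀ a → par a s' ≡ par a t'
    pars a = trans (par-pair a s s' (λ b → trans (par-count b (s ++ s')) (cong odd (cs' b)))) (trans (po a) (sym (par-pair a t t' (λ b → trans (par-count b (t ++ t')) (cong odd (ct b))))))
    sm : ∀ x → count x (mark s s') ≡ count x (mark t t')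
    sm zero = trans (count-marker s s') (sym (count-marker t t'))
    sm (suc y) = trans (count-mark s s' (suc y) λ ()) (trans (go (kind (suc y))) (sym (count-mark t t' (suc y) λ ())))
      where
      go : ∀ {x} → Kind x → count x (map inl (s ++ s')) ≡ count x (map inl (t ++ t'))
      go marker = trans (no-zero (s ++ s')) (sym (no-zero (t ++ t')))
      go (isLeft a) = trans (ML.count-match (matchL a) (s ++ s')) (trans (trans (cs' a) (sym (ct a))) (sym (ML.count-match (matchL a) (t ++ t'))))
      go (isRight b) = trans (ML.count-miss (λ a e → disjoint a b (sym e)) (s ++ s')) (sym (ML.count-miss (λ a e → disjoint a b (sym e)) (t ++ t')))
    off : ∀ b w → count (inr b) (map inl w) ≡ 0
    off b w = ML.count-miss (λ a e → disjoint a b (sym e)) w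
    from-marker : ∀ y → ord zero (suc y) (mark s s') ≡ ord zero (suc y) (mark t t')
    from-marker y = trans (ord-marker s s' (suc y) λ ()) (trans (go (kind (suc y))) (sym (ord-marker t t' (suc y) λ ())))
      where
      go : ∀ {x} → Kind x → par x (map inl s') ≡ par x (map inl t')
      go marker = trans (par-count zero (map inl s')) (trans (cong odd (trans (no-zero s') (sym (no-zero t')))) (sym (par-count zero (map inl t'))))
      go (isLeft a) = trans (ML.par-match (matchL a) s') (trans (pars a) (sym (ML.par-match (matchL a) t')))
      go (isRight b) = trans (par-count (inr b) (map inl s')) (trans (cong odd (trans (off b s') (sym (off b t')))) (sym (par-count (inr b) (map inl t'))))
    os : ∀ x y → ord x y (mark s s') ≡ ord x y (mark t t')
    os zero zero = trans (ord-self zero (mark s s') (count-marker s s')) (sym (ord-self zero (mark t t') (count-marker t t')))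
    os zero (suc y) = from-marker y
    os (suc x) zero = trans (ord-swap {a = zero} {suc x} (λ ()) (mark s s')) (trans (cong₂ _xor_ (from-marker x) (trans (cong (_∧ par (suc x) (mark s s')) (DO⇒Even (mark s s') dS zero)) (sym (cong (_∧ par (suc x) (mark t t')) (DO⇒Even (mark t t') dT zero)))))
      (sym (ord-swap {a = zero} {suc x} (λ ()) (mark t t'))))
    os (suc x) (suc y) = trans (ord-mark s s' (suc x) (suc y) (λ ()) λ ()) (trans (go (kind (suc x)) (kind (suc y))) (sym (ord-mark t t' (suc x) (suc y) (λ ()) λ ())))
      where
      go : ∀ {x y} → Kind x → Kind y → ord x y (map inl (s ++ s')) ≡ ord x y (map inl (t ++ t'))
      go {y = y} marker _ = trans (ord-0ˡ {b = y} (map inl (s ++ s')) (no-zero (s ++ s'))) (sym (ord-0ˡ {b = y} (map inl (t ++ t')) (no-zero (t ++ t'))))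
      go {y = y} (isRight b) _ = trans (ord-0ˡ {b = y} (map inl (s ++ s')) (off b (s ++ s'))) (sym (ord-0ˡ {b = y} (map inl (t ++ t')) (off b (t ++ t'))))
      go {x} (isLeft a) marker = trans (ord-0ʳ {a = x} (map inl (s ++ s')) (no-zero (s ++ s'))) (sym (ord-0ʳ {a = x} (map inl (t ++ t')) (no-zero (t ++ t'))))
      go {x} (isLeft a) (isRight b) = trans (ord-0ʳ {a = x} (map inl (s ++ s')) (off b (s ++ s'))) (sym (ord-0ʳ {a = x} (map inl (t ++ t')) (off b (t ++ t'))))
      go (isLeft a) (isLeft b) = trans (ML.ord-match (matchL a) (matchL b) (s ++ s')) (trans (oo a b) (sym (ML.ord-match (matchL a) (matchL b) (t ++ t'))))

  module _ (H : Share m) where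

    K L : Wd (suc (n + m))
    K = map inr (strand₁ H)
    L = map inr (strand₂ H)

    fill : Wd n → Wd n → Wd (suc (n + m))
    fill s s' = map inl s ++ K ++ map inl s' ++ L

    no-zeroR : ∀ w → count zero (map inr w) ≡ 0
    no-zeroR w = MR.count-miss (λ _ ()) w

    joinKL : K ++ L ≡ map inr (closure H)
    joinKL = sym (map-++ inr (strand₁ H) (strand₂ H))

    DO-KL : DO (K ++ L)
    DO-KL x = subst (λ w → (count x w ≡ 0) ⊎ (count x w ≡ 2)) (sym joinKL) (go (kind x))
      where
      go : ∀ {x} → Kind x → (count x (map inr (closure H)) ≡ 0) ⊎ (count x (map inr (closure H)) ≡ 2)
      go marker = inj₁ (no-zeroR (closure H))
      go (isLeft a) = inj₁ (MR.count-miss (λ b → disjoint a b) (closure H))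
      go (isRight b) = inj₂ (trans (MR.count-match (matchR b) (closure H)) (twice H b))

    fill-∼ : ∀ s s' t t' → (∀ a → count a (s ++ s') ≡ 2) → SG (mark s s') (mark t t') → fill s s' ∼ fill t t'
    fill-∼ s s' t t' c g = subst₂ _∼_ (filled s s') (filled t t') (sub-∼ zero K L (DO⇒Even (K ++ L) DO-KL) (same-graph⇒∼ (mark s s') (mark t t') (DO-mark s s' c) g) (DO⇒Even (mark s s') (DO-mark s s' c)) (inj₂ (count-marker s s')))
      where
      filled : ∀ s s' → sub zero K L (mark s s') ≡ fill s s'
      filled s s' = trans (sub-2 zero K L (map inl s) (map inl s') [] (no-zero s) (no-zero s') refl) (cong (λ z → map inl s ++ K ++ map inl s' ++ z) (++-identityʳ L))

    DO-fill : ∀ s s' → (∀ a → count a (s ++ s') ≡ 2) → DO (fill s s')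
    DO-fill s s' c x = subst (λ n → (n ≡ 0) ⊎ (n ≡ 2)) (sym total) (go (kind x))
      where
      total : count x (fill s s') ≡ count x (map inl (s ++ s')) + count x (map inr (closure H))
      total = trans (count-↭ x (cs 4 (λ a k b l → a ⊗ k ⊗ b ⊗ l ≜ (a ⊗ b) ⊗ k ⊗ l) ↭-refl (map inl s) K (map inl s') L)) (trans (count-++ x (map inl s ++ map inl s') (K ++ L)) (cong₂ _+_ (cong (count x) (sym (map-++ inl s s'))) (cong (count x) joinKL)))
      go : ∀ {x} → Kind x → (count x (map inl (s ++ s')) + count x (map inr (closure H)) ≡ 0) ⊎ (count x (map inl (s ++ s')) + count x (map inr (closure H)) ≡ 2)
      go marker = inj₁ (cong₂ _+_ (no-zero (s ++ s')) (no-zeroR (closure H)))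
      go (isLeft a) = inj₂ (cong₂ _+_ (trans (ML.count-match (matchL a) (s ++ s')) (c a)) (MR.count-miss (λ b → disjoint a b) (closure H)))
      go (isRight b) = inj₂ (cong₂ _+_ (ML.count-miss (λ a e → disjoint a b (sym e)) (s ++ s')) (trans (MR.count-match (matchR b) (closure H)) (twice H b)))

    pair-word : Wd n → Wd n → Wd (n + m)
    pair-word s s' = map (_↑ˡ m) s ++ map (n ↑ʳ_) (strand₁ H) ++ map (_↑ˡ m) s' ++ map (n ↑ʳ_) (strand₂ H)

    fill-suc : ∀ s s' → fill s s' ≡ map suc (pair-word s s')
    fill-suc s s' = sym (trans (map-++ suc (map (_↑ˡ m) s) _) (cong₂ _++_ (sym (map-∘ s)) (trans (map-++ suc (map (n ↑ʳ_) (strand₁ H)) _) (cong₂ _++_ (sym (map-∘ (strand₁ H))) (trans (map-++ suc (map (_↑ˡ m) s') _) (cong₂ _++_ (sym (map-∘ s')) (sym (map-∘ (strand₂ H)))))))))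

    -- After the substitution the label `zero` of the marker is idle in `fill`, which multiplies the
    -- weight of the pairing by 3.
    pair-Null : ∀ s s' t t' → (∀ a → count a (s ++ s') ≡ 2) → SG (mark s s') (mark t t') → Null λ w → I (pair-word s s') w +ᵢ (-ᵢ I (pair-word t t') w)
    pair-Null s s' t t' c g = Null-resp (λ w → ring {I (pair-word s s') w} {I (pair-word t t') w} (trans (cong (λ u → I u w) (fill-suc s s')) (I-suc (pair-word s s') w)) (trans (cong (λ u → I u w) (fill-suc t t')) (I-suc (pair-word t t') w)))
        (Null-* third-part (∼-sound (DO-fill s s' c) (fill-∼ s s' t t' c g)))
      where
      ring : ∀ {a b a1 b1} → a1 ≡ 3ᵢ *ᵢ a → b1 ≡ 3ᵢ *ᵢ b → third-part *ᵢ (a1 +ᵢ (-ᵢ b1)) ≡ a +ᵢ (-ᵢ b)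
      ring {a} {b} refl refl = rs 2 (λ a b → con third-part :* (con 3ᵢ :* a :+ :- (con 3ᵢ :* b)) := a :+ :- b) refl a b

-- Isomorphic graphs give equivalent shares

module Relabelled {n} (I₁ I₂ : Share n) (σ : Fin n ↔ Fin n)
  (colours : ∀ a → colour I₁ a ≡ colour I₂ (Inverse.to σ a)) (edges : ∀ a b → Intersect I₁ a b ⇔ Intersect I₂ (Inverse.to σ a) (Inverse.to σ b)) where

  to from : Fin n → Fin n
  to = Inverse.to σ
  from = Inverse.from σ
  to-from : ∀ x → to (from x) ≡ x
  to-from x = Inverse.strictlyInverseˡ σ x
  from-to : ∀ x → from (to x) ≡ x
  from-to x = Inverse.strictlyInverseʳ σ x
  open Matching from

  match : ∀ a → Match a (to a)
  match a b with a ≟ᶠ from b | to a ≟ᶠ b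
  ... | yes _ | yes _ = refl
  ... | no _ | no _ = refl
  ... | yes refl | no q = ⊥-elim (q (to-from b))
  ... | no p | yes refl = ⊥-elim (p (sym (from-to a)))

  t t' : Wd n
  t = map from (strand₁ I₂)
  t' = map from (strand₂ I₂)

  join : t ++ t' ≡ map from (closure I₂)
  join = sym (map-++ from (strand₁ I₂) (strand₂ I₂))

  counts : ∀ a → count a (t ++ t') ≡ 2
  counts a = trans (cong (count a) join) (trans (count-match (match a) (closure I₂)) (twice I₂ (to a)))

  pars : ∀ a → par a (strand₁ I₁) ≡ par a t
  pars a = trans (bridge-injective (trans (sym (colour-par I₁ a)) (trans (colours a) (colour-par I₂ (to a))))) (sym (par-match (match a) (strand₁ I₂)))
    where
    bridge-injective : ∀ {x y} → bridge I₁ x ≡ bridge I₂ y → x ≡ y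
    bridge-injective {true} {true} _ = refl
    bridge-injective {false} {false} _ = refl

  orders : ∀ a b → ord a b (closure I₁) ≡ ord a b (t ++ t')
  orders a b = trans (same-edge (a ≟ᶠ b)) (sym (trans (cong (ord a b) join) (ord-match (match a) (match b) (closure I₂))))
    where
    iff : ∀ {x y} → (x ≡ true → y ≡ true) → (y ≡ true → x ≡ true) → x ≡ y
    iff {true} f _ = sym (f refl)
    iff {false} {true} _ g = g refl
    iff {false} {false} _ _ = refl
    same-edge : Dec (a ≡ b) → ord a b (closure I₁) ≡ ord (to a) (to b) (closure I₂)
    -- On the diagonal the edge relation gives no information, but `ord` is true there for every
    -- letter occurring twice.
    same-edge (yes refl) = trans (ord-self a (closure I₁) (twice I₁ a)) (sym (ord-self (to a) (closure I₂) (twice I₂ (to a))))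
    same-edge (no n) = iff (λ o → intersect⇒ord I₂ n' (Equivalence.to (edges a b) (ord⇒intersect I₁ n o))) (λ o → intersect⇒ord I₁ n (Equivalence.from (edges a b) (ord⇒intersect I₂ n' o)))
      where
      n' : to a ≢ to b
      n' e = n (trans (sym (from-to a)) (trans (cong from e) (from-to b)))

  -- The second share is renamed by `from`, so that both marked words have the same labelled graph.
  -- The renaming extends by the identity to the chords of `H`, and `I-relabel` shows that it does
  -- not change the weight of the pairing.
  equivalent : Equivalent I₁ I₂
  equivalent m H = Null⇒≈U (wsl2 (pairing I₁ H)) (wsl2 (pairing I₂ H)) (Null-resp (λ w → cong₂ (λ x y → x +ᵢ (-ᵢ y)) (sym (coeff-wsl2 (pairing I₁ H) w)) (trans (trans (cong (λ u → I u w) renamed) (I-relabel (pairing I₂ H) w)) (sym (coeff-wsl2 (pairing I₂ H) w))))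
      (pair-Null H (strand₁ I₁) (strand₂ I₁) t t' (twice I₁) (SG-mark (strand₁ I₁) (strand₂ I₁) t t' (twice I₁) counts pars orders)))
    where
    open Marked n m
    on-inl : (Fin n → Fin n) → Fin (n + m) → Fin (n + m)
    on-inl f x with splitAt n x
    ... | inj₁ a = f a ↑ˡ m
    ... | inj₂ b = n ↑ʳ b
    on-inl-l : ∀ f a → on-inl f (a ↑ˡ m) ≡ f a ↑ˡ m
    on-inl-l f a rewrite splitAt-↑ˡ n a m = refl
    on-inl-r : ∀ f b → on-inl f (n ↑ʳ b) ≡ n ↑ʳ b
    on-inl-r f b rewrite splitAt-↑ʳ n m b = refl
    inverse : ∀ f g → (∀ a → f (g a) ≡ a) → ∀ x → on-inl f (on-inl g x) ≡ x
    inverse f g h x with splitAt n x in e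
    ... | inj₁ a = trans (on-inl-l f (g a)) (trans (cong (_↑ˡ m) (h a)) (splitAt⁻¹-↑ˡ e))
    ... | inj₂ b = trans (on-inl-r f b) (splitAt⁻¹-↑ʳ {i = x} e)
    open Reindex (on-inl from) (on-inl to) (inverse from to from-to) (inverse to from to-from)
    push-l : ∀ s → map (_↑ˡ m) (map from s) ≡ map (on-inl from) (map (_↑ˡ m) s)
    push-l s = trans (sym (map-∘ s)) (trans (map-cong (λ a → sym (on-inl-l from a)) s) (map-∘ s))
    push-r : ∀ s → map (n ↑ʳ_) s ≡ map (on-inl from) (map (n ↑ʳ_) s)
    push-r s = trans (map-cong (λ b → sym (on-inl-r from b)) s) (map-∘ s)
    renamed : pair-word H t t' ≡ map (on-inl from) (pairing I₂ H)
    renamed = trans (cong₂ _++_ (push-l (strand₁ I₂)) (trans (cong₂ _++_ (push-r (strand₁ H)) (trans (cong₂ _++_ (push-l (strand₂ I₂)) (push-r (strand₂ H))) (sym (map-++ (on-inl from) (map (_↑ˡ m) (strand₂ I₂)) _)))) (sym (map-++ (on-inl from) (map (n ↑ʳ_) (strand₁ H)) _))))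
      (sym (map-++ (on-inl from) (map (_↑ˡ m) (strand₁ I₂)) _))

theorem3 : ∀ {n₁ n₂} (I₁ : Share n₁) (I₂ : Share n₂) (σ : Fin n₁ ↔ Fin n₂)
  → (∀ a → colour I₁ a ≡ colour I₂ (Inverse.to σ a))
  → (∀ a b → Intersect I₁ a b ⇔ Intersect I₂ (Inverse.to σ a) (Inverse.to σ b))
  → Equivalent I₁ I₂
-- The bijection forces the two numbers of chords to be equal, which brings both shares over one
-- label set.
theorem3 I₁ I₂ σ colours edges with ↔⇒≡ σ
... | refl = Relabelled.equivalent I₁ I₂ σ colours edges
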